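{- The Recurrent Reachability Problem is decidable for UCSes, and it is $\Sigma_1^0$-complete (hence undecidable) for UCST[$Z_1^{\mathtt r}$]. Here UCSes are UCSTs with no test rules, and UCST[$Z_1^{\mathtt r}$] is the class of UCSTs in which the only tests are emptiness tests $Z$ performed by Sender on channel $\mathtt r$.
   Context: A UCST (unidirectional channel system with tests) is a tuple $S=(\{\mathtt r,\mathtt l\},M,Q_1,\Delta_1,Q_2,\Delta_2)$ where $M$ is a finite message alphabet, $Q_1,Q_2$ are disjoint finite sets of states of Sender and Receiver respectively, and $\Delta_1,\Delta_2$ are finite sets of rules of Sender and Receiver. There are two channels: $\mathtt r$ (reliable) and $\mathtt l$ (lossy). A rule in $\Delta_i$ is a tuple $(q,\mathtt c,\alpha,q')\in Q_i\times\{\mathtt r,\mathtt l\}\times \mathrm{Act}\times Q_i$ with $\mathrm{Act}=\mathrm{Reg}(M)\cup M\cup\{\epsilon\}$, where $\mathrm{Reg}(M)$ is the set of regular languages over $M$ (finitely represented). If $\alpha=R\in\mathrm{Reg}(M)$ the rule is a test on $\mathtt c$; if $\alpha=x\in M\cup\{\epsilon\}$ it is a write $\mathtt c!x$ when in $\Delta_1$ and a read $\mathtt c?x$ when in $\Delta_2$ ($\alpha=\epsilon$ is the empty action). The emptiness test is $Z=\{\epsilon\}$. Configurations are tuples $(q_1,q_2,u,v)\in Q_1\times Q_2\times M^*\times M^*$ ($u$ is the content of $\mathtt r$, $v$ that of $\mathtt l$). Reliable steps: a rule $(q,\mathtt c,\alpha,q')$ of Sender (respectively Receiver) can be fired if $q$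 is the current Sender (respectively Receiver) state, which becomes $q'$, the other agent's state being unchanged; a test $R$ on $\mathtt c$ requires the content of $\mathtt c$ to be in $R$ and changes no content; a write $\mathtt c!x$ appends $x$ at the right end of the content of $\mathtt c$; a read $\mathtt c?x$ requires $x$ to be a prefix of the content of $\mathtt c$ and removes it. Loss steps: $(q_1,q_2,u,v)\to(q_1,q_2,u,v')$ whenever $v'$ is obtained from $v$ by deleting one occurrence of a symbol. A step is a reliable step or a loss step; $C\xrightarrow{*}D$ (respectively $C\xrightarrow{+}D$) means that $D$ is reached from $C$ by a finite (respectively finite nonempty) sequence of chained steps. Recurrent Reachability Problem: given a system $S$ and states $p_{\mathrm{in}},p\in Q_1$, $q_{\mathrm{in}},q\in Q_2$, does $S$ have an infinite run $(p_{\mathrm{in}},q_{\mathrm{in}},\epsilon,\epsilon)\xrightarrow{*}(p,q,u_1,v_1)\xrightarrow{+}(p,q,u_2,v_2)\xrightarrow{+}\cdots$ visiting the pair of control states $(p,q)$ infinitely often (with no constraint on the channel contents $u_i,v_i$)? -}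

module Defs where

open import Data.Fin.Base using (Fin; toℕ)
open import Data.Fin.Properties using (≤-preorder)
open import Data.List.Base using (List; []; _∷_; _++_; map; length; fromMaybe; removeAt)
open import Data.List.Membership.Propositional using (_∈_)
open import Data.List.Relation.Unary.All using (All)
open import Data.Maybe.Base using (Maybe; just; nothing)
open import Data.Nat.Base using (ℕ; zero; suc; _+_; _<_)
open import Data.Product.Base using (Σ-syntax; ∃-syntax; _×_; _,_)
open import Data.Sum.Base using (_⊎_)
open import Data.Vec.Base as Vec using (Vec; []; _∷_; lookup)
open import Data.Vec.Relation.Binary.Pointwise.Inductive using (Pointwise)
open import Function.Bundles using (_⇔_)
open import Relation.Binary.Construct.Closure.ReflexiveTransitive using (Star)
open import Relation.Binary.Construct.Closure.Transitive using (TransClosure)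
open import Relation.Binary.PropositionalEquality.Core using (_≡_)
open import Relation.Nullary.Negation.Core using (¬_)
import Text.Regex.Base

-- The finite sets M, Q₁, Q₂ are Fin m, Fin n₁, Fin n₂; Q₁ and Q₂ are
-- disjoint because they are never mixed. Regular languages are finitely
-- represented by regular expressions.

module Regex (m : ℕ) = Text.Regex.Base (≤-preorder m)

Word : ℕ → Set
Word m = List (Fin m)

RegExp : ℕ → Set
RegExp m = Regex.Exp m

data Channel : Set where
  r l : Channel

-- `comm nothing` is the empty action ε.

data Act (m : ℕ) : Set where
  test : RegExp m → Act m
  comm : Maybe (Fin m) → Act m

record Rule (m n : ℕ) : Set where
  constructor rule
  field
    source : Fin n
    chan   : Channel
    action : Act m
    target : Fin n

record UCST : Set where
  field
    m n₁ n₂ : ℕ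
    Δ₁      : List (Rule m n₁)
    Δ₂      : List (Rule m n₂)

Contents : ℕ → Set
Contents m = Word m × Word m

get : ∀ {m} → Channel → Contents m → Word m
get r (u , v) = u
get l (u , v) = v

set : ∀ {m} → Channel → Word m → Contents m → Contents m
set r w (u , v) = w , v
set l w (u , v) = u , w

module _ (S : UCST) where
  open UCST S
  open Regex m using () renaming (_∈_ to _matches_)

  Config : Set
  Config = Fin n₁ × Fin n₂ × Contents m

  data Step : Config → Config → Set where
    test₁ : ∀ {p p′ q w c R} → rule p c (test R) p′ ∈ Δ₁ →
            get c w matches R →
            Step (p , q , w) (p′ , q , w)
    test₂ : ∀ {p q q′ w c R} → rule q c (test R) q′ ∈ Δ₂ →
            get c w matches R →
            Step (p , q , w) (p , q′ , w)
    write : ∀ {p p′ q w c x} → rule p c (comm x) p′ ∈ Δ₁ →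
            Step (p , q , w) (p′ , q , set c (get c w ++ fromMaybe x) w)
    read  : ∀ {p q q′ w c x s} → rule q c (comm x) q′ ∈ Δ₂ →
            get c w ≡ fromMaybe x ++ s →
            Step (p , q , w) (p , q′ , set c s w)
    loss  : ∀ {p q u v} (i : Fin (length v)) →
            Step (p , q , u , v) (p , q , u , removeAt v i)

record Instance : Set where
  field
    system  : UCST
  open UCST system public
  field
    pᵢₙ p : Fin n₁
    qᵢₙ q : Fin n₂

RecurrentlyReachable : Instance → Set
RecurrentlyReachable I =
  Σ[ w ∈ (ℕ → Contents m) ]
    Star (Step system) (pᵢₙ , qᵢₙ , [] , []) (p , q , w 0) ×
    (∀ i → TransClosure (Step system) (p , q , w i) (p , q , w (suc i)))
  where open Instance I

data NoTest {m n} : Rule m n → Set where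
  isComm : ∀ {s c x t} → NoTest (rule s c (comm x) t)

-- The language Z = {ε} is represented by the regular expression ε.

Z : ∀ {m} → RegExp m
Z {m} = Regex.ε {m}

data OnlyZʳ {m n} : Rule m n → Set where
  isComm : ∀ {s c x t} → OnlyZʳ (rule s c (comm x) t)
  isZʳ   : ∀ {s t} → OnlyZʳ (rule s r (test Z) t)

IsUCS : UCST → Set
IsUCS S = All NoTest Δ₁ × All NoTest Δ₂
  where open UCST S

IsUCST[Z₁ʳ] : UCST → Set
IsUCST[Z₁ʳ] S = All OnlyZʳ Δ₁ × All NoTest Δ₂
  where open UCST S

triangle : ℕ → ℕ
triangle zero    = 0
triangle (suc n) = suc n + triangle n

-- Cantor's bijection ℕ × ℕ → ℕ

pair : ℕ → ℕ → ℕ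
pair a b = triangle (a + b) + b

code : List ℕ → ℕ
code []       = 0
code (x ∷ xs) = suc (pair x (code xs))

module _ {m : ℕ} where
  open Regex m using (Range; Exp; [_]; _─_; ε; [^_]; _∣_; _∙_; _⋆)

  codeRange : Range → ℕ
  codeRange [ a ]   = code (toℕ a ∷ [])
  codeRange (a ─ b) = code (toℕ a ∷ toℕ b ∷ [])

  codeExp : Exp → ℕ
  codeExp ε       = code (0 ∷ [])
  codeExp [ rs ]  = code (1 ∷ map codeRange rs)
  codeExp [^ rs ] = code (2 ∷ map codeRange rs)
  codeExp (e ∣ f) = code (3 ∷ codeExp e ∷ codeExp f ∷ [])
  codeExp (e ∙ f) = code (4 ∷ codeExp e ∷ codeExp f ∷ [])
  codeExp (e ⋆)   = code (5 ∷ codeExp e ∷ [])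

codeChannel : Channel → ℕ
codeChannel r = 0
codeChannel l = 1

codeAct : ∀ {m} → Act m → ℕ
codeAct (comm nothing)  = code (0 ∷ [])
codeAct (comm (just x)) = code (1 ∷ toℕ x ∷ [])
codeAct (test R)        = code (2 ∷ codeExp R ∷ [])

codeRule : ∀ {m n} → Rule m n → ℕ
codeRule (rule s c α t) =
  code (toℕ s ∷ codeChannel c ∷ codeAct α ∷ toℕ t ∷ [])

codeInstance : Instance → ℕ
codeInstance I =
  code (m ∷ n₁ ∷ n₂ ∷ code (map codeRule Δ₁) ∷ code (map codeRule Δ₂) ∷
        toℕ pᵢₙ ∷ toℕ qᵢₙ ∷ toℕ p ∷ toℕ q ∷ [])
  where open Instance I

RecurrentReachability : (UCST → Set) → ℕ → Set
RecurrentReachability Class x =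
  ∃[ I ] codeInstance I ≡ x × Class (Instance.system I) × RecurrentlyReachable I

-- Kleene's partial recursive functions, as programs, with their graphs
-- (xs ↦ y whenever f ⟨ xs ⟩⇓ y).

data PR : ℕ → Set where
  zero : ∀ {n} → PR n
  suc  : PR 1
  proj : ∀ {n} → Fin n → PR n
  comp : ∀ {k n} → PR k → Vec (PR n) k → PR n
  rec  : ∀ {n} → PR n → PR (2 + n) → PR (1 + n)
  min  : ∀ {n} → PR (1 + n) → PR n

infix 4 _⟨_⟩⇓_

data _⟨_⟩⇓_ : ∀ {n} → PR n → Vec ℕ n → ℕ → Set where
  zero  : ∀ {n} {xs : Vec ℕ n} → zero ⟨ xs ⟩⇓ 0
  suc   : ∀ {x} → suc ⟨ x ∷ [] ⟩⇓ suc x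
  proj  : ∀ {n} {xs : Vec ℕ n} (i : Fin n) → proj i ⟨ xs ⟩⇓ lookup xs i
  comp  : ∀ {k n} {f : PR k} {gs : Vec (PR n) k} {xs ys z} →
          Pointwise (λ g y → g ⟨ xs ⟩⇓ y) gs ys → f ⟨ ys ⟩⇓ z →
          comp f gs ⟨ xs ⟩⇓ z
  rec-z : ∀ {n} {f : PR n} {g xs y} →
          f ⟨ xs ⟩⇓ y →
          rec f g ⟨ 0 ∷ xs ⟩⇓ y
  rec-s : ∀ {n} {f : PR n} {g xs k y z} →
          rec f g ⟨ k ∷ xs ⟩⇓ y → g ⟨ k ∷ y ∷ xs ⟩⇓ z →
          rec f g ⟨ suc k ∷ xs ⟩⇓ z
  min   : ∀ {n} {f : PR (1 + n)} {xs y} →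
          (∀ k → k < y → ∃[ z ] f ⟨ k ∷ xs ⟩⇓ suc z) → f ⟨ y ∷ xs ⟩⇓ 0 →
          min f ⟨ xs ⟩⇓ y

Recursive : ∀ {n} → (Vec ℕ n → Set) → Set
Recursive {n} R =
  Σ[ f ∈ PR n ] ∀ xs → (R xs × f ⟨ xs ⟩⇓ 1) ⊎ (¬ R xs × f ⟨ xs ⟩⇓ 0)

DecidableSet : (ℕ → Set) → Set
DecidableSet A = Recursive {1} λ xs → A (Vec.head xs)

Σ⁰₁ : (ℕ → Set) → Set₁
Σ⁰₁ A = Σ[ R ∈ (Vec ℕ 2 → Set) ]
  Recursive R × (∀ x → A x ⇔ (∃[ y ] R (x ∷ y ∷ [])))

infix 4 _≤ₘ_

_≤ₘ_ : (ℕ → Set) → (ℕ → Set) → Set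
A ≤ₘ B = Σ[ f ∈ PR 1 ] ∀ x → ∃[ y ] f ⟨ x ∷ [] ⟩⇓ y × (A x ⇔ B y)

Σ⁰₁-Complete : (ℕ → Set) → Set₁
Σ⁰₁-Complete A = Σ⁰₁ A × (∀ B → Σ⁰₁ B → B ≤ₘ A)

{-# OPTIONS --safe #-}

-- By Higman's lemma, the configurations in which r is empty are
-- well-quasi-ordered by the content of l. Hence a recurrent run contains a
-- lasso: a run to (p, q, w) followed by a cycle at (p, q, w) or by a loop of
-- the sender without tests.
--
-- Without tests, a run to (p, q) can be scheduled so that the receiver takes
-- each letter of r as soon as it is written. What remains of l is a Post
-- embedding problem: is there a path in the product of the two agents whose
-- reads form a subword of its writes? Saturation under the almost-full
-- ordering gives a finite certificate when there is none, so that a search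
-- for a lasso or for a certificate always ends.
--
-- For hardness, the receiver forwards the letters of l to r. A cycle on which
-- the sender writes as many letters to l as to r, and on which r is found
-- empty, loses nothing: if it writes U to r and V to l, then U W = W V for
-- the letters W in transit at the test. Thus the sender can use l as a queue,
-- put letters at its end, guess the letters at its front, and execute a
-- counter program in rounds over the queue. The code of the resulting system
-- is a primitive recursive function of parameters of the predicate and of its
-- argument; since this function is the same for all predicates, the diagonal
-- argument needs no universal program.

module Submission where

open import Defs
open import Data.Bool.Base using (Bool; true; false; if_then_else_)
open import Data.Empty using (⊥; ⊥-elim)
open import Data.Fin.Base as Fin using (Fin; zero; suc; toℕ; fromℕ<; _↑ˡ_; _↑ʳ_; splitAt)
open import Data.Fin using (#_)
open import Data.Fin.Patterns using (0F; 1F; 2F; 3F; 4F; 5F; 6F; 7F; 8F; 9F)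
import Data.Fin.Properties as Finₚ
open import Data.List.Base as List using (List; []; _∷_; _++_; fromMaybe; map; length; foldl; reverse; _ʳ++_; concatMap; allFin; downFrom; removeAt)
import Data.List.Properties as Listₚ
open import Data.List.Membership.Propositional using (_∈_; find; lose)
open import Data.List.Membership.Propositional.Properties using (∈-filter⁺; ∈-filter⁻; ∈-downFrom⁺; ∈-downFrom⁻; ∈-map⁺; ∈-map⁻; ∈-++⁺ˡ; ∈-++⁺ʳ; ∈-++⁻; ∈-allFin; ∈-concatMap⁺)
open import Data.List.Relation.Unary.All as All using (All; []; _∷_)
import Data.List.Relation.Unary.All.Properties as Allₚ
open import Data.List.Relation.Unary.Any as Any using (Any; here; there; any?)
import Data.List.Relation.Unary.Any.Properties as Anyₚ
open import Data.List.Relation.Binary.Sublist.Propositional using (_⊆_; []; _∷_; _∷ʳ_; ⊆-refl; ⊆-trans; minimum)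
import Data.List.Relation.Binary.Sublist.Propositional.Properties as Subₚ
open import Data.Maybe.Base using (Maybe; just; nothing)
import Data.Maybe.Properties as Maybeₚ
import Data.Product.Properties as Productₚ
import Data.List.Relation.Binary.Sublist.DecPropositional as DecSublist
open import Data.Nat.Base
open import Data.Nat.Properties hiding (suc-injective)
import Data.Nat.Properties as ℕₚ
open import Data.Nat.Induction using (<-wellFounded)
open import Data.Product.Base using (Σ-syntax; ∃-syntax; _×_; _,_; proj₁; proj₂; map₁; map₂; uncurry)
open import Data.Sum.Base using (_⊎_; inj₁; inj₂; [_,_]′)
import Data.Sum.Base as Sum
open import Data.Unit.Base using (⊤; tt)
open import Data.Vec.Base as Vec using (Vec; []; _∷_; lookup; tabulate)
import Data.Vec.Properties as Vecₚ
open import Data.Vec.Relation.Binary.Pointwise.Inductive using (Pointwise; []; _∷_)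
open import Function.Base using (_∘_; id; case_of_; flip; const)
open import Function.Bundles using (_⇔_; mk⇔; Equivalence)
open import Induction.WellFounded using (Acc; acc)
open import Relation.Binary.Construct.Closure.ReflexiveTransitive as Star using (Star; ε; _◅_; _◅◅_)
open import Relation.Binary.Construct.Closure.Transitive using (TransClosure; [_]; _∷_)
open import Relation.Binary.Definitions using (tri<; tri≈; tri>)
open import Relation.Binary.PropositionalEquality using (_≡_; _≢_; refl; sym; trans; cong; cong₂; subst; subst₂; module ≡-Reasoning)
open import Relation.Nullary.Decidable.Core using (Dec; yes; no; does; map′; _×-dec_; ¬?)
open import Relation.Nullary.Negation.Core using (¬_; contradiction)

-- Coding of lists by numbers

next : ℕ × ℕ → ℕ × ℕ
next (zero , b)  = suc b , zero
next (suc a , b) = a , suc b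

unpair : ℕ → ℕ × ℕ
unpair zero    = 0 , 0
unpair (suc n) = next (unpair n)

pair-suc : ∀ a b → pair a (suc b) ≡ suc (pair (suc a) b)
pair-suc a b rewrite +-suc a b = +-suc (suc (a + b) + triangle (a + b)) b

pair-zero : ∀ a → pair (suc a) 0 ≡ suc (pair 0 a)
pair-zero a rewrite +-identityʳ a =
  cong suc (trans (+-identityʳ _) (+-comm a (triangle a)))

pair-next : ∀ p → uncurry pair (next p) ≡ suc (uncurry pair p)
pair-next (zero , b)  = pair-zero b
pair-next (suc a , b) = pair-suc a b

pair-unpair : ∀ n → uncurry pair (unpair n) ≡ n
pair-unpair zero    = refl
pair-unpair (suc n) = trans (pair-next (unpair n)) (cong suc (pair-unpair n))

unpair-pair : ∀ a b → unpair (pair a b) ≡ (a , b)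
unpair-pair a b = go (a + b) a b refl
  where
  go : ∀ s a b → a + b ≡ s → unpair (pair a b) ≡ (a , b)
  go zero    zero    zero    _  = refl
  go (suc s) (suc a) zero    eq = trans (cong unpair (pair-zero a))
    (cong next (go s 0 a (ℕₚ.suc-injective (trans (cong suc (sym (+-identityʳ a))) eq))))
  go s       a       (suc b) eq = trans (cong unpair (pair-suc a b))
    (cong next (go s (suc a) b (trans (sym (+-suc a b)) eq)))

pair-injective : ∀ a b c d → pair a b ≡ pair c d → a ≡ c × b ≡ d
pair-injective a b c d eq = cong proj₁ p , cong proj₂ p
  where p = trans (sym (unpair-pair a b)) (trans (cong unpair eq) (unpair-pair c d))

pair≥₂ : ∀ a b → b ≤ pair a b
pair≥₂ a b = m≤n+m b (triangle (a + b))

hd tl : ℕ → ℕ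
hd zero    = 0
hd (suc n) = proj₁ (unpair n)
tl zero    = 0
tl (suc n) = proj₂ (unpair n)

-- Opaque, since conversion checking must not unfold Cantor's polynomial.

opaque
  cons : ℕ → ℕ → ℕ
  cons a b = suc (pair a b)

  cons-def : ∀ a b → cons a b ≡ suc (pair a b)
  cons-def a b = refl

cons≢0 : ∀ {a b} → cons a b ≢ 0
cons≢0 {a} {b} eq with trans (sym (cons-def a b)) eq
... | ()

cons-injective : ∀ {a b c d} → cons a b ≡ cons c d → a ≡ c × b ≡ d
cons-injective {a} {b} {c} {d} eq = pair-injective a b c d
  (ℕₚ.suc-injective (trans (sym (cons-def a b)) (trans eq (cons-def c d))))

cons-hd-tl : ∀ n → cons (hd (suc n)) (tl (suc n)) ≡ suc n
cons-hd-tl n = trans (cons-def _ _) (cong suc (pair-unpair n))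

hd-cons : ∀ a b → hd (cons a b) ≡ a
hd-cons a b = trans (cong hd (cons-def a b)) (cong proj₁ (unpair-pair a b))

tl-cons : ∀ a b → tl (cons a b) ≡ b
tl-cons a b = trans (cong tl (cons-def a b)) (cong proj₂ (unpair-pair a b))

tl-≤ : ∀ n → tl (suc n) ≤ n
tl-≤ n = ≤-trans (pair≥₂ (hd (suc n)) (tl (suc n))) (≤-reflexive (pair-unpair n))

encode : List ℕ → ℕ
encode []       = 0
encode (x ∷ xs) = cons x (encode xs)

encode≡code : ∀ xs → encode xs ≡ code xs
encode≡code []       = refl
encode≡code (x ∷ xs) = trans (cons-def x _) (cong (λ k → suc (pair x k)) (encode≡code xs))

encode-injective : ∀ xs ys → encode xs ≡ encode ys → xs ≡ ys
encode-injective []       []       _  = refl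
encode-injective []       (y ∷ ys) eq = contradiction (sym eq) cons≢0
encode-injective (x ∷ xs) []       eq = contradiction eq cons≢0
encode-injective (x ∷ xs) (y ∷ ys) eq with cons-injective eq
... | refl , eq′ = cong (x ∷_) (encode-injective xs ys eq′)

opaque
  private
   decode′ : ℕ → ℕ → List ℕ
   decode′ zero    _       = []
   decode′ (suc k) zero    = []
   decode′ (suc k) (suc n) = hd (suc n) ∷ decode′ k (tl (suc n))

   encode-decode′ : ∀ k n → n ≤ k → encode (decode′ k n) ≡ n
   encode-decode′ zero    zero    _       = refl
   encode-decode′ (suc k) zero    _       = refl
   encode-decode′ (suc k) (suc n) (s≤s le)
     rewrite encode-decode′ k (tl (suc n)) (≤-trans (tl-≤ n) le) = cons-hd-tl n

  decode : ℕ → List ℕ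
  decode n = decode′ n n

  encode-decode : ∀ n → encode (decode n) ≡ n
  encode-decode n = encode-decode′ n n ≤-refl

decode-encode : ∀ xs → decode (encode xs) ≡ xs
decode-encode xs = encode-injective _ _ (encode-decode (encode xs))

decode-cons : ∀ a b → decode (cons a b) ≡ a ∷ decode b
decode-cons a b = trans (cong (decode ∘ cons a) (sym (encode-decode b))) (decode-encode (a ∷ decode b))

decode-hd-tl : ∀ n → decode (suc n) ≡ hd (suc n) ∷ decode (tl (suc n))
decode-hd-tl n = trans (cong decode (sym (cons-hd-tl n))) (decode-cons _ _)

-- Total functions computed by programs

Computes : ∀ {n} → PR n → (Vec ℕ n → ℕ) → Set
Computes g f = ∀ xs → g ⟨ xs ⟩⇓ f xs

Fun : (n : ℕ) → (Vec ℕ n → ℕ) → Set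
Fun n f = Σ[ g ∈ PR n ] Computes g f

⇓-deterministic : ∀ {n} {f : PR n} {xs y z} → f ⟨ xs ⟩⇓ y → f ⟨ xs ⟩⇓ z → y ≡ z
⇓*-deterministic : ∀ {k n} {gs : Vec (PR n) k} {xs ys zs} →
  Pointwise (λ g y → g ⟨ xs ⟩⇓ y) gs ys → Pointwise (λ g y → g ⟨ xs ⟩⇓ y) gs zs → ys ≡ zs
⇓-deterministic zero       zero       = refl
⇓-deterministic suc        suc        = refl
⇓-deterministic (proj i)   (proj .i)  = refl
⇓-deterministic (comp p d) (comp q e) with refl ← ⇓*-deterministic p q = ⇓-deterministic d e
⇓-deterministic (rec-z d)  (rec-z e)  = ⇓-deterministic d e
⇓-deterministic (rec-s d d′) (rec-s e e′) with refl ← ⇓-deterministic d e = ⇓-deterministic d′ e′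
⇓-deterministic {y = y} {z} (min p d) (min q e) with <-cmp y z
... | tri< y<z _ _ = contradiction (⇓-deterministic d (proj₂ (q y y<z))) λ ()
... | tri≈ _ eq _  = eq
... | tri> _ _ z<y = contradiction (⇓-deterministic e (proj₂ (p z z<y))) λ ()
⇓*-deterministic []       []       = refl
⇓*-deterministic (d ∷ ds) (e ∷ es) = cong₂ _∷_ (⇓-deterministic d e) (⇓*-deterministic ds es)

data Funs (n : ℕ) : ∀ {k} → (Vec ℕ n → Vec ℕ k) → Set where
  []  : Funs n (λ _ → [])
  _∷_ : ∀ {k f} {h : Vec ℕ n → Vec ℕ k} → Fun n f → Funs n h → Funs n (λ xs → f xs ∷ h xs)

progs : ∀ {n k} {h : Vec ℕ n → Vec ℕ k} → Funs n h → Vec (PR n) k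
progs []            = []
progs ((g , _) ∷ F) = g ∷ progs F

progs⇓ : ∀ {n k} {h : Vec ℕ n → Vec ℕ k} (F : Funs n h) xs → Pointwise (λ g y → g ⟨ xs ⟩⇓ y) (progs F) (h xs)
progs⇓ []            xs = []
progs⇓ ((g , c) ∷ F) xs = c xs ∷ progs⇓ F xs

compᶠ : ∀ {n k f} {h : Vec ℕ n → Vec ℕ k} → Fun k f → Funs n h → Fun n (f ∘ h)
compᶠ {h = h} (g , c) F = comp g (progs F) , λ xs → comp (progs⇓ F xs) (c (h xs))

projᶠ : ∀ {n} (i : Fin n) → Fun n (λ xs → lookup xs i)
projᶠ i = proj i , λ xs → proj i

projsᶠ : ∀ {n k} (θ : Fin k → Fin n) → Funs n (λ xs → tabulate (lookup xs ∘ θ))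
projsᶠ {k = zero}  θ = []
projsᶠ {k = suc k} θ = projᶠ (θ zero) ∷ projsᶠ (θ ∘ suc)

sucᶠ : ∀ {n f} → Fun n f → Fun n (λ xs → suc (f xs))
sucᶠ F = compᶠ {f = λ xs → suc (lookup xs 0F)} (suc , λ where (x ∷ []) → suc) (F ∷ [])

zeroᶠ : ∀ {n} → Fun n (λ _ → 0)
zeroᶠ = zero , λ _ → zero

litᶠ : ∀ {n} k → Fun n (λ _ → k)
litᶠ zero    = zeroᶠ
litᶠ (suc k) = sucᶠ (litᶠ k)

extᶠ : ∀ {n f f′} → (∀ xs → f xs ≡ f′ xs) → Fun n f → Fun n f′
extᶠ eq (g , c) = g , λ xs → subst (g ⟨ xs ⟩⇓_) (eq xs) (c xs)

primrec : ∀ {n} → (Vec ℕ n → ℕ) → (Vec ℕ (2 + n) → ℕ) → ℕ → Vec ℕ n → ℕ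
primrec f g zero    xs = f xs
primrec f g (suc k) xs = g (k ∷ primrec f g k xs ∷ xs)

recᶠ : ∀ {n f g} → Fun n f → Fun (2 + n) g → Fun (1 + n) (λ xs → primrec f g (Vec.head xs) (Vec.tail xs))
recᶠ {f = f} {g} (F , c) (G , d) = rec F G , λ where (k ∷ xs) → go k xs
  where
  go : ∀ k xs → rec F G ⟨ k ∷ xs ⟩⇓ primrec f g k xs
  go zero    xs = rec-z (c xs)
  go (suc k) xs = rec-s (go k xs) (d _)

private
  v0 : ∀ {n} → Fun (1 + n) (λ xs → lookup xs 0F)
  v0 = projᶠ 0F
  v1 : ∀ {n} → Fun (2 + n) (λ xs → lookup xs 1F)
  v1 = projᶠ 1F
  v2 : ∀ {n} → Fun (3 + n) (λ xs → lookup xs 2F)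
  v2 = projᶠ 2F

predᶠ : Fun 1 (λ xs → pred (lookup xs 0F))
predᶠ = extᶠ (λ { (zero ∷ []) → refl ; (suc x ∷ []) → refl }) (recᶠ zeroᶠ v0)

addᶠ : Fun 2 (λ xs → lookup xs 0F + lookup xs 1F)
addᶠ = extᶠ (λ { (x ∷ y ∷ []) → go x y }) (recᶠ v0 (sucᶠ v1))
  where
  go : ∀ x y → primrec {1} (λ xs → lookup xs 0F) (λ xs → suc (lookup xs 1F)) x (y ∷ []) ≡ x + y
  go zero    y = refl
  go (suc x) y = cong suc (go x y)

subᶠ : Fun 2 (λ xs → lookup xs 1F ∸ lookup xs 0F)
subᶠ = extᶠ (λ { (x ∷ y ∷ []) → go x y }) (recᶠ v0 (compᶠ predᶠ (v1 ∷ [])))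
  where
  go : ∀ x y → primrec {1} (λ xs → lookup xs 0F) (λ xs → pred (lookup xs 1F)) x (y ∷ []) ≡ y ∸ x
  go zero    y = refl
  go (suc x) y rewrite go x y = pred[m∸n]≡m∸[1+n] y x

ifz : ℕ → ℕ → ℕ → ℕ
ifz zero    a b = a
ifz (suc _) a b = b

ifzᶠ : Fun 3 (λ xs → ifz (lookup xs 0F) (lookup xs 1F) (lookup xs 2F))
ifzᶠ = extᶠ (λ { (zero ∷ _ ∷ _ ∷ []) → refl ; (suc _ ∷ _ ∷ _ ∷ []) → refl }) (recᶠ v0 (projᶠ 3F))

branch : ∀ {P A : Set} → Dec P → A → A → A
branch (yes _) x _ = x
branch (no  _) _ y = y

ifeq : ℕ → ℕ → ℕ → ℕ → ℕ
ifeq a b c d = branch (a ≟ b) c d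

ifeqᶠ : Fun 4 (λ xs → ifeq (lookup xs 0F) (lookup xs 1F) (lookup xs 2F) (lookup xs 3F))
ifeqᶠ = extᶠ (λ { (a ∷ b ∷ c ∷ d ∷ []) → go a b c d })
  (compᶠ ifzᶠ (compᶠ addᶠ (compᶠ subᶠ (v0 ∷ v1 ∷ []) ∷ compᶠ subᶠ (v1 ∷ v0 ∷ []) ∷ []) ∷ v2 ∷ projᶠ 3F ∷ []))
  where
  dist≡0 : ∀ a → (a ∸ a) + (a ∸ a) ≡ 0
  dist≡0 a rewrite n∸n≡0 a = refl
  dist≢0 : ∀ {a b} → a ≢ b → ∃[ k ] (b ∸ a) + (a ∸ b) ≡ suc k
  dist≢0 {zero}  {zero}  ne = contradiction refl ne
  dist≢0 {zero}  {suc b} ne = b , +-identityʳ (suc b)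
  dist≢0 {suc a} {zero}  ne = a , refl
  dist≢0 {suc a} {suc b} ne = dist≢0 (ne ∘ cong suc)
  go : ∀ a b c d → ifz ((b ∸ a) + (a ∸ b)) c d ≡ ifeq a b c d
  go a b c d with a ≟ b
  ... | yes refl = cong (λ k → ifz k c d) (dist≡0 a)
  ... | no  ne   = cong (λ k → ifz k c d) (proj₂ (dist≢0 ne))

triangleᶠ : Fun 1 (λ xs → triangle (lookup xs 0F))
triangleᶠ = extᶠ (λ { (x ∷ []) → go x }) (recᶠ zeroᶠ (compᶠ addᶠ (sucᶠ v0 ∷ v1 ∷ [])))
  where
  go : ∀ x → primrec {0} (λ _ → 0) (λ xs → suc (lookup xs 0F) + lookup xs 1F) x [] ≡ triangle x
  go zero    = refl
  go (suc x) = cong (suc x +_) (go x)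

consᶠ : Fun 2 (λ xs → cons (lookup xs 0F) (lookup xs 1F))
consᶠ = extᶠ (λ { (a ∷ b ∷ []) → sym (cons-def a b) }) (sucᶠ (compᶠ addᶠ (compᶠ triangleᶠ (addᶠ ∷ []) ∷ v1 ∷ [])))

-- The index a + b of the diagonal of pair a b is obtained without
-- unpairing: it increases exactly when the next triangular number is hit.

diagonalᶠ : Fun 1 (λ xs → proj₁ (unpair (lookup xs 0F)) + proj₂ (unpair (lookup xs 0F)))
diagonalᶠ = extᶠ (λ { (x ∷ []) → go x })
  (recᶠ zeroᶠ (compᶠ ifeqᶠ (compᶠ triangleᶠ (sucᶠ v1 ∷ []) ∷ sucᶠ v0 ∷ sucᶠ v1 ∷ v1 ∷ [])))
  where
  step : ∀ p → let s = proj₁ p + proj₂ p in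
    ifeq (triangle (suc s)) (suc (uncurry pair p)) (suc s) s ≡ proj₁ (next p) + proj₂ (next p)
  step (zero , b) with triangle (suc b) ≟ suc (pair 0 b)
  ... | yes _ = cong suc (sym (+-identityʳ b))
  ... | no ne = contradiction (cong suc (+-comm b (triangle b))) ne
  step (suc a , b) with triangle (suc (suc a + b)) ≟ suc (pair (suc a) b)
  ... | no _   = sym (+-suc a b)
  ... | yes eq = contradiction eq′ (<⇒≢ (s≤s (s≤s (m≤n+m b a))) ∘ sym)
    where
    eq′ : 2 + (a + b) ≡ suc b
    eq′ = +-cancelʳ-≡ (triangle (suc (a + b))) _ _ (trans eq (cong suc (+-comm (triangle (suc (a + b))) b)))
  go : ∀ x → primrec {0} (λ _ → 0) (λ xs → ifeq (triangle (suc (lookup xs 1F))) (suc (lookup xs 0F)) (suc (lookup xs 1F)) (lookup xs 1F)) x []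
       ≡ proj₁ (unpair x) + proj₂ (unpair x)
  go zero    = refl
  go (suc x) rewrite go x = trans
    (cong (λ k → ifeq (triangle (suc s)) (suc k) (suc s) s) (sym (pair-unpair x))) (step (unpair x))
    where s = proj₁ (unpair x) + proj₂ (unpair x)

unpair₂ᶠ : Fun 1 (λ xs → proj₂ (unpair (lookup xs 0F)))
unpair₂ᶠ = extᶠ (λ { (x ∷ []) → go x }) (compᶠ subᶠ (compᶠ triangleᶠ (diagonalᶠ ∷ []) ∷ v0 ∷ []))
  where
  go : ∀ x → x ∸ triangle (proj₁ (unpair x) + proj₂ (unpair x)) ≡ proj₂ (unpair x)
  go x = trans (cong (_∸ triangle (proj₁ (unpair x) + proj₂ (unpair x))) (sym (pair-unpair x)))
    (m+n∸m≡n (triangle (proj₁ (unpair x) + proj₂ (unpair x))) _)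

unpair₁ᶠ : Fun 1 (λ xs → proj₁ (unpair (lookup xs 0F)))
unpair₁ᶠ = extᶠ (λ { (x ∷ []) → m+n∸n≡m _ (proj₂ (unpair x)) }) (compᶠ subᶠ (unpair₂ᶠ ∷ diagonalᶠ ∷ []))

hdᶠ : Fun 1 (λ xs → hd (lookup xs 0F))
hdᶠ = extᶠ (λ { (zero ∷ []) → refl ; (suc x ∷ []) → refl })
  (compᶠ ifzᶠ (v0 ∷ zeroᶠ ∷ compᶠ unpair₁ᶠ (predᶠ ∷ []) ∷ []))

tlᶠ : Fun 1 (λ xs → tl (lookup xs 0F))
tlᶠ = extᶠ (λ { (zero ∷ []) → refl ; (suc x ∷ []) → refl })
  (compᶠ ifzᶠ (v0 ∷ zeroᶠ ∷ compᶠ unpair₂ᶠ (predᶠ ∷ []) ∷ []))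

tails : ℕ → ℕ → ℕ
tails zero    c = c
tails (suc k) c = tl (tails k c)

tailsᶠ : Fun 2 (λ xs → tails (lookup xs 0F) (lookup xs 1F))
tailsᶠ = extᶠ (λ { (x ∷ c ∷ []) → go x c }) (recᶠ v0 (compᶠ tlᶠ (v1 ∷ [])))
  where
  go : ∀ x c → primrec {1} (λ xs → lookup xs 0F) (λ xs → tl (lookup xs 1F)) x (c ∷ []) ≡ tails x c
  go zero    c = refl
  go (suc x) c = cong tl (go x c)

foldCode : ∀ {n} → (Vec ℕ n → ℕ) → (Vec ℕ (2 + n) → ℕ) → ℕ → Vec ℕ n → ℕ
foldCode z f c xs = foldl (λ a x → f (x ∷ a ∷ xs)) (z xs) (decode c)

-- The k-th stage of the recursion has consumed the first k elements;
-- a list has at most as many elements as its code.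

foldᶠ : ∀ {n z f} → Fun n z → Fun (2 + n) f → Fun (1 + n) (λ xs → foldCode z f (Vec.head xs) (Vec.tail xs))
foldᶠ {n} {z} {f} Z F = extᶠ (λ { (c ∷ xs) → correct c xs })
  (compᶠ (recᶠ (wk Z) (compᶠ ifzᶠ (t ∷ v1 ∷ compᶠ F (compᶠ hdᶠ (t ∷ []) ∷ v1 ∷ projsᶠ (3 ↑ʳ_)) ∷ [])))
         (v0 ∷ v0 ∷ projsᶠ (1 ↑ʳ_)))
  where
  wk : Fun n z → Fun (1 + n) (z ∘ Vec.tail)
  wk Z = extᶠ (λ { (_ ∷ xs) → cong z (Vecₚ.tabulate∘lookup xs) }) (compᶠ Z (projsᶠ (1 ↑ʳ_)))
  t : Fun (3 + n) _
  t = compᶠ tailsᶠ (v0 ∷ v2 ∷ [])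
  stage : ∀ c (xs : Vec ℕ n) → ℕ → ℕ
  stage c xs k = primrec (z ∘ Vec.tail) (λ ys → ifz (tails (lookup ys 0F) (lookup ys 2F)) (lookup ys 1F)
    (f (hd (tails (lookup ys 0F) (lookup ys 2F)) ∷ lookup ys 1F ∷ tabulate (lookup ys ∘ (3 ↑ʳ_))))) k (c ∷ xs)
  g : Vec ℕ n → ℕ → ℕ → ℕ
  g xs a x = f (x ∷ a ∷ xs)
  rest : ∀ c xs k → foldl (g xs) (stage c xs k) (decode (tails k c)) ≡ foldCode z f c xs
  rest c xs zero    = refl
  rest c xs (suc k) with tails k c in eq | rest c xs k
  ... | zero  | ih = ih
  ... | suc t | ih rewrite decode-hd-tl t | Vecₚ.tabulate∘lookup xs = ih
  empty : ∀ c k → c ≤ k → tails k c ≡ 0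
  empty zero    zero    _  = refl
  empty c       (suc k) le with c ≤? k
  ... | yes c≤k rewrite empty c k c≤k = refl
  ... | no  c≰k with ≤-antisym le (≰⇒> c≰k)
  ... | refl = n≤0⇒n≡0 (≤-trans (lem (suc k) (suc k)) (≤-reflexive (n∸n≡0 k)))
    where
    lem : ∀ c k → tails k c ≤ c ∸ k
    lem c zero    = ≤-refl
    lem c (suc k) with tails k c | lem c k
    ... | zero  | _  = z≤n
    ... | suc t | le = ≤-trans (tl-≤ t) (≤-trans (pred-mono-≤ le) (≤-reflexive (pred[m∸n]≡m∸[1+n] c k)))
  correct : ∀ c xs → stage c (tabulate (λ i → lookup xs i)) c ≡ foldCode z f c xs
  correct c xs rewrite Vecₚ.tabulate∘lookup xs = trans
    (cong (foldl (g xs) (stage c xs c)) (sym (trans (cong decode (empty c c ≤-refl)) (decode-encode [])))) (rest c xs c)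

-- A language of terms and of decidable formulas

infix  6 _≐_
infixr 5 _∧_
infixr 4 _∨_

data Tm : ℕ → Set where
  var  : ∀ {n} → Fin n → Tm n
  lit  : ∀ {n} → ℕ → Tm n
  suc  : ∀ {n} → Tm n → Tm n
  consᵗ : ∀ {n} → Tm n → Tm n → Tm n
  tlᵗ  : ∀ {n} → Tm n → Tm n
  ifeqᵗ : ∀ {n} → Tm n → Tm n → Tm n → Tm n → Tm n
  rec  : ∀ {n} → Tm n → Tm n → Tm (2 + n) → Tm n
  fold : ∀ {n} → Tm n → Tm n → Tm (2 + n) → Tm n
  call : ∀ {n k} → Tm k → Vec (Tm n) k → Tm n

data Fm : ℕ → Set where
  _≐_  : ∀ {n} → Tm n → Tm n → Fm n
  _∧_  : ∀ {n} → Fm n → Fm n → Fm n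
  _∨_  : ∀ {n} → Fm n → Fm n → Fm n
  neg  : ∀ {n} → Fm n → Fm n
  all∈ : ∀ {n} → Tm n → Fm (1 + n) → Fm n
  any∈ : ∀ {n} → Tm n → Fm (1 + n) → Fm n
  view : ∀ {n} k → Tm n → Fm (k + n) → Fm n
  call : ∀ {n k} → Fm k → Vec (Tm n) k → Fm n

⟦_⟧ᵗ  : ∀ {n} → Tm n → Vec ℕ n → ℕ
⟦_⟧ᵗˢ : ∀ {n k} → Vec (Tm n) k → Vec ℕ n → Vec ℕ k
⟦ var i ⟧ᵗ xs        = lookup xs i
⟦ lit k ⟧ᵗ xs        = k
⟦ suc t ⟧ᵗ xs        = suc (⟦ t ⟧ᵗ xs)
⟦ consᵗ s t ⟧ᵗ xs     = cons (⟦ s ⟧ᵗ xs) (⟦ t ⟧ᵗ xs)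
⟦ tlᵗ t ⟧ᵗ xs         = tl (⟦ t ⟧ᵗ xs)
⟦ ifeqᵗ s t u v ⟧ᵗ xs = ifeq (⟦ s ⟧ᵗ xs) (⟦ t ⟧ᵗ xs) (⟦ u ⟧ᵗ xs) (⟦ v ⟧ᵗ xs)
⟦ rec t z s ⟧ᵗ xs    = primrec ⟦ z ⟧ᵗ ⟦ s ⟧ᵗ (⟦ t ⟧ᵗ xs) xs
⟦ fold t z s ⟧ᵗ xs   = foldCode ⟦ z ⟧ᵗ ⟦ s ⟧ᵗ (⟦ t ⟧ᵗ xs) xs
⟦ call t ts ⟧ᵗ xs    = ⟦ t ⟧ᵗ (⟦ ts ⟧ᵗˢ xs)
⟦ [] ⟧ᵗˢ xs          = []
⟦ t ∷ ts ⟧ᵗˢ xs      = ⟦ t ⟧ᵗ xs ∷ ⟦ ts ⟧ᵗˢ xs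

⟦_⟧ : ∀ {n} → Fm n → Vec ℕ n → Set
⟦ s ≐ t ⟧ xs      = ⟦ s ⟧ᵗ xs ≡ ⟦ t ⟧ᵗ xs
⟦ φ ∧ ψ ⟧ xs      = ⟦ φ ⟧ xs × ⟦ ψ ⟧ xs
⟦ φ ∨ ψ ⟧ xs      = ⟦ φ ⟧ xs ⊎ ⟦ ψ ⟧ xs
⟦ neg φ ⟧ xs      = ¬ ⟦ φ ⟧ xs
⟦ all∈ t φ ⟧ xs   = All (λ a → ⟦ φ ⟧ (a ∷ xs)) (decode (⟦ t ⟧ᵗ xs))
⟦ any∈ t φ ⟧ xs   = Any (λ a → ⟦ φ ⟧ (a ∷ xs)) (decode (⟦ t ⟧ᵗ xs))
⟦ view k t φ ⟧ xs = Σ[ as ∈ Vec ℕ k ] ⟦ t ⟧ᵗ xs ≡ encode (Vec.toList as) × ⟦ φ ⟧ (as Vec.++ xs)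
⟦ call φ ts ⟧ xs  = ⟦ φ ⟧ (⟦ ts ⟧ᵗˢ xs)

encode-toList-injective : ∀ {k} (as bs : Vec ℕ k) → encode (Vec.toList as) ≡ encode (Vec.toList bs) → as ≡ bs
encode-toList-injective []       []       _  = refl
encode-toList-injective (a ∷ as) (b ∷ bs) eq with cons-injective eq
... | refl , eq′ = cong (a ∷_) (encode-toList-injective as bs eq′)

view⁻ : ∀ {n k xs} {t : Tm n} (φ : Fm (k + n)) (as : Vec ℕ k) → ⟦ t ⟧ᵗ xs ≡ encode (Vec.toList as) →
  ⟦ view k t φ ⟧ xs → ⟦ φ ⟧ (as Vec.++ xs)
view⁻ {xs = xs} φ as eq (bs , eq′ , h) =
  subst (λ as → ⟦ φ ⟧ (as Vec.++ xs)) (encode-toList-injective bs as (trans (sym eq′) eq)) h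

funᵗ  : ∀ {n} (t : Tm n) → Fun n ⟦ t ⟧ᵗ
funsᵗ : ∀ {n k} (ts : Vec (Tm n) k) → Funs n ⟦ ts ⟧ᵗˢ
idᶠ   : ∀ {n} → Funs n (λ xs → tabulate (lookup xs))
idᶠ = projsᶠ id
funᵗ (var i)        = projᶠ i
funᵗ (lit k)        = litᶠ k
funᵗ (suc t)        = sucᶠ (funᵗ t)
funᵗ (consᵗ s t)     = compᶠ consᶠ (funᵗ s ∷ funᵗ t ∷ [])
funᵗ (tlᵗ t)         = compᶠ tlᶠ (funᵗ t ∷ [])
funᵗ (ifeqᵗ s t u v) = compᶠ ifeqᶠ (funᵗ s ∷ funᵗ t ∷ funᵗ u ∷ funᵗ v ∷ [])
funᵗ (rec t z s)    = extᶠ (λ xs → cong (primrec ⟦ z ⟧ᵗ ⟦ s ⟧ᵗ (⟦ t ⟧ᵗ xs)) (Vecₚ.tabulate∘lookup xs))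
  (compᶠ (recᶠ (funᵗ z) (funᵗ s)) (funᵗ t ∷ idᶠ))
funᵗ (fold t z s)   = extᶠ (λ xs → cong (foldCode ⟦ z ⟧ᵗ ⟦ s ⟧ᵗ (⟦ t ⟧ᵗ xs)) (Vecₚ.tabulate∘lookup xs))
  (compᶠ (foldᶠ (funᵗ z) (funᵗ s)) (funᵗ t ∷ idᶠ))
funᵗ (call t ts)    = compᶠ (funᵗ t) (funsᵗ ts)
funsᵗ []            = []
funsᵗ (t ∷ ts)      = funᵗ t ∷ funsᵗ ts

Char : ∀ {n} → (Vec ℕ n → Set) → Set
Char {n} R = Σ[ χ ∈ (Vec ℕ n → ℕ) ] Fun n χ × (∀ xs → (R xs × χ xs ≡ 1) ⊎ (¬ R xs × χ xs ≡ 0))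

nths : ∀ k → ℕ → Vec ℕ k
nths zero    c = []
nths (suc k) c = hd c ∷ nths k (tl c)

nths-encode : ∀ {k} (as : Vec ℕ k) → nths k (encode (Vec.toList as)) ≡ as
nths-encode []       = refl
nths-encode (a ∷ as) = cong₂ _∷_ (hd-cons a _) (trans (cong (nths _) (tl-cons a _)) (nths-encode as))

nthsᶠ : ∀ {n f} k → Fun n f → Funs n (nths k ∘ f)
nthsᶠ zero    F = []
nthsᶠ (suc k) F = compᶠ hdᶠ (F ∷ []) ∷ nthsᶠ k (compᶠ tlᶠ (F ∷ []))

codeᶠ : ∀ {n k} {h : Vec ℕ n → Vec ℕ k} → Funs n h → Fun n (λ xs → encode (Vec.toList (h xs)))
codeᶠ []      = zeroᶠ
codeᶠ (F ∷ G) = compᶠ consᶠ (F ∷ codeᶠ G ∷ [])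

_++ᶠ_ : ∀ {n k l} {h : Vec ℕ n → Vec ℕ k} {h′ : Vec ℕ n → Vec ℕ l} →
  Funs n h → Funs n h′ → Funs n (λ xs → h xs Vec.++ h′ xs)
[]      ++ᶠ H = H
(F ∷ G) ++ᶠ H = F ∷ (G ++ᶠ H)

module _ {P : ℕ → Set} (χ : ℕ → ℕ) (ok : ∀ x → (P x × χ x ≡ 1) ⊎ (¬ P x × χ x ≡ 0)) where

  foldl-any : ∀ xs → let v = foldl (λ a x → ifz (χ x) a 1) 0 xs in (Any P xs × v ≡ 1) ⊎ (¬ Any P xs × v ≡ 0)
  foldl-any []       = inj₂ ((λ ()) , refl)
  foldl-any (x ∷ xs) with χ x | ok x
  ... | .1 | inj₁ (p , refl) = inj₁ (here p , found xs)
    where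
    found : ∀ xs → foldl (λ a x → ifz (χ x) a 1) 1 xs ≡ 1
    found []       = refl
    found (x ∷ xs) with χ x
    ... | zero  = found xs
    ... | suc _ = found xs
  ... | .0 | inj₂ (np , refl) with foldl-any xs
  ... | inj₁ (a , eq) = inj₁ (there a , eq)
  ... | inj₂ (na , eq) = inj₂ ((λ { (here p) → np p ; (there a) → na a }) , eq)

  foldl-all : ∀ xs → let v = foldl (λ a x → ifz (χ x) 0 a) 1 xs in (All P xs × v ≡ 1) ⊎ (¬ All P xs × v ≡ 0)
  foldl-all []       = inj₁ ([] , refl)
  foldl-all (x ∷ xs) with χ x | ok x
  ... | .0 | inj₂ (np , refl) = inj₂ ((λ { (p ∷ _) → np p }) , failed xs)
    where
    failed : ∀ xs → foldl (λ a x → ifz (χ x) 0 a) 0 xs ≡ 0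
    failed []       = refl
    failed (x ∷ xs) with χ x
    ... | zero  = failed xs
    ... | suc _ = failed xs
  ... | .1 | inj₁ (p , refl) with foldl-all xs
  ... | inj₁ (a , eq) = inj₁ (p ∷ a , eq)
  ... | inj₂ (na , eq) = inj₂ ((λ { (_ ∷ a) → na a }) , eq)

charᶠ : ∀ {n} (φ : Fm n) → Char ⟦ φ ⟧
charᶠ (s ≐ t) = _ , compᶠ ifeqᶠ (funᵗ s ∷ funᵗ t ∷ litᶠ 1 ∷ litᶠ 0 ∷ []) , λ xs → go (⟦ s ⟧ᵗ xs) (⟦ t ⟧ᵗ xs)
  where
  go : ∀ a b → (a ≡ b × ifeq a b 1 0 ≡ 1) ⊎ (¬ a ≡ b × ifeq a b 1 0 ≡ 0)
  go a b with a ≟ b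
  ... | yes eq = inj₁ (eq , refl)
  ... | no  ne = inj₂ (ne , refl)
charᶠ (φ ∧ ψ) with χ , F , ok ← charᶠ φ | χ′ , F′ , ok′ ← charᶠ ψ =
  _ , compᶠ ifzᶠ (F ∷ litᶠ 0 ∷ F′ ∷ []) , go
  where
  go : ∀ xs → ((⟦ φ ⟧ xs × ⟦ ψ ⟧ xs) × ifz (χ xs) 0 (χ′ xs) ≡ 1) ⊎ (¬ (⟦ φ ⟧ xs × ⟦ ψ ⟧ xs) × ifz (χ xs) 0 (χ′ xs) ≡ 0)
  go xs with χ xs | ok xs
  ... | .0 | inj₂ (n , refl) = inj₂ (n ∘ proj₁ , refl)
  ... | .1 | inj₁ (p , refl) = Sum.map (map₁ (p ,_)) (map₁ (_∘ proj₂)) (ok′ xs)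
charᶠ (φ ∨ ψ) with χ , F , ok ← charᶠ φ | χ′ , F′ , ok′ ← charᶠ ψ =
  _ , compᶠ ifzᶠ (F ∷ F′ ∷ litᶠ 1 ∷ []) , go
  where
  go : ∀ xs → ((⟦ φ ⟧ xs ⊎ ⟦ ψ ⟧ xs) × ifz (χ xs) (χ′ xs) 1 ≡ 1) ⊎ (¬ (⟦ φ ⟧ xs ⊎ ⟦ ψ ⟧ xs) × ifz (χ xs) (χ′ xs) 1 ≡ 0)
  go xs with χ xs | ok xs
  ... | .0 | inj₂ (n , refl) = Sum.map (map₁ inj₂) (map₁ (λ n′ → [ n , n′ ]′)) (ok′ xs)
  ... | .1 | inj₁ (p , refl) = inj₁ (inj₁ p , refl)
charᶠ (neg φ) with χ , F , ok ← charᶠ φ = _ , compᶠ ifzᶠ (F ∷ litᶠ 1 ∷ litᶠ 0 ∷ []) , go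
  where
  go : ∀ xs → ((¬ ⟦ φ ⟧ xs) × ifz (χ xs) 1 0 ≡ 1) ⊎ (¬ ¬ ⟦ φ ⟧ xs × ifz (χ xs) 1 0 ≡ 0)
  go xs with χ xs | ok xs
  ... | .0 | inj₂ (n , refl) = inj₁ (n , refl)
  ... | .1 | inj₁ (p , refl) = inj₂ ((λ n → n p) , refl)
charᶠ (all∈ t φ) with χ , F , ok ← charᶠ φ =
  _ , extᶠ (λ xs → cong (foldCode (λ _ → 1) (body χ) (⟦ t ⟧ᵗ xs)) (Vecₚ.tabulate∘lookup xs))
        (compᶠ (foldᶠ {z = λ _ → 1} {f = body χ} (litᶠ 1)
          (extᶠ (λ { (_ ∷ _ ∷ ys) → cong (λ zs → ifz (χ (_ ∷ zs)) 0 _) (Vecₚ.tabulate∘lookup ys) })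
            (compᶠ ifzᶠ (compᶠ F (projᶠ 0F ∷ projsᶠ (2 ↑ʳ_)) ∷ litᶠ 0 ∷ projᶠ 1F ∷ [])))) (funᵗ t ∷ idᶠ))
    , λ xs → foldl-all (λ x → χ (x ∷ xs)) (λ x → ok (x ∷ xs)) (decode (⟦ t ⟧ᵗ xs))
  where
  body : (Vec ℕ _ → ℕ) → Vec ℕ _ → ℕ
  body χ ys = ifz (χ (lookup ys 0F ∷ Vec.tail (Vec.tail ys))) 0 (lookup ys 1F)
charᶠ (any∈ t φ) with χ , F , ok ← charᶠ φ =
  _ , extᶠ (λ xs → cong (foldCode (λ _ → 0) (body χ) (⟦ t ⟧ᵗ xs)) (Vecₚ.tabulate∘lookup xs))
        (compᶠ (foldᶠ {z = λ _ → 0} {f = body χ} (litᶠ 0)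
          (extᶠ (λ { (_ ∷ _ ∷ ys) → cong (λ zs → ifz (χ (_ ∷ zs)) _ 1) (Vecₚ.tabulate∘lookup ys) })
            (compᶠ ifzᶠ (compᶠ F (projᶠ 0F ∷ projsᶠ (2 ↑ʳ_)) ∷ projᶠ 1F ∷ litᶠ 1 ∷ [])))) (funᵗ t ∷ idᶠ))
    , λ xs → foldl-any (λ x → χ (x ∷ xs)) (λ x → ok (x ∷ xs)) (decode (⟦ t ⟧ᵗ xs))
  where
  body : (Vec ℕ _ → ℕ) → Vec ℕ _ → ℕ
  body χ ys = ifz (χ (lookup ys 0F ∷ Vec.tail (Vec.tail ys))) (lookup ys 1F) 1
charᶠ (view k t φ) with χ , F , ok ← charᶠ φ =
  _ , compᶠ ifeqᶠ (funᵗ t ∷ codeᶠ (nthsᶠ k (funᵗ t)) ∷ compᶠ F (nthsᶠ k (funᵗ t) ++ᶠ idᶠ) ∷ litᶠ 0 ∷ []) , go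
  where
  go : ∀ xs → let c = ⟦ t ⟧ᵗ xs ; v = ifeq c (encode (Vec.toList (nths k c))) (χ (nths k c Vec.++ tabulate (lookup xs))) 0 in
    (⟦ view k t φ ⟧ xs × v ≡ 1) ⊎ (¬ ⟦ view k t φ ⟧ xs × v ≡ 0)
  go xs with ⟦ t ⟧ᵗ xs ≟ encode (Vec.toList (nths k (⟦ t ⟧ᵗ xs)))
  ... | no ne = inj₂ ((λ (as , eq , _) → ne (trans eq (cong (encode ∘ Vec.toList)
                  (sym (trans (cong (nths k) eq) (nths-encode as)))))) , refl)
  ... | yes eq rewrite Vecₚ.tabulate∘lookup xs =
    Sum.map (map₁ (λ h → _ , eq , h)) (map₁ (_∘ view⁻ {t = t} φ _ eq)) (ok (nths k (⟦ t ⟧ᵗ xs) Vec.++ xs))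
charᶠ (call φ ts) with χ , F , ok ← charᶠ φ = _ , compᶠ F (funsᵗ ts) , λ xs → ok (⟦ ts ⟧ᵗˢ xs)

recursive : ∀ {n} (φ : Fm n) → Recursive ⟦ φ ⟧
recursive φ with χ , (g , c) , ok ← charᶠ φ = g , λ xs →
  Sum.map (map₂ (λ eq → subst (g ⟨ xs ⟩⇓_) eq (c xs))) (map₂ (λ eq → subst (g ⟨ xs ⟩⇓_) eq (c xs))) (ok xs)

-- Post's theorem

post : ∀ {A : ℕ → Set} (φ ψ : Fm 2) →
  (∀ x y → ⟦ φ ⟧ (x ∷ y ∷ []) → A x) → (∀ x y → ⟦ ψ ⟧ (x ∷ y ∷ []) → ¬ A x) →
  (∀ x → (∃[ y ] ⟦ φ ⟧ (x ∷ y ∷ [])) ⊎ (∃[ y ] ⟦ ψ ⟧ (x ∷ y ∷ []))) → DecidableSet A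
post {A} φ ψ sound refute complete
  with χ , (g , c) , ok ← charᶠ (call (neg (φ ∨ ψ)) (var 1F ∷ var 0F ∷ []))
     | h , d ← recursive φ
  = comp h (proj zero ∷ min g ∷ []) , λ where (x ∷ []) → decide x
  where
  least : ∀ x n y → (∀ k → k < n → χ (k ∷ x ∷ []) ≡ 1) → ⟦ φ ∨ ψ ⟧ (x ∷ n + y ∷ []) →
    ∃[ z ] min g ⟨ x ∷ [] ⟩⇓ z × (⟦ φ ⟧ (x ∷ z ∷ []) ⊎ ⟦ ψ ⟧ (x ∷ z ∷ []))
  least x n y below found with ok (n ∷ x ∷ []) | charᶠ (φ ∨ ψ)
  least x n zero    below found | inj₁ (nn , _) | _ =
    contradiction (subst (λ k → ⟦ φ ∨ ψ ⟧ (x ∷ k ∷ [])) (+-identityʳ n) found) nn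
  least x n (suc y) below found | inj₁ (nn , eq) | _ = least x (suc n) y
    (λ k k<sn → case m≤n⇒m<n∨m≡n (s≤s⁻¹ k<sn) of λ { (inj₁ k<n) → below k k<n ; (inj₂ refl) → eq })
    (subst (λ k → ⟦ φ ∨ ψ ⟧ (x ∷ k ∷ [])) (+-suc n y) found)
  ... | inj₂ (nn , eq) | _ , _ , ok′ with ok′ (x ∷ n ∷ [])
  ... | inj₁ (p , _) = n , min (λ k k<n → 0 , subst (g ⟨ _ ⟩⇓_) (below k k<n) (c _)) (subst (g ⟨ _ ⟩⇓_) eq (c _)) , p
  ... | inj₂ (n′ , _) = contradiction n′ nn
  decide : ∀ x → (A x × comp h (proj zero ∷ min g ∷ []) ⟨ x ∷ [] ⟩⇓ 1) ⊎ (¬ A x × comp h (proj zero ∷ min g ∷ []) ⟨ x ∷ [] ⟩⇓ 0)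
  decide x with y , p ← [ map₂ inj₁ , map₂ inj₂ ]′ (complete x) with least x 0 y (λ k ()) p
  ... | z , m , inj₁ p = case d (x ∷ z ∷ []) of λ where
    (inj₁ (_ , e)) → inj₁ (sound x z p , comp (proj zero ∷ m ∷ []) e)
    (inj₂ (n , _)) → contradiction p n
  ... | z , m , inj₂ q = case d (x ∷ z ∷ []) of λ where
    (inj₁ (p , _)) → contradiction (sound x z p) (refute x z q)
    (inj₂ (_ , e)) → inj₂ (refute x z q , comp (proj zero ∷ m ∷ []) e)

module Residual {A : Set} (_≟_ : ∀ (x y : A) → Dec (x ≡ y)) where

  pop : A → List A → List A
  pop x []       = []
  pop x (y ∷ ys) = branch (y ≟ x) ys (y ∷ ys)

  res : List A → List A → List A
  res t p = foldl (flip pop) p t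

  pop⁺ : ∀ {x p s} → p ⊆ x ∷ s → pop x p ⊆ s
  pop⁺ {p = []}     _ = minimum _
  pop⁺ {x} {y ∷ p} h with y ≟ x
  pop⁺ (_ ∷ʳ h) | yes _ = ⊆-trans (_ ∷ʳ ⊆-refl) h
  pop⁺ (_ ∷ h)  | yes _ = h
  pop⁺ (_ ∷ʳ h) | no _  = h
  pop⁺ (eq ∷ h) | no ne = contradiction eq ne

  pop⁻ : ∀ {x p s} → pop x p ⊆ s → p ⊆ x ∷ s
  pop⁻ {p = []}     _ = minimum _
  pop⁻ {x} {y ∷ p} h with y ≟ x
  ... | yes refl = refl ∷ h
  ... | no  _    = x ∷ʳ h

  res⁺ : ∀ t {p s} → p ⊆ t ++ s → res t p ⊆ s
  res⁺ []      h = h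
  res⁺ (x ∷ t) h = res⁺ t (pop⁺ h)

  res⁻ : ∀ t {p s} → res t p ⊆ s → p ⊆ t ++ s
  res⁻ []      h = h
  res⁻ (x ∷ t) h = pop⁻ (res⁻ t h)

open Residual _≟_ public

popᵗ : Tm 2
popᵗ = ifeqᵗ (var 1F) (consᵗ (var 0F) (tlᵗ (var 1F))) (tlᵗ (var 1F)) (var 1F)

reverseᵗ : Tm 1
reverseᵗ = fold (var 0F) (lit 0) (consᵗ (var 0F) (var 1F))

_++ᵗ_ : ∀ {n} → Tm n → Tm n → Tm n
s ++ᵗ t = call (fold (call reverseᵗ (var 0F ∷ [])) (var 1F) (consᵗ (var 0F) (var 1F))) (s ∷ t ∷ [])

resᵗ : ∀ {n} → Tm n → Tm n → Tm n
resᵗ t p = call (fold (var 0F) (var 1F) (call popᵗ (var 0F ∷ var 1F ∷ []))) (t ∷ p ∷ [])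

_⊆ᵗ_ : ∀ {n} → Tm n → Tm n → Fm n
p ⊆ᵗ t = resᵗ t p ≐ lit 0

⟦popᵗ⟧ : ∀ x ys → ⟦ popᵗ ⟧ᵗ (x ∷ encode ys ∷ []) ≡ encode (pop x ys)
⟦popᵗ⟧ x [] with 0 ≟ cons x 0
... | yes eq = contradiction (sym eq) cons≢0
... | no  _  = refl
⟦popᵗ⟧ x (y ∷ ys) rewrite tl-cons y (encode ys) with y ≟ x | cons y (encode ys) ≟ cons x (encode ys)
... | yes refl | yes _  = refl
... | yes refl | no  ne = contradiction refl ne
... | no  _    | no  _  = refl
... | no  ne   | yes eq = contradiction (proj₁ (cons-injective eq)) ne

foldl-cons : ∀ xs zs → foldl (λ a x → cons x a) (encode zs) xs ≡ encode (xs ʳ++ zs)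
foldl-cons []       zs = refl
foldl-cons (x ∷ xs) zs = foldl-cons xs (x ∷ zs)

⟦reverseᵗ⟧ : ∀ xs → ⟦ reverseᵗ ⟧ᵗ (encode xs ∷ []) ≡ encode (reverse xs)
⟦reverseᵗ⟧ xs rewrite decode-encode xs = foldl-cons xs []

⟦++ᵗ⟧ : ∀ {n} (s t : Tm n) {xs u v} → ⟦ s ⟧ᵗ xs ≡ encode u → ⟦ t ⟧ᵗ xs ≡ encode v → ⟦ s ++ᵗ t ⟧ᵗ xs ≡ encode (u ++ v)
⟦++ᵗ⟧ s t {xs} {u} {v} eq eq′ rewrite eq | eq′ | ⟦reverseᵗ⟧ u | decode-encode (reverse u) =
  trans (foldl-cons (reverse u) v) (cong encode (trans (Listₚ.ʳ++-defn (reverse u)) (cong (_++ v) (Listₚ.reverse-involutive u))))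

⟦resᵗ⟧ : ∀ {n} (s t : Tm n) {xs u v} → ⟦ s ⟧ᵗ xs ≡ encode u → ⟦ t ⟧ᵗ xs ≡ encode v → ⟦ resᵗ s t ⟧ᵗ xs ≡ encode (res u v)
⟦resᵗ⟧ s t {xs} {u} {v} eq eq′ rewrite eq | eq′ | decode-encode u = go u v
  where
  go : ∀ u v → foldl (λ a x → ⟦ popᵗ ⟧ᵗ (x ∷ a ∷ [])) (encode v) u ≡ encode (res u v)
  go []      v = refl
  go (x ∷ u) v = trans (cong (λ a → foldl (λ a x → ⟦ popᵗ ⟧ᵗ (x ∷ a ∷ [])) a u) (⟦popᵗ⟧ x v)) (go u (pop x v))

⊆[]⇒≡ : ∀ {A : Set} {p : List A} → p ⊆ [] → p ≡ []
⊆[]⇒≡ [] = refl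

⟦⊆ᵗ⟧⁺ : ∀ {n} (s t : Tm n) {xs u v} → ⟦ s ⟧ᵗ xs ≡ encode u → ⟦ t ⟧ᵗ xs ≡ encode v → u ⊆ v → ⟦ s ⊆ᵗ t ⟧ xs
⟦⊆ᵗ⟧⁺ s t {u = u} {v} eq eq′ h = trans (⟦resᵗ⟧ t s {u = v} {u} eq′ eq)
  (cong encode (⊆[]⇒≡ (res⁺ v (subst (_ ⊆_) (sym (Listₚ.++-identityʳ v)) h))))

⟦⊆ᵗ⟧⁻ : ∀ {n} (s t : Tm n) {xs u v} → ⟦ s ⟧ᵗ xs ≡ encode u → ⟦ t ⟧ᵗ xs ≡ encode v → ⟦ s ⊆ᵗ t ⟧ xs → u ⊆ v
⟦⊆ᵗ⟧⁻ s t {u = u} {v} eq eq′ h = subst (_ ⊆_) (Listₚ.++-identityʳ v)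
  (res⁻ v (subst (_⊆ []) (sym (encode-injective _ [] (trans (sym (⟦resᵗ⟧ t s {u = v} {u} eq′ eq)) h))) []))

-- Almost-full relations and Higman's lemma

data AF {A : Set} (R : A → A → Set) : Set where
  now   : (∀ x y → R x y) → AF R
  later : (∀ x → AF (λ y z → R y z ⊎ R x y)) → AF R

AF-mono : ∀ {A : Set} {R S : A → A → Set} → (∀ {x y} → R x y → S x y) → AF R → AF S
AF-mono h (now t)   = now (λ x y → h (t x y))
AF-mono h (later t) = later (λ x → AF-mono (Sum.map h h) (t x))

AF-partial : ∀ {A B : Set} {R : A → A → Set} (f : B → Maybe A) → AF R →
  AF (λ x y → ∀ {a a′} → f x ≡ just a → f y ≡ just a′ → R a a′)
AF-partial f (now t) = now (λ _ _ _ _ → t _ _)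
AF-partial {B = B} {R} f (later t) = later go
  where
  go : ∀ (x : B) → AF (λ y z → (∀ {b c} → f y ≡ just b → f z ≡ just c → R b c) ⊎ (∀ {b c} → f x ≡ just b → f y ≡ just c → R b c))
  go x with f x
  ... | nothing = now (λ _ _ → inj₂ (λ ()))
  ... | just a  = AF-mono split (AF-partial f (t a))
    where
    split : ∀ {y z} → (∀ {b c} → f y ≡ just b → f z ≡ just c → R b c ⊎ R a b) →
      (∀ {b c} → f y ≡ just b → f z ≡ just c → R b c) ⊎ (∀ {b c} → just a ≡ just b → f y ≡ just c → R b c)
    split {y} {z} h with f y | f z
    ... | nothing | _       = inj₁ (λ ())
    ... | just b  | nothing = inj₁ (λ _ ())
    ... | just b  | just c with h refl refl
    ... | inj₁ q = inj₁ (λ { refl refl → q })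
    ... | inj₂ q = inj₂ (λ { refl refl → q })

AF-comap : ∀ {A B : Set} {R : A → A → Set} (f : B → A) → AF R → AF (λ x y → R (f x) (f y))
AF-comap f t = AF-mono (λ h → h refl refl) (AF-partial (just ∘ f) t)

-- Ramsey: the intersection is treated by increasing the arity of the part
-- on which the two relations are still to be intersected.

private
  nullary : ∀ {X : Set} {R S C T : X → X → Set} {A B : Set} → AF R → AF S →
    (∀ {x y} → R x y → C x y ⊎ A) → (∀ {x y} → S x y → C x y ⊎ B) →
    (∀ {x y} → C x y ⊎ A × B → T x y) → AF T
  nullary (now t) s f g h = AF-mono (λ {x} {y} q → h (case g q of λ where
    (inj₁ c) → inj₁ c
    (inj₂ b) → Sum.map₂ (_, b) (f (t x y)))) s
  nullary {C = C} (later t) s f g h = later λ x → nullary {C = λ y z → C y z ⊎ C x y} (t x) s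
    [ Sum.map₁ inj₁ ∘ f , Sum.map₁ inj₂ ∘ f ]′ (Sum.map₁ inj₁ ∘ g)
    [ [ inj₁ ∘ h ∘ inj₁ , inj₂ ∘ h ∘ inj₁ ]′ , inj₁ ∘ h ∘ inj₂ ]′

  unary : ∀ {X : Set} {R S C T : X → X → Set} {A B : X → Set} → AF R → AF S →
    (∀ {x y} → R x y → C x y ⊎ A x) → (∀ {x y} → S x y → C x y ⊎ B x) →
    (∀ {x y} → C x y ⊎ A x × B x → T x y) → AF T
  unary (now t) s f g h = AF-mono (λ {x} {y} q → h (case g q of λ where
    (inj₁ c) → inj₁ c
    (inj₂ b) → Sum.map₂ (_, b) (f (t x y)))) s
  unary t (now s) f g h = AF-mono (λ {x} {y} q → h (case f q of λ where
    (inj₁ c) → inj₁ c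
    (inj₂ a) → Sum.map₂ (a ,_) (g (s x y)))) t
  unary {C = C} {A = A} {B} (later t) (later s) f g h = later λ x →
    nullary {C = λ y z → (C y z ⊎ C x y) ⊎ A y × B y} {A = A x} {B = B x}
      (unary {C = λ y z → (C y z ⊎ C x y) ⊎ A x} {A = A} {B = B} (t x) (later s)
        [ Sum.map₁ (inj₁ ∘ inj₁) ∘ f , [ inj₁ ∘ inj₁ ∘ inj₂ , inj₁ ∘ inj₂ ]′ ∘ f ]′ (Sum.map₁ (inj₁ ∘ inj₁) ∘ g) id)
      (unary {C = λ y z → (C y z ⊎ C x y) ⊎ B x} {A = A} {B = B} (later t) (s x)
        (Sum.map₁ (inj₁ ∘ inj₁) ∘ f) [ Sum.map₁ (inj₁ ∘ inj₁) ∘ g , [ inj₁ ∘ inj₁ ∘ inj₂ , inj₁ ∘ inj₂ ]′ ∘ g ]′ id)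
      [ [ inj₁ ∘ inj₁ , inj₂ ]′ , inj₁ ∘ inj₂ ]′ [ [ inj₁ ∘ inj₁ , inj₂ ]′ , inj₁ ∘ inj₂ ]′
      [ [ [ inj₁ ∘ h ∘ inj₁ , inj₂ ∘ h ∘ inj₁ ]′ , inj₁ ∘ h ∘ inj₂ ]′ , inj₂ ∘ h ∘ inj₂ ]′

  binary : ∀ {X : Set} {R S C T A B : X → X → Set} → AF R → AF S →
    (∀ {x y} → R x y → C x y ⊎ A x y) → (∀ {x y} → S x y → C x y ⊎ B x y) →
    (∀ {x y} → C x y ⊎ A x y × B x y → T x y) → AF T
  binary (now t) s f g h = AF-mono (λ {x} {y} q → h (case g q of λ where
    (inj₁ c) → inj₁ c
    (inj₂ b) → Sum.map₂ (_, b) (f (t x y)))) s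
  binary t (now s) f g h = AF-mono (λ {x} {y} q → h (case f q of λ where
    (inj₁ c) → inj₁ c
    (inj₂ a) → Sum.map₂ (a ,_) (g (s x y)))) t
  binary {C = C} {A = A} {B} (later t) (later s) f g h = later λ x →
    unary {C = λ y z → (C y z ⊎ C x y) ⊎ A y z × B y z} {A = A x} {B = B x}
      (binary {C = λ y z → (C y z ⊎ C x y) ⊎ A x y} {A = A} {B = B} (t x) (later s)
        [ Sum.map₁ (inj₁ ∘ inj₁) ∘ f , [ inj₁ ∘ inj₁ ∘ inj₂ , inj₁ ∘ inj₂ ]′ ∘ f ]′ (Sum.map₁ (inj₁ ∘ inj₁) ∘ g) id)
      (binary {C = λ y z → (C y z ⊎ C x y) ⊎ B x y} {A = A} {B = B} (later t) (s x)
        (Sum.map₁ (inj₁ ∘ inj₁) ∘ f) [ Sum.map₁ (inj₁ ∘ inj₁) ∘ g , [ inj₁ ∘ inj₁ ∘ inj₂ , inj₁ ∘ inj₂ ]′ ∘ g ]′ id)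
      [ [ inj₁ ∘ inj₁ , inj₂ ]′ , inj₁ ∘ inj₂ ]′ [ [ inj₁ ∘ inj₁ , inj₂ ]′ , inj₁ ∘ inj₂ ]′
      [ [ [ inj₁ ∘ h ∘ inj₁ , inj₂ ∘ h ∘ inj₁ ]′ , inj₁ ∘ h ∘ inj₂ ]′ , inj₂ ∘ h ∘ inj₂ ]′

AF-∩ : ∀ {X : Set} {R S : X → X → Set} → AF R → AF S → AF (λ x y → R x y × S x y)
AF-∩ {R = R} {S} t s = binary {C = λ _ _ → ⊥} {A = R} {B = S} t s inj₂ inj₂ (λ { (inj₂ p) → p })

AF-× : ∀ {A B : Set} {R : A → A → Set} {S : B → B → Set} → AF R → AF S →
  AF {A × B} (λ x y → R (proj₁ x) (proj₁ y) × S (proj₂ x) (proj₂ y))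
AF-× t s = AF-∩ (AF-comap proj₁ t) (AF-comap proj₂ s)

AF-Bool : AF {Bool} _≡_
AF-Bool = later λ a → later λ b → now (λ x _ → go a b x)
  where
  go : ∀ a b x {y : Bool} → (x ≡ y ⊎ a ≡ x) ⊎ (b ≡ x ⊎ a ≡ b)
  go true  true  x     = inj₂ (inj₂ refl)
  go false false x     = inj₂ (inj₂ refl)
  go true  false true  = inj₁ (inj₂ refl)
  go true  false false = inj₂ (inj₁ refl)
  go false true  false = inj₁ (inj₂ refl)
  go false true  true  = inj₂ (inj₁ refl)

AF-Fin : ∀ n → AF {Fin n} _≡_
AF-Fin zero    = now (λ ())
AF-Fin (suc n) = AF-mono same (AF-∩ (AF-comap isZero AF-Bool) (AF-partial predecessor (AF-Fin n)))
  where
  isZero : Fin (suc n) → Bool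
  isZero zero    = true
  isZero (suc _) = false
  predecessor : Fin (suc n) → Maybe (Fin n)
  predecessor zero    = nothing
  predecessor (suc i) = just i
  same : ∀ {x y} → isZero x ≡ isZero y × (∀ {a b} → predecessor x ≡ just a → predecessor y ≡ just b → a ≡ b) → x ≡ y
  same {zero}  {zero}  _       = refl
  same {suc x} {suc y} (_ , h) = cong suc (h refl refl)

-- A word that does not contain a ∷ w either avoids a, or it is u a v where u
-- avoids a and v does not contain w; words avoiding a live on a smaller
-- alphabet.

private
  Split : ℕ → Set
  Split n = List (Fin n) ⊎ List (Fin n) × List (Fin (suc n))

  cutAt : ∀ {n} → Fin (suc n) → List (Fin (suc n)) → Split n
  cutAt a []      = inj₁ []
  cutAt a (b ∷ u) with a Finₚ.≟ b
  ... | yes _  = inj₂ ([] , u)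
  ... | no  ne = Sum.map (Fin.punchOut ne ∷_) (map₁ (Fin.punchOut ne ∷_)) (cutAt a u)

  uncut : ∀ {n} → Fin (suc n) → Split n → List (Fin (suc n))
  uncut a (inj₁ v)       = map (Fin.punchIn a) v
  uncut a (inj₂ (v , u)) = map (Fin.punchIn a) v ++ a ∷ u

  uncut-cutAt : ∀ {n} (a : Fin (suc n)) u → uncut a (cutAt a u) ≡ u
  uncut-cutAt a []      = refl
  uncut-cutAt a (b ∷ u) with a Finₚ.≟ b
  ... | yes refl = refl
  ... | no  ne with cutAt a u | uncut-cutAt a u
  ... | inj₁ v | eq = cong₂ _∷_ (Finₚ.punchIn-punchOut ne) eq
  ... | inj₂ v | eq = cong₂ _∷_ (Finₚ.punchIn-punchOut ne) eq

  left : ∀ {A B : Set} → A ⊎ B → Maybe A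
  left = [ just , const nothing ]′
  right : ∀ {A B : Set} → A ⊎ B → Maybe B
  right = [ const nothing , just ]′

higman : ∀ n → AF {List (Fin n)} _⊆_
higman zero    = now (λ { [] [] → [] ; (() ∷ _) _ ; [] (() ∷ _) })
higman (suc n) = later containing
  where
  containing : ∀ w → AF (λ u v → u ⊆ v ⊎ w ⊆ u)
  containing []      = now (λ u _ → inj₂ (minimum u))
  containing (a ∷ w) = AF-mono combine
    (AF-∩ (AF-comap {R = _≡_} (isLeft ∘ cutAt a) AF-Bool)
    (AF-∩ (AF-partial {R = _⊆_} (left ∘ cutAt a) (higman n))
          (AF-partial {R = λ p q → proj₁ p ⊆ proj₁ q × (proj₂ p ⊆ proj₂ q ⊎ w ⊆ proj₂ p)}
             (right ∘ cutAt a) (AF-× (higman n) (containing w)))))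
    where
    isLeft : ∀ {A B : Set} → A ⊎ B → Bool
    isLeft = [ const true , const false ]′
    embed : ∀ s t → isLeft s ≡ isLeft t ×
      (∀ {p q} → left s ≡ just p → left t ≡ just q → p ⊆ q) ×
      (∀ {p q} → right s ≡ just p → right t ≡ just q → proj₁ p ⊆ proj₁ q × (proj₂ p ⊆ proj₂ q ⊎ w ⊆ proj₂ p)) →
      uncut a s ⊆ uncut a t ⊎ a ∷ w ⊆ uncut a s
    embed (inj₁ p) (inj₁ q) (_ , h , _) = inj₁ (Subₚ.map⁺ (Fin.punchIn a) (h refl refl))
    embed (inj₂ (p , p′)) (inj₂ (q , q′)) (_ , _ , h) with h refl refl
    ... | i , inj₁ j = inj₁ (Subₚ.++⁺ (Subₚ.map⁺ (Fin.punchIn a) i) (refl ∷ j))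
    ... | i , inj₂ j = inj₂ (Subₚ.++⁺ˡ (map (Fin.punchIn a) p) (refl ∷ j))
    combine : ∀ {u v} → _ → u ⊆ v ⊎ a ∷ w ⊆ u
    combine {u} {v} h = subst₂ (λ u v → u ⊆ v ⊎ a ∷ w ⊆ u) (uncut-cutAt a u) (uncut-cutAt a v) (embed (cutAt a u) (cutAt a v) h)

-- Runs, traces and lassos

Label : ℕ → Set
Label m = Channel × Act m

data Path {m n} (Δ : List (Rule m n)) : Fin n → List (Label m) → Fin n → Set where
  []  : ∀ {s} → Path Δ s [] s
  _∷_ : ∀ {s c α s′ z s″} → rule s c α s′ ∈ Δ → Path Δ s′ z s″ → Path Δ s ((c , α) ∷ z) s″

_⧺_ : ∀ {m n} {Δ : List (Rule m n)} {s z s′ z′ s″} → Path Δ s z s′ → Path Δ s′ z′ s″ → Path Δ s (z ++ z′) s″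
[]      ⧺ q = q
(e ∷ p) ⧺ q = e ∷ (p ⧺ q)

letters : ∀ {m} → Channel → Label m → Word m
letters _ (_ , test _) = []
letters r (r , comm x) = fromMaybe x
letters r (l , comm x) = []
letters l (r , comm x) = []
letters l (l , comm x) = fromMaybe x

traffic : ∀ {m} → Channel → List (Label m) → Word m
traffic c = concatMap (letters c)

data IsComm {m} : Label m → Set where
  comm : ∀ {c x} → IsComm (c , comm x)

traffic-++ : ∀ {m} c (y z : List (Label m)) → traffic c (y ++ z) ≡ traffic c y ++ traffic c z
traffic-++ c y z = Listₚ.concatMap-++ (letters c) y z

removeAt-⊆ : ∀ {A : Set} (v : List A) i → removeAt v i ⊆ v
removeAt-⊆ (x ∷ v) zero            = x ∷ʳ ⊆-refl
removeAt-⊆ (x ∷ v) (suc i) = refl ∷ removeAt-⊆ v i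

⊆-length⇒≡ : ∀ {A : Set} {u v : List A} → u ⊆ v → length v ≤ length u → u ≡ v
⊆-length⇒≡ []       _        = refl
⊆-length⇒≡ (y ∷ʳ h) le       = contradiction (≤-trans le (Subₚ.length-mono-≤ h)) 1+n≰n
⊆-length⇒≡ (refl ∷ h) (s≤s le) = cong (_ ∷_) (⊆-length⇒≡ h le)

Star⇒Trans : ∀ {A : Set} {R : A → A → Set} {x y z} → R x y → Star R y z → TransClosure R x z
Star⇒Trans e ε       = [ e ]
Star⇒Trans e (f ◅ p) = e ∷ Star⇒Trans f p

Trans⇒Star : ∀ {A : Set} {R : A → A → Set} {x y} → TransClosure R x y → Star R x y
Trans⇒Star [ e ]   = e ◅ ε
Trans⇒Star (e ∷ p) = e ◅ Trans⇒Star p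

_◅◅⁺_ : ∀ {A : Set} {R : A → A → Set} {x y z} → Star R x y → TransClosure R y z → TransClosure R x z
ε       ◅◅⁺ q = q
(e ◅ p) ◅◅⁺ q = e ∷ (p ◅◅⁺ q)

module _ (S : UCST) where
  open UCST S

  -- What remains of a run once the interleaving of the two agents is
  -- forgotten.

  record Extract (C D : Config S) : Set where
    constructor extract
    field
      {sent received} : List (Label m)
      lost     : ℕ
      sender   : Path Δ₁ (proj₁ C) sent (proj₁ D)
      receiver : Path Δ₂ (proj₁ (proj₂ C)) received (proj₁ (proj₂ D))
      reliable : proj₁ (proj₂ (proj₂ C)) ++ traffic r sent ≡ traffic r received ++ proj₁ (proj₂ (proj₂ D))
      lossy    : traffic l received ++ proj₂ (proj₂ (proj₂ D)) ⊆ proj₂ (proj₂ (proj₂ C)) ++ traffic l sent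
      balance  : length (traffic l received ++ proj₂ (proj₂ (proj₂ D))) + lost
                 ≡ length (proj₂ (proj₂ (proj₂ C)) ++ traffic l sent)

    steps : ℕ
    steps = length sent + length received + lost

  open Extract

  extract-∷ : ∀ {C D E} → Step S C D → (x : Extract D E) → Σ[ y ∈ Extract C E ] 0 < steps y
  extract-∷ (test₁ e _) x = extract (lost x) (e ∷ sender x) (receiver x) (reliable x) (lossy x) (balance x) , z<s
  extract-∷ (test₂ e _) x = extract (lost x) (sender x) (e ∷ receiver x) (reliable x) (lossy x) (balance x)
    , ≤-trans (m≤n+m 1 (length (sent x) + length (received x)))
        (≤-trans (≤-reflexive (trans (+-comm _ 1) (sym (+-suc _ _)))) (m≤m+n _ (lost x)))
  extract-∷ (write {w = u , v} {c = r} {x = a} e) x =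
    extract (lost x) (e ∷ sender x) (receiver x) (trans (sym (Listₚ.++-assoc u _ _)) (reliable x)) (lossy x) (balance x) , z<s
  extract-∷ {E = E} (write {w = u , v} {c = l} {x = a} e) x =
    extract (lost x) (e ∷ sender x) (receiver x) (reliable x) (subst (_ ⊆_) eq (lossy x)) (trans (balance x) (cong length eq)) , z<s
    where eq = Listₚ.++-assoc v (fromMaybe a) (traffic l (sent x))
  extract-∷ (read {w = u , v} {c = r} {x = a} {s = s} e eq) x =
    extract (lost x) (sender x) (e ∷ receiver x)
      (trans (cong (_++ traffic r (sent x)) eq) (trans (Listₚ.++-assoc (fromMaybe a) s _)
        (trans (cong (fromMaybe a ++_) (reliable x)) (sym (Listₚ.++-assoc (fromMaybe a) _ _))))) (lossy x) (balance x)
    , ≤-trans (m≤n+m 1 (length (sent x) + length (received x)))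
        (≤-trans (≤-reflexive (trans (+-comm _ 1) (sym (+-suc _ _)))) (m≤m+n _ (lost x)))
  extract-∷ {E = E} (read {w = u , v} {c = l} {x = a} {s = s} e refl) x =
    extract (lost x) (sender x) (e ∷ receiver x) (reliable x)
      (subst₂ _⊆_ (sym eq₁) (sym eq₂) (Subₚ.++⁺ (⊆-refl {x = fromMaybe a}) (lossy x)))
      (begin
        length ((fromMaybe a ++ traffic l (received x)) ++ v′) + lost x  ≡⟨ cong (λ w → length w + lost x) eq₁ ⟩
        length (fromMaybe a ++ (traffic l (received x) ++ v′)) + lost x  ≡⟨ cong (_+ lost x) (Listₚ.length-++ (fromMaybe a)) ⟩
        length (fromMaybe a) + length (traffic l (received x) ++ v′) + lost x ≡⟨ +-assoc (length (fromMaybe a)) _ _ ⟩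
        length (fromMaybe a) + (length (traffic l (received x) ++ v′) + lost x) ≡⟨ cong (length (fromMaybe a) +_) (balance x) ⟩
        length (fromMaybe a) + length (s ++ traffic l (sent x))          ≡⟨ sym (Listₚ.length-++ (fromMaybe a)) ⟩
        length (fromMaybe a ++ (s ++ traffic l (sent x)))                ≡⟨ cong length (sym eq₂) ⟩
        length ((fromMaybe a ++ s) ++ traffic l (sent x)) ∎)
    , ≤-trans (m≤n+m 1 (length (sent x) + length (received x)))
        (≤-trans (≤-reflexive (trans (+-comm _ 1) (sym (+-suc _ _)))) (m≤m+n _ (lost x)))
    where
    open ≡-Reasoning
    v′ = proj₂ (proj₂ (proj₂ E))
    eq₁ = Listₚ.++-assoc (fromMaybe a) (traffic l (received x)) v′
    eq₂ = Listₚ.++-assoc (fromMaybe a) s (traffic l (sent x))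
  extract-∷ (loss {v = v} i) x =
    extract (suc (lost x)) (sender x) (receiver x) (reliable x)
      (⊆-trans (lossy x) (Subₚ.++⁺ (removeAt-⊆ v i) ⊆-refl))
      (trans (+-suc _ _) (trans (cong suc (balance x))
        (trans (cong suc (Listₚ.length-++ (removeAt v i)))
        (trans (cong (_+ length (traffic l (sent x))) (sym (Listₚ.length-removeAt′ v i))) (sym (Listₚ.length-++ v))))))
    , ≤-trans (s≤s z≤n) (≤-reflexive (sym (+-suc _ (lost x))))

  extractStar : ∀ {C D} → Star (Step S) C D → Extract C D
  extractStar {D = D} ε = extract 0 [] [] (Listₚ.++-identityʳ _) (Subₚ.++⁺ʳ [] ⊆-refl)
    (trans (+-identityʳ _) (cong length (sym (Listₚ.++-identityʳ (proj₂ (proj₂ (proj₂ D)))))))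
  extractStar (e ◅ p) = proj₁ (extract-∷ e (extractStar p))

  extractTrans : ∀ {C D} → TransClosure (Step S) C D → Σ[ x ∈ Extract C D ] 0 < steps x
  extractTrans [ e ]   = extract-∷ e (extractStar ε)
  extractTrans (e ∷ p) = extract-∷ e (proj₁ (extractTrans p))

  senderRun : ∀ {s z s′ t u v} → Path Δ₁ s z s′ → All IsComm z →
    Star (Step S) (s , t , u , v) (s′ , t , u ++ traffic r z , v ++ traffic l z)
  senderRun {s} {t = t} {u} {v} [] [] =
    subst₂ (λ u′ v′ → Star (Step S) (s , t , u , v) (s , t , u′ , v′)) (sym (Listₚ.++-identityʳ u)) (sym (Listₚ.++-identityʳ v)) ε
  senderRun {s} {_} {s′} {t} {u} {v} (_∷_ {c = r} {α = comm x} {z = z} e p) (comm ∷ c) =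
    write e ◅ subst (λ u′ → Star (Step S) _ (s′ , t , u′ , v ++ traffic l z)) (Listₚ.++-assoc u (fromMaybe x) (traffic r z)) (senderRun p c)
  senderRun {s} {_} {s′} {t} {u} {v} (_∷_ {c = l} {α = comm x} {z = z} e p) (comm ∷ c) =
    write e ◅ subst (λ v′ → Star (Step S) _ (s′ , t , u ++ traffic r z , v′)) (Listₚ.++-assoc v (fromMaybe x) (traffic l z)) (senderRun p c)

  receiverRun : ∀ {s t y t′ u v} → Path Δ₂ t y t′ → All IsComm y →
    Star (Step S) (s , t , traffic r y ++ u , traffic l y ++ v) (s , t′ , u , v)
  receiverRun [] [] = ε
  receiverRun {s} {t} {_} {t′} {u} {v} (_∷_ {c = r} {α = comm x} {z = z} e p) (comm ∷ c) =
    read e (Listₚ.++-assoc (fromMaybe x) (traffic r z) u) ◅ receiverRun p c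
  receiverRun {s} {t} {_} {t′} {u} {v} (_∷_ {c = l} {α = comm x} {z = z} e p) (comm ∷ c) =
    read e (Listₚ.++-assoc (fromMaybe x) (traffic l z) v) ◅ receiverRun p c

  lossRun : ∀ {s t u v v′} → v′ ⊆ v → Star (Step S) (s , t , u , v) (s , t , u , v′)
  lossRun {s} {t} {u} = go []
    where
    index : ∀ (w : Word m) {x v} → Fin (length (w ++ x ∷ v))
    index []      = zero
    index (_ ∷ w) = suc (index w)
    removeIndex : ∀ (w : Word m) {x v} → removeAt (w ++ x ∷ v) (index w) ≡ w ++ v
    removeIndex []                    = refl
    removeIndex (y ∷ []) = refl
    removeIndex (y ∷ w@(_ ∷ _)) = cong (y ∷_) (removeIndex w)
    go : ∀ w {v v′} → v′ ⊆ v → Star (Step S) (s , t , u , w ++ v) (s , t , u , w ++ v′)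
    go w []       = ε
    go w (_∷ʳ_ {ys = v} x h) =
      subst (λ v′ → Step S (s , t , u , w ++ x ∷ v) (s , t , u , v′)) (removeIndex w) (loss (index w)) ◅ go w h
    go w {v} {v′} (_∷_ {x = x} refl h) = subst₂ (λ a b → Star (Step S) (s , t , u , a) (s , t , u , b))
      (Listₚ.++-assoc w (x ∷ []) _) (Listₚ.++-assoc w (x ∷ []) _) (go (w ++ x ∷ []) h)

  SenderLoop : Fin n₁ → Set
  SenderLoop s = ∃[ e ] ∃[ z ] Path Δ₁ s (e ∷ z) s × All IsComm (e ∷ z)

IsUCS⇒IsUCST[Z₁ʳ] : ∀ {S} → IsUCS S → IsUCST[Z₁ʳ] S
IsUCS⇒IsUCST[Z₁ʳ] (h₁ , h₂) = All.map (λ { isComm → isComm }) h₁ , h₂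

-- A lasso is a finite certificate for recurrent reachability.

Lasso : Instance → Set
Lasso I = ∃[ w ] Star (Step system) (pᵢₙ , qᵢₙ , [] , []) (p , q , w) ×
                 (TransClosure (Step system) (p , q , w) (p , q , w) ⊎ SenderLoop system p)
  where open Instance I

Lasso⇒RecurrentlyReachable : ∀ I → Lasso I → RecurrentlyReachable I
Lasso⇒RecurrentlyReachable I (w , reach , inj₁ loop) = const w , reach , const loop
Lasso⇒RecurrentlyReachable I (w , reach , inj₂ (e , z , path , comms)) = ws , reach , loop
  where
  open Instance I
  ws : ℕ → Contents m
  ws zero    = w
  ws (suc i) = proj₁ (ws i) ++ traffic r (e ∷ z) , proj₂ (ws i) ++ traffic l (e ∷ z)
  plus : ∀ {s s′ t u v} → Path Δ₁ s (e ∷ z) s′ → All IsComm (e ∷ z) →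
    TransClosure (Step system) (s , t , u , v) (s′ , t , u ++ traffic r (e ∷ z) , v ++ traffic l (e ∷ z))
  plus {t = t} {u} {v} (_∷_ {c = r} {α = comm x} {s′} e p) (comm ∷ c) =
    Star⇒Trans (write e) (subst (λ u′ → Star (Step system) (s′ , t , u ++ fromMaybe x , v) (_ , _ , u′ , v ++ traffic l z)) (Listₚ.++-assoc u (fromMaybe x) (traffic r z)) (senderRun system p c))
  plus {t = t} {u} {v} (_∷_ {c = l} {α = comm x} {s′} e p) (comm ∷ c) =
    Star⇒Trans (write e) (subst (λ v′ → Star (Step system) (s′ , t , u , v ++ fromMaybe x) (_ , _ , u ++ traffic r z , v′)) (Listₚ.++-assoc v (fromMaybe x) (traffic l z)) (senderRun system p c))
  loop : ∀ i → TransClosure (Step system) (p , q , ws i) (p , q , ws (suc i))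
  loop i = plus path comms

findPair : ∀ {A Goal : Set} {R : A → A → Set} (M : ℕ → A → Set) → AF R → (∀ i → Goal ⊎ (∃[ j ] i ≤ j × ∃[ a ] M j a)) →
  ∀ i → Goal ⊎ (∃[ j ] ∃[ k ] i ≤ j × j < k × ∃[ a ] ∃[ b ] M j a × M k b × R a b)
findPair M (now t) next i with next i
... | inj₁ g = inj₁ g
... | inj₂ (j , i≤j , a , ma) with next (suc j)
... | inj₁ g = inj₁ g
... | inj₂ (k , j<k , b , mb) = inj₂ (j , k , i≤j , j<k , a , b , ma , mb , t a b)
findPair M (later t) next i with next i
... | inj₁ g = inj₁ g
... | inj₂ (j , i≤j , a , ma) with findPair M (t a) next (suc j)
... | inj₁ g = inj₁ g
... | inj₂ (k , o , j<k , k<o , b , c , mb , mc , inj₁ h) = inj₂ (k , o , ≤-trans i≤j (<⇒≤ j<k) , k<o , b , c , mb , mc , h)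
... | inj₂ (k , o , j<k , k<o , b , c , mb , mc , inj₂ h) = inj₂ (j , k , i≤j , j<k , a , b , ma , mb , h)

module _ (I : Instance) (restricted : IsUCST[Z₁ʳ] (Instance.system I)) where
  open Instance I
  open Extract

  private
    _⇝_ _⇝⁺_ : Config system → Config system → Set
    _⇝_  = Star (Step system)
    _⇝⁺_ = TransClosure (Step system)

    Moment : Set
    Moment = Fin n₁ × Fin n₂ × Word m

    config : Moment → Config system
    config (s , t , v) = s , t , [] , v

    uncommon : ∀ {s c R s′} → rule s c (test R) s′ ∈ Δ₁ → c ≡ r × R ≡ Z
    uncommon e with All.lookup (proj₁ restricted) e
    ... | isZʳ = refl , refl

    lastTest : ∀ {C D} → C ⇝ D → (∃[ a ] C ⇝ config a × config a ⇝⁺ D) ⊎ (Σ[ x ∈ Extract system C D ] All IsComm (sent x))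
    lastTest ε = inj₂ (extractStar system ε , [])
    lastTest (e ◅ p) with lastTest p
    ... | inj₁ (a , h , h′) = inj₁ (a , e ◅ h , h′)
    lastTest (test₁ e h ◅ p)  | inj₂ (x , c) with uncommon e | h
    ... | refl , refl | Regex.ε = inj₁ (_ , ε , Star⇒Trans (test₁ e h) p)
    lastTest (test₂ e h ◅ p)  | inj₂ (x , c) = case All.lookup (proj₂ restricted) e of λ ()
    lastTest (e@(write {c = r} _) ◅ p) | inj₂ (x , c) = inj₂ (proj₁ (extract-∷ system e x) , comm ∷ c)
    lastTest (e@(write {c = l} _) ◅ p) | inj₂ (x , c) = inj₂ (proj₁ (extract-∷ system e x) , comm ∷ c)
    lastTest (e@(read {c = r} _ _) ◅ p) | inj₂ (x , c) = inj₂ (proj₁ (extract-∷ system e x) , c)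
    lastTest (e@(read {c = l} _ refl) ◅ p) | inj₂ (x , c) = inj₂ (proj₁ (extract-∷ system e x) , c)
    lastTest (e@(loss _) ◅ p) | inj₂ (x , c) = inj₂ (proj₁ (extract-∷ system e x) , c)

    total : Contents m → ℕ
    total (u , v) = length u + length v

  RecurrentlyReachable⇒Lasso : RecurrentlyReachable I → Lasso I
  RecurrentlyReachable⇒Lasso (w , init , loop) =
    [ id , close ]′ (findPair M (AF-× (AF-Fin n₁) (AF-× (AF-Fin n₂) (higman m))) (λ i → nextMoment i (<-wellFounded (total (w i)))) 0)
    where
    M : ℕ → Moment → Set
    M i a = (p , q , w i) ⇝ config a × config a ⇝⁺ (p , q , w (suc i))

    runs : ∀ i → (p , q , w 0) ⇝ (p , q , w i)
    runs zero    = ε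
    runs (suc i) = runs i ◅◅ Trans⇒Star (loop i)

    between : ∀ {i j} → i ≤ j → (p , q , w i) ⇝ (p , q , w j)
    between {i} {j} i≤j with ≤⇒≤′ i≤j
    ... | ≤′-refl       = ε
    ... | ≤′-step i≤′k = between (≤′⇒≤ i≤′k) ◅◅ Trans⇒Star (loop _)

    close : (∃[ j ] ∃[ k ] 0 ≤ j × j < k × ∃[ a ] ∃[ b ] M j a × M k b ×
      proj₁ a ≡ proj₁ b × proj₁ (proj₂ a) ≡ proj₁ (proj₂ b) × proj₂ (proj₂ a) ⊆ proj₂ (proj₂ b)) → Lasso I
    close (j , k , _ , j<k , a , b , (_ , from) , (to , _) , refl , refl , v⊆v′) =
      w (suc j) , init ◅◅ runs (suc j) , inj₁ ((between j<k ◅◅ to ◅◅ lossRun system v⊆v′) ◅◅⁺ from)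

    nextMoment : ∀ i → Acc _<_ (total (w i)) → Lasso I ⊎ (∃[ j ] i ≤ j × ∃[ a ] M j a)
    nextMoment i (acc smaller) with lastTest (Trans⇒Star (loop i))
    ... | inj₁ (a , h) = inj₂ (i , ≤-refl , a , h)
    ... | inj₂ (x@(extract {sent = e ∷ z} _ path _ _ _ _) , c) = inj₁ (w i , init ◅◅ runs i , inj₂ (e , z , path , c))
    ... | inj₂ (x@(extract {sent = []} {y} _ [] _ rel los _) , c) with total (w (suc i)) <? total (w i)
    ... | yes lt = Sum.map₂ (λ (j , i<j , h) → j , <⇒≤ i<j , h) (nextMoment (suc i) (smaller lt))
    ... | no ¬lt = inj₁ (w i , init ◅◅ runs i , inj₁ (subst (λ w′ → (p , q , w i) ⇝⁺ (p , q , w′)) (cong₂ _,_ u≡ v≡) (loop i)))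
      where
      u⊆ : proj₁ (w (suc i)) ⊆ proj₁ (w i)
      u⊆ = subst (_ ⊆_) (trans (sym rel) (Listₚ.++-identityʳ _)) (Subₚ.++⁺ˡ (traffic r y) ⊆-refl)
      v⊆ : proj₂ (w (suc i)) ⊆ proj₂ (w i)
      v⊆ = subst (_ ⊆_) (Listₚ.++-identityʳ _) (⊆-trans (Subₚ.++⁺ˡ (traffic l y) ⊆-refl) los)
      u≡ = ⊆-length⇒≡ u⊆ (+-cancelʳ-≤ (length (proj₂ (w i))) _ _ (≤-trans (≮⇒≥ ¬lt) (+-monoʳ-≤ (length (proj₁ (w (suc i)))) (Subₚ.length-mono-≤ v⊆))))
      v≡ = ⊆-length⇒≡ v⊆ (+-cancelˡ-≤ (length (proj₁ (w i))) _ _ (≤-trans (≮⇒≥ ¬lt) (+-monoˡ-≤ (length (proj₂ (w (suc i)))) (Subₚ.length-mono-≤ u⊆))))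

-- Instances and lassos as arithmetical objects

range : ∀ {n} → Tm n → Tm n
range t = call (rec (var 0F) (lit 0) (consᵗ (var 0F) (var 1F))) (t ∷ [])

_<ᵗ_ : ∀ {n} → Tm n → Tm n → Fm n
s <ᵗ t = call (any∈ (range (var 1F)) (var 0F ≐ var 1F)) (s ∷ t ∷ [])

decode-range : ∀ n (t : Tm n) xs → decode (⟦ range t ⟧ᵗ xs) ≡ downFrom (⟦ t ⟧ᵗ xs)
decode-range n t xs = trans (cong decode (go (⟦ t ⟧ᵗ xs))) (decode-encode _)
  where
  go : ∀ k → primrec (λ _ → 0) (λ ys → cons (lookup ys 0F) (lookup ys 1F)) k (⟦ t ⟧ᵗ xs ∷ []) ≡ encode (downFrom k)
  go zero    = refl
  go (suc k) = cong (cons k) (go k)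

⟦<ᵗ⟧⁺ : ∀ {a b} → a < b → ⟦ var 0F <ᵗ var 1F ⟧ (a ∷ b ∷ [])
⟦<ᵗ⟧⁺ {a} {b} lt rewrite decode-range 2 (var 1F) (a ∷ b ∷ []) = lose (∈-downFrom⁺ lt) refl

⟦<ᵗ⟧⁻ : ∀ {a b} → ⟦ var 0F <ᵗ var 1F ⟧ (a ∷ b ∷ []) → a < b
⟦<ᵗ⟧⁻ {a} {b} h rewrite decode-range 2 (var 1F) (a ∷ b ∷ []) with find h
... | _ , i , refl = ∈-downFrom⁻ i

encodeAct : ∀ {m} → Act m → ℕ
encodeAct (comm nothing)  = encode (0 ∷ [])
encodeAct (comm (just x)) = encode (1 ∷ toℕ x ∷ [])
encodeAct (test R)        = encode (2 ∷ codeExp R ∷ [])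

ruleVec : ∀ {m n} → Rule m n → Vec ℕ 4
ruleVec (rule s c α t) = toℕ s ∷ codeChannel c ∷ encodeAct α ∷ toℕ t ∷ []

encodeRule : ∀ {m n} → Rule m n → ℕ
encodeRule ρ = encode (Vec.toList (ruleVec ρ))

instanceVec : Instance → Vec ℕ 9
instanceVec I = m ∷ n₁ ∷ n₂ ∷ encode (map encodeRule Δ₁) ∷ encode (map encodeRule Δ₂) ∷ toℕ pᵢₙ ∷ toℕ qᵢₙ ∷ toℕ p ∷ toℕ q ∷ []
  where open Instance I

encodeInstance : Instance → ℕ
encodeInstance I = encode (Vec.toList (instanceVec I))

encodeAct≡codeAct : ∀ {m} (α : Act m) → encodeAct α ≡ codeAct α
encodeAct≡codeAct (comm nothing)  = encode≡code (0 ∷ [])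
encodeAct≡codeAct (comm (just x)) = encode≡code (1 ∷ toℕ x ∷ [])
encodeAct≡codeAct (test R)        = encode≡code (2 ∷ codeExp R ∷ [])

encodeRule≡codeRule : ∀ {m n} (ρ : Rule m n) → encodeRule ρ ≡ codeRule ρ
encodeRule≡codeRule (rule s c α t) = trans (cong (λ a → encode (toℕ s ∷ codeChannel c ∷ a ∷ toℕ t ∷ [])) (encodeAct≡codeAct α))
  (encode≡code (toℕ s ∷ codeChannel c ∷ codeAct α ∷ toℕ t ∷ []))

encodeInstance≡codeInstance : ∀ I → encodeInstance I ≡ codeInstance I
encodeInstance≡codeInstance I = trans
  (cong₂ (λ D D′ → encode (m ∷ n₁ ∷ n₂ ∷ D ∷ D′ ∷ toℕ pᵢₙ ∷ toℕ qᵢₙ ∷ toℕ p ∷ toℕ q ∷ [])) (rules Δ₁) (rules Δ₂))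
  (encode≡code (m ∷ n₁ ∷ n₂ ∷ code (map codeRule Δ₁) ∷ code (map codeRule Δ₂) ∷ toℕ pᵢₙ ∷ toℕ qᵢₙ ∷ toℕ p ∷ toℕ q ∷ []))
  where
  open Instance I
  rules : ∀ {n} (Δ : List (Rule m n)) → encode (map encodeRule Δ) ≡ code (map codeRule Δ)
  rules Δ = trans (cong encode (Listₚ.map-cong encodeRule≡codeRule Δ)) (encode≡code (map codeRule Δ))

codeZ : ℕ
codeZ = encodeAct (test {0} Z)

-- The arguments of the next two formulas are a rule, m and n.

commRule zRule : Fm 3
commRule = view 4 (var 0F) (var 0F <ᵗ var 6F ∧ var 3F <ᵗ var 6F ∧ (var 1F ≐ lit 0 ∨ var 1F ≐ lit 1) ∧
  (var 2F ≐ lit (encode (0 ∷ [])) ∨ view 2 (var 2F) (var 0F ≐ lit 1 ∧ var 1F <ᵗ var 7F)))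
zRule = commRule ∨ view 4 (var 0F) (var 0F <ᵗ var 6F ∧ var 3F <ᵗ var 6F ∧ var 1F ≐ lit 0 ∧ var 2F ≐ lit codeZ)

commRule⁺ : ∀ {m n} {ρ : Rule m n} → NoTest ρ → ⟦ commRule ⟧ (encodeRule ρ ∷ m ∷ n ∷ [])
commRule⁺ {m} {n} {rule s c α t} h = toℕ s ∷ codeChannel c ∷ encodeAct α ∷ toℕ t ∷ [] , refl , ⟦<ᵗ⟧⁺ (Finₚ.toℕ<n s) ,
  ⟦<ᵗ⟧⁺ (Finₚ.toℕ<n t) , chan c , act h
  where
  chan : ∀ c → codeChannel c ≡ 0 ⊎ codeChannel c ≡ 1
  chan r = inj₁ refl
  chan l = inj₂ refl
  act : ∀ {ρ : Rule m n} → NoTest ρ → encodeAct (Rule.action ρ) ≡ encode (0 ∷ []) ⊎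
    ⟦ view 2 (var 2F) (var 0F ≐ lit 1 ∧ var 1F <ᵗ var 7F) ⟧ (toℕ s ∷ codeChannel c ∷ encodeAct (Rule.action ρ) ∷ toℕ t ∷ encodeRule (rule s c α t) ∷ m ∷ n ∷ [])
  act (isComm {x = nothing}) = inj₁ refl
  act (isComm {x = just x})  = inj₂ (1 ∷ toℕ x ∷ [] , refl , refl , ⟦<ᵗ⟧⁺ (Finₚ.toℕ<n x))

asFin : ∀ {k n} → k < n → ∃[ i ] toℕ {n} i ≡ k
asFin lt = fromℕ< lt , Finₚ.toℕ-fromℕ< lt

commRule⁻ : ∀ {m n k} → ⟦ commRule ⟧ (k ∷ m ∷ n ∷ []) → Σ[ ρ ∈ Rule m n ] encodeRule ρ ≡ k × NoTest ρ
commRule⁻ {m} {n} (a ∷ ch ∷ α ∷ b ∷ [] , refl , a< , b< , chan , act) =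
  build (asFin (⟦<ᵗ⟧⁻ a<)) (asFin (⟦<ᵗ⟧⁻ b<)) chan (action {a} {ch} {α} {b} act)
  where
  action : ∀ {a ch α b k} → ⟦ var 2F ≐ lit (encode (0 ∷ [])) ∨ view 2 (var 2F) (var 0F ≐ lit 1 ∧ var 1F <ᵗ var 7F) ⟧ (a ∷ ch ∷ α ∷ b ∷ k ∷ m ∷ n ∷ []) →
    Σ[ x ∈ Maybe (Fin m) ] α ≡ encodeAct (comm x)
  action (inj₁ refl) = nothing , refl
  action (inj₂ (_ ∷ x ∷ [] , refl , refl , x<)) =
    let y , eq = asFin (⟦<ᵗ⟧⁻ x<) in just y , cong (λ x → encode (1 ∷ x ∷ [])) (sym eq)
  build : ∀ {a b ch α} → ∃[ i ] toℕ {n} i ≡ a → ∃[ i ] toℕ {n} i ≡ b → ch ≡ 0 ⊎ ch ≡ 1 → Σ[ x ∈ Maybe (Fin m) ] α ≡ encodeAct (comm x) →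
    Σ[ ρ ∈ Rule m n ] encodeRule ρ ≡ encode (a ∷ ch ∷ α ∷ b ∷ []) × NoTest ρ
  build (s , refl) (t , refl) (inj₁ refl) (x , refl) = rule s r (comm x) t , refl , isComm
  build (s , refl) (t , refl) (inj₂ refl) (x , refl) = rule s l (comm x) t , refl , isComm

zRule⁺ : ∀ {m n} {ρ : Rule m n} → OnlyZʳ ρ → ⟦ zRule ⟧ (encodeRule ρ ∷ m ∷ n ∷ [])
zRule⁺ {ρ = rule s c (comm x) t} isComm = inj₁ (commRule⁺ {ρ = rule s c (comm x) t} isComm)
zRule⁺ {ρ = rule s _ _ t} isZʳ = inj₂ (toℕ s ∷ 0 ∷ codeZ ∷ toℕ t ∷ [] , refl , ⟦<ᵗ⟧⁺ (Finₚ.toℕ<n s) , ⟦<ᵗ⟧⁺ (Finₚ.toℕ<n t) , refl , refl)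

zRule⁻ : ∀ {m n k} → ⟦ zRule ⟧ (k ∷ m ∷ n ∷ []) → Σ[ ρ ∈ Rule m n ] encodeRule ρ ≡ k × OnlyZʳ ρ
zRule⁻ (inj₁ h) = map₂ (map₂ λ { isComm → isComm }) (commRule⁻ h)
zRule⁻ {m} {n} (inj₂ (a ∷ ch ∷ α ∷ b ∷ [] , refl , a< , b< , refl , refl)) = build (asFin (⟦<ᵗ⟧⁻ a<)) (asFin (⟦<ᵗ⟧⁻ b<))
  where
  build : ∀ {a b} → ∃[ i ] toℕ {n} i ≡ a → ∃[ i ] toℕ {n} i ≡ b → Σ[ ρ ∈ Rule m n ] encodeRule ρ ≡ encode (a ∷ 0 ∷ codeZ ∷ b ∷ []) × OnlyZʳ ρ
  build (s , refl) (t , refl) = rule s r (test Z) t , refl , isZʳ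

opaque
  valid : Fm 3 → Fm 1
  valid φ = view 9 (var 0F)
    (all∈ (var 3F) (call φ (var 0F ∷ var 1F ∷ var 2F ∷ [])) ∧ all∈ (var 4F) (call commRule (var 0F ∷ var 1F ∷ var 3F ∷ [])) ∧
     var 5F <ᵗ var 1F ∧ var 6F <ᵗ var 2F ∧ var 7F <ᵗ var 1F ∧ var 8F <ᵗ var 2F)

module _ (φ : Fm 3) (P : ∀ {m n} → Rule m n → Set)
  (φ⁺ : ∀ {m n} {ρ : Rule m n} → P ρ → ⟦ φ ⟧ (encodeRule ρ ∷ m ∷ n ∷ []))
  (φ⁻ : ∀ {m n k} → ⟦ φ ⟧ (k ∷ m ∷ n ∷ []) → Σ[ ρ ∈ Rule m n ] encodeRule ρ ≡ k × P ρ) where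

  opaque
    unfolding valid

    valid⁺ : ∀ I → All P (Instance.Δ₁ I) × All NoTest (Instance.Δ₂ I) → ⟦ valid φ ⟧ (encodeInstance I ∷ [])
    valid⁺ I (h₁ , h₂) = instanceVec I , refl ,
      subst (All _) (sym (decode-encode _)) (Allₚ.map⁺ (All.map φ⁺ h₁)) ,
      subst (All _) (sym (decode-encode _)) (Allₚ.map⁺ (All.map commRule⁺ h₂)) ,
      ⟦<ᵗ⟧⁺ (Finₚ.toℕ<n pᵢₙ) , ⟦<ᵗ⟧⁺ (Finₚ.toℕ<n qᵢₙ) ,
      ⟦<ᵗ⟧⁺ (Finₚ.toℕ<n p) , ⟦<ᵗ⟧⁺ (Finₚ.toℕ<n q)
      where open Instance I

    valid⁻ : ∀ {x} → ⟦ valid φ ⟧ (x ∷ []) → Σ[ I ∈ Instance ] encodeInstance I ≡ x × All P (Instance.Δ₁ I) × All NoTest (Instance.Δ₂ I)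
    valid⁻ (m ∷ n₁ ∷ n₂ ∷ D₁ ∷ D₂ ∷ _ ∷ _ ∷ _ ∷ _ ∷ [] , refl , h₁ , h₂ , i₁ , i₂ , i₃ , i₄) =
      build (codedRules D₁ h₁ φ⁻) (codedRules D₂ h₂ commRule⁻) (asFin (⟦<ᵗ⟧⁻ i₁)) (asFin (⟦<ᵗ⟧⁻ i₂)) (asFin (⟦<ᵗ⟧⁻ i₃)) (asFin (⟦<ᵗ⟧⁻ i₄))
      where
      codedRules : ∀ {m n} D {Q : ℕ → Set} {P : Rule m n → Set} → All Q (decode D) → (∀ {k} → Q k → Σ[ ρ ∈ Rule m n ] encodeRule ρ ≡ k × P ρ) →
        Σ[ Δ ∈ List (Rule m n) ] encode (map encodeRule Δ) ≡ D × All P Δ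
      codedRules {m} {n} D {Q} {P} all f with go _ all
        where
        go : ∀ ks → All Q ks → Σ[ Δ ∈ List (Rule m n) ] map encodeRule Δ ≡ ks × All P Δ
        go []       []       = [] , refl , []
        go (k ∷ ks) (h ∷ hs) with f h | go ks hs
        ... | ρ , refl , pρ | Δ , refl , pΔ = ρ ∷ Δ , refl , pρ ∷ pΔ
      ... | Δ , eq , pΔ = Δ , trans (cong encode eq) (encode-decode D) , pΔ
      build : ∀ {D₁ D₂ a b c d} →
        Σ[ Δ ∈ List (Rule m n₁) ] encode (map encodeRule Δ) ≡ D₁ × All P Δ → Σ[ Δ ∈ List (Rule m n₂) ] encode (map encodeRule Δ) ≡ D₂ × All NoTest Δ →
        ∃[ i ] toℕ {n₁} i ≡ a → ∃[ i ] toℕ {n₂} i ≡ b → ∃[ i ] toℕ {n₁} i ≡ c → ∃[ i ] toℕ {n₂} i ≡ d →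
        Σ[ I ∈ Instance ] encodeInstance I ≡ encode (m ∷ n₁ ∷ n₂ ∷ D₁ ∷ D₂ ∷ a ∷ b ∷ c ∷ d ∷ []) × All P (Instance.Δ₁ I) × All NoTest (Instance.Δ₂ I)
      build (Δ₁ , refl , p₁) (Δ₂ , refl , p₂) (pᵢₙ , refl) (qᵢₙ , refl) (p , refl) (q , refl) =
        record { system = record { m = m ; n₁ = n₁ ; n₂ = n₂ ; Δ₁ = Δ₁ ; Δ₂ = Δ₂ } ; pᵢₙ = pᵢₙ ; p = p ; qᵢₙ = qᵢₙ ; q = q } , refl , p₁ , p₂

listᵗ : ∀ {n k} → Vec (Tm n) k → Tm n
listᵗ []       = lit 0
listᵗ (t ∷ ts) = consᵗ t (listᵗ ts)

vars : ∀ {k} n → Vec (Tm (n + k)) k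
vars n = tabulate (var ∘ (n ↑ʳ_))

⟦vars⟧ : ∀ {k n} (as : Vec ℕ n) (xs : Vec ℕ k) → ⟦ vars n ⟧ᵗˢ (as Vec.++ xs) ≡ xs
⟦vars⟧ {n = n} as xs = trans (go (n ↑ʳ_)) (trans (Vecₚ.tabulate-cong (Vecₚ.lookup-++ʳ as xs)) (Vecₚ.tabulate∘lookup xs))
  where
  go : ∀ {j} (θ : Fin j → Fin _) → ⟦ tabulate (var ∘ θ) ⟧ᵗˢ (as Vec.++ xs) ≡ tabulate (lookup (as Vec.++ xs) ∘ θ)
  go {zero}  θ = refl
  go {suc j} θ = cong (lookup (as Vec.++ xs) (θ zero) ∷_) (go (θ ∘ suc))

-- A derivation is a set of pairs [k, c] in which c is reached in k steps.

opaque
  derivation : ∀ {n} → Fm (2 + n) → Fm (2 + n)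
  derivation φ = all∈ (var 0F)
    (var 0F ≐ consᵗ (lit 0) (consᵗ (var 2F) (lit 0)) ∨
     any∈ (var 1F) (view 2 (var 0F) (view 2 (var 3F) (var 0F ≐ suc (var 2F) ∧ call φ (var 3F ∷ var 1F ∷ vars 8)))))

entry : ℕ → ℕ → ℕ
entry k c = encode (k ∷ c ∷ [])

module _ {n} (φ : Fm (2 + n)) (ps : Vec ℕ n) (c₀ : ℕ) where

  private
    Transition : ℕ → ℕ → Set
    Transition a b = ⟦ φ ⟧ (a ∷ b ∷ ps)

  opaque
   unfolding derivation
   private
    Justified : List ℕ → ℕ → Set
    Justified Y e = e ≡ entry 0 c₀ ⊎ Any (λ e′ → ⟦ view 2 (var 0F) (view 2 (var 3F) (var 0F ≐ suc (var 2F) ∧ call φ (var 3F ∷ var 1F ∷ vars 8))) ⟧ (e′ ∷ e ∷ encode Y ∷ c₀ ∷ ps)) Y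

    justified⁺ : ∀ {Y} k c {c′} → Transition c c′ → entry k c ∈ Y → Justified Y (entry (suc k) c′)
    justified⁺ {Y} k c {c′} t i = inj₂ (lose i (k ∷ c ∷ [] , refl , suc k ∷ c′ ∷ [] , refl , refl ,
      subst (λ ps → ⟦ φ ⟧ (c ∷ c′ ∷ ps)) (sym (⟦vars⟧ (suc k ∷ c′ ∷ k ∷ c ∷ entry k c ∷ entry (suc k) c′ ∷ encode Y ∷ c₀ ∷ []) ps)) t))

    Derivation : List ℕ → Set
    Derivation Y = ∀ {e} → e ∈ Y → Justified Y e

    justified-mono : ∀ {Y e e′} → Justified Y e → Justified (e′ ∷ Y) e
    justified-mono (inj₁ eq) = inj₁ eq
    justified-mono {Y} {e} {e′} (inj₂ a) with find a
    ... | .(encode (k ∷ c ∷ [])) , i , (k ∷ c ∷ [] , refl , .(suc k) ∷ c′ ∷ [] , refl , refl , h) = justified⁺ k c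
      (subst (λ ps → ⟦ φ ⟧ (c ∷ c′ ∷ ps)) (⟦vars⟧ (suc k ∷ c′ ∷ k ∷ c ∷ entry k c ∷ entry (suc k) c′ ∷ encode Y ∷ c₀ ∷ []) ps) h) (there i)

    extendEdge : ∀ {Y} k c {c′} → Derivation Y → entry k c ∈ Y → Transition c c′ → Derivation (entry (suc k) c′ ∷ Y)
    extendEdge k c D i t (here refl) = justified-mono (justified⁺ k c t i)
    extendEdge k c D i t (there j)   = justified-mono (D j)

    extendStar : ∀ {Y} k c {c′} → Derivation Y → entry k c ∈ Y → Star Transition c c′ →
      ∃[ Y′ ] ∃[ k′ ] Derivation Y′ × entry k′ c′ ∈ Y′ × k ≤ k′
    extendStar k c D i ε       = _ , k , D , i , ≤-refl
    extendStar k c D i (_◅_ {j = d} t p) with extendStar (suc k) d (extendEdge k c D i t) (here refl) p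
    ... | Y , o , D′ , i′ , le = Y , o , D′ , i′ , <⇒≤ le

    initial : Derivation (entry 0 c₀ ∷ [])
    initial (here refl) = inj₁ refl

    coded : ∀ {Y} → Derivation Y → ⟦ derivation φ ⟧ (encode Y ∷ c₀ ∷ ps)
    coded {Y} D rewrite decode-encode Y = All.tabulate (λ i → D i)

   derivation⁺ : ∀ {c} → Star Transition c₀ c → ∃[ Y ] ∃[ k ] ⟦ derivation φ ⟧ (Y ∷ c₀ ∷ ps) × entry k c ∈ decode Y
   derivation⁺ p with Y , k , D , i , _ ← extendStar 0 c₀ initial (here refl) p =
     encode Y , k , coded D , subst (_ ∈_) (sym (decode-encode Y)) i

   derivation⁺′ : ∀ {c} → TransClosure Transition c₀ c → ∃[ Y ] ∃[ k ] ⟦ derivation φ ⟧ (Y ∷ c₀ ∷ ps) × entry (suc k) c ∈ decode Y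
   derivation⁺′ p with first p
     where
     first : ∀ {c d} → TransClosure Transition c d → ∃[ e ] Transition c e × Star Transition e d
     first [ t ]   = _ , t , ε
     first (t ∷ p) = _ , t , Trans⇒Star p
   ... | c , t , p with extendStar 1 c (extendEdge 0 c₀ initial (here refl) t) (here refl) p
   ... | Y , zero , _ , _ , ()
   ... | Y , suc k , D , i , _ = encode Y , k , coded D , subst (_ ∈_) (sym (decode-encode Y)) i

   derivation⁻ : ∀ {Y} → ⟦ derivation φ ⟧ (Y ∷ c₀ ∷ ps) → ∀ k {c} → entry k c ∈ decode Y → Star Transition c₀ c × (k ≢ 0 → TransClosure Transition c₀ c)
   derivation⁻ {Y} D k i with All.lookup D i
   derivation⁻ {Y} D k {c} i | inj₁ eq with encode-injective (k ∷ c ∷ []) (0 ∷ c₀ ∷ []) eq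
   ... | refl = ε , λ ne → contradiction refl ne
   derivation⁻ {Y} D k {c} i | inj₂ a with find a
   ... | .(entry k′ c′) , i′ , (k′ ∷ c′ ∷ [] , refl , h) with view⁻ {xs = k′ ∷ c′ ∷ entry k′ c′ ∷ entry k c ∷ Y ∷ c₀ ∷ ps} {t = var 3F} (var 0F ≐ suc (var 2F) ∧ call φ (var 3F ∷ var 1F ∷ vars 8)) (k ∷ c ∷ []) refl h
   ... | refl , t with derivation⁻ D k′ i′
   ... | p , _ = p ◅◅ (t′ ◅ ε) , λ _ → p ◅◅⁺ [ t′ ]
     where
     t′ : Transition c′ c
     t′ = subst (λ ps → ⟦ φ ⟧ (c′ ∷ c ∷ ps)) (⟦vars⟧ (k ∷ c ∷ k′ ∷ c′ ∷ entry k′ c′ ∷ entry k c ∷ Y ∷ c₀ ∷ []) ps) t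

-- Steps and lassos; the arguments of stepᶠ are the new configuration, the
-- old one, Δ₁ and Δ₂.

senderBody receiverBody : Fm 17
senderBody = (var 0F ≐ var 9F ∧ var 3F ≐ var 5F ∧ var 6F ≐ var (# 10) ∧
  (var 2F ≐ lit codeZ ∧ var (# 11) ≐ lit 0 ∧ var 7F ≐ lit 0 ∧ var 8F ≐ var (# 12)
  ∨ neg (var 2F ≐ lit codeZ) ∧
    (var 1F ≐ lit 0 ∧ var 7F ≐ (var (# 11) ++ᵗ tlᵗ (var 2F)) ∧ var 8F ≐ var (# 12)
    ∨ var 1F ≐ lit 1 ∧ var 7F ≐ var (# 11) ∧ var 8F ≐ (var (# 12) ++ᵗ tlᵗ (var 2F)))))
receiverBody = (var 0F ≐ var (# 10) ∧ var 3F ≐ var 6F ∧ var 5F ≐ var 9F ∧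
  (var 1F ≐ lit 0 ∧ (tlᵗ (var 2F) ++ᵗ var 7F) ≐ var (# 11) ∧ var 8F ≐ var (# 12)
  ∨ var 1F ≐ lit 1 ∧ var 7F ≐ var (# 11) ∧ (tlᵗ (var 2F) ++ᵗ var 8F) ≐ var (# 12)))

stepBody : Fm 12
stepBody = any∈ (var (# 10)) (view 4 (var 0F) senderBody) ∨ any∈ (var (# 11)) (view 4 (var 0F) receiverBody)
  ∨ var 0F ≐ var 4F ∧ var 1F ≐ var 5F ∧ var 2F ≐ var 6F ∧ (var 3F ⊆ᵗ var 7F) ∧ neg (var 3F ≐ var 7F)

opaque
  stepᶠ : Fm 4
  stepᶠ = view 4 (var 0F) (view 4 (var 5F) stepBody)

encodeWord : ∀ {m} → Word m → ℕ
encodeWord u = encode (map toℕ u)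

encodeWord-injective : ∀ {m} {u v : Word m} → encodeWord u ≡ encodeWord v → u ≡ v
encodeWord-injective {u = u} {v} eq = Listₚ.map-injective Finₚ.toℕ-injective (encode-injective (map toℕ u) (map toℕ v) eq)

configVec : ∀ {a b m} → Fin a × Fin b × Word m × Word m → Vec ℕ 4
configVec (s , t , u , v) = toℕ s ∷ toℕ t ∷ encodeWord u ∷ encodeWord v ∷ []

encodeConfig : ∀ {a b m} → Fin a × Fin b × Word m × Word m → ℕ
encodeConfig C = encode (Vec.toList (configVec C))

encodeWord-++ : ∀ {m} (u v : Word m) → encodeWord (u ++ v) ≡ encode (map toℕ u ++ map toℕ v)
encodeWord-++ u v = cong encode (Listₚ.map-++ toℕ u v)

⊆-map⁻ : ∀ {A : Set} (f : A → ℕ) {ks} v → ks ⊆ map f v → ∃[ u ] u ⊆ v × map f u ≡ ks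
⊆-map⁻ f []      []         = [] , [] , refl
⊆-map⁻ f (x ∷ v) (_ ∷ʳ h)   with u , h′ , eq ← ⊆-map⁻ f v h = u , x ∷ʳ h′ , eq
⊆-map⁻ f (x ∷ v) (refl ∷ h) with u , h′ , eq ← ⊆-map⁻ f v h = x ∷ u , refl ∷ h′ , cong (f x ∷_) eq

payload : ∀ {m} (x : Maybe (Fin m)) → tl (encodeAct (comm x)) ≡ encodeWord (fromMaybe x)
payload nothing  = tl-cons 0 0
payload (just x) = tl-cons 1 (encodeWord (x ∷ []))

comm≢Z : ∀ {m} (x : Maybe (Fin m)) → encodeAct (comm x) ≢ codeZ
comm≢Z nothing  eq with encode-injective (0 ∷ []) (2 ∷ codeExp (Z {0}) ∷ []) eq
... | ()
comm≢Z (just x) eq with encode-injective (1 ∷ toℕ x ∷ []) (2 ∷ codeExp (Z {0}) ∷ []) eq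
... | ()

appended : ∀ {m} (u : Word m) x → ⟦ var 0F ++ᵗ tlᵗ (var 1F) ⟧ᵗ (encodeWord u ∷ encodeAct (comm x) ∷ []) ≡ encodeWord (u ++ fromMaybe x)
appended u x = trans (⟦++ᵗ⟧ (var 0F) (tlᵗ (var 1F)) {xs = encodeWord u ∷ encodeAct (comm x) ∷ []} {u = map toℕ u} {v = map toℕ (fromMaybe x)} refl (payload x)) (sym (encodeWord-++ u (fromMaybe x)))

prepended : ∀ {m} (x : Maybe (Fin m)) k → ⟦ tlᵗ (var 1F) ++ᵗ var 0F ⟧ᵗ (k ∷ encodeAct (comm x) ∷ []) ≡ encode (map toℕ (fromMaybe x) ++ decode k)
prepended x k = ⟦++ᵗ⟧ (tlᵗ (var 1F)) (var 0F) {xs = k ∷ encodeAct (comm x) ∷ []} {u = map toℕ (fromMaybe x)} (payload x) (sym (encode-decode k))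

prepended⁺ : ∀ {m} (x : Maybe (Fin m)) s → ⟦ tlᵗ (var 1F) ++ᵗ var 0F ⟧ᵗ (encodeWord s ∷ encodeAct (comm x) ∷ []) ≡ encodeWord (fromMaybe x ++ s)
prepended⁺ x s = trans (prepended x (encodeWord s)) (trans (cong (λ ks → encode (map toℕ (fromMaybe x) ++ ks)) (decode-encode _)) (sym (encodeWord-++ (fromMaybe x) s)))

prepended⁻ : ∀ {m} (x : Maybe (Fin m)) k u → ⟦ tlᵗ (var 1F) ++ᵗ var 0F ⟧ᵗ (k ∷ encodeAct (comm x) ∷ []) ≡ encodeWord u →
  ∃[ s ] u ≡ fromMaybe x ++ s × k ≡ encodeWord s
prepended⁻ x k u eq with encode-injective (map toℕ (fromMaybe x) ++ decode k) (map toℕ u) (trans (sym (prepended x k)) eq)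
prepended⁻ nothing  k u       _ | eq = u , refl , trans (sym (encode-decode k)) (cong encode eq)
prepended⁻ (just x) k (y ∷ u) _ | eq with Listₚ.∷-injective eq
... | x≡y , eq′ rewrite Finₚ.toℕ-injective x≡y = u , refl , trans (sym (encode-decode k)) (cong encode eq′)

any-rules⁺ : ∀ {m n} {Δ : List (Rule m n)} {P : ℕ → Set} {ρ} → ρ ∈ Δ → P (encodeRule ρ) → Any P (decode (encode (map encodeRule Δ)))
any-rules⁺ {Δ = Δ} i h = subst (Any _) (sym (decode-encode (map encodeRule Δ))) (lose (∈-map⁺ encodeRule i) h)

any-rules⁻ : ∀ {m n} {Δ : List (Rule m n)} {P : ℕ → Set} → Any P (decode (encode (map encodeRule Δ))) → ∃[ ρ ] ρ ∈ Δ × P (encodeRule ρ)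
any-rules⁻ {Δ = Δ} a with find (subst (Any _) (decode-encode (map encodeRule Δ)) a)
... | k , i , h with ∈-map⁻ encodeRule i
... | ρ , j , refl = ρ , j , h

lift* : ∀ {A : Set} (f : A → ℕ) {T : ℕ → ℕ → Set} {E : A → A → Set} → (∀ {a k} → T (f a) k → ∃[ b ] k ≡ f b × E a b) →
  ∀ {a k} → Star T (f a) k → ∃[ b ] k ≡ f b × Star E a b
lift* f g ε       = _ , refl , ε
lift* f {T} g (t ◅ p) with g t
... | b , refl , e = map₂ (map₂ (e ◅_)) (lift* f {T} g p)

lift⁺ : ∀ {A : Set} (f : A → ℕ) {T : ℕ → ℕ → Set} {E : A → A → Set} → (∀ {a k} → T (f a) k → ∃[ b ] k ≡ f b × E a b) →
  ∀ {a k} → TransClosure T (f a) k → ∃[ b ] k ≡ f b × TransClosure E a b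
lift⁺ f g [ t ] = map₂ (map₂ [_]) (g t)
lift⁺ f {T} g (t ∷ p) with g t
... | b , refl , e = map₂ (map₂ (e ∷_)) (lift⁺ f {T} g p)

module _ (S : UCST) (restricted : IsUCST[Z₁ʳ] S) where
  open UCST S

  rules₁ rules₂ : ℕ
  rules₁ = encode (map encodeRule Δ₁)
  rules₂ = encode (map encodeRule Δ₂)

  opaque
    unfolding stepᶠ

    step⁺ : ∀ {C D} → Step S C D → ⟦ stepᶠ ⟧ (encodeConfig C ∷ encodeConfig D ∷ rules₁ ∷ rules₂ ∷ [])
    step⁺ {C} {D} e = configVec C , refl , configVec D , refl , go e
      where
      Goal : Config S → Config S → Set
      Goal C D = ⟦ stepBody ⟧ (configVec D Vec.++ configVec C Vec.++ encodeConfig C ∷ encodeConfig D ∷ rules₁ ∷ rules₂ ∷ [])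
      go : ∀ {C D} → Step S C D → Goal C D
      go (test₁ {w = u , v} i h) with All.lookup (proj₁ restricted) i | h
      ... | isZʳ {s} {t} | Regex.ε = inj₁ (any-rules⁺ {Δ = Δ₁} i (ruleVec (rule s r (test (Z {m})) t) , refl , refl , refl , refl , inj₁ (refl , refl , refl , refl)))
      go (test₂ i h) = case All.lookup (proj₂ restricted) i of λ ()
      go (write {p = s} {s′} {w = u , v} {c = r} {x} i) = inj₁ (any-rules⁺ i (ruleVec (rule s r (comm x) s′) , refl , refl , refl , refl ,
        inj₂ (comm≢Z x , inj₁ (refl , sym (appended u x) , refl))))
      go (write {p = s} {s′} {w = u , v} {c = l} {x} i) = inj₁ (any-rules⁺ i (ruleVec (rule s l (comm x) s′) , refl , refl , refl , refl ,
        inj₂ (comm≢Z x , inj₂ (refl , refl , sym (appended v x)))))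
      go (read {q = t} {t′} {w = u , v} {c = r} {x} {s} i refl) = inj₂ (inj₁ (any-rules⁺ i (ruleVec (rule t r (comm x) t′) , refl , refl , refl , refl ,
        inj₁ (refl , prepended⁺ x s , refl))))
      go (read {q = t} {t′} {w = u , v} {c = l} {x} {s} i refl) = inj₂ (inj₁ (any-rules⁺ i (ruleVec (rule t l (comm x) t′) , refl , refl , refl , refl ,
        inj₂ (refl , refl , prepended⁺ x s))))
      go (loss {p = s} {t} {u} {v} i) = inj₂ (inj₂ (refl , refl , refl ,
        ⟦⊆ᵗ⟧⁺ (var 3F) (var 7F) {xs = configVec (s , t , u , removeAt v i) Vec.++ configVec (s , t , u , v)} refl refl (Subₚ.map⁺ toℕ (removeAt-⊆ v i)) ,
        λ eq → 1+n≢n (trans (sym (Listₚ.length-removeAt′ v i)) (cong length (sym (encodeWord-injective {u = removeAt v i} {v} eq))))))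

    step⁻ : ∀ {C c} → ⟦ stepᶠ ⟧ (encodeConfig C ∷ c ∷ rules₁ ∷ rules₂ ∷ []) → Σ[ D ∈ Config S ] c ≡ encodeConfig D × TransClosure (Step S) C D
    step⁻ {C@(s , t , u , v)} {c} h
      with d@(a ∷ b ∷ x ∷ y ∷ []) , refl , h′ ← view⁻ {xs = encodeConfig C ∷ c ∷ rules₁ ∷ rules₂ ∷ []} {t = var 0F}
        (view 4 (var 5F) stepBody) (configVec C) refl h
      = go h′
      where
      env : Vec ℕ 12
      env = a ∷ b ∷ x ∷ y ∷ toℕ s ∷ toℕ t ∷ encodeWord u ∷ encodeWord v ∷ encodeConfig C ∷ c ∷ rules₁ ∷ rules₂ ∷ []
      Result : Set
      Result = Σ[ D ∈ Config S ] encode (a ∷ b ∷ x ∷ y ∷ []) ≡ encodeConfig D × TransClosure (Step S) C D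
      build : ∀ (D : Config S) → TransClosure (Step S) C D → a ≡ toℕ (proj₁ D) → b ≡ toℕ (proj₁ (proj₂ D)) →
        x ≡ encodeWord (proj₁ (proj₂ (proj₂ D))) → y ≡ encodeWord (proj₂ (proj₂ (proj₂ D))) → Result
      build D p refl refl refl refl = D , refl , p
      matches : ∀ (w : Word m) → w ≡ [] → Regex._∈_ m w Z
      matches w refl = Regex.ε
      empty : ∀ (w : Word m) → encodeWord w ≡ 0 → w ≡ []
      empty w eq = encodeWord-injective {u = w} {[]} eq
      sent : ∀ {s′ ch α s″} → rule s′ ch α s″ ∈ Δ₁ → ⟦ senderBody ⟧ (ruleVec (rule s′ ch α s″) Vec.++ encodeRule (rule s′ ch α s″) ∷ env) → Result
      sent {s′} {ch} {α} {s″} i (s′≡s , s″≡a , b≡t , h) with Finₚ.toℕ-injective s′≡s | All.lookup (proj₁ restricted) i | h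
      ... | refl | isZʳ | inj₁ (_ , u≡0 , x≡0 , y≡v) =
        build (s″ , t , u , v) [ test₁ i (matches u (empty u u≡0)) ] (sym s″≡a) b≡t (trans x≡0 (sym u≡0)) y≡v
      sent i _ | refl | isZʳ | inj₂ (ne , _) = contradiction refl ne
      sent i _ | refl | isComm {x = y} | inj₁ (eq , _) = contradiction eq (comm≢Z y)
      sent {s″ = s″} i (_ , s″≡a , b≡t , _) | refl | isComm {c = r} {x = z} | inj₂ (_ , inj₁ (_ , x≡ , y≡)) =
        build (s″ , t , u ++ fromMaybe z , v) [ write i ] (sym s″≡a) b≡t (trans x≡ (appended u z)) y≡
      sent {s″ = s″} i (_ , s″≡a , b≡t , _) | refl | isComm {c = l} {x = z} | inj₂ (_ , inj₂ (_ , x≡ , y≡)) =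
        build (s″ , t , u , v ++ fromMaybe z) [ write i ] (sym s″≡a) b≡t x≡ (trans y≡ (appended v z))
      received : ∀ {t′ ch α t″} → rule t′ ch α t″ ∈ Δ₂ → ⟦ receiverBody ⟧ (ruleVec (rule t′ ch α t″) Vec.++ encodeRule (rule t′ ch α t″) ∷ env) → Result
      received {t″ = t″} i (t′≡t , t″≡b , a≡s , h) with Finₚ.toℕ-injective t′≡t | All.lookup (proj₂ restricted) i | h
      ... | refl | isComm {c = r} {x = z} | inj₁ (_ , u≡ , y≡) with prepended⁻ z x u u≡
      ... | w , eq , x≡ = build (s , t″ , w , v) [ read i eq ] a≡s (sym t″≡b) x≡ y≡
      received {t″ = t″} i (t′≡t , t″≡b , a≡s , h) | refl | isComm {c = l} {x = z} | inj₂ (_ , x≡ , v≡) with prepended⁻ z y v v≡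
      ... | w , eq , y≡ = build (s , t″ , u , w) [ read i eq ] a≡s (sym t″≡b) x≡ y≡
      go : ⟦ stepBody ⟧ env → Result
      go (inj₁ any₁) with any-rules⁻ {Δ = Δ₁} any₁
      ... | ρ , i , g = sent i (view⁻ {xs = encodeRule ρ ∷ env} {t = var 0F} senderBody (ruleVec ρ) refl g)
      go (inj₂ (inj₁ any₂)) with any-rules⁻ {Δ = Δ₂} any₂
      ... | ρ , i , g = received i (view⁻ {xs = encodeRule ρ ∷ env} {t = var 0F} receiverBody (ruleVec ρ) refl g)
      go (inj₂ (inj₂ (a≡s , b≡t , x≡u , y⊆v , y≢v)))
        with ⊆-map⁻ toℕ v (⟦⊆ᵗ⟧⁻ (var 3F) (var 7F) {xs = env} {u = decode y} {map toℕ v} (sym (encode-decode y)) refl y⊆v)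
      ... | w , w⊆v , eq = build (s , t , u , w) (nonempty (lossRun S w⊆v)) a≡s b≡t x≡u y≡
        where
        y≡ : y ≡ encodeWord w
        y≡ = trans (sym (encode-decode y)) (cong encode (sym eq))
        nonempty : Star (Step S) (s , t , u , v) (s , t , u , w) → TransClosure (Step S) (s , t , u , v) (s , t , u , w)
        nonempty p with first p
          where
          first : ∀ {C D} → Star (Step S) C D → C ≡ D ⊎ TransClosure (Step S) C D
          first ε       = inj₁ refl
          first (e ◅ p) = inj₂ (Star⇒Trans e p)
        ... | inj₁ refl = contradiction y≡ y≢v
        ... | inj₂ p⁺   = p⁺

-- The arguments are the old state, the new one and Δ₁.

opaque
  loopᶠ : Fm 3
  loopᶠ = any∈ (var 2F) (view 4 (var 0F) (var 0F ≐ var 5F ∧ var 3F ≐ var 6F ∧ neg (var 2F ≐ lit codeZ)))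

module _ (S : UCST) (restricted : IsUCST[Z₁ʳ] S) where
  open UCST S

  private
    LoopStep : ℕ → ℕ → Set
    LoopStep a b = ⟦ loopᶠ ⟧ (a ∷ b ∷ rules₁ S restricted ∷ [])

  opaque
    unfolding loopᶠ

    loop⁺ : ∀ {s z t e} → Path Δ₁ s (e ∷ z) t → All IsComm (e ∷ z) → TransClosure LoopStep (toℕ s) (toℕ t)
    loop⁺ (_∷_ {s} {c} {comm x} {s′} i p) (comm ∷ cs) = continue p cs
      where
      first : LoopStep (toℕ s) (toℕ s′)
      first = any-rules⁺ {Δ = Δ₁} i (ruleVec (rule s c (comm x) s′) , refl , refl , refl , comm≢Z x)
      continue : ∀ {z t} → Path Δ₁ s′ z t → All IsComm z → TransClosure LoopStep (toℕ s) (toℕ t)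
      continue []      []       = [ first ]
      continue (j ∷ p) (c ∷ cs) = first ∷ loop⁺ (j ∷ p) (c ∷ cs)

    loopStep⁻ : ∀ {s k} → LoopStep (toℕ s) k → ∃[ t ] k ≡ toℕ t × ∃[ e ] IsComm e × Path Δ₁ s (e ∷ []) t
    loopStep⁻ {s} {k} h with any-rules⁻ {Δ = Δ₁} h
    ... | ρ@(rule s′ c α t) , i , g with view⁻ {xs = encodeRule ρ ∷ toℕ s ∷ k ∷ rules₁ S restricted ∷ []} {t = var 0F}
      (var 0F ≐ var 5F ∧ var 3F ≐ var 6F ∧ neg (var 2F ≐ lit codeZ)) (ruleVec ρ) refl g
    ... | s′≡s , t≡k , α≢Z with Finₚ.toℕ-injective s′≡s | All.lookup (proj₁ restricted) i
    ... | refl | isZʳ   = contradiction refl α≢Z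
    ... | refl | isComm = t , sym t≡k , _ , comm , i ∷ []

  loop⁻ : ∀ {s k} → TransClosure LoopStep (toℕ s) k → ∃[ t ] k ≡ toℕ t × ∃[ e ] ∃[ z ] Path Δ₁ s (e ∷ z) t × All IsComm (e ∷ z)
  loop⁻ {s} h = map₂ (map₂ path) (lift⁺ toℕ {LoopStep} (λ {s} {k} → loopStep⁻ {s} {k}) h)
    where
    path : ∀ {s t} → TransClosure (λ s t → ∃[ e ] IsComm e × Path Δ₁ s (e ∷ []) t) s t → ∃[ e ] ∃[ z ] Path Δ₁ s (e ∷ z) t × All IsComm (e ∷ z)
    path [ e , c , p ] = e , [] , p , c ∷ []
    path ((e , c , p) ∷ h) with path h
    ... | e′ , z , p′ , cs = e , e′ ∷ z , p ⧺ p′ , c ∷ cs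

-- The arguments are the instance and [Y₁, Y₂, Y₃, u, v], where Y₁ derives
-- the configuration of the lasso, and Y₂ or Y₃ its loop.

lassoBody : Fm 16
lassoBody =
  call (derivation stepᶠ) (var 0F ∷ listᵗ (var (# 10) ∷ var (# 11) ∷ lit 0 ∷ lit 0 ∷ []) ∷ var 8F ∷ var 9F ∷ []) ∧
  any∈ (var 0F) (view 2 (var 0F) (var 1F ≐ base 3)) ∧
  (call (derivation stepᶠ) (var 1F ∷ base 0 ∷ var 8F ∷ var 9F ∷ []) ∧
     any∈ (var 1F) (view 2 (var 0F) (var 1F ≐ base 3 ∧ neg (var 0F ≐ lit 0)))
   ∨ call (derivation loopᶠ) (var 2F ∷ var (# 12) ∷ var 8F ∷ []) ∧
     any∈ (var 2F) (view 2 (var 0F) (var 1F ≐ var (# 15) ∧ neg (var 0F ≐ lit 0))))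
  where
  base : ∀ n → Tm (n + 16)
  base n = listᵗ (var (n ↑ʳ # 12) ∷ var (n ↑ʳ # 13) ∷ var (n ↑ʳ # 3) ∷ var (n ↑ʳ # 4) ∷ [])


opaque
  lassoᶠ : Fm 2
  lassoᶠ = view 9 (var 0F) (view 5 (var (# 10)) lassoBody)

module _ (I : Instance) (restricted : IsUCST[Z₁ʳ] (Instance.system I)) where
  open Instance I

  private
    codes₁ codes₂ : ℕ
    codes₁ = rules₁ system restricted
    codes₂ = rules₂ system restricted

    CodedStep : ℕ → ℕ → Set
    CodedStep a b = ⟦ stepᶠ ⟧ (a ∷ b ∷ codes₁ ∷ codes₂ ∷ [])

    star⁺ : ∀ {C D} → Star (Step system) C D → Star CodedStep (encodeConfig C) (encodeConfig D)
    star⁺ = Star.gmap encodeConfig (step⁺ system restricted)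

    trans⁺ : ∀ {C D} → TransClosure (Step system) C D → TransClosure CodedStep (encodeConfig C) (encodeConfig D)
    trans⁺ [ e ]   = [ step⁺ system restricted e ]
    trans⁺ (e ∷ p) = step⁺ system restricted e ∷ trans⁺ p

    star⁻ : ∀ {C d} → Star CodedStep (encodeConfig C) d → Σ[ D ∈ Config system ] d ≡ encodeConfig D × Star (Step system) C D
    star⁻ h = map₂ (map₂ (λ p → Star.concat (Star.map Trans⇒Star p))) (lift* encodeConfig {CodedStep} (step⁻ system restricted) h)

    trans⁻ : ∀ {C d} → TransClosure CodedStep (encodeConfig C) d → Σ[ D ∈ Config system ] d ≡ encodeConfig D × TransClosure (Step system) C D
    trans⁻ h = map₂ (map₂ flatten) (lift⁺ encodeConfig {CodedStep} (step⁻ system restricted) h)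
      where
      flatten : ∀ {C D} → TransClosure (TransClosure (Step system)) C D → TransClosure (Step system) C D
      flatten [ p ]   = p
      flatten (p ∷ q) = Trans⇒Star p ◅◅⁺ flatten q

    configVec-injective : ∀ {C D : Config system} → encodeConfig C ≡ encodeConfig D → C ≡ D
    configVec-injective {s , t , u , v} {s′ , t′ , u′ , v′} eq with encode-toList-injective (configVec (s , t , u , v)) (configVec (s′ , t′ , u′ , v′)) eq
    ... | eq′ with Vecₚ.∷-injective eq′
    ... | s≡ , eq₁ with Vecₚ.∷-injective eq₁
    ... | t≡ , eq₂ with Vecₚ.∷-injective eq₂
    ... | u≡ , eq₃ with Vecₚ.∷-injective eq₃
    ... | v≡ , _ = cong₂ _,_ (Finₚ.toℕ-injective s≡) (cong₂ _,_ (Finₚ.toℕ-injective t≡) (cong₂ _,_ (encodeWord-injective {u = u} {u′} u≡) (encodeWord-injective {u = v} {v′} v≡)))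

    place : ∀ {C : Config system} {x₁ x₂} → encodeConfig C ≡ encode (toℕ p ∷ toℕ q ∷ x₁ ∷ x₂ ∷ []) → C ≡ (p , q , proj₂ (proj₂ C))
    place {s , t , u , v} {x₁} {x₂} eq with encode-injective (toℕ s ∷ toℕ t ∷ encodeWord u ∷ encodeWord v ∷ []) (toℕ p ∷ toℕ q ∷ x₁ ∷ x₂ ∷ []) eq
    ... | e = cong₂ (λ s t → s , t , u , v) (Finₚ.toℕ-injective (proj₁ (Listₚ.∷-injective e))) (Finₚ.toℕ-injective (proj₁ (Listₚ.∷-injective (proj₂ (Listₚ.∷-injective e)))))

    initialConfig : Config system
    initialConfig = pᵢₙ , qᵢₙ , [] , []

  opaque
    unfolding lassoᶠ

    lasso⁺ : Lasso I → ∃[ y ] ⟦ lassoᶠ ⟧ (encodeInstance I ∷ y ∷ [])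
    lasso⁺ ((u , v) , reach , loop) with derivation⁺ stepᶠ (codes₁ ∷ codes₂ ∷ []) (encodeConfig initialConfig) (star⁺ {initialConfig} reach)
    ... | Y₁ , k₁ , d₁ , i₁ = build loop
      where
      w : Config system
      w = p , q , u , v
      build : TransClosure (Step system) w w ⊎ SenderLoop system p → ∃[ y ] ⟦ lassoᶠ ⟧ (encodeInstance I ∷ y ∷ [])
      build (inj₁ cycle) with derivation⁺′ stepᶠ (codes₁ ∷ codes₂ ∷ []) (encodeConfig w) (trans⁺ cycle)
      ... | Y₂ , k₂ , d₂ , i₂ =
        encode (Y₁ ∷ Y₂ ∷ 0 ∷ encodeWord u ∷ encodeWord v ∷ []) , instanceVec I , refl , Y₁ ∷ Y₂ ∷ 0 ∷ encodeWord u ∷ encodeWord v ∷ [] , refl ,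
        d₁ , lose i₁ (k₁ ∷ encodeConfig w ∷ [] , refl , refl) ,
        inj₁ (d₂ , lose i₂ (suc k₂ ∷ encodeConfig w ∷ [] , refl , refl , λ ()))
      build (inj₂ (e , z , path , comms)) with derivation⁺′ loopᶠ (codes₁ ∷ []) (toℕ p) (loop⁺ system restricted path comms)
      ... | Y₃ , k₃ , d₃ , i₃ =
        encode (Y₁ ∷ 0 ∷ Y₃ ∷ encodeWord u ∷ encodeWord v ∷ []) , instanceVec I , refl , Y₁ ∷ 0 ∷ Y₃ ∷ encodeWord u ∷ encodeWord v ∷ [] , refl ,
        d₁ , lose i₁ (k₁ ∷ encodeConfig w ∷ [] , refl , refl) ,
        inj₂ (d₃ , lose i₃ (suc k₃ ∷ toℕ p ∷ [] , refl , refl , λ ()))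

    lasso⁻ : ∀ {y} → ⟦ lassoᶠ ⟧ (encodeInstance I ∷ y ∷ []) → Lasso I
    lasso⁻ {y} h with view⁻ {xs = encodeInstance I ∷ y ∷ []} {t = var 0F} (view 5 (var (# 10)) lassoBody) (instanceVec I) refl h
    ... | Y₁ ∷ Y₂ ∷ Y₃ ∷ x₁ ∷ x₂ ∷ [] , refl , d₁ , any₁ , loop with find any₁
    ... | _ , i₁ , (k₁ ∷ c₁ ∷ [] , refl , c₁≡)
      with star⁻ {initialConfig} (proj₁ (derivation⁻ stepᶠ (codes₁ ∷ codes₂ ∷ []) (encodeConfig initialConfig) {Y₁} d₁ k₁ i₁))
    ... | C@(s , t , w) , eq , reach with trans (sym eq) c₁≡
    ... | eqs with place {C} eqs | loop
    ... | C≡ | inj₁ (d₂ , any₂) with find any₂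
    ... | _ , i₂ , (k₂ ∷ c₂ ∷ [] , refl , c₂≡ , k₂≢0)
      with trans⁻ {C} (proj₂ (derivation⁻ stepᶠ (codes₁ ∷ codes₂ ∷ []) (encodeConfig C) {Y₂} (subst (λ c → ⟦ derivation stepᶠ ⟧ (Y₂ ∷ c ∷ codes₁ ∷ codes₂ ∷ [])) (sym eqs) d₂) k₂ i₂) k₂≢0)
    ... | D , eq′ , cycle = w , subst (Star (Step system) initialConfig) C≡ reach ,
      inj₁ (subst₂ (TransClosure (Step system)) C≡ (trans (configVec-injective {D} {C} (trans (sym eq′) (trans c₂≡ (sym eqs)))) C≡) cycle)
    lasso⁻ {y} h | Y₁ ∷ Y₂ ∷ Y₃ ∷ x₁ ∷ x₂ ∷ [] , refl , d₁ , any₁ , loop | _ , i₁ , (k₁ ∷ c₁ ∷ [] , refl , c₁≡) | C@(s , t , w) , eq , reach | eqs | C≡ | inj₂ (d₃ , any₃) with find any₃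
    ... | _ , i₃ , (k₃ ∷ c₃ ∷ [] , refl , c₃≡ , k₃≢0)
      with loop⁻ system restricted (proj₂ (derivation⁻ loopᶠ (codes₁ ∷ []) (toℕ p) {Y₃} d₃ k₃ i₃) k₃≢0)
    ... | t′ , eq′ , e , z , path , comms = w , subst (Star (Step system) initialConfig) C≡ reach ,
      inj₂ (e , z , subst (Path Δ₁ p (e ∷ z)) (Finₚ.toℕ-injective (trans (sym eq′) c₃≡)) path , comms)

-- Saturation under an almost-full decidable relation

module _ {A : Set} {_≼_ : A → A → Set} (≼-refl : ∀ {x} → x ≼ x) (≼-trans : ∀ {x y z} → x ≼ y → y ≼ z → x ≼ z)
  (_≼?_ : ∀ x y → Dec (x ≼ y)) (succs : A → List A) (P : A → Set) (preserved : ∀ {x} → P x → All P (succs x)) where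

  private
    Below : List A → A → Set
    Below L y = Any (_≼ y) L

    Closed : List A → List A → Set
    Closed L K = All (λ x → All (Below L) (succs x)) K

    -- The search from x stops at elements that lie above an ancestor.
    explore : ∀ {R : A → A → Set} → AF R → (ancestors : List A) → (∀ {y z} → R y z → y ≼ z ⊎ Below ancestors y) →
      ∀ x → P x → ∃[ K ] Below (K ++ ancestors) x × Closed (K ++ ancestors) K × All P K

    exploreAll : ∀ {R : A → A → Set} → AF R → (ancestors : List A) → (∀ {y z} → R y z → y ≼ z ⊎ Below ancestors y) →
      ∀ xs → All P xs → ∃[ K ] All (Below (K ++ ancestors)) xs × Closed (K ++ ancestors) K × All P K

    exploreAll t anc f []       []       = [] , [] , [] , []
    exploreAll t anc f (x ∷ xs) (p ∷ ps) with explore t anc f x p | exploreAll t anc f xs ps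
    ... | K , b , c , k | K′ , b′ , c′ , k′ = K ++ K′ , weaken₁ b ∷ All.map weaken₂ b′ ,
      Allₚ.++⁺ (All.map (All.map weaken₁) c) (All.map (All.map weaken₂) c′) , Allₚ.++⁺ k k′
      where
      weaken₁ : ∀ {y} → Below (K ++ anc) y → Below ((K ++ K′) ++ anc) y
      weaken₁ h = subst (Any _) (sym (Listₚ.++-assoc K K′ anc)) ([ Anyₚ.++⁺ˡ , Anyₚ.++⁺ʳ K ∘ Anyₚ.++⁺ʳ K′ ]′ (Anyₚ.++⁻ K h))
      weaken₂ : ∀ {y} → Below (K′ ++ anc) y → Below ((K ++ K′) ++ anc) y
      weaken₂ h = subst (Any _) (sym (Listₚ.++-assoc K K′ anc)) (Anyₚ.++⁺ʳ K h)

    explore t anc f x p with any? (_≼? x) anc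
    explore t anc f x p | yes b = [] , b , [] , []
    explore (now t) anc f x p | no ¬b = x ∷ [] , here ≼-refl , All.tabulate (λ {y} _ → above y) ∷ [] , p ∷ []
      where
      above : ∀ y → Below (x ∷ anc) y
      above y with f (t x y)
      ... | inj₁ h = here h
      ... | inj₂ b = contradiction b ¬b
    explore (later t) anc f x p | no ¬b with exploreAll (t x) (x ∷ anc) g (succs x) (preserved p)
      where
      g : ∀ {y z} → _ → y ≼ z ⊎ Below (x ∷ anc) y
      g (inj₁ h) with f h
      ... | inj₁ h′ = inj₁ h′
      ... | inj₂ b  = inj₂ (there b)
      g (inj₂ h) with f h
      ... | inj₁ h′ = inj₂ (here h′)
      ... | inj₂ b  = contradiction b ¬b
    ... | K , b , c , k = x ∷ K , here ≼-refl , All.map move b ∷ All.map (All.map move) c , p ∷ k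
      where
      move : ∀ {y} → Below (K ++ x ∷ anc) y → Below (x ∷ K ++ anc) y
      move h with Anyₚ.++⁻ K h
      ... | inj₁ i         = there (Anyₚ.++⁺ˡ i)
      ... | inj₂ (here i)  = here i
      ... | inj₂ (there i) = there (Anyₚ.++⁺ʳ K i)

  saturate : AF _≼_ → ∀ xs → All P xs → ∃[ L ] All (λ x → Any (_≼ x) L) xs × All (λ x → All (λ y → Any (_≼ y) L) (succs x)) L × All P L
  saturate t xs ps with exploreAll t [] inj₁ xs ps
  ... | K , b , c , k = K , All.map clean b , All.map (All.map clean) c , k
    where
    clean : ∀ {y} → Below (K ++ []) y → Below K y
    clean = subst (λ L → Below L _) (Listₚ.++-identityʳ K)

-- Post embedding: paths of a labelled graph whose reads form a subword of
-- their writes. A path is cut into pieces that either read before they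
-- write or write before they read; forward t describes paths with reads
-- embedded in writes followed by t, and backward t (with t reversed) paths
-- with reads embedded in t followed by the writes.

data Lab (A : Set) : Set where
  none  : Lab A
  wr rd : A → Lab A

module _ {A : Set} where

  wrote red : Lab A → List A
  wrote (wr a) = a ∷ []
  wrote _      = []
  red (rd a)   = a ∷ []
  red _        = []

data GPath {N A : Set} (Edge : N → Lab A → N → Set) : N → List (Lab A) → N → Set where
  []  : ∀ {s} → GPath Edge s [] s
  _∷_ : ∀ {s λ′ s′ z s″} → Edge s λ′ s′ → GPath Edge s′ z s″ → GPath Edge s (λ′ ∷ z) s″

module _ {N A : Set} {Edge : N → Lab A → N → Set} where

  _⧺ᵍ_ : ∀ {s z s′ z′ s″} → GPath Edge s z s′ → GPath Edge s′ z′ s″ → GPath Edge s (z ++ z′) s″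
  []      ⧺ᵍ q = q
  (e ∷ p) ⧺ᵍ q = e ∷ (p ⧺ᵍ q)

module Pending {N A : Set} (_≟_ : ∀ (x y : A) → Dec (x ≡ y)) (Edge : N → Lab A → N → Set) where

  private module R = Residual _≟_

  writes reads : List (Lab A) → List A
  writes = concatMap wrote
  reads  = concatMap red

  Embeds : N → N → Set
  Embeds s s′ = ∃[ z ] GPath Edge s z s′ × reads z ⊆ writes z

  shift : Lab A → List A → List A
  shift e t = R.res (wrote e) (t ++ red e)

  Forward Backward : N → N → List A → Set
  Forward  s₀ s t = ∃[ z ] GPath Edge s₀ z s × reads z ⊆ writes z ++ t
  Backward s₀ s t = ∃[ z ] GPath Edge s z s₀ × reads z ⊆ reverse t ++ writes z

  forward-step : ∀ {s₀ s s′ t e} → Edge s e s′ → Forward s₀ s t → Forward s₀ s′ (shift e t)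
  forward-step {t = t} {e} i (z , p , h) = z ++ e ∷ [] , p ⧺ᵍ (i ∷ []) ,
    subst₂ _⊆_ (sym (Listₚ.concatMap-++ red z (e ∷ [])))
      (sym (trans (cong (_++ shift e t) (trans (Listₚ.concatMap-++ wrote z (e ∷ [])) (cong (writes z ++_) (Listₚ.++-identityʳ (wrote e))))) (Listₚ.++-assoc (writes z) (wrote e) (shift e t))))
      (⊆-trans (Subₚ.++⁺ h (⊆-refl {x = red e ++ []}))
        (subst (_⊆ writes z ++ wrote e ++ shift e t)
          (trans (cong (λ w → writes z ++ t ++ w) (sym (Listₚ.++-identityʳ (red e)))) (sym (Listₚ.++-assoc (writes z) t (red e ++ []))))
          (Subₚ.++⁺ (⊆-refl {x = writes z}) (R.res⁻ (wrote e) ⊆-refl))))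

  backward-step : ∀ {s₀ s s′ t e} → Edge s e s′ → Backward s₀ s′ t → Backward s₀ s (shift e t)
  backward-step {t = t} {e} i (z , p , h) = e ∷ z , i ∷ p ,
    ⊆-trans (Subₚ.++⁺ (⊆-refl {x = red e}) h)
      (subst₂ _⊆_ (Listₚ.++-assoc (red e) (reverse t) (writes z)) (Listₚ.++-assoc (reverse (shift e t)) (wrote e) (writes z)) (Subₚ.++⁺ prefix (⊆-refl {x = writes z})))
    where
    reverse-short : ∀ e → reverse (red e) ≡ red e × reverse (wrote e) ≡ wrote e
    reverse-short none   = refl , refl
    reverse-short (wr a) = refl , refl
    reverse-short (rd a) = refl , refl
    prefix : red e ++ reverse t ⊆ reverse (shift e t) ++ wrote e
    prefix = subst₂ _⊆_
      (trans (Listₚ.reverse-++ t (red e)) (cong (_++ reverse t) (proj₁ (reverse-short e))))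
      (trans (Listₚ.reverse-++ (wrote e) (shift e t)) (cong (reverse (shift e t) ++_) (proj₂ (reverse-short e))))
      (Subₚ.reverse⁺ (R.res⁻ (wrote e) {t ++ red e} ⊆-refl))

  module _ (s₀ : N) (𝒜 : N → List A → Set) (𝒞 : N → N → List A → Set)
    (𝒜-up : ∀ {s} {t t′ : List A} → t ⊆ t′ → 𝒜 s t → 𝒜 s t′) (𝒞-up : ∀ {s s′} {t t′ : List A} → t ⊆ t′ → 𝒞 s s′ t → 𝒞 s s′ t′)
    (𝒜-start : 𝒜 s₀ []) (𝒞-start : ∀ s → 𝒞 s s [])
    (𝒜-step : ∀ {s e s′ t} → Edge s e s′ → 𝒜 s t → 𝒜 s′ (shift e t))
    (𝒞-step : ∀ {s e s′ s″ t} → Edge s e s′ → 𝒞 s″ s′ t → 𝒞 s″ s (shift e t))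
    (join : ∀ {s s′} → 𝒜 s [] → 𝒞 s′ s [] → 𝒜 s′ []) where

    private
      skip : ∀ {b : A} {y′ : List A} (v : List A) {y : List A} → b ∷ y′ ⊆ v ++ y → (Σ[ v′ ∈ List A ] b ∷ v′ ⊆ v × y′ ⊆ v′ ++ y) ⊎ b ∷ y′ ⊆ y
      skip []      h          = inj₂ h
      skip (a ∷ v) (refl ∷ h) = inj₁ (v , ⊆-refl , h)
      skip (a ∷ v) (_ ∷ʳ h)   = Sum.map₁ (λ (v′ , i , j) → v′ , a ∷ʳ i , j) (skip v h)

      causal : ∀ {s z s′} → GPath Edge s z s′ → ∀ (v : List A) → reads z ⊆ v ++ writes z →
        ∃[ s″ ] 𝒞 s″ s (reverse v) × ∃[ z′ ] GPath Edge s″ z′ s′ × reads z′ ⊆ writes z′ × length z′ ≤ length z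
      causal {s} [] v h = s , 𝒞-up (minimum _) (𝒞-start s) , [] , [] , [] , z≤n
      causal (_∷_ {λ′ = none} e p) v h with causal p v h
      ... | s″ , c , z′ , p′ , h′ , le = s″ , subst (𝒞 s″ _) (Listₚ.++-identityʳ _) (𝒞-step e c) , z′ , p′ , h′ , m≤n⇒m≤1+n le
      causal (_∷_ {λ′ = wr a} {z = z} e p) v h with causal p (v ++ a ∷ []) (subst (reads z ⊆_) (sym (Listₚ.++-assoc v (a ∷ []) (writes z))) h)
      ... | s″ , c , z′ , p′ , h′ , le = s″ , subst (𝒞 s″ _) same (𝒞-step e c) , z′ , p′ , h′ , m≤n⇒m≤1+n le
        where
        popped : ∀ w → R.pop a (a ∷ w) ≡ w
        popped w with a ≟ a
        ... | yes _ = refl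
        ... | no ne = contradiction refl ne
        same : R.pop a (reverse (v ++ a ∷ []) ++ []) ≡ reverse v
        same = trans (cong (R.pop a) (trans (Listₚ.++-identityʳ _) (Listₚ.reverse-++ v (a ∷ [])))) (popped (reverse v))
      causal q@(_∷_ {s} {λ′ = rd b} {z = z} e p) v h with skip v h
      ... | inj₂ h′ = s , 𝒞-up (minimum _) (𝒞-start s) , rd b ∷ z , q , h′ , ≤-refl
      ... | inj₁ (v′ , i , j) with causal p v′ j
      ... | s″ , c , z′ , p′ , h′ , le = s″ , 𝒞-up up (𝒞-step e c) , z′ , p′ , h′ , m≤n⇒m≤1+n le
        where
        up : reverse v′ ++ b ∷ [] ⊆ reverse v
        up = subst (_⊆ reverse v) (Listₚ.unfold-reverse b v′) (Subₚ.reverse⁺ i)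

    forward-complete : ∀ {s z s′ t} → Acc _<_ (length z) → GPath Edge s z s′ → 𝒜 s t → t ++ reads z ⊆ writes z → 𝒜 s′ []
    forward-complete {s} {t = t} _ [] a h = subst (𝒜 s) (Listₚ.++-conicalˡ t [] (⊆[]⇒≡ h)) a
    forward-complete {t = t} (acc rs) (_∷_ {λ′ = none} e p) a h =
      forward-complete (rs ≤-refl) p (subst (𝒜 _) (Listₚ.++-identityʳ t) (𝒜-step e a)) h
    forward-complete {t = t} (acc rs) (_∷_ {λ′ = rd b} {z = z} e p) a h =
      forward-complete (rs ≤-refl) p (𝒜-step e a) (subst (_⊆ writes z) (sym (Listₚ.++-assoc t (b ∷ []) (reads z))) h)
    forward-complete {t = []} (acc rs) (_∷_ {λ′ = wr a} e p) h₀ h with causal p (a ∷ []) h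
    ... | s″ , c , z′ , p′ , h′ , le = forward-complete (rs (s≤s le)) p′ (join h₀ (subst (𝒞 s″ _) same (𝒞-step e c))) h′
      where
      same : R.pop a (a ∷ []) ≡ []
      same with a ≟ a
      ... | yes _ = refl
      ... | no ne = contradiction refl ne
    forward-complete {t = t@(c ∷ t′)} (acc rs) (_∷_ {λ′ = wr a} {z = z} e p) h₀ h =
      forward-complete (rs ≤-refl) p (𝒜-step e h₀) (subst (_⊆ writes z) (sym same) (R.pop⁺ h))
      where
      same : R.pop a (t ++ []) ++ reads z ≡ R.pop a (t ++ reads z)
      same rewrite Listₚ.++-identityʳ t′ with c ≟ a
      ... | yes _ = refl
      ... | no  _ = refl

    embeds⇒final : ∀ {s} → Embeds s₀ s → 𝒜 s []
    embeds⇒final (z , p , h) = forward-complete (<-wellFounded _) p 𝒜-start h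

-- Channel systems without tests as a post embedding problem. The reliable
-- channel is used as a rendezvous; nothing stands for a receiver that has
-- read its last letter, after which the sender may write to r freely.

data Local {m} : Channel → Maybe (Fin m) → Set where
  onL  : ∀ {x} → Local l x
  idle : Local r nothing

local? : ∀ {m} c (x : Maybe (Fin m)) → Dec (Local c x)
local? l x        = yes onL
local? r nothing  = yes idle
local? r (just _) = no (λ ())

label : ∀ {A : Set} → (A → Lab A) → Channel → Maybe A → Lab A
label f l (just a) = f a
label f _ _        = none

rulesIn : ∀ {m n} (Δ : List (Rule m n)) → List (∃[ ρ ] ρ ∈ Δ)
rulesIn []      = []
rulesIn (ρ ∷ Δ) = (ρ , here refl) ∷ map (map₂ there) (rulesIn Δ)

∈-rulesIn : ∀ {m n} {Δ : List (Rule m n)} {ρ} (i : ρ ∈ Δ) → (ρ , i) ∈ rulesIn Δ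
∈-rulesIn (here refl) = here refl
∈-rulesIn (there i)   = there (∈-map⁺ (map₂ there) (∈-rulesIn i))

∈-concatMap : ∀ {A B : Set} (f : A → List B) {xs x y} → x ∈ xs → y ∈ f x → y ∈ concatMap f xs
∈-concatMap f i j = ∈-concatMap⁺ f (lose i j)

when : ∀ {P A : Set} → Dec P → (P → A) → List A
when (yes p) f = f p ∷ []
when (no  _) f = []

∈-when : ∀ {P A : Set} (d : Dec P) (f : P → A) → P → ∃[ p ] f p ∈ when d f
∈-when (yes p) f _ = p , here refl
∈-when (no ¬p) f p = contradiction p ¬p

allMaybe : ∀ n → List (Maybe (Fin n))
allMaybe n = nothing ∷ map just (allFin n)

∈-allMaybe : ∀ {n} t → t ∈ allMaybe n
∈-allMaybe nothing  = here refl
∈-allMaybe (just t) = there (∈-map⁺ just (∈-allFin t))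

module Product (I : Instance) (ucs : IsUCS (Instance.system I)) where
  open Instance I

  Node : Set
  Node = Fin n₁ × Maybe (Fin n₂)

  data Edge : Node → Lab (Fin m) → Node → Set where
    send : ∀ {s c x s′} → rule s c (comm x) s′ ∈ Δ₁ → ∀ t → Local c x ⊎ t ≡ nothing → Edge (s , t) (label wr c x) (s′ , t)
    recv : ∀ {t c x t′} → rule t c (comm x) t′ ∈ Δ₂ → Local c x → ∀ s → Edge (s , just t) (label rd c x) (s , just t′)
    sync : ∀ {s t x s′ t′} → rule s r (comm x) s′ ∈ Δ₁ → rule t r (comm x) t′ ∈ Δ₂ → Edge (s , just t) none (s′ , just t′)
    stop : ∀ s → Edge (s , just q) none (s , nothing)

  open Pending Finₚ._≟_ Edge

  Arc : Set
  Arc = Σ[ e ∈ Node × Lab (Fin m) × Node ] Edge (proj₁ e) (proj₁ (proj₂ e)) (proj₂ (proj₂ e))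

  private
    free? : ∀ c (x : Maybe (Fin m)) (t : Maybe (Fin n₂)) → Dec (Local c x ⊎ t ≡ nothing)
    free? c x nothing  = yes (inj₂ refl)
    free? c x (just t) = map′ inj₁ (λ { (inj₁ h) → h }) (local? c x)

    sendArcs : (∃[ ρ ] ρ ∈ Δ₁) → List Arc
    sendArcs (rule s c (test _) s′ , i) = []
    sendArcs (rule s c (comm x) s′ , i) = concatMap (λ t → when (free? c x t) (λ f → _ , send i t f)) (allMaybe n₂)

    recvArcs : (∃[ ρ ] ρ ∈ Δ₂) → List Arc
    recvArcs (rule t c (test _) t′ , i) = []
    recvArcs (rule t c (comm x) t′ , i) = concatMap (λ s → when (local? c x) (λ f → _ , recv i f s)) (allFin n₁)

    syncArc : (∃[ ρ ] ρ ∈ Δ₁) → (∃[ ρ ] ρ ∈ Δ₂) → List Arc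
    syncArc (rule s r (comm nothing) s′ , i)  (rule t r (comm nothing) t′ , j)  = (_ , sync i j) ∷ []
    syncArc (rule s r (comm (just x)) s′ , i) (rule t r (comm (just y)) t′ , j) with x Finₚ.≟ y
    ... | yes refl = (_ , sync i j) ∷ []
    ... | no _     = []
    syncArc _ _ = []

  arcs : List Arc
  arcs = concatMap sendArcs (rulesIn Δ₁) ++ concatMap recvArcs (rulesIn Δ₂) ++
         concatMap (λ i → concatMap (syncArc i) (rulesIn Δ₂)) (rulesIn Δ₁) ++ map (λ s → _ , stop s) (allFin n₁)

  ∈-arcs : ∀ {s e s′} → Edge s e s′ → (s , e , s′) ∈ map proj₁ arcs
  ∈-arcs h = let k , i = go h in ∈-map⁺ proj₁ i
    where
    go : ∀ {s e s′} → Edge s e s′ → ∃[ h ] ((s , e , s′) , h) ∈ arcs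
    go (send {c = c} {x} i t f) with ∈-when (free? c x t) (λ f → _ , send i t f) f
    ... | f′ , j = _ , ∈-++⁺ˡ (∈-concatMap sendArcs (∈-rulesIn i) (∈-concatMap (λ t → when (free? c x t) (λ f → _ , send i t f)) (∈-allMaybe t) j))
    go (recv {c = c} {x} i f s) with ∈-when (local? c x) (λ f → _ , recv i f s) f
    ... | f′ , j = _ , ∈-++⁺ʳ (concatMap sendArcs (rulesIn Δ₁)) (∈-++⁺ˡ (∈-concatMap recvArcs (∈-rulesIn i) (∈-concatMap (λ s → when (local? c x) (λ f → _ , recv i f s)) (∈-allFin s) j)))
    go (sync i j) = sync i j , ∈-++⁺ʳ (concatMap sendArcs (rulesIn Δ₁)) (∈-++⁺ʳ (concatMap recvArcs (rulesIn Δ₂)) (∈-++⁺ˡ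
      (∈-concatMap (λ i → concatMap (syncArc i) (rulesIn Δ₂)) (∈-rulesIn i) (∈-concatMap (syncArc (_ , i)) (∈-rulesIn j) (synced i j)))))
      where
      synced : ∀ {s t x s′ t′} (i : rule s r (comm x) s′ ∈ Δ₁) (j : rule t r (comm x) t′ ∈ Δ₂) → (_ , sync i j) ∈ syncArc (_ , i) (_ , j)
      synced {x = nothing} i j = here refl
      synced {x = just x}  i j with x Finₚ.≟ x
      ... | yes refl = here refl
      ... | no ne    = contradiction refl ne
    go (stop s) = stop s , ∈-++⁺ʳ (concatMap sendArcs (rulesIn Δ₁)) (∈-++⁺ʳ (concatMap recvArcs (rulesIn Δ₂))
      (∈-++⁺ʳ (concatMap (λ i → concatMap (syncArc i) (rulesIn Δ₂)) (rulesIn Δ₁)) (∈-map⁺ (λ s → _ , stop s) (∈-allFin s))))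

  comms₁ : ∀ {s z s′} → Path Δ₁ s z s′ → All IsComm z
  comms₁ [] = []
  comms₁ (i ∷ p) with All.lookup (proj₁ ucs) i
  ... | isComm = comm ∷ comms₁ p

  comms₂ : ∀ {s z s′} → Path Δ₂ s z s′ → All IsComm z
  comms₂ [] = []
  comms₂ (i ∷ p) with All.lookup (proj₂ ucs) i
  ... | isComm = comm ∷ comms₂ p

  private
    wrote-label : ∀ c (x : Maybe (Fin m)) → wrote (label wr c x) ≡ letters l (c , comm x) × red (label wr c x) ≡ []
    wrote-label r nothing  = refl , refl
    wrote-label r (just _) = refl , refl
    wrote-label l nothing  = refl , refl
    wrote-label l (just _) = refl , refl

    red-label : ∀ c (x : Maybe (Fin m)) → red (label rd c x) ≡ letters l (c , comm x) × wrote (label rd c x) ≡ []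
    red-label r nothing  = refl , refl
    red-label r (just _) = refl , refl
    red-label l nothing  = refl , refl
    red-label l (just _) = refl , refl

    unheard : ∀ {c} {x : Maybe (Fin m)} → Local c x → letters r (c , comm x) ≡ []
    unheard onL  = refl
    unheard idle = refl

    record Joined (s : Node) (σ τ : List (Label m)) (s′ : Node) : Set where
      constructor joined
      field
        {labels} : List (Lab (Fin m))
        path     : GPath Edge s labels s′
        written  : writes labels ≡ traffic l σ
        consumed : reads labels ≡ traffic l τ

    send⁺ : ∀ {s c x s′ t σ τ s″} → rule s c (comm x) s′ ∈ Δ₁ → Local c x ⊎ t ≡ nothing → Joined (s′ , t) σ τ s″ → Joined (s , t) ((c , comm x) ∷ σ) τ s″
    send⁺ {c = c} {x} i f (joined {z} p w h) with wrote-label c x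
    ... | eq , eq′ = joined (send i _ f ∷ p) (cong₂ _++_ eq w) (trans (cong (_++ reads z) eq′) h)

    recv⁺ : ∀ {t c x t′ s σ τ s″} → rule t c (comm x) t′ ∈ Δ₂ → Local c x → Joined (s , just t′) σ τ s″ → Joined (s , just t) σ ((c , comm x) ∷ τ) s″
    recv⁺ {c = c} {x} i f (joined {z} p w h) with red-label c x
    ... | eq , eq′ = joined (recv i f _ ∷ p) (trans (cong (_++ writes z) eq′) w) (cong₂ _++_ eq h)

  alone : ∀ {s σ s′} → Path Δ₁ s σ s′ → All IsComm σ → Joined (s , nothing) σ [] (s′ , nothing)
  alone []      []         = joined [] refl refl
  alone (i ∷ p) (comm ∷ c) = send⁺ i (inj₂ refl) (alone p c)

  together : ∀ {s σ s′ t τ u} → Path Δ₁ s σ s′ → All IsComm σ → Path Δ₂ t τ q → All IsComm τ → traffic r σ ≡ traffic r τ ++ u →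
    Joined (s , just t) σ τ (s′ , nothing)
  together {s} p c [] [] eq with alone p c
  ... | joined p′ w h = joined (stop s ∷ p′) w h
  together p c (_∷_ {c = l} j q) (comm ∷ d) eq = recv⁺ j onL (together p c q d eq)
  together p c (_∷_ {c = r} {α = comm nothing} j q) (comm ∷ d) eq = recv⁺ j idle (together p c q d eq)
  together (_∷_ {c = l} i p) (comm ∷ c) q@(_∷_ {c = r} {α = comm (just x)} _ _) d eq = send⁺ i (inj₁ onL) (together p c q d eq)
  together (_∷_ {c = r} {α = comm nothing} i p) (comm ∷ c) q@(_∷_ {c = r} {α = comm (just x)} _ _) d eq = send⁺ i (inj₁ idle) (together p c q d eq)
  together (_∷_ {c = r} {α = comm (just y)} i p) (comm ∷ c) (_∷_ {c = r} {α = comm (just x)} j q) (comm ∷ d) eq with Listₚ.∷-injective eq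
  ... | refl , eq′ with together p c q d eq′
  ... | joined p′ w h = joined (sync i j ∷ p′) w h

  private
    Splits : Node → List (Lab (Fin m)) → Fin n₁ → Set
    Splits (s , nothing) z s′ = ∃[ σ ] Path Δ₁ s σ s′ × traffic l σ ≡ writes z × [] ≡ reads z
    Splits (s , just t)  z s′ = ∃[ σ ] ∃[ τ ] ∃[ u ] Path Δ₁ s σ s′ × Path Δ₂ t τ q × traffic l σ ≡ writes z × traffic l τ ≡ reads z × traffic r σ ≡ traffic r τ ++ u

  split : ∀ {s z s′} → GPath Edge s z (s′ , nothing) → Splits s z s′
  split {s , nothing} [] = [] , [] , refl , refl
  split {s , nothing} (send {c = c} {x} i _ f ∷ p) with split p | wrote-label c x
  ... | σ , p′ , w , h | eq , eq′ = (c , comm x) ∷ σ , i ∷ p′ , cong₂ _++_ (sym eq) w , trans h (cong (_++ _) (sym eq′))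
  split {s , just t} (send {c = c} {x} i _ (inj₁ f) ∷ p) with split p | wrote-label c x
  ... | σ , τ , u , p′ , q′ , w , h , e | eq , eq′ = (c , comm x) ∷ σ , τ , u , i ∷ p′ , q′ , cong₂ _++_ (sym eq) w , trans h (cong (_++ _) (sym eq′)) , trans (cong (_++ _) (unheard f)) e
  split {s , just t} (recv {c = c} {x} i f _ ∷ p) with split p | red-label c x
  ... | σ , τ , u , p′ , q′ , w , h , e | eq , eq′ = σ , (c , comm x) ∷ τ , u , p′ , i ∷ q′ , trans w (cong (_++ _) (sym eq′)) , cong₂ _++_ (sym eq) h , trans e (cong (λ v → (v ++ traffic r τ) ++ u) (sym (unheard f)))
  split (sync {x = x} i j ∷ p) with split p
  ... | σ , τ , u , p′ , q′ , w , h , e = (r , comm x) ∷ σ , (r , comm x) ∷ τ , u , i ∷ p′ , j ∷ q′ , w , h , trans (cong (fromMaybe x ++_) e) (sym (Listₚ.++-assoc (fromMaybe x) _ u))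
  split (stop s ∷ p) with split p
  ... | σ , p′ , w , h = σ , [] , traffic r σ , p′ , [] , w , h , refl

  Reaches : Set
  Reaches = Embeds (pᵢₙ , just qᵢₙ) (p , nothing)

  Reaches⇒run : Reaches → ∃[ w ] Star (Step system) (pᵢₙ , qᵢₙ , [] , []) (p , q , w)
  Reaches⇒run (z , path , h) with split path
  ... | σ , τ , u , p₁ , p₂ , w , v , e = (u , []) , senderRun system p₁ (comms₁ p₁) ◅◅ lossRun system v⊆ ◅◅
    subst (λ u′ → Star (Step system) (p , qᵢₙ , u′ , traffic l τ) (p , q , u , [])) (sym e)
      (subst (λ v′ → Star (Step system) (p , qᵢₙ , traffic r τ ++ u , v′) (p , q , u , [])) (Listₚ.++-identityʳ _) (receiverRun system p₂ (comms₂ p₂)))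
    where
    v⊆ : traffic l τ ⊆ traffic l σ
    v⊆ = subst₂ _⊆_ (sym v) (sym w) h

  run⇒Reaches : ∀ {w} → Star (Step system) (pᵢₙ , qᵢₙ , [] , []) (p , q , w) → Reaches
  run⇒Reaches run with extractStar system run
  ... | extract {σ} {τ} _ p₁ p₂ rel los _ with together p₁ (comms₁ p₁) p₂ (comms₂ p₂) rel
  ... | joined {z} path w v = z , path , subst₂ _⊆_ (sym v) (sym w) (⊆-trans (Subₚ.++⁺ʳ _ ⊆-refl) los)


  data Idle : Label m → Set where
    idle : ∀ {c} → Idle (c , comm nothing)

  IdleLoop : Set
  IdleLoop = ∃[ e ] ∃[ z ] Path Δ₂ q (e ∷ z) q × All Idle (e ∷ z)

  Lasso⁺ : Reaches → SenderLoop system p ⊎ IdleLoop → Lasso I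
  Lasso⁺ reach loop with Reaches⇒run reach
  ... | w , run = w , run , Sum.swap (Sum.map₂ idleRun loop)
    where
    idleStep : ∀ {s t c t′ w} → rule t c (comm nothing) t′ ∈ Δ₂ → Step system (s , t , w) (s , t′ , w)
    idleStep {c = r} {w = u , v} i = read {c = r} {s = u} i refl
    idleStep {c = l} {w = u , v} i = read {c = l} {s = v} i refl
    idleStar : ∀ {t z t′} → Path Δ₂ t z t′ → All Idle z → Star (Step system) (p , t , w) (p , t′ , w)
    idleStar []      []         = ε
    idleStar (i ∷ p) (idle ∷ c) = idleStep i ◅ idleStar p c
    idleRun : IdleLoop → TransClosure (Step system) (p , q , w) (p , q , w)
    idleRun (_ , z , i ∷ path , idle ∷ c) = Star⇒Trans (idleStep i) (idleStar path c)

  Lasso⁻ : Lasso I → Reaches × (SenderLoop system p ⊎ IdleLoop)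
  Lasso⁻ ((u , v) , run , inj₂ loop) = run⇒Reaches run , inj₁ loop
  Lasso⁻ ((u , v) , run , inj₁ cycle) = run⇒Reaches run , loops (extractTrans system cycle)
    where
    idle-only : ∀ {y} → All IsComm y → traffic r y ≡ [] → traffic l y ≡ [] → All Idle y
    idle-only [] _ _ = []
    idle-only (comm {r} {nothing} ∷ cs) e e′ = idle ∷ idle-only cs e e′
    idle-only (comm {l} {nothing} ∷ cs) e e′ = idle ∷ idle-only cs e e′
    idle-only (comm {r} {just _} ∷ cs) () _
    idle-only (comm {l} {just _} ∷ cs) _ ()
    loops : Σ[ x ∈ Extract system (p , q , u , v) (p , q , u , v) ] 0 < Extract.steps x → SenderLoop system p ⊎ IdleLoop
    loops (extract {e ∷ z} _ path _ _ _ _ , _) = inj₁ (e , z , path , comms₁ path)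
    loops (extract {[]} {[]} d [] _ _ _ bal , pos) = contradiction pos (<-irrefl (sym (+-cancelˡ-≡ (length v) d 0
      (trans bal (trans (cong length (Listₚ.++-identityʳ v)) (sym (+-identityʳ _)))))))
    loops (extract {[]} {y@(e ∷ z)} _ [] path rel los _ , _) = inj₂ (e , z , path , idle-only (comms₂ path) eqr eql)
      where
      eqr : traffic r y ≡ []
      eqr = Listₚ.++-cancelʳ u (traffic r y) [] (trans (sym rel) (Listₚ.++-identityʳ u))
      eql : traffic l y ≡ []
      eql = shrink (traffic l y) (subst (traffic l y ++ v ⊆_) (Listₚ.++-identityʳ v) los)
        where
        shrink : ∀ w → w ++ v ⊆ v → w ≡ []
        shrink []      _ = refl
        shrink (a ∷ w) h = contradiction (≤-trans (s≤s (Subₚ.length-mono-≤ (Subₚ.++⁺ˡ w ⊆-refl))) (Subₚ.length-mono-≤ h)) 1+n≰n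

-- Certificates for the absence of a lasso

infix 6 _∈ᵗ_
_∈ᵗ_ : ∀ {n} → Tm n → Tm n → Fm n
x ∈ᵗ L = call (any∈ (var 1F) (var 0F ≐ var 1F)) (x ∷ L ∷ [])

member⁺ : ∀ {x L} → x ∈ decode L → ⟦ var 0F ∈ᵗ var 1F ⟧ (x ∷ L ∷ [])
member⁺ = Any.map sym

member⁻ : ∀ {x L} → ⟦ var 0F ∈ᵗ var 1F ⟧ (x ∷ L ∷ []) → x ∈ decode L
member⁻ = Any.map sym

all-range⁺ : ∀ {P : ℕ → Set} n → (∀ k → k < n → P k) → All P (decode (⟦ range (var 0F) ⟧ᵗ (n ∷ [])))
all-range⁺ n f = subst (All _) (sym (decode-range 1 (var 0F) (n ∷ []))) (All.tabulate (λ {k} i → f k (∈-downFrom⁻ i)))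

all-range⁻ : ∀ {P : ℕ → Set} n → All P (decode (⟦ range (var 0F) ⟧ᵗ (n ∷ []))) → ∀ {k} → k < n → P k
all-range⁻ n h lt = All.lookup (subst (All _) (decode-range 1 (var 0F) (n ∷ [])) h) (∈-downFrom⁺ lt)

all-coded⁺ : ∀ {A : Set} (f : A → ℕ) {P : ℕ → Set} xs → (∀ {x} → x ∈ xs → P (f x)) → All P (decode (encode (map f xs)))
all-coded⁺ f xs h = subst (All _) (sym (decode-encode (map f xs))) (Allₚ.map⁺ (All.tabulate h))

all-coded⁻ : ∀ {A : Set} (f : A → ℕ) {P : ℕ → Set} xs → All P (decode (encode (map f xs))) → ∀ {x} → x ∈ xs → P (f x)
all-coded⁻ f xs h i = All.lookup (Allₚ.map⁻ (subst (All _) (decode-encode (map f xs)) h)) i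

∈-coded⁺ : ∀ {A : Set} (f : A → ℕ) {xs x} → x ∈ xs → f x ∈ decode (encode (map f xs))
∈-coded⁺ f {xs} i = subst (_ ∈_) (sym (decode-encode (map f xs))) (∈-map⁺ f i)

∈-coded⁻ : ∀ {A : Set} (f : A → ℕ) xs {k} → k ∈ decode (encode (map f xs)) → ∃[ x ] x ∈ xs × k ≡ f x
∈-coded⁻ f xs i = ∈-map⁻ f (subst (_ ∈_) (decode-encode (map f xs)) i)

encodeMaybe : ∀ {n} → Maybe (Fin n) → ℕ
encodeMaybe {n} nothing  = n
encodeMaybe {n} (just i) = toℕ i

encodeMaybe-injective : ∀ {n} {x y : Maybe (Fin n)} → encodeMaybe x ≡ encodeMaybe y → x ≡ y
encodeMaybe-injective {x = nothing} {nothing} _  = refl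
encodeMaybe-injective {x = nothing} {just j}  eq = contradiction (sym eq) (<⇒≢ (Finₚ.toℕ<n j))
encodeMaybe-injective {x = just i}  {nothing} eq = contradiction eq (<⇒≢ (Finₚ.toℕ<n i))
encodeMaybe-injective {x = just i}  {just j}  eq = cong just (Finₚ.toℕ-injective eq)

encodeMaybe< : ∀ {n} (x : Maybe (Fin n)) → encodeMaybe x < suc n
encodeMaybe< nothing  = n<1+n _
encodeMaybe< (just i) = m<n⇒m<1+n (Finₚ.toℕ<n i)

asMaybe : ∀ {n k} → k < suc n → ∃[ x ] encodeMaybe {n} x ≡ k
asMaybe {n} {k} lt with k <? n
... | yes k<n = just (fromℕ< k<n) , Finₚ.toℕ-fromℕ< k<n
... | no  k≮n = nothing , ≤-antisym (≮⇒≥ k≮n) (s≤s⁻¹ lt)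

encodeNode : ∀ {a b} → Fin a × Maybe (Fin b) → ℕ
encodeNode (s , t) = encode (toℕ s ∷ encodeMaybe t ∷ [])

encodeNode-injective : ∀ {a b} {x y : Fin a × Maybe (Fin b)} → encodeNode x ≡ encodeNode y → x ≡ y
encodeNode-injective {x = s , t} {s′ , t′} eq with Listₚ.∷-injective (encode-injective (toℕ s ∷ encodeMaybe t ∷ []) (toℕ s′ ∷ encodeMaybe t′ ∷ []) eq)
... | e , eq′ = cong₂ _,_ (Finₚ.toℕ-injective e) (encodeMaybe-injective (proj₁ (Listₚ.∷-injective eq′)))

-- The arguments of closedᶠ are two nodes a and b, the words written and read
-- on an edge between them, and a list of items [s₀, s, t].

closedItem : Fm 9
closedItem = neg (var 1F ≐ var 4F) ∨ any∈ (var 8F) (view 3 (var 0F)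
  (var 0F ≐ var 4F ∧ var 1F ≐ var 9F ∧ (var 2F ⊆ᵗ resᵗ (var (# 10)) (var 6F ++ᵗ var (# 11)))))

item : ℕ → ℕ → List ℕ → ℕ
item a b x = encode (a ∷ b ∷ encode x ∷ [])

Advances : (a b : ℕ) (w v : List ℕ) (L i : ℕ) → Set
Advances a b w v L i = ∃[ s₀ ] ∃[ s ] ∃[ x ] i ≡ item s₀ s x × (s ≢ a ⊎ ∃[ x′ ] item s₀ b x′ ∈ decode L × x′ ⊆ res w (x ++ v))

opaque
  closedᶠ : Fm 5
  closedᶠ = all∈ (var 4F) (view 3 (var 0F) closedItem)

  closed⁺ : ∀ {a b w v L} → (∀ {i} → i ∈ decode L → Advances a b w v L i) →
    ⟦ closedᶠ ⟧ (a ∷ b ∷ encode w ∷ encode v ∷ L ∷ [])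
  closed⁺ {a} {b} {w} {v} {L} h = All.tabulate λ {i} i∈L → go (h i∈L)
    where
    go : ∀ {i} → Advances a b w v L i → ⟦ view 3 (var 0F) closedItem ⟧ (i ∷ a ∷ b ∷ encode w ∷ encode v ∷ L ∷ [])
    go (s₀ , s , x , refl , inj₁ ne) = s₀ ∷ s ∷ encode x ∷ [] , refl , inj₁ ne
    go (s₀ , s , x , refl , inj₂ (x′ , k , sub)) = s₀ ∷ s ∷ encode x ∷ [] , refl ,
      inj₂ (lose k (s₀ ∷ b ∷ encode x′ ∷ [] , refl , refl , refl ,
        ⟦⊆ᵗ⟧⁺ (var 2F) (resᵗ (var (# 10)) (var 6F ++ᵗ var (# 11))) {xs} {x′} {res w (x ++ v)} refl
          (⟦resᵗ⟧ (var (# 10)) (var 6F ++ᵗ var (# 11)) {xs} {w} {x ++ v} refl (⟦++ᵗ⟧ (var 6F) (var (# 11)) {xs} {x} {v} refl refl)) sub))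
      where
      xs : Vec ℕ 13
      xs = s₀ ∷ b ∷ encode x′ ∷ item s₀ b x′ ∷ s₀ ∷ s ∷ encode x ∷ item s₀ s x ∷ a ∷ b ∷ encode w ∷ encode v ∷ L ∷ []

  closed⁻ : ∀ {a b w v L} → ⟦ closedᶠ ⟧ (a ∷ b ∷ encode w ∷ encode v ∷ L ∷ []) →
    ∀ {s₀ x} → item s₀ a x ∈ decode L → ∃[ x′ ] item s₀ b x′ ∈ decode L × x′ ⊆ res w (x ++ v)
  closed⁻ {a} {b} {w} {v} {L} h {s₀} {x} i
    with view⁻ {xs = item s₀ a x ∷ a ∷ b ∷ encode w ∷ encode v ∷ L ∷ []} {t = var 0F} closedItem (s₀ ∷ a ∷ encode x ∷ []) refl (All.lookup h i)
  ... | inj₁ ne = contradiction refl ne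
  ... | inj₂ any with find any
  ... | _ , k , (_ ∷ _ ∷ y ∷ [] , refl , refl , refl , sub) = decode y ,
    subst (λ y → encode (s₀ ∷ b ∷ y ∷ []) ∈ decode L) (sym (encode-decode y)) k ,
    ⟦⊆ᵗ⟧⁻ (var 2F) (resᵗ (var (# 10)) (var 6F ++ᵗ var (# 11))) {xs} {decode y} {res w (x ++ v)} (sym (encode-decode y))
      (⟦resᵗ⟧ (var (# 10)) (var 6F ++ᵗ var (# 11)) {xs} {w} {x ++ v} refl (⟦++ᵗ⟧ (var 6F) (var (# 11)) {xs} {x} {v} refl refl)) sub
    where
    xs : Vec ℕ 13
    xs = s₀ ∷ b ∷ y ∷ encode (s₀ ∷ b ∷ y ∷ []) ∷ s₀ ∷ a ∷ encode x ∷ item s₀ a x ∷ a ∷ b ∷ encode w ∷ encode v ∷ L ∷ []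

-- The arguments of edgesᶠ are G, Δ₁, Δ₂, n₁, n₂ and q.

epsilon : ℕ
epsilon = encode (0 ∷ [])

edgeᵗ : ∀ {n} → Tm n → Tm n → Tm n → Tm n → Tm n → Tm n → Tm n
edgeᵗ a b w v a′ b′ = listᵗ (listᵗ (a ∷ b ∷ []) ∷ w ∷ v ∷ listᵗ (a′ ∷ b′ ∷ []) ∷ [])

sendBody recvBody : Fm 12
sendBody = (var 2F ≐ lit 0 ∧ neg (var 3F ≐ lit epsilon) ∧ neg (var 0F ≐ var (# 10))) ∨
  edgeᵗ (var 1F) (var 0F) (ifeqᵗ (var 2F) (lit 1) (tlᵗ (var 3F)) (lit 0)) (lit 0) (var 4F) (var 0F) ∈ᵗ var 6F
recvBody = (var 2F ≐ lit 0 ∧ neg (var 3F ≐ lit epsilon)) ∨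
  edgeᵗ (var 0F) (var 1F) (lit 0) (ifeqᵗ (var 2F) (lit 1) (tlᵗ (var 3F)) (lit 0)) (var 0F) (var 4F) ∈ᵗ var 6F

syncBody : Fm 16
syncBody = neg (var 6F ≐ lit 0) ∨ neg (var 1F ≐ lit 0) ∨ neg (var 7F ≐ var 2F) ∨
  edgeᵗ (var 5F) (var 0F) (lit 0) (lit 0) (var 8F) (var 3F) ∈ᵗ var (# 10)

module _ (I : Instance) (ucs : IsUCS (Instance.system I)) where
  open Instance I
  open Product I ucs

  encodeEdge : Node × Lab (Fin m) × Node → ℕ
  encodeEdge (a , e , b) = encode (encodeNode a ∷ encodeWord (wrote e) ∷ encodeWord (red e) ∷ encodeNode b ∷ [])

  private
    D₁ D₂ : ℕ
    D₁ = encode (map encodeRule Δ₁)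
    D₂ = encode (map encodeRule Δ₂)

    carried : ∀ c (x : Maybe (Fin m)) → ifeq (codeChannel c) 1 (tl (encodeAct (comm x))) 0 ≡ encodeWord (letters l (c , comm x))
    carried r x = refl
    carried l x = payload x

    encode-wr : ∀ c (x : Maybe (Fin m)) → encodeWord (wrote (label wr c x)) ≡ encodeWord (letters l (c , comm x)) × encodeWord (red (label wr c x)) ≡ 0
    encode-wr r nothing  = refl , refl
    encode-wr r (just _) = refl , refl
    encode-wr l nothing  = refl , refl
    encode-wr l (just _) = refl , refl

    encode-rd : ∀ c (x : Maybe (Fin m)) → encodeWord (red (label rd c x)) ≡ encodeWord (letters l (c , comm x)) × encodeWord (wrote (label rd c x)) ≡ 0
    encode-rd r nothing  = refl , refl
    encode-rd r (just _) = refl , refl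
    encode-rd l nothing  = refl , refl
    encode-rd l (just _) = refl , refl

    just≢ε : ∀ {x : Fin m} → encodeAct (comm (just x)) ≢ epsilon
    just≢ε {x} eq with encode-injective (1 ∷ toℕ x ∷ []) (0 ∷ []) eq
    ... | ()

    comm-injective : ∀ {x y : Maybe (Fin m)} → encodeAct (comm x) ≡ encodeAct (comm y) → x ≡ y
    comm-injective {nothing} {nothing} _  = refl
    comm-injective {nothing} {just y}  eq = contradiction (sym eq) just≢ε
    comm-injective {just x}  {nothing} eq = contradiction eq just≢ε
    comm-injective {just x}  {just y}  eq with encode-injective (1 ∷ toℕ x ∷ []) (1 ∷ toℕ y ∷ []) eq
    ... | eq′ = cong just (Finₚ.toℕ-injective (proj₁ (Listₚ.∷-injective (proj₂ (Listₚ.∷-injective eq′)))))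

    sendCode : ∀ s c x t s′ → encodeEdge ((s , t) , label wr c x , (s′ , t)) ≡
      encode (encode (toℕ s ∷ encodeMaybe t ∷ []) ∷ ifeq (codeChannel c) 1 (tl (encodeAct (comm x))) 0 ∷ 0 ∷ encode (toℕ s′ ∷ encodeMaybe t ∷ []) ∷ [])
    sendCode s c x t s′ = cong₂ (λ w v → encode (encodeNode (s , t) ∷ w ∷ v ∷ encodeNode (s′ , t) ∷ []))
      (trans (proj₁ (encode-wr c x)) (sym (carried c x))) (proj₂ (encode-wr c x))

    recvCode : ∀ s c x t t′ → encodeEdge ((s , just t) , label rd c x , (s , just t′)) ≡
      encode (encode (toℕ s ∷ toℕ t ∷ []) ∷ 0 ∷ ifeq (codeChannel c) 1 (tl (encodeAct (comm x))) 0 ∷ encode (toℕ s ∷ toℕ t′ ∷ []) ∷ [])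
    recvCode s c x t t′ = cong₂ (λ w v → encode (encodeNode (s , just t) ∷ w ∷ v ∷ encodeNode (s , just t′) ∷ []))
      (proj₂ (encode-rd c x)) (trans (proj₁ (encode-rd c x)) (sym (carried c x)))

  Covers : ℕ → Set
  Covers G = ∀ {a e b} → Edge a e b → encodeEdge (a , e , b) ∈ decode G

  edgesVec : ℕ → Vec ℕ 6
  edgesVec G = G ∷ D₁ ∷ D₂ ∷ n₁ ∷ n₂ ∷ toℕ q ∷ []

  SendBody RecvBody : ℕ → ∀ {n} → Rule m n → ℕ → Set
  SendBody G ρ t = ⟦ sendBody ⟧ (t ∷ ruleVec ρ Vec.++ encodeRule ρ ∷ edgesVec G)
  RecvBody G ρ s = ⟦ recvBody ⟧ (s ∷ ruleVec ρ Vec.++ encodeRule ρ ∷ edgesVec G)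

  send⁺ᶠ : ∀ {G ρ} → Covers G → ρ ∈ Δ₁ → ∀ t → t < suc n₂ → SendBody G ρ t
  send⁺ᶠ {G} {ρ@(rule s c (comm x) s′)} cov i t lt with asMaybe lt | local? c x
  ... | t′ , refl | yes h = inj₂ (member⁺ {L = G} (subst (_∈ decode G) (sendCode s c x t′ s′) (cov (send i t′ (inj₁ h)))))
  ... | nothing , refl | no _ = inj₂ (member⁺ {L = G} (subst (_∈ decode G) (sendCode s c x nothing s′) (cov (send i nothing (inj₂ refl)))))
  send⁺ᶠ {ρ = rule s l (comm x) s′} cov i t lt | just t′ , refl | no nl = contradiction onL nl
  send⁺ᶠ {ρ = rule s r (comm nothing) s′} cov i t lt | just t′ , refl | no nl = contradiction idle nl
  send⁺ᶠ {ρ = rule s r (comm (just x)) s′} cov i t lt | just t′ , refl | no nl = inj₁ (refl , just≢ε {x} , <⇒≢ (Finₚ.toℕ<n t′))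
  send⁺ᶠ {ρ = rule s c (test _) s′} cov i t lt = case All.lookup (proj₁ ucs) i of λ ()

  send⁻ᶠ : ∀ {G s c x s′} t → Local c x ⊎ t ≡ nothing → SendBody G (rule s c (comm x) s′) (encodeMaybe t) →
    encodeEdge ((s , t) , label wr c x , (s′ , t)) ∈ decode G
  send⁻ᶠ {G} {s} {c} {x} {s′} t f (inj₂ h) = subst (_∈ decode G) (sym (sendCode s c x t s′)) (member⁻ {L = G} h)
  send⁻ᶠ t (inj₁ idle) (inj₁ (_ , ne , _)) = contradiction refl ne
  send⁻ᶠ _ (inj₂ refl) (inj₁ (_ , _ , ne)) = contradiction refl ne

  recv⁺ᶠ : ∀ {G ρ} → Covers G → ρ ∈ Δ₂ → ∀ s → s < n₁ → RecvBody G ρ s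
  recv⁺ᶠ {G} {rule t c (comm x) t′} cov i s lt with asFin lt | local? c x
  ... | s , refl | yes h = inj₂ (member⁺ {L = G} (subst (_∈ decode G) (recvCode s c x t t′) (cov (recv i h s))))
  recv⁺ᶠ {ρ = rule t l (comm x) t′} cov i _ lt | s , refl | no nl = contradiction onL nl
  recv⁺ᶠ {ρ = rule t r (comm nothing) t′} cov i _ lt | s , refl | no nl = contradiction idle nl
  recv⁺ᶠ {ρ = rule t r (comm (just x)) t′} cov i _ lt | s , refl | no nl = inj₁ (refl , just≢ε {x})
  recv⁺ᶠ {ρ = rule t c (test _) t′} cov i s lt = case All.lookup (proj₂ ucs) i of λ ()

  recv⁻ᶠ : ∀ {G t c x t′} s → Local c x → RecvBody G (rule t c (comm x) t′) (toℕ s) →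
    encodeEdge ((s , just t) , label rd c x , (s , just t′)) ∈ decode G
  recv⁻ᶠ {G} {t} {c} {x} {t′} s f (inj₂ h) = subst (_∈ decode G) (sym (recvCode s c x t t′)) (member⁻ {L = G} h)
  recv⁻ᶠ s idle (inj₁ (_ , ne)) = contradiction refl ne

  SyncBody : ℕ → Rule m n₁ → Rule m n₂ → Set
  SyncBody G ρ ρ′ = ⟦ syncBody ⟧ (ruleVec ρ′ Vec.++ encodeRule ρ′ ∷ ruleVec ρ Vec.++ encodeRule ρ ∷ edgesVec G)

  sync⁺ᶠ : ∀ {G ρ ρ′} → Covers G → ρ ∈ Δ₁ → ρ′ ∈ Δ₂ → SyncBody G ρ ρ′
  sync⁺ᶠ {G} {rule s c (comm x) s′} {rule t d (comm y) t′} cov i j with c | d | encodeAct (comm x) ≟ encodeAct (comm y)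
  ... | l | _ | _ = inj₁ λ ()
  ... | r | l | _ = inj₂ (inj₁ λ ())
  ... | r | r | no ne = inj₂ (inj₂ (inj₁ ne))
  ... | r | r | yes eq with comm-injective {x} {y} eq
  ... | refl = inj₂ (inj₂ (inj₂ (member⁺ {L = G} (cov (sync i j)))))
  sync⁺ᶠ {ρ = rule s c (test _) s′} cov i j = case All.lookup (proj₁ ucs) i of λ ()
  sync⁺ᶠ {ρ′ = rule s c (test _) s′} cov i j = case All.lookup (proj₂ ucs) j of λ ()

  sync⁻ᶠ : ∀ {G s x s′ t t′} → SyncBody G (rule s r (comm x) s′) (rule t r (comm x) t′) → encodeEdge ((s , just t) , none , (s′ , just t′)) ∈ decode G
  sync⁻ᶠ (inj₁ ne) = contradiction refl ne
  sync⁻ᶠ (inj₂ (inj₁ ne)) = contradiction refl ne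
  sync⁻ᶠ (inj₂ (inj₂ (inj₁ ne))) = contradiction refl ne
  sync⁻ᶠ {G} (inj₂ (inj₂ (inj₂ h))) = member⁻ {L = G} h

edgesᶠ : Fm 6
edgesᶠ = all∈ (var 1F) (view 4 (var 0F) (all∈ (range (suc (var 9F))) sendBody)) ∧
  all∈ (var 2F) (view 4 (var 0F) (all∈ (range (var 8F)) recvBody)) ∧
  all∈ (var 1F) (view 4 (var 0F) (all∈ (var 7F) (view 4 (var 0F) syncBody))) ∧
  all∈ (range (var 3F)) (edgeᵗ (var 0F) (var 6F) (lit 0) (lit 0) (var 0F) (var 5F) ∈ᵗ var 1F)

joinBody : Fm 19
joinBody = neg (var 6F ≐ lit 0) ∨ neg (var 2F ≐ lit 0) ∨ neg (var 5F ≐ var 1F) ∨ listᵗ (var 4F ∷ var 0F ∷ lit 0 ∷ []) ∈ᵗ var (# 10)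

opaque
  -- The arguments are G, two lists of items (backward and forward), Δ₁, Δ₂,
  -- n₁, n₂ and the four states of the instance.
  noReachᶠ : Fm 11
  noReachᶠ = call edgesᶠ (var 0F ∷ var 3F ∷ var 4F ∷ var 5F ∷ var 6F ∷ var (# 10) ∷ []) ∧
    all∈ (var 0F) (view 4 (var 0F) (call closedᶠ (var 0F ∷ var 3F ∷ var 1F ∷ var 2F ∷ var 7F ∷ []))) ∧
    all∈ (var 0F) (view 4 (var 0F) (call closedᶠ (var 3F ∷ var 0F ∷ var 1F ∷ var 2F ∷ var 6F ∷ []))) ∧
    all∈ (range (var 5F)) (all∈ (range (suc (var 7F))) (listᵗ (listᵗ (var 1F ∷ var 0F ∷ []) ∷ listᵗ (var 1F ∷ var 0F ∷ []) ∷ lit 0 ∷ []) ∈ᵗ var 3F)) ∧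
    listᵗ (listᵗ (var 7F ∷ var 8F ∷ []) ∷ listᵗ (var 7F ∷ var 8F ∷ []) ∷ lit 0 ∷ []) ∈ᵗ var 2F ∧
    all∈ (var 2F) (view 3 (var 0F) (all∈ (var 5F) (view 3 (var 0F) joinBody))) ∧
    neg (listᵗ (listᵗ (var 7F ∷ var 8F ∷ []) ∷ listᵗ (var 9F ∷ var 6F ∷ []) ∷ lit 0 ∷ []) ∈ᵗ var 2F)

module _ (I : Instance) (ucs : IsUCS (Instance.system I)) where
  open Instance I
  open Product I ucs
  open Pending Finₚ._≟_ Edge
  private module F = Residual {Fin m} Finₚ._≟_

  noReachVec : ℕ → ℕ → ℕ → Vec ℕ 11
  noReachVec G C A = G ∷ C ∷ A ∷ encode (map encodeRule Δ₁) ∷ encode (map encodeRule Δ₂) ∷ n₁ ∷ n₂ ∷ toℕ pᵢₙ ∷ toℕ qᵢₙ ∷ toℕ p ∷ toℕ q ∷ []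

  private
    code′ : Node × Lab (Fin m) × Node → ℕ
    code′ = encodeEdge I ucs

    environment : ℕ → Vec ℕ 6
    environment = edgesVec I ucs

    edges⁻ : ∀ {G} → ⟦ edgesᶠ ⟧ (environment G) → Covers I ucs G
    edges⁻ {G} (h , _) (send {s} {c} {x} {s′} i t f) = send⁻ᶠ I ucs {G} {s} {c} {x} {s′} t f
      (all-range⁻ (suc n₂) (view⁻ {xs = encodeRule ρ ∷ environment G} {t = var 0F} (all∈ (range (suc (var 9F))) sendBody) (ruleVec ρ) refl (all-coded⁻ encodeRule Δ₁ h i)) (encodeMaybe< t))
      where ρ = rule s c (comm x) s′
    edges⁻ {G} (_ , h , _) (recv {t} {c} {x} {t′} i f s) = recv⁻ᶠ I ucs {G} {t} {c} {x} {t′} s f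
      (all-range⁻ n₁ (view⁻ {xs = encodeRule ρ ∷ environment G} {t = var 0F} (all∈ (range (var 8F)) recvBody) (ruleVec ρ) refl (all-coded⁻ encodeRule Δ₂ h i)) (Finₚ.toℕ<n s))
      where ρ = rule t c (comm x) t′
    edges⁻ {G} (_ , _ , h , _) (sync {s} {t} {x} {s′} {t′} i j) = sync⁻ᶠ I ucs {G} {s} {x} {s′} {t} {t′}
      (view⁻ {xs = encodeRule ρ′ ∷ ruleVec ρ Vec.++ encodeRule ρ ∷ environment G} {t = var 0F} syncBody (ruleVec ρ′) refl
        (all-coded⁻ encodeRule Δ₂ (view⁻ {xs = encodeRule ρ ∷ environment G} {t = var 0F} (all∈ (var 7F) (view 4 (var 0F) syncBody)) (ruleVec ρ) refl (all-coded⁻ encodeRule Δ₁ h i)) j))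
      where ρ = rule s r (comm x) s′
            ρ′ = rule t r (comm x) t′
    edges⁻ {G} (_ , _ , _ , h) (stop s) = member⁻ {L = G} (all-range⁻ n₁ h (Finₚ.toℕ<n s))

    edges⁺ : ∀ {G} → Covers I ucs G → ⟦ edgesᶠ ⟧ (environment G)
    edges⁺ {G} cov =
      all-coded⁺ encodeRule Δ₁ (λ {ρ} i → ruleVec ρ , refl , all-range⁺ (suc n₂) (send⁺ᶠ I ucs cov i)) ,
      all-coded⁺ encodeRule Δ₂ (λ {ρ} i → ruleVec ρ , refl , all-range⁺ n₁ (recv⁺ᶠ I ucs cov i)) ,
      all-coded⁺ encodeRule Δ₁ (λ {ρ} i → ruleVec ρ , refl , all-coded⁺ encodeRule Δ₂ (λ {ρ′} j → ruleVec ρ′ , refl , sync⁺ᶠ I ucs cov i j)) ,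
      all-range⁺ n₁ (λ s lt → stopped (asFin lt))
      where
      stopped : ∀ {s} → ∃[ i ] toℕ {n₁} i ≡ s →
        ⟦ edgeᵗ (var 0F) (var 6F) (lit 0) (lit 0) (var 0F) (var 5F) ∈ᵗ var 1F ⟧ (s ∷ environment G)
      stopped (s , refl) = member⁺ {L = G} (cov (stop s))

    map-pop : ∀ a (t : Word m) → map toℕ (F.pop a t) ≡ pop (toℕ a) (map toℕ t)
    map-pop a []      = refl
    map-pop a (b ∷ t) with b Finₚ.≟ a | toℕ b ≟ toℕ a
    ... | yes _  | yes _  = refl
    ... | no _   | no _   = refl
    ... | yes eq | no ne  = contradiction (cong toℕ eq) ne
    ... | no ne  | yes eq = contradiction (Finₚ.toℕ-injective eq) ne

    map-res : ∀ w (t : Word m) → map toℕ (F.res w t) ≡ res (map toℕ w) (map toℕ t)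
    map-res []      t = refl
    map-res (a ∷ w) t = trans (map-res w (F.pop a t)) (cong (res (map toℕ w)) (map-pop a t))

    map-shift : ∀ e (t : Word m) → map toℕ (shift e t) ≡ res (map toℕ (wrote e)) (map toℕ t ++ map toℕ (red e))
    map-shift e t = trans (map-res (wrote e) (t ++ red e)) (cong (res (map toℕ (wrote e))) (Listₚ.map-++ toℕ t (red e)))

    entrance final : Node
    entrance = pᵢₙ , just qᵢₙ
    final = p , nothing

    record Contains (L : ℕ) (s₀ s : Node) (t : Word m) : Set where
      constructor contains
      field
        word   : List ℕ
        occurs : item (encodeNode s₀) (encodeNode s) word ∈ decode L
        below  : word ⊆ map toℕ t

    contains-step : ∀ L a b e → ⟦ closedᶠ ⟧ (encodeNode a ∷ encodeNode b ∷ encodeWord (wrote e) ∷ encodeWord (red e) ∷ L ∷ []) →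
      ∀ {s₀ t} → Contains L s₀ a t → Contains L s₀ b (shift e t)
    contains-step L a b e h {s₀} {t} (contains x i x⊆) with closed⁻ {w = map toℕ (wrote e)} {map toℕ (red e)} h {encodeNode s₀} {x} i
    ... | x′ , j , x′⊆ = contains x′ j (⊆-trans x′⊆ (subst (res (map toℕ (wrote e)) (x ++ map toℕ (red e)) ⊆_) (sym (map-shift e t))
      (res⁺ (map toℕ (wrote e)) (⊆-trans (Subₚ.++⁺ x⊆ ⊆-refl) (res⁻ (map toℕ (wrote e)) ⊆-refl)))))

  opaque
    unfolding noReachᶠ

    noReach⁻ : ∀ {G C A} → ⟦ noReachᶠ ⟧ (noReachVec G C A) → ¬ Reaches
    noReach⁻ {G} {C} {A} (edges , fwd , bwd , starts , init , joins , ¬fin) reach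
      with embeds⇒final entrance (Contains A entrance) (Contains C)
        (λ le (contains x i h) → contains x i (⊆-trans h (Subₚ.map⁺ toℕ le))) (λ le (contains x i h) → contains x i (⊆-trans h (Subₚ.map⁺ toℕ le)))
        (contains [] (member⁻ {L = A} init) [])
        (λ (s , t) → contains [] (member⁻ {L = C} (all-range⁻ (suc n₂) (all-range⁻ n₁ starts (Finₚ.toℕ<n s)) (encodeMaybe< t))) [])
        (λ {a} {e} {b} h → contains-step A a b e (view⁻ {xs = code′ (a , e , b) ∷ noReachVec G C A} {t = var 0F} (call closedᶠ (var 0F ∷ var 3F ∷ var 1F ∷ var 2F ∷ var 7F ∷ []))
           (encodeNode a ∷ encodeWord (wrote e) ∷ encodeWord (red e) ∷ encodeNode b ∷ []) refl (All.lookup fwd (edges⁻ {G} edges h))))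
        (λ {a} {e} {b} h → contains-step C b a e (view⁻ {xs = code′ (a , e , b) ∷ noReachVec G C A} {t = var 0F} (call closedᶠ (var 3F ∷ var 0F ∷ var 1F ∷ var 2F ∷ var 6F ∷ []))
           (encodeNode a ∷ encodeWord (wrote e) ∷ encodeWord (red e) ∷ encodeNode b ∷ []) refl (All.lookup bwd (edges⁻ {G} edges h))))
        joined reach
      where
      joined : ∀ {s s′} → Contains A entrance s [] → Contains C s′ s [] → Contains A entrance s′ []
      joined {s} {s′} (contains .[] i []) (contains .[] j [])
        with view⁻ {xs = item (encodeNode entrance) (encodeNode s) [] ∷ noReachVec G C A} {t = var 0F} (all∈ (var 5F) (view 3 (var 0F) joinBody)) (encodeNode entrance ∷ encodeNode s ∷ 0 ∷ []) refl (All.lookup joins i)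
      ... | h with view⁻ {xs = item (encodeNode s′) (encodeNode s) [] ∷ encodeNode entrance ∷ encodeNode s ∷ 0 ∷ item (encodeNode entrance) (encodeNode s) [] ∷ noReachVec G C A} {t = var 0F} joinBody
        (encodeNode s′ ∷ encodeNode s ∷ 0 ∷ []) refl (All.lookup h j)
      ... | inj₁ ne = contradiction refl ne
      ... | inj₂ (inj₁ ne) = contradiction refl ne
      ... | inj₂ (inj₂ (inj₁ ne)) = contradiction refl ne
      ... | inj₂ (inj₂ (inj₂ k)) = contains [] (member⁻ {L = A} k) []
    ... | contains .[] i [] = ¬fin (member⁺ {L = A} i)

  private
    Item : Set
    Item = Node × Node × Word m

    _≟ⁿ_ : (x y : Node) → Dec (x ≡ y)
    _≟ⁿ_ = Productₚ.≡-dec Finₚ._≟_ (Maybeₚ.≡-dec Finₚ._≟_)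

    _≼_ : Item → Item → Set
    (a , b , t) ≼ (a′ , b′ , t′) = a ≡ a′ × b ≡ b′ × t ⊆ t′

    _≼?_ : ∀ x y → Dec (x ≼ y)
    (a , b , t) ≼? (a′ , b′ , t′) = (a ≟ⁿ a′) ×-dec (b ≟ⁿ b′) ×-dec DecSublist._⊆?_ Finₚ._≟_ t t′

    ≼-refl : ∀ {x} → x ≼ x
    ≼-refl = refl , refl , ⊆-refl

    ≼-trans : ∀ {x y z} → x ≼ y → y ≼ z → x ≼ z
    ≼-trans (refl , refl , h) (refl , refl , h′) = refl , refl , ⊆-trans h h′

    AF-Maybe : ∀ n → AF {Maybe (Fin n)} _≡_
    AF-Maybe n = AF-mono (λ {x} {y} → injective {x} {y}) (AF-comap f (AF-Fin (suc n)))
      where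
      f : Maybe (Fin n) → Fin (suc n)
      f nothing  = zero
      f (just i) = suc i
      injective : ∀ {x y} → f x ≡ f y → x ≡ y
      injective {nothing} {nothing} _    = refl
      injective {just _}  {just _}  refl = refl

    AF-Node : AF {Node} _≡_
    AF-Node = AF-mono (λ { (refl , refl) → refl }) (AF-× (AF-Fin n₁) (AF-Maybe n₂))

    AF-Item : AF _≼_
    AF-Item = AF-× AF-Node (AF-× AF-Node (higman m))

    all-concatMap : ∀ {A B : Set} {P : B → Set} (f : A → List B) → (∀ x → All P (f x)) → ∀ xs → All P (concatMap f xs)
    all-concatMap f h []       = []
    all-concatMap f h (x ∷ xs) = Allₚ.++⁺ (h x) (all-concatMap f h xs)

    all-when : ∀ {Q A : Set} {P : A → Set} (d : Dec Q) (f : Q → A) → (∀ q → P (f q)) → All P (when d f)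
    all-when (yes q) f h = h q ∷ []
    all-when (no _)  f h = []

    forwardSteps backwardSteps : Item → Arc → List Item
    forwardSteps  (s₀ , s , t) ((a , e , b) , _) = when (s ≟ⁿ a) (λ _ → s₀ , b , shift e t)
    backwardSteps (s₀ , s , t) ((a , e , b) , _) = when (s ≟ⁿ b) (λ _ → s₀ , a , shift e t)

    IsForward IsBackward : Item → Set
    IsForward  (s₀ , s , t) = s₀ ≡ entrance × Forward s₀ s t
    IsBackward (s₀ , s , t) = Backward s₀ s t

    backward-preserved : ∀ {x} → IsBackward x → All IsBackward (concatMap (backwardSteps x) arcs)
    backward-preserved {s₀ , s , t} h = all-concatMap (backwardSteps (s₀ , s , t)) (λ ((a , e , b) , i) → all-when (s ≟ⁿ b) _ λ { refl → backward-step {e = e} i h }) arcs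

    joins : List Item → Item → Item → List Item
    joins C (s₀ , s , [])    (s₂ , s′ , [])    = when (s ≟ⁿ s′) (λ _ → s₀ , s₂ , [])
    joins C (s₀ , s , _ ∷ _) _                 = []
    joins C (s₀ , s , [])    (s₂ , s′ , _ ∷ _) = []

    nexts : List Item → Item → List Item
    nexts C x = concatMap (forwardSteps x) arcs ++ concatMap (joins C x) C

    forward-preserved : ∀ C → All IsBackward C → ∀ {x} → IsForward x → All IsForward (nexts C x)
    forward-preserved C hC {x@(s₀ , s , t)} (eq , h) = Allₚ.++⁺
      (all-concatMap (forwardSteps x) (λ ((a , e , b) , i) → all-when (s ≟ⁿ a) _ λ { refl → eq , forward-step {e = e} i h }) arcs)
      (joined C hC)
      where
      compose : ∀ {s₀ s s₂} → Forward s₀ s [] → Backward s₂ s [] → Forward s₀ s₂ []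
      compose (z , p , h) (z′ , p′ , h′) = z ++ z′ , p ⧺ᵍ p′ , subst₂ _⊆_ (sym (Listₚ.concatMap-++ red z z′))
        (trans (sym (Listₚ.concatMap-++ wrote z z′)) (sym (Listₚ.++-identityʳ _)))
        (Subₚ.++⁺ (subst (reads z ⊆_) (Listₚ.++-identityʳ _) h) h′)
      joinedOne : ∀ {x y} → IsForward x → IsBackward y → All IsForward (joins C x y)
      joinedOne {s₀ , s , []}    {s₂ , s′ , []}    (eq , h) h′ = all-when (s ≟ⁿ s′) _ λ { refl → eq , compose h h′ }
      joinedOne {s₀ , s , _ ∷ _} {s₂ , s′ , _}     (eq , h) h′ = []
      joinedOne {s₀ , s , []}    {s₂ , s′ , _ ∷ _} (eq , h) h′ = []
      joined : ∀ C′ → All IsBackward C′ → All IsForward (concatMap (joins C x) C′)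
      joined []       []       = []
      joined (y ∷ C′) (k ∷ ks) = Allₚ.++⁺ (joinedOne {x} {y} (eq , h) k) (joined C′ ks)

    nodes : List Node
    nodes = concatMap (λ s → map (s ,_) (allMaybe n₂)) (allFin n₁)

    ∈-nodes : ∀ s → s ∈ nodes
    ∈-nodes (s , t) = ∈-concatMap (λ s → map (s ,_) (allMaybe n₂)) (∈-allFin s) (∈-map⁺ (s ,_) (∈-allMaybe t))

    itemCode : Item → ℕ
    itemCode (a , b , t) = item (encodeNode a) (encodeNode b) (map toℕ t)

    codes : List Item → ℕ
    codes L = encode (map itemCode L)

    saturated⇒closed : ∀ L {a b e} → (∀ {s₀ t} → (s₀ , a , t) ∈ L → Any (_≼ (s₀ , b , shift e t)) L) →
      ⟦ closedᶠ ⟧ (encodeNode a ∷ encodeNode b ∷ encodeWord (wrote e) ∷ encodeWord (red e) ∷ codes L ∷ [])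
    saturated⇒closed L {a} {b} {e} h = closed⁺ {w = map toℕ (wrote e)} {map toℕ (red e)} λ {i} i∈ → go (∈-coded⁻ itemCode L i∈)
      where
      go : ∀ {i} → ∃[ x ] x ∈ L × i ≡ itemCode x → Advances (encodeNode a) (encodeNode b) (map toℕ (wrote e)) (map toℕ (red e)) (codes L) i
      go ((s₀ , s , t) , x∈ , refl) with s ≟ⁿ a
      ... | no ne = encodeNode s₀ , encodeNode s , map toℕ t , refl , inj₁ (ne ∘ encodeNode-injective {x = s} {a})
      ... | yes refl with find (h x∈)
      ... | (_ , _ , t′) , k , (refl , refl , t′⊆) = encodeNode s₀ , encodeNode s , map toℕ t , refl ,
        inj₂ (map toℕ t′ , ∈-coded⁺ itemCode k , subst (map toℕ t′ ⊆_) (map-shift e t) (Subₚ.map⁺ toℕ t′⊆))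

    exact : ∀ {L s₀ s} → Any (_≼ (s₀ , s , [])) L → (s₀ , s , []) ∈ L
    exact h with find h
    ... | (_ , _ , .[]) , k , (refl , refl , []) = k

  opaque
    unfolding noReachᶠ

    noReach⁺ : Reaches ⊎ (∃[ G ] ∃[ C ] ∃[ A ] ⟦ noReachᶠ ⟧ (noReachVec G C A))
    noReach⁺ with saturate {_≼_ = _≼_} ≼-refl (λ {x} {y} {z} → ≼-trans {x} {y} {z}) _≼?_ (λ x → concatMap (backwardSteps x) arcs) IsBackward backward-preserved AF-Item
      (map (λ s → s , s , []) nodes) (Allₚ.map⁺ (All.tabulate λ _ → [] , [] , []))
    ... | C , startC , closedC , isC with saturate {_≼_ = _≼_} ≼-refl (λ {x} {y} {z} → ≼-trans {x} {y} {z}) _≼?_ (nexts C) IsForward (forward-preserved C isC) AF-Item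
      ((entrance , entrance , []) ∷ []) ((refl , [] , [] , []) ∷ [])
    ... | A , startA ∷ [] , closedA , isA with any? (λ x → _≼?_ x (entrance , final , [])) A
    ... | yes found with All.lookup isA (exact found)
    ... | _ , z , path , h = inj₁ (z , path , subst (reads z ⊆_) (Listₚ.++-identityʳ _) h)
    noReach⁺ | C , startC , closedC , isC | A , startA ∷ [] , closedA , isA | no ¬found =
      inj₂ (G , codes C , codes A , edges⁺ {G} covers ,
        all-coded⁺ code′ (map proj₁ arcs) (λ {(a , e , b)} i → encodeNode a ∷ encodeWord (wrote e) ∷ encodeWord (red e) ∷ encodeNode b ∷ [] , refl ,
          saturated⇒closed A {a} {b} {e} (λ k → forwardStep i k)) ,
        all-coded⁺ code′ (map proj₁ arcs) (λ {(a , e , b)} i → encodeNode a ∷ encodeWord (wrote e) ∷ encodeWord (red e) ∷ encodeNode b ∷ [] , refl ,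
          saturated⇒closed C {b} {a} {e} (λ k → backwardStep i k)) ,
        all-range⁺ n₁ (λ s lt → all-range⁺ (suc n₂) (λ t lt′ → started (asFin lt) (asMaybe lt′))) ,
        member⁺ {L = codes A} (∈-coded⁺ itemCode (exact startA)) ,
        all-coded⁺ itemCode A (λ {(a , b , t)} i → encodeNode a ∷ encodeNode b ∷ encodeWord t ∷ [] , refl ,
          all-coded⁺ itemCode C (λ {(a′ , b′ , t′)} j → encodeNode a′ ∷ encodeNode b′ ∷ encodeWord t′ ∷ [] , refl , joined {a} {b} {t} {a′} {b′} {t′} i j)) ,
        λ h → absent (∈-coded⁻ itemCode A (member⁻ {L = codes A} h)))
      where
      G : ℕ
      G = encode (map code′ (map proj₁ arcs))
      covers : Covers I ucs G
      covers h = ∈-coded⁺ code′ (∈-arcs h)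
      forwardStep : ∀ {a e b s₀ t} → (a , e , b) ∈ map proj₁ arcs → (s₀ , a , t) ∈ A → Any (_≼ (s₀ , b , shift e t)) A
      forwardStep {a} {e} {b} {s₀} {t} i k with ∈-map⁻ proj₁ i
      ... | (_ , h) , j , refl with ∈-when (a ≟ⁿ a) (λ _ → s₀ , b , shift e t) refl
      ... | _ , o = All.lookup (All.lookup closedA k) (∈-++⁺ˡ (∈-concatMap (forwardSteps (s₀ , a , t)) j o))
      backwardStep : ∀ {a e b s₀ t} → (a , e , b) ∈ map proj₁ arcs → (s₀ , b , t) ∈ C → Any (_≼ (s₀ , a , shift e t)) C
      backwardStep {a} {e} {b} {s₀} {t} i k with ∈-map⁻ proj₁ i
      ... | (_ , h) , j , refl with ∈-when (b ≟ⁿ b) (λ _ → s₀ , a , shift e t) refl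
      ... | _ , o = All.lookup (All.lookup closedC k) (∈-concatMap (backwardSteps (s₀ , b , t)) j o)
      started : ∀ {s t} → ∃[ i ] toℕ {n₁} i ≡ s → ∃[ j ] encodeMaybe {n₂} j ≡ t →
        ⟦ listᵗ (listᵗ (var 1F ∷ var 0F ∷ []) ∷ listᵗ (var 1F ∷ var 0F ∷ []) ∷ lit 0 ∷ []) ∈ᵗ var 3F ⟧ (t ∷ s ∷ noReachVec G (codes C) (codes A))
      started (s , refl) (t , refl) = member⁺ {L = codes C} (∈-coded⁺ itemCode (exact (All.lookup startC (∈-map⁺ (λ s → s , s , []) (∈-nodes (s , t))))))
      joined : ∀ {a b t a′ b′ t′} → (a , b , t) ∈ A → (a′ , b′ , t′) ∈ C →
        ⟦ joinBody ⟧ (encodeNode a′ ∷ encodeNode b′ ∷ encodeWord t′ ∷ itemCode (a′ , b′ , t′) ∷ encodeNode a ∷ encodeNode b ∷ encodeWord t ∷ itemCode (a , b , t) ∷ noReachVec G (codes C) (codes A))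
      joined {a} {b} {t} {a′} {b′} {t′} i j with encodeWord t ≟ 0 | encodeWord t′ ≟ 0 | b ≟ⁿ b′
      ... | no ne | _ | _ = inj₁ ne
      ... | yes _ | no ne | _ = inj₂ (inj₁ ne)
      ... | yes _ | yes _ | no ne = inj₂ (inj₂ (inj₁ (ne ∘ encodeNode-injective {x = b} {b′})))
      ... | yes e | yes e′ | yes refl with encodeWord-injective {u = t} {[]} e | encodeWord-injective {u = t′} {[]} e′
      ... | refl | refl with ∈-when (b ≟ⁿ b) (λ _ → a , a′ , []) refl
      ... | _ , o = inj₂ (inj₂ (inj₂ (member⁺ {L = codes A} (∈-coded⁺ itemCode (exact
        (All.lookup (All.lookup closedA i) (∈-++⁺ʳ (concatMap (forwardSteps (a , b , [])) arcs) (∈-concatMap (joins C (a , b , [])) j o))))))))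
      absent : ∃[ x ] x ∈ A × encode (encodeNode entrance ∷ encodeNode final ∷ 0 ∷ []) ≡ itemCode x → ⊥
      absent ((a , b , t) , i , eq) with encode-toList-injective (encodeNode entrance ∷ encodeNode final ∷ 0 ∷ []) (encodeNode a ∷ encodeNode b ∷ encodeWord t ∷ []) eq
      ... | eq′ with Vecₚ.∷-injective eq′
      ... | e , eq″ with Vecₚ.∷-injective eq″
      ... | e′ , eq‴ with encodeNode-injective {x = entrance} {a} e | encodeNode-injective {x = final} {b} e′ | encodeWord-injective {u = t} {[]} (sym (proj₁ (Vecₚ.∷-injective eq‴)))
      ... | refl | refl | refl = ¬found (lose i ≼-refl)

-- Loops of one agent; the arguments of avoidsᶠ are its rules, a state s and a
-- set of states that contains those reachable from s in at least one step.

avoidsBody : Fm 1 → Fm 8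
avoidsBody γ = neg (call γ (var 2F ∷ [])) ∨ neg (var 0F ≐ var 6F) ∧ neg (var 0F ∈ᵗ var 7F) ∨ var 3F ∈ᵗ var 7F

opaque
  avoidsᶠ : Fm 1 → Fm 3
  avoidsᶠ γ = all∈ (var 0F) (view 4 (var 0F) (avoidsBody γ)) ∧ neg (var 1F ∈ᵗ var 2F)

module _ {m n} (Δ : List (Rule m n)) (A : Label m → Set) (A? : ∀ e → Dec (A e)) (γ : Fm 1)
  (γ⁺ : ∀ {s c α t} → rule s c α t ∈ Δ → A (c , α) → ⟦ γ ⟧ (encodeAct α ∷ []))
  (γ⁻ : ∀ {s c α t} → rule s c α t ∈ Δ → ⟦ γ ⟧ (encodeAct α ∷ []) → A (c , α)) (s : Fin n) where

  private
    ruleCodes : ℕ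
    ruleCodes = encode (map encodeRule Δ)

    Reached : Fin n → Set
    Reached t = ∃[ e ] ∃[ z ] Path Δ s (e ∷ z) t × All A (e ∷ z)

    after : Fin n → (∃[ ρ ] ρ ∈ Δ) → List (Fin n)
    after t (rule a c α b , i) = when ((a Finₚ.≟ t) ×-dec A? (c , α)) (λ _ → b)

    succs : Fin n → List (Fin n)
    succs t = concatMap (after t) (rulesIn Δ)

    ∈-succs : ∀ {a c α b} → rule a c α b ∈ Δ → A (c , α) → b ∈ succs a
    ∈-succs {a} {c} {α} {b} i h with ∈-when ((a Finₚ.≟ a) ×-dec A? (c , α)) (λ _ → b) (refl , h)
    ... | _ , j = ∈-concatMap (after a) (∈-rulesIn i) j

    all-succs : ∀ {P : Fin n → Set} t → (∀ {c α b} → rule t c α b ∈ Δ → A (c , α) → P b) → All P (succs t)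
    all-succs {P} t f = go (rulesIn Δ)
      where
      one : ∀ ρ → All P (after t ρ)
      one (rule a c α b , i) with a Finₚ.≟ t | A? (c , α)
      ... | yes refl | yes h = f i h ∷ []
      ... | yes _    | no _  = []
      ... | no _     | yes _ = []
      ... | no _     | no _  = []
      go : ∀ ρs → All P (concatMap (after t) ρs)
      go []       = []
      go (ρ ∷ ρs) = Allₚ.++⁺ (one ρ) (go ρs)

    next-reached : ∀ {t} → Reached t → All Reached (succs t)
    next-reached {t} (e , z , p , as) = all-succs t λ i h → e , z ++ _ ∷ [] , p ⧺ (i ∷ []) , Allₚ.++⁺ as (h ∷ [])

  opaque
    unfolding avoidsᶠ

    avoids⁻ : ∀ {X} → ⟦ avoidsᶠ γ ⟧ (ruleCodes ∷ toℕ s ∷ X ∷ []) → ¬ Reached s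
    avoids⁻ {X} (h , s∉X) (e , z , i ∷ p , a ∷ as) = s∉X (member⁺ {L = X} (go p as (step i a (inj₁ refl))))
      where
      step : ∀ {t c α b} → rule t c α b ∈ Δ → A (c , α) → toℕ t ≡ toℕ s ⊎ toℕ t ∈ decode X → toℕ b ∈ decode X
      step {t} {c} {α} {b} i a t∈ with view⁻ {xs = encodeRule (rule t c α b) ∷ ruleCodes ∷ toℕ s ∷ X ∷ []} {t = var 0F} (avoidsBody γ) (ruleVec (rule t c α b)) refl (all-coded⁻ encodeRule Δ h i)
      ... | inj₁ ne = contradiction (γ⁺ i a) ne
      ... | inj₂ (inj₂ b∈) = member⁻ {L = X} b∈
      ... | inj₂ (inj₁ (t≢s , t∉X)) with t∈
      ... | inj₁ eq = contradiction eq t≢s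
      ... | inj₂ t∈X = contradiction (member⁺ {L = X} t∈X) t∉X
      go : ∀ {t z t′} → Path Δ t z t′ → All A z → toℕ t ∈ decode X → toℕ t′ ∈ decode X
      go []      []       t∈ = t∈
      go (i ∷ p) (a ∷ as) t∈ = go p as (step i a (inj₂ t∈))

    avoids⁺ : Reached s ⊎ (∃[ X ] ⟦ avoidsᶠ γ ⟧ (ruleCodes ∷ toℕ s ∷ X ∷ []))
    avoids⁺ with saturate {_≼_ = _≡_} refl trans Finₚ._≟_ succs Reached next-reached (AF-Fin n) (succs s) (all-succs s λ i h → _ , [] , i ∷ [] , h ∷ [])
    ... | L , starts , closed , reached with any? (Finₚ._≟ s) L
    ... | yes found = inj₁ (let t , i , eq = find found in subst Reached eq (All.lookup reached i))
    ... | no ¬found = inj₂ (X , all-coded⁺ encodeRule Δ (λ {ρ} i → ruleVec ρ , refl , go i) ,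
      λ h → absent (∈-coded⁻ toℕ L (member⁻ {L = X} h)))
      where
      X : ℕ
      X = encode (map toℕ L)
      ∈X : ∀ {t} → Any (_≡ t) L → toℕ t ∈ decode X
      ∈X h with find h
      ... | _ , i , refl = ∈-coded⁺ toℕ i
      absent : ∃[ t ] t ∈ L × toℕ s ≡ toℕ t → ⊥
      absent (t , i , eq) = ¬found (lose i (sym (Finₚ.toℕ-injective eq)))
      go : ∀ {ρ} → ρ ∈ Δ → ⟦ avoidsBody γ ⟧ (ruleVec ρ Vec.++ encodeRule ρ ∷ ruleCodes ∷ toℕ s ∷ X ∷ [])
      go {rule a c α b} i with A? (c , α) | a Finₚ.≟ s | any? (Finₚ._≟ a) L
      ... | no ¬h | _        | _       = inj₁ (¬h ∘ γ⁻ i)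
      ... | yes h | yes refl | _       = inj₂ (inj₂ (member⁺ {L = X} (∈X (All.lookup starts (∈-succs i h)))))
      ... | yes h | no _     | yes a∈L = inj₂ (inj₂ (member⁺ {L = X} (let _ , j , eq = find a∈L in ∈X (All.lookup (All.lookup closed (subst (_∈ L) eq j)) (∈-succs i h)))))
      ... | yes h | no a≢s   | no a∉L  = inj₂ (inj₁ ((λ eq → a≢s (Finₚ.toℕ-injective eq)) ,
        λ k → let t , j , eq = ∈-coded⁻ toℕ L (member⁻ {L = X} k) in a∉L (lose j (sym (Finₚ.toℕ-injective eq)))))

anyAct epsilonAct : Fm 1
anyAct     = lit 0 ≐ lit 0
epsilonAct = var 0F ≐ lit epsilon

-- The arguments are the instance and [G, C, A, X, Y]: either the lasso is not
-- reachable, or neither agent can loop.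

noLassoBody : Fm 16
noLassoBody =
  call noReachᶠ (var 0F ∷ var 1F ∷ var 2F ∷ var 8F ∷ var 9F ∷ var 6F ∷ var 7F ∷ var (# 10) ∷ var (# 11) ∷ var (# 12) ∷ var (# 13) ∷ []) ∨
  call (avoidsᶠ anyAct) (var 8F ∷ var (# 12) ∷ var 3F ∷ []) ∧ call (avoidsᶠ epsilonAct) (var 9F ∷ var (# 13) ∷ var 4F ∷ [])

opaque
  noLassoᶠ : Fm 2
  noLassoᶠ = view 9 (var 0F) (view 5 (var (# 10)) noLassoBody)

module _ (I : Instance) (ucs : IsUCS (Instance.system I)) where
  open Instance I
  open Product I ucs

  private
    comm? : ∀ (e : Label m) → Dec (IsComm e)
    comm? (c , comm x) = yes comm
    comm? (c , test R) = no (λ ())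

    idle? : ∀ (e : Label m) → Dec (Idle e)
    idle? (c , comm nothing)  = yes idle
    idle? (c , comm (just _)) = no (λ ())
    idle? (c , test R)        = no (λ ())

    comm⁻ : ∀ {s c α t} → rule s c α t ∈ Δ₁ → ⟦ anyAct ⟧ (encodeAct α ∷ []) → IsComm (c , α)
    comm⁻ i _ with All.lookup (proj₁ ucs) i
    ... | isComm = comm

    idle⁺ : ∀ {s c α t} → rule s c α t ∈ Δ₂ → Idle (c , α) → ⟦ epsilonAct ⟧ (encodeAct α ∷ [])
    idle⁺ i idle = refl

    idle⁻ : ∀ {s c α t} → rule s c α t ∈ Δ₂ → ⟦ epsilonAct ⟧ (encodeAct α ∷ []) → Idle (c , α)
    idle⁻ i eq with All.lookup (proj₂ ucs) i
    ... | isComm {x = nothing} = idle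
    ... | isComm {x = just x} with encode-injective (1 ∷ toℕ x ∷ []) (0 ∷ []) eq
    ... | ()

  opaque
    unfolding noLassoᶠ

    noLasso⁻ : ∀ {y} → ⟦ noLassoᶠ ⟧ (encodeInstance I ∷ y ∷ []) → ¬ Lasso I
    noLasso⁻ {y} h lasso with view⁻ {xs = encodeInstance I ∷ y ∷ []} {t = var 0F} (view 5 (var (# 10)) noLassoBody) (instanceVec I) refl h | Lasso⁻ lasso
    ... | G ∷ C ∷ A ∷ X ∷ Y ∷ [] , refl , inj₁ nr | reach , _ = noReach⁻ I ucs {G} {C} {A} nr reach
    ... | G ∷ C ∷ A ∷ X ∷ Y ∷ [] , refl , inj₂ (h₁ , h₂) | _ , inj₁ loop = avoids⁻ Δ₁ IsComm comm? anyAct (λ _ _ → refl) comm⁻ p {X} h₁ loop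
    ... | G ∷ C ∷ A ∷ X ∷ Y ∷ [] , refl , inj₂ (h₁ , h₂) | _ , inj₂ loop = avoids⁻ Δ₂ Idle idle? epsilonAct idle⁺ idle⁻ q {Y} h₂ loop

    noLasso⁺ : Lasso I ⊎ (∃[ y ] ⟦ noLassoᶠ ⟧ (encodeInstance I ∷ y ∷ []))
    noLasso⁺ with noReach⁺ I ucs | avoids⁺ Δ₁ IsComm comm? anyAct (λ _ _ → refl) comm⁻ p | avoids⁺ Δ₂ Idle idle? epsilonAct idle⁺ idle⁻ q
    ... | inj₁ reach | inj₁ loop | _ = inj₁ (Lasso⁺ reach (inj₁ loop))
    ... | inj₁ reach | inj₂ _ | inj₁ loop = inj₁ (Lasso⁺ reach (inj₂ loop))
    ... | inj₂ (G , C , A , nr) | _ | _ = inj₂ (encode (G ∷ C ∷ A ∷ 0 ∷ 0 ∷ []) , instanceVec I , refl , G ∷ C ∷ A ∷ 0 ∷ 0 ∷ [] , refl , inj₁ nr)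
    ... | inj₁ _ | inj₂ (X , h₁) | inj₂ (Y , h₂) = inj₂ (encode (0 ∷ 0 ∷ 0 ∷ X ∷ Y ∷ []) , instanceVec I , refl , 0 ∷ 0 ∷ 0 ∷ X ∷ Y ∷ [] , refl , inj₂ (h₁ , h₂))

decidable : DecidableSet (RecurrentReachability IsUCS)
decidable = post φ ψ sound refute complete
  where
  validity : Fm 2
  validity = call (valid commRule) (var 0F ∷ [])
  φ ψ : Fm 2
  φ = validity ∧ lassoᶠ
  ψ = neg validity ∨ noLassoᶠ
  validI⁻ : ∀ {x} → ⟦ valid commRule ⟧ (x ∷ []) → Σ[ I ∈ Instance ] encodeInstance I ≡ x × IsUCS (Instance.system I)
  validI⁻ = valid⁻ commRule NoTest (λ {m} {n} {ρ} → commRule⁺ {ρ = ρ}) commRule⁻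
  validI⁺ : ∀ I → IsUCS (Instance.system I) → ⟦ valid commRule ⟧ (encodeInstance I ∷ [])
  validI⁺ = valid⁺ commRule NoTest (λ {m} {n} {ρ} → commRule⁺ {ρ = ρ}) commRule⁻
  sound : ∀ x y → ⟦ φ ⟧ (x ∷ y ∷ []) → RecurrentReachability IsUCS x
  sound x y (v , h) with validI⁻ v
  ... | I , refl , ucs = I , sym (encodeInstance≡codeInstance I) , ucs , Lasso⇒RecurrentlyReachable I (lasso⁻ I (IsUCS⇒IsUCST[Z₁ʳ] ucs) {y} h)
  refute : ∀ x y → ⟦ ψ ⟧ (x ∷ y ∷ []) → ¬ RecurrentReachability IsUCS x
  refute x y h (I , refl , ucs , rr) with subst (λ x → ⟦ ψ ⟧ (x ∷ y ∷ [])) (sym (encodeInstance≡codeInstance I)) h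
  ... | inj₁ nv = nv (validI⁺ I ucs)
  ... | inj₂ nl = noLasso⁻ I ucs {y} nl (RecurrentlyReachable⇒Lasso I (IsUCS⇒IsUCST[Z₁ʳ] ucs) rr)
  complete : ∀ x → (∃[ y ] ⟦ φ ⟧ (x ∷ y ∷ [])) ⊎ (∃[ y ] ⟦ ψ ⟧ (x ∷ y ∷ []))
  complete x with proj₂ (recursive (valid commRule)) (x ∷ [])
  ... | inj₂ (nv , _) = inj₂ (0 , inj₁ nv)
  ... | inj₁ (v , _) with validI⁻ v
  ... | I , refl , ucs with noLasso⁺ I ucs
  ... | inj₂ (y , h) = inj₂ (y , inj₂ h)
  ... | inj₁ lasso with lasso⁺ I (IsUCS⇒IsUCST[Z₁ʳ] ucs) lasso
  ... | y , h = inj₁ (y , validI⁺ I ucs , h)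

semidecidable : Σ⁰₁ (RecurrentReachability IsUCST[Z₁ʳ])
semidecidable = ⟦ φ ⟧ , recursive φ , λ x → mk⇔ (to x) (from x)
  where
  φ : Fm 2
  φ = call (valid zRule) (var 0F ∷ []) ∧ lassoᶠ
  to : ∀ x → RecurrentReachability IsUCST[Z₁ʳ] x → ∃[ y ] ⟦ φ ⟧ (x ∷ y ∷ [])
  to x (I , refl , restricted , rr) with lasso⁺ I restricted (RecurrentlyReachable⇒Lasso I restricted rr)
  ... | y , h = y , subst (λ x → ⟦ φ ⟧ (x ∷ y ∷ [])) (encodeInstance≡codeInstance I)
    (valid⁺ zRule OnlyZʳ (λ {m} {n} {ρ} → zRule⁺ {ρ = ρ}) zRule⁻ I restricted , h)
  from : ∀ x → (∃[ y ] ⟦ φ ⟧ (x ∷ y ∷ [])) → RecurrentReachability IsUCST[Z₁ʳ] x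
  from x (y , v , h) with valid⁻ zRule OnlyZʳ (λ {m} {n} {ρ} → zRule⁺ {ρ = ρ}) zRule⁻ v
  ... | I , refl , restricted = I , sym (encodeInstance≡codeInstance I) , restricted , Lasso⇒RecurrentlyReachable I (lasso⁻ I restricted {y} h)

-- Counter programs for partial recursive functions

-- Register i of a program is counted from the innermost local variable.
-- loop i p runs p, decrementing i before each round, until i is zero.

infix  4 _⊢_⇒_
infixr 5 _⨟_
infixl 8 _[_]+1 _[_]+_

data Prog : ℕ → Set where
  skip : ∀ {k} → Prog k
  inc  : ∀ {k} → Fin k → Prog k
  _⨟_  : ∀ {k} → Prog k → Prog k → Prog k
  loop : ∀ {k} → Fin k → Prog k → Prog k
  new  : ∀ {k} → Prog (suc k) → Prog k

_[_]+1 : ∀ {k} → Vec ℕ k → Fin k → Vec ℕ k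
xs [ i ]+1 = xs Vec.[ i ]%= suc

data _⊢_⇒_ : ∀ {k} → Prog k → Vec ℕ k → Vec ℕ k → Set where
  skip : ∀ {k} {xs : Vec ℕ k} → skip ⊢ xs ⇒ xs
  inc  : ∀ {k} {xs : Vec ℕ k} i → inc i ⊢ xs ⇒ xs [ i ]+1
  _⨟_  : ∀ {k} {p q : Prog k} {xs ys zs} → p ⊢ xs ⇒ ys → q ⊢ ys ⇒ zs → p ⨟ q ⊢ xs ⇒ zs
  done : ∀ {k i} {p : Prog k} {xs} → lookup xs i ≡ 0 → loop i p ⊢ xs ⇒ xs
  more : ∀ {k i} {p : Prog k} {xs ys zs} → p ⊢ xs ⇒ ys → loop i p ⊢ ys ⇒ zs → loop i p ⊢ xs [ i ]+1 ⇒ zs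
  new  : ∀ {k} {p : Prog (suc k)} {xs ys} → p ⊢ 0 ∷ xs ⇒ 0 ∷ ys → new p ⊢ xs ⇒ ys

[]+1-injective : ∀ {k} {xs ys : Vec ℕ k} i → xs [ i ]+1 ≡ ys [ i ]+1 → xs ≡ ys
[]+1-injective {xs = x ∷ xs} {y ∷ ys} zero    eq with Vecₚ.∷-injective eq
... | e , e′ = cong₂ _∷_ (ℕₚ.suc-injective e) e′
[]+1-injective {xs = x ∷ xs} {y ∷ ys} (suc i) eq with Vecₚ.∷-injective eq
... | e , e′ = cong₂ _∷_ e ([]+1-injective i e′)

lookup-[]+1 : ∀ {k} (xs : Vec ℕ k) i → lookup (xs [ i ]+1) i ≡ suc (lookup xs i)
lookup-[]+1 xs i = Vecₚ.lookup∘updateAt i xs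

⇒-deterministic : ∀ {k} {p : Prog k} {xs xs′ ys zs} → p ⊢ xs ⇒ ys → p ⊢ xs′ ⇒ zs → xs ≡ xs′ → ys ≡ zs
⇒-deterministic skip     skip       refl = refl
⇒-deterministic (inc i)  (inc .i)   refl = refl
⇒-deterministic (d ⨟ e)  (d′ ⨟ e′)  refl with refl ← ⇒-deterministic d d′ refl = ⇒-deterministic e e′ refl
⇒-deterministic (done _) (done _)   refl = refl
⇒-deterministic {xs′ = _} (done z) (more {i = i} {xs = xs} _ _) refl = case trans (sym z) (lookup-[]+1 xs i) of λ ()
⇒-deterministic (more {i = i} {xs = xs} _ _) (done z) refl = case trans (sym z) (lookup-[]+1 xs i) of λ ()
⇒-deterministic (more {i = i} d e) (more d′ e′) eq = ⇒-deterministic e e′ (⇒-deterministic d d′ ([]+1-injective i eq))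
⇒-deterministic (new d)  (new d′)   refl with refl ← ⇒-deterministic d d′ refl = refl

clear : ∀ {k} → Fin k → Prog k
clear i = loop i skip

clear⇒ : ∀ {k} (xs : Vec ℕ k) x → clear zero ⊢ x ∷ xs ⇒ (0 ∷ xs)
clear⇒ xs zero    = done refl
clear⇒ xs (suc x) = more skip (clear⇒ xs x)

move : ∀ {k} → Fin k → Prog (suc k)
move j = loop zero (inc (suc j))

_[_]+_ : ∀ {k} → Vec ℕ k → Fin k → ℕ → Vec ℕ k
xs [ i ]+ n = xs Vec.[ i ]%= (n +_)

add-suc : ∀ {k} (xs : Vec ℕ k) j n → (xs [ j ]+1) [ j ]+ n ≡ xs [ j ]+ suc n
add-suc xs j n = trans (Vecₚ.updateAt-updateAt j xs) (Vecₚ.updateAt-cong j (+-suc n) xs)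

add-zero : ∀ {k} (xs : Vec ℕ k) j → xs [ j ]+ 0 ≡ xs
add-zero xs j = Vecₚ.updateAt-id j xs

move⇒ : ∀ {k} (j : Fin k) x xs → move j ⊢ x ∷ xs ⇒ (0 ∷ xs [ j ]+ x)
move⇒ j zero    xs = subst (λ ys → move j ⊢ 0 ∷ xs ⇒ (0 ∷ ys)) (sym (add-zero xs j)) (done refl)
move⇒ j (suc x) xs = more {xs = x ∷ xs} (inc (suc j)) (subst (λ ys → move j ⊢ x ∷ xs [ j ]+1 ⇒ (0 ∷ ys)) (add-suc xs j x) (move⇒ j x (xs [ j ]+1)))

both : ∀ {k} → Prog (2 + k)
both = inc zero ⨟ inc (suc zero)

copy : ∀ {k} → Fin k → Prog (suc k)
copy i = new (loop (suc (suc i)) both ⨟ move (suc i))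

drain⇒ : ∀ {k} (i : Fin k) ys → lookup ys i ≡ 0 → ∀ n a b →
  loop (suc (suc i)) both ⊢ a ∷ b ∷ ys [ i ]+ n ⇒ (n + a ∷ n + b ∷ ys)
drain⇒ i ys z zero    a b = subst (λ zs → loop (suc (suc i)) both ⊢ a ∷ b ∷ zs ⇒ _) (sym (add-zero ys i)) (done z)
drain⇒ i ys z (suc n) a b = subst₂ (λ zs us → loop (suc (suc i)) both ⊢ a ∷ b ∷ zs ⇒ us)
  (Vecₚ.updateAt-updateAt i {suc} {n +_} ys) (cong₂ (λ a b → a ∷ b ∷ ys) (+-suc n a) (+-suc n b))
  (more {xs = a ∷ b ∷ ys [ i ]+ n} (inc zero ⨟ inc (suc zero)) (drain⇒ i ys z n (suc a) (suc b)))

copy⇒ : ∀ {k} (i : Fin k) xs → copy i ⊢ 0 ∷ xs ⇒ (lookup xs i ∷ xs)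
copy⇒ i xs = new (subst₂ (λ zs us → loop (suc (suc i)) both ⊢ 0 ∷ 0 ∷ zs ⇒ us) restore
    (cong (λ a → a ∷ a ∷ ys) (+-identityʳ n)) (drain⇒ i ys (Vecₚ.lookup∘updateAt i xs) n 0 0) ⨟
  subst (λ zs → move (suc i) ⊢ n ∷ n ∷ ys ⇒ (0 ∷ n ∷ zs)) restore (move⇒ (suc i) n (n ∷ ys)))
  where
  n = lookup xs i
  ys = xs Vec.[ i ]≔ 0
  restore : ys [ i ]+ n ≡ xs
  restore = trans (Vecₚ.updateAt-updateAt i xs) (Vecₚ.updateAt-id-local i xs (+-identityʳ n))

-- compute f θ adds f to register 0, which must be zero; the arguments are the
-- registers θ of the enclosing block.

under : ∀ {j k} → (Fin j → Fin k) → Fin (suc j) → Fin (suc k)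
under θ zero    = zero
under θ (suc i) = suc (θ i)

stepArgs : ∀ {n k} → (Fin (suc n) → Fin k) → Fin (2 + n) → Fin (3 + k)
stepArgs θ zero          = suc zero
stepArgs θ (suc zero)    = suc (suc zero)
stepArgs θ (suc (suc i)) = suc (suc (suc (θ (suc i))))

round : ∀ {k} → Prog (4 + k) → Prog (3 + k)
round p = new (p ⨟ clear (suc (suc (suc zero))) ⨟ move (suc (suc zero))) ⨟ inc (suc zero)

compute : ∀ {n k} → PR n → (Fin n → Fin k) → Prog (suc k)
bind    : ∀ {n j k} → Vec (PR n) j → (Fin n → Fin k) → Prog (j + k) → Prog k
compute zero        θ = skip
compute suc         θ = copy (θ zero) ⨟ inc zero
compute (proj i)    θ = copy (θ i)
compute (comp {j} f gs) θ = bind gs (suc ∘ θ) (new (compute f (_↑ˡ _) ⨟ move (j ↑ʳ zero)))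
compute (rec f g)   θ = compute f (θ ∘ suc) ⨟ new (new (copy (suc (suc (θ zero))) ⨟
  loop zero (round (compute g (stepArgs θ)))) ⨟ clear zero)
compute (min f)     θ = new (compute f (under θ) ⨟ loop zero (clear zero ⨟ inc (suc zero) ⨟ compute f (under θ)))
bind []       θ p = p
bind {j = suc j} (g ∷ gs) θ p = bind gs θ (new (compute g ((j ↑ʳ_) ∘ θ) ⨟ p ⨟ clear zero))

Reads : ∀ {n k} → Vec ℕ k → (Fin n → Fin k) → Vec ℕ n → Set
Reads xs θ ys = ∀ i → lookup xs (θ i) ≡ lookup ys i

data Rounds {n} (g : PR (2 + n)) (ys : Vec ℕ n) : ℕ → ℕ → ℕ → ℕ → Set where
  []  : ∀ {c v} → Rounds g ys c 0 v v
  _∷_ : ∀ {c b v w z} → g ⟨ c ∷ v ∷ ys ⟩⇓ w → Rounds g ys (suc c) b w z → Rounds g ys c (suc b) v z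

snoc : ∀ {n g} {ys : Vec ℕ n} {c b v w z} → Rounds g ys c b v w → g ⟨ b + c ∷ w ∷ ys ⟩⇓ z → Rounds g ys c (suc b) v z
snoc []       e = e ∷ []
snoc {g = g} {ys} {c} {suc b} {w = w} {z} (d ∷ rs) e = d ∷ snoc rs (subst (λ k → g ⟨ k ∷ w ∷ ys ⟩⇓ z) (sym (+-suc b c)) e)

rounds : ∀ {n f g} {ys : Vec ℕ n} {k z} → rec f g ⟨ k ∷ ys ⟩⇓ z → ∃[ v ] f ⟨ ys ⟩⇓ v × Rounds g ys 0 k v z
rounds (rec-z d) = _ , d , []
rounds {g = g} {ys} {suc k} {z} (rec-s {y = y} d e) with rounds d
... | v , d′ , rs = v , d′ , snoc rs (subst (λ k → g ⟨ k ∷ y ∷ ys ⟩⇓ z) (sym (+-identityʳ k)) e)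

compute⇒ : ∀ {n k} (f : PR n) {θ : Fin n → Fin k} {xs ys y} → f ⟨ ys ⟩⇓ y → Reads xs θ ys → compute f θ ⊢ 0 ∷ xs ⇒ (y ∷ xs)
bind⇒ : ∀ {n j k} (gs : Vec (PR n) j) {θ : Fin n → Fin k} {xs xs′ ys zs p} → Pointwise (λ g z → g ⟨ ys ⟩⇓ z) gs zs → Reads xs θ ys →
  p ⊢ zs Vec.++ xs ⇒ (zs Vec.++ xs′) → bind gs θ p ⊢ xs ⇒ xs′
bind⇒ []       []       h d = d
bind⇒ {j = suc j} (g ∷ gs) {θ} {xs} {zs = z ∷ zs} (e ∷ es) h d = bind⇒ gs es h
  (new (compute⇒ g e (λ i → trans (Vecₚ.lookup-++ʳ zs xs (θ i)) (h i)) ⨟ d ⨟ clear⇒ _ z))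
compute⇒ zero zero h = skip
compute⇒ suc {θ} {xs} (suc {x}) h =
  subst (λ v → copy (θ zero) ⊢ 0 ∷ xs ⇒ (v ∷ xs)) (h zero) (copy⇒ (θ zero) xs) ⨟ inc zero
compute⇒ (proj i) {θ} {xs} (proj .i) h = subst (λ v → copy (θ i) ⊢ 0 ∷ xs ⇒ (v ∷ xs)) (h i) (copy⇒ (θ i) xs)
compute⇒ (comp {j} f gs) {θ} {xs} {y = y} (comp {ys = zs} es e) h = bind⇒ gs es h
  (new (compute⇒ f e (Vecₚ.lookup-++ˡ zs (0 ∷ xs)) ⨟
    subst (λ us → move (j ↑ʳ zero) ⊢ y ∷ zs Vec.++ 0 ∷ xs ⇒ (0 ∷ us)) (trans (add-++ zs) (cong (λ v → zs Vec.++ v ∷ xs) (+-identityʳ y)))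
      (move⇒ (j ↑ʳ zero) y (zs Vec.++ 0 ∷ xs))))
  where
  add-++ : ∀ {j} (zs : Vec ℕ j) → (zs Vec.++ 0 ∷ xs) [ j ↑ʳ zero ]+ y ≡ zs Vec.++ (y + 0) ∷ xs
  add-++ []       = refl
  add-++ (z ∷ zs) = cong (z ∷_) (add-++ zs)
compute⇒ (rec f g) {θ} {xs} {k ∷ ys} {y} e h with rounds e
... | v , d , rs = compute⇒ f d (h ∘ suc) ⨟ new (new (
    subst (λ b → copy (suc (suc (θ zero))) ⊢ 0 ∷ 0 ∷ v ∷ xs ⇒ (b ∷ 0 ∷ v ∷ xs)) (h zero) (copy⇒ (suc (suc (θ zero))) (0 ∷ v ∷ xs)) ⨟ iterate rs) ⨟
    clear⇒ _ (k + 0))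
  where
  clearOut : ∀ t b c v → clear (suc (suc (suc zero))) ⊢ t ∷ b ∷ c ∷ v ∷ xs ⇒ (t ∷ b ∷ c ∷ 0 ∷ xs)
  clearOut t b c zero    = done refl
  clearOut t b c (suc v) = more skip (clearOut t b c v)
  iterate : ∀ {b c v z} → Rounds g ys c b v z →
    loop zero (round (compute g (stepArgs θ))) ⊢ b ∷ c ∷ v ∷ xs ⇒ (0 ∷ b + c ∷ z ∷ xs)
  iterate [] = done refl
  iterate {suc b} {c} {v} {z} (_∷_ {w = w} d rs) = more
    (new (compute⇒ g d (λ { zero → refl ; (suc zero) → refl ; (suc (suc i)) → h (suc i) }) ⨟ clearOut w b c v ⨟
      subst (λ w′ → move (suc (suc zero)) ⊢ w ∷ b ∷ c ∷ 0 ∷ xs ⇒ (0 ∷ b ∷ c ∷ w′ ∷ xs)) (+-identityʳ w) (move⇒ (suc (suc zero)) w (b ∷ c ∷ 0 ∷ xs))) ⨟ inc (suc zero))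
    (subst (λ c′ → loop zero (round (compute g (stepArgs θ))) ⊢ b ∷ suc c ∷ w ∷ xs ⇒ (0 ∷ c′ ∷ z ∷ xs)) (+-suc b c) (iterate rs))
compute⇒ (min f) {θ} {xs} {ys} {y} (min below e) h = new (compute⇒ f (value 0 y (+-identityʳ y)) (reads 0) ⨟ search 0 y (+-identityʳ y))
  where
  reads : ∀ i → Reads (i ∷ xs) (under θ) (i ∷ ys)
  reads i zero    = refl
  reads i (suc j) = h j
  result : ∀ i d → d + i ≡ y → ℕ
  result i zero    _  = 0
  result i (suc d) eq = suc (proj₁ (below i (≤-trans (s≤s (m≤n+m i d)) (≤-reflexive eq))))
  value : ∀ i d (eq : d + i ≡ y) → f ⟨ i ∷ ys ⟩⇓ result i d eq
  value i zero    refl = e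
  value i (suc d) eq   = proj₂ (below i (≤-trans (s≤s (m≤n+m i d)) (≤-reflexive eq)))
  search : ∀ i d (eq : d + i ≡ y) → loop zero (clear zero ⨟ inc (suc zero) ⨟ compute f (under θ)) ⊢ result i d eq ∷ i ∷ xs ⇒ (0 ∷ y ∷ xs)
  search i zero    refl = done refl
  search i (suc d) eq   = more (clear⇒ (i ∷ xs) _ ⨟ inc (suc zero) ⨟ compute⇒ f (value (suc i) d eq′) (reads (suc i))) (search (suc i) d eq′)
    where eq′ = trans (+-suc d i) eq

-- Regular programs and their automata

skipL : ∀ {m} → Label m
skipL = r , comm nothing

infixr 6 _·_
infixr 5 _∪_
infix  7 _*

data Reg (m : ℕ) : Set where
  prim : Label m → Reg m
  _·_  : Reg m → Reg m → Reg m
  _∪_  : Reg m → Reg m → Reg m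
  _*   : Reg m → Reg m

module _ {m : ℕ} where

  -- The traces include the silent steps of the automaton.
  data Lang : Reg m → List (Label m) → Set where
    prim  : ∀ {a} → Lang (prim a) (a ∷ [])
    _·_   : ∀ {P Q y z} → Lang P y → Lang Q z → Lang (P · Q) (y ++ z)
    inl   : ∀ {P Q z} → Lang P z → Lang (P ∪ Q) (skipL ∷ z)
    inr   : ∀ {P Q z} → Lang Q z → Lang (P ∪ Q) (skipL ∷ z)
    stop  : ∀ {P} → Lang (P *) (skipL ∷ [])
    again : ∀ {P y z} → Lang P y → Lang (P *) z → Lang (P *) (skipL ∷ y ++ z)

  St : Reg m → Set
  St (prim a) = ⊤
  St (P · Q)  = St P ⊎ St Q
  St (P ∪ Q)  = ⊤ ⊎ St P ⊎ St Q
  St (P *)    = ⊤ ⊎ St P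

  start : ∀ P → St P
  start (prim a) = tt
  start (P · Q)  = inj₁ (start P)
  start (P ∪ Q)  = inj₁ tt
  start (P *)    = inj₁ tt

  edges : ∀ {n} P → (St P → Fin n) → Fin n → List (Rule m n)
  edges (prim (c , α)) ι e = rule (ι tt) c α e ∷ []
  edges (P · Q) ι e = edges P (ι ∘ inj₁) (ι (inj₂ (start Q))) ++ edges Q (ι ∘ inj₂) e
  edges (P ∪ Q) ι e =
    rule (ι (inj₁ tt)) r (comm nothing) (ι (inj₂ (inj₁ (start P)))) ∷
    rule (ι (inj₁ tt)) r (comm nothing) (ι (inj₂ (inj₂ (start Q)))) ∷
    edges P (ι ∘ inj₂ ∘ inj₁) e ++ edges Q (ι ∘ inj₂ ∘ inj₂) e
  edges (P *) ι e =
    rule (ι (inj₁ tt)) r (comm nothing) e ∷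
    rule (ι (inj₁ tt)) r (comm nothing) (ι (inj₂ (start P))) ∷
    edges P (ι ∘ inj₂) (ι (inj₁ tt))

  Included : ∀ {n} → List (Rule m n) → List (Rule m n) → Set
  Included Δ Δ′ = ∀ {ρ} → ρ ∈ Δ → ρ ∈ Δ′

  edges-complete : ∀ {n Δ} P {ι : St P → Fin n} {e z} → Included (edges P ι e) Δ → Lang P z → Path Δ (ι (start P)) z e
  edges-complete (prim a) inj prim = inj (here refl) ∷ []
  edges-complete (P · Q) {ι} {e} inj (h · h′) = edges-complete P (inj ∘ ∈-++⁺ˡ) h ⧺ edges-complete Q (inj ∘ ∈-++⁺ʳ (edges P (ι ∘ inj₁) _)) h′
  edges-complete (P ∪ Q) inj (inl h) = inj (here refl) ∷ edges-complete P (inj ∘ there ∘ there ∘ ∈-++⁺ˡ) h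
  edges-complete (P ∪ Q) {ι} {e} inj (inr h) = inj (there (here refl)) ∷ edges-complete Q (inj ∘ there ∘ there ∘ ∈-++⁺ʳ (edges P (ι ∘ inj₂ ∘ inj₁) e)) h
  edges-complete (P *) inj stop = inj (here refl) ∷ []
  edges-complete (P *) {ι} inj (again h h′) = inj (there (here refl)) ∷ (edges-complete P (inj ∘ there ∘ there) h ⧺ edges-complete (P *) {ι} inj h′)

  -- Traces from a state to the exit.
  From : ∀ P → St P → List (Label m) → Set
  From (prim a) tt z = z ≡ a ∷ []
  From (P · Q)  (inj₁ s) z = ∃[ x ] ∃[ y ] z ≡ x ++ y × From P s x × Lang Q y
  From (P · Q)  (inj₂ s) z = From Q s z
  From (P ∪ Q)  (inj₁ tt) z = Lang (P ∪ Q) z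
  From (P ∪ Q)  (inj₂ (inj₁ s)) z = From P s z
  From (P ∪ Q)  (inj₂ (inj₂ s)) z = From Q s z
  From (P *)    (inj₁ tt) z = Lang (P *) z
  From (P *)    (inj₂ s) z = ∃[ x ] ∃[ y ] z ≡ x ++ y × From P s x × Lang (P *) y

  From⇒Lang : ∀ P {z} → From P (start P) z → Lang P z
  From⇒Lang (prim a) refl = prim
  From⇒Lang (P · Q) (x , y , refl , h , h′) = From⇒Lang P h · h′
  From⇒Lang (P ∪ Q) h = h
  From⇒Lang (P *) h = h

  Lang⇒From : ∀ P {z} → Lang P z → From P (start P) z
  Lang⇒From (prim a) prim = refl
  Lang⇒From (P · Q) (h · h′) = _ , _ , refl , Lang⇒From P h , h′
  Lang⇒From (P ∪ Q) h = h
  Lang⇒From (P *) h = h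

  record Describes {n} (D : Fin n → List (Label m) → Set) (P : Reg m) (ι : St P → Fin n) (K : List (Label m) → Set) : Set where
    field
      intro : ∀ s {x y} → From P s x → K y → D (ι s) (x ++ y)
      elim  : ∀ s {z} → D (ι s) z → ∃[ x ] ∃[ y ] z ≡ x ++ y × From P s x × K y

  open Describes

  edges-sound : ∀ {n} {D : Fin n → List (Label m) → Set} P {ι : St P → Fin n} {e} → Describes D P ι (D e) →
    ∀ {s c α s′ z} → rule s c α s′ ∈ edges P ι e → D s′ z → D s ((c , α) ∷ z)
  edges-sound (prim a) d (here refl) h = intro d tt refl h
  edges-sound {D = D} (P · Q) {ι} {e} d i h with ∈-++⁻ (edges P (ι ∘ inj₁) (ι (inj₂ (start Q)))) i
  ... | inj₁ j = edges-sound {D = D} P {ι ∘ inj₁} (record { intro = intro₁ ; elim = elim₁ }) j h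
    where
    intro₁ : ∀ s {x y} → From P s x → D (ι (inj₂ (start Q))) y → D (ι (inj₁ s)) (x ++ y)
    intro₁ s {x} f k with elim d (inj₂ (start Q)) k
    ... | x′ , y′ , refl , f′ , k′ = subst (D _) (Listₚ.++-assoc x x′ y′) (intro d (inj₁ s) (x , x′ , refl , f , From⇒Lang Q f′) k′)
    elim₁ : ∀ s {z} → D (ι (inj₁ s)) z → ∃[ x ] ∃[ y ] z ≡ x ++ y × From P s x × D (ι (inj₂ (start Q))) y
    elim₁ s k with elim d (inj₁ s) k
    ... | _ , y′ , refl , (x , y , refl , f , f′) , k′ = x , y ++ y′ , Listₚ.++-assoc x y y′ , f , intro d (inj₂ (start Q)) (Lang⇒From Q f′) k′
  ... | inj₂ j = edges-sound Q (record { intro = λ s → intro d (inj₂ s) ; elim = λ s → elim d (inj₂ s) }) j h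
  edges-sound (P ∪ Q) d (here refl) h with elim d (inj₂ (inj₁ (start P))) h
  ... | x , y , refl , f , k = intro d (inj₁ tt) (inl (From⇒Lang P f)) k
  edges-sound (P ∪ Q) d (there (here refl)) h with elim d (inj₂ (inj₂ (start Q))) h
  ... | x , y , refl , f , k = intro d (inj₁ tt) (inr (From⇒Lang Q f)) k
  edges-sound (P ∪ Q) {ι} {e} d (there (there i)) h with ∈-++⁻ (edges P (ι ∘ inj₂ ∘ inj₁) e) i
  ... | inj₁ j = edges-sound P (record { intro = λ s → intro d (inj₂ (inj₁ s)) ; elim = λ s → elim d (inj₂ (inj₁ s)) }) j h
  ... | inj₂ j = edges-sound Q (record { intro = λ s → intro d (inj₂ (inj₂ s)) ; elim = λ s → elim d (inj₂ (inj₂ s)) }) j h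
  edges-sound (P *) d (here refl) h = intro d (inj₁ tt) stop h
  edges-sound (P *) d (there (here refl)) h with elim d (inj₂ (start P)) h
  ... | _ , y , refl , (x , x′ , refl , f , f′) , k = intro d (inj₁ tt) (again (From⇒Lang P f) f′) k
  edges-sound {D = D} (P *) {ι} {e} d (there (there i)) h = edges-sound {D = D} P {ι ∘ inj₂} (record { intro = intro₁ ; elim = elim₁ }) i h
    where
    intro₁ : ∀ s {x y} → From P s x → D (ι (inj₁ tt)) y → D (ι (inj₂ s)) (x ++ y)
    intro₁ s {x} f k with elim d (inj₁ tt) k
    ... | x′ , y′ , refl , f′ , k′ = subst (D _) (Listₚ.++-assoc x x′ y′) (intro d (inj₂ s) (x , x′ , refl , f , f′) k′)
    elim₁ : ∀ s {z} → D (ι (inj₂ s)) z → ∃[ x ] ∃[ y ] z ≡ x ++ y × From P s x × D (ι (inj₁ tt)) y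
    elim₁ s k with elim d (inj₂ s) k
    ... | _ , y′ , refl , (x , y , refl , f , f′) , k′ = x , y ++ y′ , Listₚ.++-assoc x y y′ , f , intro d (inj₁ tt) f′ k′

  automaton-sound : ∀ {n} P {ι : St P → Fin n} {e} → (∀ {s s′} → ι s ≡ ι s′ → s ≡ s′) → (∀ s → ι s ≢ e) →
    ∀ s {z} → Path (edges P ι e) (ι s) z e → From P s z
  automaton-sound {n} P {ι} {e} ι-injective ι≢e s p = result s (go p)
    where
    D : Fin n → List (Label m) → Set
    D x z = (∃[ s ] ι s ≡ x × From P s z) ⊎ x ≡ e × z ≡ []
    result : ∀ s {z} → D (ι s) z → From P s z
    result s (inj₁ (s′ , eq , f)) with ι-injective eq
    ... | refl = f
    result s (inj₂ (eq , _)) = contradiction eq (ι≢e s)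
    described : Describes D P ι (D e)
    described .intro s {x} f (inj₁ (s′ , eq , _)) = contradiction eq (ι≢e s′)
    described .intro s {x} f (inj₂ (_ , refl)) = inj₁ (s , refl , subst (From P s) (sym (Listₚ.++-identityʳ x)) f)
    described .elim s h = _ , [] , sym (Listₚ.++-identityʳ _) , result s h , inj₂ (refl , refl)
    go : ∀ {x z} → Path (edges P ι e) x z e → D x z
    go []      = inj₂ (refl , refl)
    go (i ∷ p) = edges-sound P described i (go p)

  size : Reg m → ℕ
  size (prim a) = 1
  size (P · Q)  = size P + size Q
  size (P ∪ Q)  = 1 + (size P + size Q)
  size (P *)    = 1 + size P

  number : ∀ P → St P → Fin (size P)
  number (prim a) tt = zero
  number (P · Q) (inj₁ s) = number P s ↑ˡ size Q
  number (P · Q) (inj₂ s) = size P ↑ʳ number Q s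
  number (P ∪ Q) (inj₁ tt) = zero
  number (P ∪ Q) (inj₂ (inj₁ s)) = suc (number P s ↑ˡ size Q)
  number (P ∪ Q) (inj₂ (inj₂ s)) = suc (size P ↑ʳ number Q s)
  number (P *) (inj₁ tt) = zero
  number (P *) (inj₂ s) = suc (number P s)

  ↑ˡ≢↑ʳ : ∀ {a b} (i : Fin a) (j : Fin b) → i ↑ˡ b ≢ a ↑ʳ j
  ↑ˡ≢↑ʳ {a} {b} i j eq with trans (sym (Finₚ.splitAt-↑ˡ a i b)) (trans (cong (splitAt a) eq) (Finₚ.splitAt-↑ʳ a b j))
  ... | ()

  number-injective : ∀ P {s s′} → number P s ≡ number P s′ → s ≡ s′
  number-injective (prim a) _ = refl
  number-injective (P · Q) {inj₁ s} {inj₁ s′} eq = cong inj₁ (number-injective P (Finₚ.↑ˡ-injective (size Q) _ _ eq))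
  number-injective (P · Q) {inj₁ s} {inj₂ s′} eq = contradiction eq (↑ˡ≢↑ʳ _ _)
  number-injective (P · Q) {inj₂ s} {inj₁ s′} eq = contradiction (sym eq) (↑ˡ≢↑ʳ _ _)
  number-injective (P · Q) {inj₂ s} {inj₂ s′} eq = cong inj₂ (number-injective Q (Finₚ.↑ʳ-injective (size P) _ _ eq))
  number-injective (P ∪ Q) {inj₁ _} {inj₁ _} _ = refl
  number-injective (P ∪ Q) {inj₁ _} {inj₂ (inj₁ _)} ()
  number-injective (P ∪ Q) {inj₁ _} {inj₂ (inj₂ _)} ()
  number-injective (P ∪ Q) {inj₂ (inj₁ _)} {inj₁ _} ()
  number-injective (P ∪ Q) {inj₂ (inj₂ _)} {inj₁ _} ()
  number-injective (P ∪ Q) {inj₂ (inj₁ s)} {inj₂ (inj₁ s′)} eq = cong (inj₂ ∘ inj₁) (number-injective P (Finₚ.↑ˡ-injective (size Q) _ _ (Finₚ.suc-injective eq)))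
  number-injective (P ∪ Q) {inj₂ (inj₁ s)} {inj₂ (inj₂ s′)} eq = contradiction (Finₚ.suc-injective eq) (↑ˡ≢↑ʳ _ _)
  number-injective (P ∪ Q) {inj₂ (inj₂ s)} {inj₂ (inj₁ s′)} eq = contradiction (sym (Finₚ.suc-injective eq)) (↑ˡ≢↑ʳ _ _)
  number-injective (P ∪ Q) {inj₂ (inj₂ s)} {inj₂ (inj₂ s′)} eq = cong (inj₂ ∘ inj₂) (number-injective Q (Finₚ.↑ʳ-injective (size P) _ _ (Finₚ.suc-injective eq)))
  number-injective (P *) {inj₁ _} {inj₁ _} _ = refl
  number-injective (P *) {inj₂ s} {inj₂ s′} eq = cong inj₂ (number-injective P (Finₚ.suc-injective eq))

  data AllPrims (Q : Label m → Set) : Reg m → Set where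
    prim : ∀ {a} → Q a → AllPrims Q (prim a)
    _·_  : ∀ {P P′} → AllPrims Q P → AllPrims Q P′ → AllPrims Q (P · P′)
    _∪_  : ∀ {P P′} → AllPrims Q P → AllPrims Q P′ → AllPrims Q (P ∪ P′)
    _*   : ∀ {P} → AllPrims Q P → AllPrims Q (P *)

  edges-restricted : ∀ {n} {P} {ι : St P → Fin n} {e} → AllPrims (λ a → ∀ {s t : Fin n} → OnlyZʳ (rule s (proj₁ a) (proj₂ a) t)) P → All OnlyZʳ (edges P ι e)
  edges-restricted (prim q) = q ∷ []
  edges-restricted (h · h′) = Allₚ.++⁺ (edges-restricted h) (edges-restricted h′)
  edges-restricted (h ∪ h′) = isComm ∷ isComm ∷ Allₚ.++⁺ (edges-restricted h) (edges-restricted h′)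
  edges-restricted (h *) = isComm ∷ isComm ∷ edges-restricted h

  edges-codes : ∀ {n n′} P {ι : St P → Fin n} {ι′ : St P → Fin n′} {e e′} → (∀ s → toℕ (ι s) ≡ toℕ (ι′ s)) → toℕ e ≡ toℕ e′ →
    map encodeRule (edges P ι e) ≡ map encodeRule (edges P ι′ e′)
  edges-codes (prim (c , α)) h eq = cong₂ (λ a b → encode (a ∷ codeChannel c ∷ encodeAct α ∷ b ∷ []) ∷ []) (h tt) eq
  edges-codes (P · Q) {ι} {ι′} {e} {e′} h eq = trans (Listₚ.map-++ encodeRule (edges P (ι ∘ inj₁) _) (edges Q (ι ∘ inj₂) e))
    (trans (cong₂ _++_ (edges-codes P (h ∘ inj₁) (h (inj₂ (start Q)))) (edges-codes Q (h ∘ inj₂) eq))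
      (sym (Listₚ.map-++ encodeRule (edges P (ι′ ∘ inj₁) _) (edges Q (ι′ ∘ inj₂) e′))))
  edges-codes (P ∪ Q) {ι} {ι′} {e} {e′} h eq = cong₂ _∷_ (silent (h (inj₁ tt)) (h (inj₂ (inj₁ (start P)))))
    (cong₂ _∷_ (silent (h (inj₁ tt)) (h (inj₂ (inj₂ (start Q)))))
      (trans (Listₚ.map-++ encodeRule (edges P (ι ∘ inj₂ ∘ inj₁) e) (edges Q (ι ∘ inj₂ ∘ inj₂) e))
        (trans (cong₂ _++_ (edges-codes P (h ∘ inj₂ ∘ inj₁) eq) (edges-codes Q (h ∘ inj₂ ∘ inj₂) eq))
          (sym (Listₚ.map-++ encodeRule (edges P (ι′ ∘ inj₂ ∘ inj₁) e′) (edges Q (ι′ ∘ inj₂ ∘ inj₂) e′))))))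
    where
    silent : ∀ {a b c d} → a ≡ c → b ≡ d → encode (a ∷ 0 ∷ epsilon ∷ b ∷ []) ≡ encode (c ∷ 0 ∷ epsilon ∷ d ∷ [])
    silent refl refl = refl
  edges-codes (P *) h eq = cong₂ _∷_ (silent (h (inj₁ tt)) eq) (cong₂ _∷_ (silent (h (inj₁ tt)) (h (inj₂ (start P)))) (edges-codes P (h ∘ inj₂) (h (inj₁ tt))))
    where
    silent : ∀ {a b c d} → a ≡ c → b ≡ d → encode (a ∷ 0 ∷ epsilon ∷ b ∷ []) ≡ encode (c ∷ 0 ∷ epsilon ∷ d ∷ [])
    silent refl refl = refl

-- Counter programs on a queue. The queue is a word v followed by mark; a
-- register is the number of occurrences of its letter in v. Every operation
-- takes the letters of v from the front of the queue and puts letters at its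
-- end, until mark comes round. Since the letter put is written before the
-- letter taken, r and l receive words that determine each other.

module Queue (K : ℕ) where

  Letter : Set
  Letter = Fin (2 + K)

  free mark : Letter
  free = zero
  mark = suc zero

  reg : Fin K → Letter
  reg j = suc (suc j)

  put take : Letter → Label (2 + K)
  put a  = l , comm (just a)
  take a = r , comm (just a)

  swap : Letter → Letter → Reg (2 + K)
  swap b a = prim (put b) · prim (take a)

  count : Letter → List Letter → ℕ
  count a []      = 0
  count a (b ∷ w) = branch (a Finₚ.≟ b) 1 0 + count a w

  count-++ : ∀ a u v → count a (u ++ v) ≡ count a u + count a v
  count-++ a []      v = refl
  count-++ a (b ∷ u) v = trans (cong (branch (a Finₚ.≟ b) 1 0 +_) (count-++ a u v)) (sym (+-assoc (branch (a Finₚ.≟ b) 1 0) _ _))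

  count-⊆ : ∀ a {u v} → u ⊆ v → count a u ≤ count a v
  count-⊆ a []         = z≤n
  count-⊆ a (b ∷ʳ h)   = ≤-trans (count-⊆ a h) (m≤n+m _ (branch (a Finₚ.≟ b) 1 0))
  count-⊆ a (_∷_ {x = b} refl h) = +-monoʳ-≤ (branch (a Finₚ.≟ b) 1 0) (count-⊆ a h)

  same : ∀ (a : Letter) → branch (a Finₚ.≟ a) 1 0 ≡ 1
  same a with a Finₚ.≟ a
  ... | yes _ = refl
  ... | no ne = contradiction refl ne

  different : ∀ {a b : Letter} → a ≢ b → branch (a Finₚ.≟ b) 1 0 ≡ 0
  different {a} {b} ne with a Finₚ.≟ b
  ... | yes eq = contradiction eq ne
  ... | no _   = refl

  count-insert : ∀ c u a v → count c (u ++ a ∷ v) ≡ branch (c Finₚ.≟ a) 1 0 + count c (u ++ v)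
  count-insert c u a v = begin
    count c (u ++ a ∷ v)                                ≡⟨ count-++ c u (a ∷ v) ⟩
    count c u + (δ + count c v)                         ≡⟨ sym (+-assoc (count c u) δ _) ⟩
    count c u + δ + count c v                           ≡⟨ cong (_+ count c v) (+-comm (count c u) δ) ⟩
    δ + count c u + count c v                           ≡⟨ +-assoc δ _ _ ⟩
    δ + (count c u + count c v)                         ≡⟨ cong (δ +_) (sym (count-++ c u v)) ⟩
    δ + count c (u ++ v) ∎
    where
    open ≡-Reasoning
    δ = branch (c Finₚ.≟ a) 1 0

  occurs : ∀ a v → 0 < count a v → ∃[ u ] ∃[ w ] v ≡ u ++ a ∷ w
  occurs a (b ∷ v) h with a Finₚ.≟ b
  ... | yes refl = [] , v , refl
  ... | no _ with occurs a v h
  ... | u , w , refl = b ∷ u , w , refl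

  Clean : List Letter → Set
  Clean = All (_≢ mark)

  absent⇒all : ∀ a v → count a v ≡ 0 → All (_≢ a) v
  absent⇒all a []      _ = []
  absent⇒all a (b ∷ v) h with a Finₚ.≟ b
  absent⇒all a (b ∷ v) () | yes _
  ... | no ne = (ne ∘ sym) ∷ absent⇒all a v h

  all⇒absent : ∀ a {v} → All (_≢ a) v → count a v ≡ 0
  all⇒absent a []      = refl
  all⇒absent a {b ∷ _} (h ∷ hs) = cong₂ _+_ (different {a} {b} (h ∘ sym)) (all⇒absent a hs)

  firstMark : ∀ {u v s t} → Clean u → Clean v → u ++ mark ∷ s ≡ v ++ mark ∷ t → u ≡ v × s ≡ t
  firstMark []       []       eq = refl , proj₂ (Listₚ.∷-injective eq)
  firstMark []       (h ∷ _)  eq = contradiction (sym (proj₁ (Listₚ.∷-injective eq))) h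
  firstMark (h ∷ _)  []       eq = contradiction (proj₁ (Listₚ.∷-injective eq)) h
  firstMark (_ ∷ hs) (_ ∷ ks) eq with Listₚ.∷-injective eq
  ... | refl , eq′ with firstMark hs ks eq′
  ... | refl , eq″ = refl , eq″

  -- R changes the queue from v mark to v′ mark, in front of pending letters.

  Sound : Reg (2 + K) → (List Letter → List Letter → Set) → Set
  Sound R T = ∀ {z} → Lang R z → ∀ {v s t} → Clean v → v ++ mark ∷ (traffic l z ++ s) ≡ traffic r z ++ t →
    ∃[ v′ ] Clean v′ × T v v′ × v′ ++ mark ∷ s ≡ t

  Run : Reg (2 + K) → List Letter → List Letter → Set
  Run R v v′ = ∃[ z ] Lang R z × (∀ s → v ++ mark ∷ (traffic l z ++ s) ≡ traffic r z ++ v′ ++ mark ∷ s)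

  _⨾_ : (T T′ : List Letter → List Letter → Set) → List Letter → List Letter → Set
  (T ⨾ T′) u v = ∃[ w ] T u w × T′ w v

  traffic-assoc : ∀ c (y z : List (Label (2 + K))) s → traffic c (y ++ z) ++ s ≡ traffic c y ++ (traffic c z ++ s)
  traffic-assoc c y z s = trans (cong (_++ s) (traffic-++ c y z)) (Listₚ.++-assoc (traffic c y) _ s)

  sound-· : ∀ {P Q T T′} → Sound P T → Sound Q T′ → Sound (P · Q) (T ⨾ T′)
  sound-· f g (_·_ {y = y} {z} h h′) {v} {s} {t} c eq
    with f h c (trans (cong (λ w → v ++ mark ∷ w) (sym (traffic-assoc l y z s))) (trans eq (traffic-assoc r y z t)))
  ... | w , cw , t₁ , eq₁ with g h′ cw eq₁
  ... | w′ , cw′ , t₂ , eq₂ = w′ , cw′ , (w , t₁ , t₂) , eq₂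

  sound-* : ∀ {P T} → Sound P T → Sound (P *) (Star T)
  sound-* f stop c eq = _ , c , ε , eq
  sound-* f (again {y = y} {z} h h′) {v} {s} {t} c eq
    with f h c (trans (cong (λ w → v ++ mark ∷ w) (sym (traffic-assoc l y z s))) (trans eq (traffic-assoc r y z t)))
  ... | w , cw , t₁ , eq₁ with sound-* f h′ cw eq₁
  ... | w′ , cw′ , t₂ , eq₂ = w′ , cw′ , t₁ ◅ t₂ , eq₂

  sound-mono : ∀ {P T T′} → (∀ {u v} → T u v → T′ u v) → Sound P T → Sound P T′
  sound-mono i f h c eq with f h c eq
  ... | v , c′ , t , eq′ = v , c′ , i t , eq′

  run-· : ∀ {P Q u v w} → Run P u v → Run Q v w → Run (P · Q) u w
  run-· {u = u} {v} {w} (y , h , e) (z , h′ , e′) = y ++ z , h · h′ , λ s →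
    trans (cong (λ x → u ++ mark ∷ x) (traffic-assoc l y z s)) (trans (e (traffic l z ++ s))
      (trans (cong (traffic r y ++_) (e′ s)) (sym (traffic-assoc r y z (w ++ mark ∷ s)))))

  run-stop : ∀ {P u} → Run (P *) u u
  run-stop = _ , stop , λ s → refl

  run-again : ∀ {P u v w} → Run P u v → Run (P *) v w → Run (P *) u w
  run-again {u = u} {v} {w} (y , h , e) (z , h′ , e′) = skipL ∷ y ++ z , again h h′ , λ s →
    trans (cong (λ x → u ++ mark ∷ x) (traffic-assoc l y z s)) (trans (e (traffic l z ++ s))
      (trans (cong (traffic r y ++_) (e′ s)) (sym (traffic-assoc r y z (w ++ mark ∷ s)))))

  Balanced : Reg (2 + K) → Set
  Balanced R = ∀ {z} → Lang R z → length (traffic l z) ≡ length (traffic r z) × count mark (traffic l z) ≡ count mark (traffic r z)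

  balanced-++ : ∀ y z → length (traffic l y) ≡ length (traffic r y) × count mark (traffic l y) ≡ count mark (traffic r y) →
    length (traffic l z) ≡ length (traffic r z) × count mark (traffic l z) ≡ count mark (traffic r z) →
    length (traffic l (y ++ z)) ≡ length (traffic r (y ++ z)) × count mark (traffic l (y ++ z)) ≡ count mark (traffic r (y ++ z))
  balanced-++ y z (a , b) (c , d) rewrite traffic-++ l y z | traffic-++ r y z | Listₚ.length-++ (traffic l y) {traffic l z} | Listₚ.length-++ (traffic r y) {traffic r z}
    | count-++ mark (traffic l y) (traffic l z) | count-++ mark (traffic r y) (traffic r z) = cong₂ _+_ a c , cong₂ _+_ b d

  balanced-· : ∀ {P Q} → Balanced P → Balanced Q → Balanced (P · Q)
  balanced-· f g (_·_ {y = y} {z} h h′) = balanced-++ y z (f h) (g h′)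

  balanced-* : ∀ {P} → Balanced P → Balanced (P *)
  balanced-* f stop = refl , refl
  balanced-* f (again {y = y} {z} h h′) = balanced-++ y z (f h) (balanced-* f h′)

  balanced-∪ : ∀ {P Q} → Balanced P → Balanced Q → Balanced (P ∪ Q)
  balanced-∪ f g (inl h) = f h
  balanced-∪ f g (inr h) = g h

  balanced-swap : ∀ {b a} → branch (mark Finₚ.≟ b) 1 0 ≡ branch (mark Finₚ.≟ a) 1 0 → Balanced (swap b a)
  balanced-swap eq (prim · prim) = refl , cong (_+ 0) eq

  -- sweep f S replaces letters c from S by f c.

  oneOf : (Letter → Letter) → Letter → List Letter → Reg (2 + K)
  oneOf f a []      = swap (f a) a
  oneOf f a (b ∷ S) = swap (f a) a ∪ oneOf f b S

  sweep : (Letter → Letter) → List Letter → Reg (2 + K)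
  sweep f S = oneOf f free S *

  oneOf⁻ : ∀ f a S {z} → Lang (oneOf f a S) z → ∃[ c ] c ∈ a ∷ S × traffic l z ≡ f c ∷ [] × traffic r z ≡ c ∷ []
  oneOf⁻ f a []      (prim · prim) = a , here refl , refl , refl
  oneOf⁻ f a (b ∷ S) (inl (prim · prim)) = a , here refl , refl , refl
  oneOf⁻ f a (b ∷ S) (inr h) with oneOf⁻ f b S h
  ... | c , i , e = c , there i , e

  oneOf⁺ : ∀ f a S {c} → c ∈ a ∷ S → ∃[ z ] Lang (oneOf f a S) z × traffic l z ≡ f c ∷ [] × traffic r z ≡ c ∷ []
  oneOf⁺ f a []      (here refl) = _ , prim · prim , refl , refl
  oneOf⁺ f a (b ∷ S) (here refl) = _ , inl (prim · prim) , refl , refl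
  oneOf⁺ f a (b ∷ S) (there i) with oneOf⁺ f b S i
  ... | z , h , e = _ , inr h , e

  sweep⁻ : ∀ f S {z} → Lang (sweep f S) z → ∃[ w ] All (_∈ free ∷ S) w × traffic l z ≡ map f w × traffic r z ≡ w
  sweep⁻ f S stop = [] , [] , refl , refl
  sweep⁻ f S (again {y = y} {z} h h′) with oneOf⁻ f free S h | sweep⁻ f S h′
  ... | c , i , e , e′ | w , is , es , es′ = c ∷ w , i ∷ is , trans (traffic-++ l y z) (cong₂ _++_ e es) , trans (traffic-++ r y z) (cong₂ _++_ e′ es′)

  sweep⁺ : ∀ f S {w} → All (_∈ free ∷ S) w → ∃[ z ] Lang (sweep f S) z × traffic l z ≡ map f w × traffic r z ≡ w
  sweep⁺ f S []       = _ , stop , refl , refl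
  sweep⁺ f S (i ∷ is) with oneOf⁺ f free S i | sweep⁺ f S is
  ... | y , h , e , e′ | z , h′ , es , es′ = _ , again h h′ , trans (traffic-++ l y z) (cong₂ _++_ e es) , trans (traffic-++ r y z) (cong₂ _++_ e′ es′)

  balanced-oneOf : ∀ f a S → (∀ c → branch (mark Finₚ.≟ f c) 1 0 ≡ branch (mark Finₚ.≟ c) 1 0) → Balanced (oneOf f a S)
  balanced-oneOf f a []      h = balanced-swap {f a} {a} (h a)
  balanced-oneOf f a (b ∷ S) h = balanced-∪ {swap (f a) a} {oneOf f b S} (balanced-swap {f a} {a} (h a)) (balanced-oneOf f b S h)

  regs : List Letter
  regs = map reg (allFin K)

  others : Fin K → List Letter
  others j = map reg (List.filter (λ i → ¬? (i Finₚ.≟ j)) (allFin K))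

  ∈-regs : ∀ {c} → c ≢ mark → c ∈ free ∷ regs
  ∈-regs {zero}        _  = here refl
  ∈-regs {suc zero}    ne = contradiction refl ne
  ∈-regs {suc (suc j)} _  = there (∈-map⁺ reg (∈-allFin j))

  ∈-regs⁻ : ∀ {c} → c ∈ free ∷ regs → c ≢ mark
  ∈-regs⁻ (here refl) ()
  ∈-regs⁻ (there i) eq with ∈-map⁻ reg i
  ∈-regs⁻ (there i) () | j , _ , refl

  ∈-others : ∀ {j c} → c ≢ mark → c ≢ reg j → c ∈ free ∷ others j
  ∈-others {j} {zero}        _  _  = here refl
  ∈-others {j} {suc zero}    ne _  = contradiction refl ne
  ∈-others {j} {suc (suc i)} _  ne = there (∈-map⁺ reg (∈-filter⁺ (λ i → ¬? (i Finₚ.≟ j)) (∈-allFin i) (ne ∘ cong reg)))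

  ∈-others⁻ : ∀ {j c} → c ∈ free ∷ others j → c ≢ mark × c ≢ reg j
  ∈-others⁻ (here refl) = (λ ()) , (λ ())
  ∈-others⁻ {j} (there i) with ∈-map⁻ reg i
  ... | k , h , refl = (λ ()) , λ { refl → proj₂ (∈-filter⁻ (λ i → ¬? (i Finₚ.≟ j)) {xs = allFin K} h) refl }

  rotate : Reg (2 + K)
  rotate = swap mark mark

  change : Letter → Letter → Reg (2 + K)
  change b a = (sweep id regs · (swap b a · sweep id regs)) · rotate

  absence : Fin K → Reg (2 + K)
  absence j = sweep id (others j) · rotate

  Changed : Letter → Letter → List Letter → List Letter → Set
  Changed b a u v = ∃[ w ] ∃[ w′ ] u ≡ w ++ a ∷ w′ × v ≡ w ++ b ∷ w′

  Absent : Fin K → List Letter → List Letter → Set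
  Absent j u v = u ≡ v × count (reg j) u ≡ 0

  pass⁻ : ∀ {u v w s t} → Clean u → Clean w → w ++ mark ∷ ((v ++ mark ∷ []) ++ s) ≡ (u ++ mark ∷ []) ++ t → w ≡ u × v ++ mark ∷ s ≡ t
  pass⁻ {u} {v} {w} {s} {t} cu cw eq with firstMark cw cu (trans eq (Listₚ.++-assoc u (mark ∷ []) t))
  ... | e , e′ = e , trans (sym (Listₚ.++-assoc v (mark ∷ []) s)) e′

  pass⁺ : ∀ u v s → u ++ mark ∷ ((v ++ mark ∷ []) ++ s) ≡ (u ++ mark ∷ []) ++ v ++ mark ∷ s
  pass⁺ u v s = trans (cong (λ x → u ++ mark ∷ x) (Listₚ.++-assoc v (mark ∷ []) s)) (sym (Listₚ.++-assoc u (mark ∷ []) (v ++ mark ∷ s)))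

  clean-sweep : ∀ {w} → All (_∈ free ∷ regs) w → Clean w
  clean-sweep = All.map ∈-regs⁻

  change-traffic : ∀ {b a z} → Lang (change b a) z → ∃[ w ] ∃[ w′ ] Clean w × Clean w′ ×
    traffic l z ≡ (w ++ b ∷ w′) ++ mark ∷ [] × traffic r z ≡ (w ++ a ∷ w′) ++ mark ∷ []
  change-traffic {b} {a} (_·_ {z = z₃} (_·_ {y = z₁} h (_·_ {z = z₂} (prim · prim) h′)) (prim · prim)) with sweep⁻ id regs h | sweep⁻ id regs h′
  ... | w , i , e , e′ | w′ , i′ , e″ , e‴ = w , w′ , clean-sweep i , clean-sweep i′ ,
    trans (traffic-++ l (z₁ ++ put b ∷ take a ∷ z₂) z₃) (cong (_++ mark ∷ []) (trans (traffic-++ l z₁ (put b ∷ take a ∷ z₂)) (cong₂ (λ x y → x ++ b ∷ y) (trans e (Listₚ.map-id w)) (trans e″ (Listₚ.map-id w′))))) ,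
    trans (traffic-++ r (z₁ ++ put b ∷ take a ∷ z₂) z₃) (cong (_++ mark ∷ []) (trans (traffic-++ r z₁ (put b ∷ take a ∷ z₂)) (cong₂ (λ x y → x ++ a ∷ y) e′ e‴)))

  sound-change : ∀ {b a} → b ≢ mark → a ≢ mark → Sound (change b a) (Changed b a)
  sound-change {b} {a} b≢ a≢ h {v} {s} {t} c eq with change-traffic h
  ... | w , w′ , cw , cw′ , el , er rewrite el | er
    with pass⁻ {w ++ a ∷ w′} {w ++ b ∷ w′} (Allₚ.++⁺ cw (a≢ ∷ cw′)) c eq
  ... | refl , eq′ = w ++ b ∷ w′ , Allₚ.++⁺ cw (b≢ ∷ cw′) , (w , w′ , refl , refl) , eq′

  run-change : ∀ {b a} w w′ → Clean w → Clean w′ → Run (change b a) (w ++ a ∷ w′) (w ++ b ∷ w′)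
  run-change {b} {a} w w′ cw cw′ with sweep⁺ id regs (All.map ∈-regs cw) | sweep⁺ id regs (All.map ∈-regs cw′)
  ... | z₁ , h , e , e′ | z₂ , h′ , e″ , e‴ = z , (h · ((prim · prim) · h′)) · (prim · prim) , eqs
    where
    z = (z₁ ++ put b ∷ take a ∷ z₂) ++ put mark ∷ take mark ∷ []
    el : traffic l z ≡ (w ++ b ∷ w′) ++ mark ∷ []
    el = trans (traffic-++ l (z₁ ++ put b ∷ take a ∷ z₂) (put mark ∷ take mark ∷ [])) (cong (_++ mark ∷ []) (trans (traffic-++ l z₁ (put b ∷ take a ∷ z₂)) (cong₂ (λ x y → x ++ b ∷ y) (trans e (Listₚ.map-id w)) (trans e″ (Listₚ.map-id w′)))))
    er : traffic r z ≡ (w ++ a ∷ w′) ++ mark ∷ []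
    er = trans (traffic-++ r (z₁ ++ put b ∷ take a ∷ z₂) (put mark ∷ take mark ∷ [])) (cong (_++ mark ∷ []) (trans (traffic-++ r z₁ (put b ∷ take a ∷ z₂)) (cong₂ (λ x y → x ++ a ∷ y) e′ e‴)))
    eqs : ∀ s → (w ++ a ∷ w′) ++ mark ∷ (traffic l z ++ s) ≡ traffic r z ++ (w ++ b ∷ w′) ++ mark ∷ s
    eqs s rewrite el | er = pass⁺ (w ++ a ∷ w′) (w ++ b ∷ w′) s

  absence-traffic : ∀ {j z} → Lang (absence j) z → ∃[ w ] All (_∈ free ∷ others j) w × traffic l z ≡ w ++ mark ∷ [] × traffic r z ≡ w ++ mark ∷ []
  absence-traffic {j} (_·_ {y = y} {z} h (prim · prim)) with sweep⁻ id (others j) h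
  ... | w , i , e , e′ = w , i , trans (traffic-++ l y z) (cong (_++ mark ∷ []) (trans e (Listₚ.map-id w))) , trans (traffic-++ r y z) (cong (_++ mark ∷ []) e′)

  sound-absence : ∀ {j} → Sound (absence j) (Absent j)
  sound-absence {j} h {v} {s} {t} c eq with absence-traffic {j} h
  ... | w , i , el , er rewrite el | er with pass⁻ {w} {w} (All.map (proj₁ ∘ ∈-others⁻) i) c eq
  ... | refl , eq′ = w , c , (refl , all⇒absent (reg j) (All.map (proj₂ ∘ ∈-others⁻) i)) , eq′

  run-absence : ∀ {j v} → Clean v → count (reg j) v ≡ 0 → Run (absence j) v v
  run-absence {j} {v} c h with sweep⁺ id (others j) (All.zipWith (λ (p , q) → ∈-others p q) (c , absent⇒all (reg j) v h))
  ... | y , lang , e , e′ = z , lang · (prim · prim) , eqs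
    where
    z = y ++ put mark ∷ take mark ∷ []
    el : traffic l z ≡ v ++ mark ∷ []
    el = trans (traffic-++ l y (put mark ∷ take mark ∷ [])) (cong (_++ mark ∷ []) (trans e (Listₚ.map-id v)))
    er : traffic r z ≡ v ++ mark ∷ []
    er = trans (traffic-++ r y (put mark ∷ take mark ∷ [])) (cong (_++ mark ∷ []) e′)
    eqs : ∀ s → v ++ mark ∷ (traffic l z ++ s) ≡ traffic r z ++ v ++ mark ∷ s
    eqs s rewrite el | er = pass⁺ v v s

  balanced-sweep : ∀ S → Balanced (sweep id S)
  balanced-sweep S = balanced-* (balanced-oneOf id free S (λ _ → refl))

  balanced-change : ∀ {b a} → b ≢ mark → a ≢ mark → Balanced (change b a)
  balanced-change {b} {a} b≢ a≢ = balanced-· (balanced-· (balanced-sweep regs) (balanced-· {swap b a} {sweep id regs} (balanced-swap {b} {a} (trans (different (b≢ ∘ sym)) (sym (different (a≢ ∘ sym))))) (balanced-sweep regs))) (balanced-swap {mark} {mark} refl)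

  balanced-absence : ∀ {j} → Balanced (absence j)
  balanced-absence {j} = balanced-· (balanced-sweep (others j)) (balanced-swap {mark} {mark} refl)

-- Lowering of counter programs

module Lower (K : ℕ) where
  open Queue K

  Fits : ∀ {k} → Prog k → Set
  Fits skip           = ⊤
  Fits (inc i)        = ⊤
  Fits (p ⨟ q)        = Fits p × Fits q
  Fits (loop i p)     = Fits p
  Fits (new {k} p)    = suc k ≤ K × Fits p

  level : ∀ {k} → k ≤ K → Fin k → Fin K
  level {suc k} le zero    = fromℕ< le
  level {suc k} le (suc i) = level (<⇒≤ le) i

  level< : ∀ {k} (le : k ≤ K) i → toℕ (level le i) < k
  level< {suc k} le zero    = s≤s (≤-reflexive (Finₚ.toℕ-fromℕ< le))
  level< {suc k} le (suc i) = m<n⇒m<1+n (level< (<⇒≤ le) i)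

  level-injective : ∀ {k} (le : k ≤ K) {i j} → level le i ≡ level le j → i ≡ j
  level-injective {suc k} le {zero}  {zero}  _  = refl
  level-injective {suc k} le {suc i} {suc j} eq = cong suc (level-injective (<⇒≤ le) eq)
  level-injective {suc k} le {zero}  {suc j} eq = contradiction (trans (sym (Finₚ.toℕ-fromℕ< le)) (cong toℕ eq)) (<⇒≢ (level< (<⇒≤ le) j) ∘ sym)
  level-injective {suc k} le {suc i} {zero}  eq = contradiction (trans (sym (Finₚ.toℕ-fromℕ< le)) (cong toℕ (sym eq))) (<⇒≢ (level< (<⇒≤ le) i) ∘ sym)

  cell : ∀ {k} → k ≤ K → Fin k → Letter
  cell le i = reg (level le i)

  lower : ∀ {k} (p : Prog k) → k ≤ K → Fits p → Reg (2 + K)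
  lower skip       le f         = prim skipL
  lower (inc i)    le f         = change (cell le i) free
  lower (p ⨟ q)    le (f , g)   = lower p le f · lower q le g
  lower (loop i p) le f         = (change free (cell le i) · lower p le f) * · absence (level le i)
  lower (new p)    le (le′ , f) = lower p le′ f · absence (level le′ zero)

  record Rep {k} (le : k ≤ K) (v : List Letter) (xs : Vec ℕ k) : Set where
    field
      present : ∀ i → count (cell le i) v ≡ lookup xs i
      unused  : ∀ j → k ≤ toℕ j → count (reg j) v ≡ 0

  open Rep

  rep-new : ∀ {k} {le : k ≤ K} {le′ : suc k ≤ K} {v xs} → Rep le v xs → Rep le′ v (0 ∷ xs)
  rep-new {le′ = le′} h .present zero    = h .unused _ (≤-reflexive (sym (Finₚ.toℕ-fromℕ< le′)))
  rep-new {le = le} {le′} {v} h .present (suc i) = trans (cong (λ le → count (cell le i) v) (≤-irrelevant (<⇒≤ le′) le)) (h .present i)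
  rep-new h .unused j lt = h .unused j (<⇒≤ lt)

  rep-old : ∀ {k} {le : k ≤ K} {le′ : suc k ≤ K} {v xs} → Rep le′ v (0 ∷ xs) → Rep le v xs
  rep-old {le = le} {le′} {v} h .present i = trans (cong (λ le → count (cell le i) v) (≤-irrelevant le (<⇒≤ le′))) (h .present (suc i))
  rep-old {k} {le′ = le′} {v} h .unused j le with m≤n⇒m<n∨m≡n le
  ... | inj₁ lt = h .unused j lt
  ... | inj₂ eq = trans (cong (λ j → count (reg j) v) (Finₚ.toℕ-injective (trans (sym eq) (sym (Finₚ.toℕ-fromℕ< le′))))) (h .present zero)

  module _ {k} (le : k ≤ K) (i : Fin k) (w w′ : List Letter) where

    private
      unswapped : ∀ j → count (reg j) (w ++ free ∷ w′) ≡ count (reg j) (w ++ w′)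
      unswapped j = count-insert (reg j) w free w′

      at : count (cell le i) (w ++ cell le i ∷ w′) ≡ suc (count (cell le i) (w ++ free ∷ w′))
      at = trans (count-insert (cell le i) w (cell le i) w′) (cong₂ _+_ (same (cell le i)) (sym (unswapped (level le i))))

      off : ∀ j → j ≢ level le i → count (reg j) (w ++ cell le i ∷ w′) ≡ count (reg j) (w ++ free ∷ w′)
      off j ne = trans (count-insert (reg j) w (cell le i) w′)
        (cong₂ _+_ {y = 0} (different (λ eq → ne (Finₚ.suc-injective (Finₚ.suc-injective eq)))) (sym (unswapped j)))

      untouched : ∀ {j} → k ≤ toℕ j → j ≢ level le i
      untouched k≤j refl = <⇒≱ (level< le i) k≤j

    rep-inc : ∀ {xs} → Rep le (w ++ free ∷ w′) xs → Rep le (w ++ cell le i ∷ w′) (xs [ i ]+1)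
    rep-inc {xs} h .present j with j Finₚ.≟ i
    ... | yes refl = trans at (trans (cong suc (h .present i)) (sym (lookup-[]+1 xs i)))
    ... | no ne = trans (off (level le j) (ne ∘ level-injective le)) (trans (h .present j) (sym (Vecₚ.lookup∘updateAt′ j i ne xs)))
    rep-inc h .unused j k≤j = trans (off j (untouched k≤j)) (h .unused j k≤j)

    rep-dec : ∀ {xs} → Rep le (w ++ cell le i ∷ w′) xs → ∃[ ys ] xs ≡ ys [ i ]+1 × Rep le (w ++ free ∷ w′) ys
    rep-dec {xs} h = ys , sym restore , record { present = pres ; unused = λ j k≤j → trans (sym (off j (untouched k≤j))) (h .unused j k≤j) }
      where
      ys = xs Vec.[ i ]%= pred
      n = count (cell le i) (w ++ free ∷ w′)
      value : lookup xs i ≡ suc n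
      value = trans (sym (h .present i)) at
      restore : ys [ i ]+1 ≡ xs
      restore = trans (Vecₚ.updateAt-updateAt i xs) (Vecₚ.updateAt-id-local i xs (trans (cong (λ n → suc (pred n)) value) (sym value)))
      pres : ∀ j → count (cell le j) (w ++ free ∷ w′) ≡ lookup ys j
      pres j with j Finₚ.≟ i
      ... | yes refl = sym (trans (Vecₚ.lookup∘updateAt i xs) (cong pred value))
      ... | no ne = trans (sym (off (level le j) (ne ∘ level-injective le))) (trans (h .present j) (sym (Vecₚ.lookup∘updateAt′ j i ne xs)))

  record Effect {k} (le : k ≤ K) (p : Prog k) (v v′ : List Letter) : Set where
    constructor effect
    field
      simulate : ∀ {xs} → Rep le v xs → ∃[ ys ] p ⊢ xs ⇒ ys × Rep le v′ ys

  open Effect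

  sound-lower : ∀ {k} (p : Prog k) le f → Sound (lower p le f) (Effect le p)
  sound-lower skip le f prim c eq = _ , c , effect (λ h → _ , skip , h) , eq
  sound-lower (inc i) le f = sound-mono (λ { (w , w′ , refl , refl) → effect λ h → _ , inc i , rep-inc le i w w′ h }) (sound-change (λ ()) (λ ()))
  sound-lower (p ⨟ q) le (f , g) = sound-mono (λ (w , e , e′) → effect λ h → let ys , d , h′ = simulate e h ; zs , d′ , h″ = simulate e′ h′ in zs , d ⨟ d′ , h″)
    (sound-· (sound-lower p le f) (sound-lower q le g))
  sound-lower (loop i p) le f = sound-mono (λ { (w , rounds , (refl , gone)) → effect (go rounds gone) })
    (sound-· (sound-* (sound-· (sound-change (λ ()) (λ ())) (sound-lower p le f))) (sound-absence {level le i}))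
    where
    go : ∀ {u v} → Star (Changed free (cell le i) ⨾ Effect le p) u v → count (cell le i) v ≡ 0 → ∀ {xs} → Rep le u xs → ∃[ ys ] loop i p ⊢ xs ⇒ ys × Rep le v ys
    go ε gone h = _ , done (trans (sym (h .present i)) gone) , h
    go ((_ , (w , w′ , refl , refl) , e) ◅ rounds) gone h with rep-dec le i w w′ h
    ... | ys , refl , h′ with simulate e h′
    ... | zs , d , h″ with go rounds gone h″
    ... | us , d′ , h‴ = us , more d d′ , h‴
  sound-lower (new p) le (le′ , f) = sound-mono (λ { (w , e , (refl , gone)) → effect (body e gone) })
    (sound-· (sound-lower p le′ f) (sound-absence {level le′ zero}))
    where
    body : ∀ {u v} → Effect le′ p u v → count (cell le′ zero) v ≡ 0 → ∀ {xs} → Rep le u xs → ∃[ ys ] new p ⊢ xs ⇒ ys × Rep le v ys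
    body e gone h with simulate e (rep-new h)
    ... | y ∷ ys , d , h′ with trans (sym (h′ .present zero)) gone
    ... | refl = ys , new d , rep-old h′

  clean-swap : ∀ {a b} w {w′} → b ≢ mark → Clean (w ++ a ∷ w′) → Clean w × Clean w′ × Clean (w ++ b ∷ w′)
  clean-swap w b≢ c with Allₚ.++⁻ w c
  ... | cw , _ ∷ cw′ = cw , cw′ , Allₚ.++⁺ cw (b≢ ∷ cw′)

  run-lower : ∀ {k} {p : Prog k} {xs ys} (le : k ≤ K) f → p ⊢ xs ⇒ ys → ∃[ c ] ∀ M {v} → Clean v → Rep le v xs → c + M ≤ count free v →
    ∃[ v′ ] Clean v′ × Rep le v′ ys × M ≤ count free v′ × Run (lower p le f) v v′
  run-lower le f skip = 0 , λ M {v} cl h b → v , cl , h , b , (_ , prim , λ s → refl)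
  run-lower le f (inc i) = 1 , go
    where
    go : ∀ M {v} → Clean v → Rep le v _ → 1 + M ≤ count free v → _
    go M {v} cl h b with occurs free v (≤-trans (s≤s z≤n) b)
    ... | w , w′ , refl with clean-swap {free} {cell le i} w {w′} (λ ()) cl
    ... | cw , cw′ , cl′ = w ++ cell le i ∷ w′ , cl′ , rep-inc le i w w′ h ,
      ≤-trans (s≤s⁻¹ (≤-trans b (≤-reflexive (count-insert free w free w′)))) (≤-reflexive (sym (count-insert free w (cell le i) w′))) , run-change w w′ cw cw′
  run-lower le (f , g) (d ⨟ e) with run-lower le f d | run-lower le g e
  ... | c , run | c′ , run′ = c + c′ , λ M cl h b →
    let _ , cl₁ , h₁ , b₁ , ρ₁ = run (c′ + M) cl h (≤-trans (≤-reflexive (sym (+-assoc c c′ M))) b)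
        v , cl₂ , h₂ , b₂ , ρ₂ = run′ M cl₁ h₁ b₁
    in v , cl₂ , h₂ , b₂ , run-· ρ₁ ρ₂
  run-lower le f (done {i = i} z) = 0 , λ M {v} cl h b → v , cl , h , b , run-· run-stop (run-absence {level le i} cl (trans (h .present i) z))
  run-lower {p = loop i p} le f (more {xs = xs} d e) with run-lower le f d | run-lower {p = loop i p} le f e
  ... | c , run | c′ , run′ = c + c′ , go
    where
    go : ∀ M {v} → Clean v → Rep le v (xs [ i ]+1) → c + c′ + M ≤ count free v → _
    go M {v} cl h b with occurs (cell le i) v (≤-trans (s≤s z≤n) (≤-reflexive (sym (trans (h .present i) (lookup-[]+1 xs i)))))
    ... | w , w′ , refl with clean-swap {cell le i} {free} w {w′} (λ ()) cl | rep-dec le i w w′ h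
    ... | cw , cw′ , cl₀ | ys , eq , h₀ with []+1-injective i eq
    ... | refl with run (c′ + M) cl₀ h₀ (≤-trans (≤-reflexive (sym (+-assoc c c′ M))) (≤-trans b (≤-trans (≤-reflexive (count-insert free w (cell le i) w′)) (≤-trans (n≤1+n _) (≤-reflexive (sym (count-insert free w free w′)))))))
    ... | _ , cl₁ , h₁ , b₁ , ρ₁ with run′ M cl₁ h₁ b₁
    ... | v₂ , cl₂ , h₂ , b₂ , ρ₂ = v₂ , cl₂ , h₂ , b₂ , prepend (run-· (run-change w w′ cw cw′) ρ₁) ρ₂
      where
      prepend : ∀ {u v x} → Run (change free (cell le i) · lower p le f) u v → Run (lower (loop i p) le f) v x → Run (lower (loop i p) le f) u x
      prepend {u} {v} {x} ρ (_ , _·_ {y = y} {z} h h′ , eqs) with ρ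
      ... | y₀ , h₀ , eqs₀ = (skipL ∷ y₀ ++ y) ++ z , again h₀ h · h′ , λ s →
        trans (cong (λ a → u ++ mark ∷ (a ++ s)) (trans (cong (λ b → traffic l b) (Listₚ.++-assoc y₀ y z)) (traffic-++ l y₀ (y ++ z))))
        (trans (cong (λ a → u ++ mark ∷ a) (Listₚ.++-assoc (traffic l y₀) (traffic l (y ++ z)) s))
        (trans (eqs₀ (traffic l (y ++ z) ++ s))
        (trans (cong (traffic r y₀ ++_) (eqs s))
        (trans (sym (Listₚ.++-assoc (traffic r y₀) (traffic r (y ++ z)) (x ++ mark ∷ s)))
               (cong (_++ x ++ mark ∷ s) (sym (trans (cong (λ b → traffic r b) (Listₚ.++-assoc y₀ y z)) (traffic-++ r y₀ (y ++ z)))))))))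
  run-lower {p = new p} le (le′ , f) (new d) with run-lower {p = p} le′ f d
  ... | c , run = c , λ M cl h b →
    let v , cl₁ , h₁ , b₁ , ρ = run M cl (rep-new h) b
    in v , cl₁ , rep-old h₁ , b₁ , run-· ρ (run-absence {level le′ zero} cl₁ (h₁ .present zero))

  balanced-lower : ∀ {k} (p : Prog k) le f → Balanced (lower p le f)
  balanced-lower skip       le f prim   = refl , refl
  balanced-lower (inc i)    le f        = balanced-change {cell le i} {free} (λ ()) (λ ())
  balanced-lower (p ⨟ q)    le (f , g)  = balanced-· (balanced-lower p le f) (balanced-lower q le g)
  balanced-lower (loop i p) le f        = balanced-· (balanced-* (balanced-· (balanced-change {free} {cell le i} (λ ()) (λ ())) (balanced-lower p le f))) (balanced-absence {level le i})
  balanced-lower (new p)    le (le′ , f) = balanced-· (balanced-lower p le′ f) (balanced-absence {level le′ zero})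

depth : ∀ {k} → Prog k → ℕ
depth skip        = 0
depth (inc i)     = 0
depth (p ⨟ q)     = depth p ⊔ depth q
depth (loop i p)  = depth p
depth (new {k} p) = suc k ⊔ depth p

fits : ∀ {K k} (p : Prog k) → depth p ≤ K → Lower.Fits K p
fits skip       le = tt
fits (inc i)    le = tt
fits (p ⨟ q)    le = fits p (m⊔n≤o⇒m≤o (depth p) (depth q) le) , fits q (m⊔n≤o⇒n≤o (depth p) (depth q) le)
fits (loop i p) le = fits p le
fits (new {k} p) le = m⊔n≤o⇒m≤o (suc k) (depth p) le , fits p (m⊔n≤o⇒n≤o (suc k) (depth p) le)

-- The sender's program for a predicate decided by g

-- Registers: the result of g, its second argument y, its first argument x.

argument : Fin 2 → Fin 2
argument zero       = suc zero
argument (suc zero) = zero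

module Body (g : PR 2) where

  program : Prog 3
  program = compute g argument

  K : ℕ
  K = 3 ⊔ depth program

  open Queue K public
  open Lower K public

  3≤K : 3 ≤ K
  3≤K = m≤m⊔n 3 (depth program)

  fitting : Fits program
  fitting = fits program (m≤n⊔m 3 (depth program))

  result guessed input : Letter
  result  = cell 3≤K zero
  guessed = cell 3≤K (suc zero)
  input   = cell 3≤K (suc (suc zero))

  main : Reg (2 + K)
  main = (change guessed free) * · (lower program 3≤K fitting · change free result)

  check reset rest : Reg (2 + K)
  check = sweep id [] · rotate
  reset = sweep (const free) regs · prim (take mark)
  rest  = check · (main · reset)

  chain : ℕ → Reg (2 + K)
  chain zero    = prim skipL
  chain (suc x) = prim (put input) · (prim (take free) · chain x)

  body : ℕ → Reg (2 + K)
  body x = prim (put mark) · (chain x · rest)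

  chain-traffic : ∀ x {z} → Lang (chain x) z → traffic l z ≡ List.replicate x input × traffic r z ≡ List.replicate x free
  chain-traffic zero    prim = refl , refl
  chain-traffic (suc x) (prim · (prim · h)) with chain-traffic x h
  ... | e , e′ = cong (input ∷_) e , cong (free ∷_) e′

  chain-lang : ∀ x → ∃[ z ] Lang (chain x) z
  chain-lang zero    = _ , prim
  chain-lang (suc x) = let z , h = chain-lang x in _ , prim · (prim · h)

  check-traffic : ∀ {z} → Lang check z → ∃[ w ] All (_∈ free ∷ []) w × traffic l z ≡ w ++ mark ∷ [] × traffic r z ≡ w ++ mark ∷ []
  check-traffic (_·_ {y = y} {z} h (prim · prim)) with sweep⁻ id [] h
  ... | w , i , e , e′ = w , i , trans (traffic-++ l y z) (cong (_++ mark ∷ []) (trans e (Listₚ.map-id w))) , trans (traffic-++ r y z) (cong (_++ mark ∷ []) e′)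

  reset-traffic : ∀ {z} → Lang reset z → ∃[ w ] Clean w × traffic l z ≡ map (const free) w × traffic r z ≡ w ++ mark ∷ []
  reset-traffic (_·_ {y = y} {z} h prim) with sweep⁻ (const free) regs h
  ... | w , i , e , e′ = w , clean-sweep i , trans (traffic-++ l y z) (trans (Listₚ.++-identityʳ _) e) , trans (traffic-++ r y z) (cong (_++ mark ∷ []) e′)

  Frees : List Letter → Set
  Frees = All (_∈ free ∷ [])

  frees-clean : ∀ {w} → Frees w → Clean w
  frees-clean = All.map λ { (here refl) () }

  frees-count : ∀ {w} j → Frees w → count (reg j) w ≡ 0
  frees-count j i = all⇒absent (reg j) (All.map (λ { (here refl) () }) i)

  inputs : ℕ → List Letter
  inputs x = List.replicate x input

  inputs-clean : ∀ x → Clean (inputs x)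
  inputs-clean zero    = []
  inputs-clean (suc x) = (λ ()) ∷ inputs-clean x

  rep-initial : ∀ x {w} → Frees w → Rep 3≤K (inputs x ++ w) (0 ∷ 0 ∷ x ∷ [])
  rep-initial x {w} i = record
    { present = λ where
        zero             → others′ (result-level zero λ ())
        (suc zero)       → others′ (result-level (suc zero) λ ())
        (suc (suc zero)) → trans (count-++ input (inputs x) w) (trans (cong₂ _+_ (own x) (frees-count _ i)) (+-identityʳ x))
    ; unused = λ j le → others′ (λ { refl → <⇒≱ (level< 3≤K (suc (suc zero))) le }) }
    where
    result-level : ∀ i → i ≢ suc (suc zero) → level 3≤K i ≢ level 3≤K (suc (suc zero))
    result-level i ne eq = ne (level-injective 3≤K eq)
    own : ∀ x → count input (inputs x) ≡ x
    own zero    = refl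
    own (suc x) = cong₂ _+_ (same input) (own x)
    foreign : ∀ x {j} → j ≢ level 3≤K (suc (suc zero)) → count (reg j) (inputs x) ≡ 0
    foreign zero    ne = refl
    foreign (suc x) ne = cong₂ _+_ (different (λ eq → ne (Finₚ.suc-injective (Finₚ.suc-injective eq)))) (foreign x ne)
    others′ : ∀ {j} → j ≢ level 3≤K (suc (suc zero)) → count (reg j) (inputs x ++ w) ≡ 0
    others′ {j} ne = trans (count-++ (reg j) (inputs x) w) (cong₂ _+_ (foreign x ne) (frees-count j i))

  Accepts : ℕ → Set
  Accepts x = ∃[ y ] ∃[ ys ] program ⊢ 0 ∷ y ∷ x ∷ [] ⇒ (ys [ zero ]+1)

  main-sound : Sound main (λ v _ → ∀ x y → Rep 3≤K v (0 ∷ y ∷ x ∷ []) → Accepts x)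
  main-sound = sound-mono (λ { (_ , gs , _ , e , (w , w′ , refl , refl)) → accepted gs e w w′ refl })
    (sound-· (sound-* (sound-change {guessed} {free} (λ ()) (λ ()))) (sound-· (sound-lower program 3≤K fitting) (sound-change {free} {result} (λ ()) (λ ()))))
    where
    accepted : ∀ {u v} → Star (Changed guessed free) u v → ∀ {t} → Effect 3≤K program v t → ∀ w w′ → t ≡ w ++ result ∷ w′ →
      ∀ x y → Rep 3≤K u (0 ∷ y ∷ x ∷ []) → Accepts x
    accepted ε e w w′ refl x y h with Effect.simulate e h
    ... | ys , d , h′ with rep-dec 3≤K zero w w′ h′
    ... | zs , refl , _ = _ , zs , d
    accepted ((v , v′ , refl , refl) ◅ gs) e w w′ eq x y h = accepted gs e w w′ eq x (suc y) (rep-inc 3≤K (suc zero) v v′ h)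

  frees : ℕ → List Letter
  frees x = List.replicate x free

  frees-Frees : ∀ x → Frees (frees x)
  frees-Frees zero    = []
  frees-Frees (suc x) = here refl ∷ frees-Frees x

  record Round (x : ℕ) (z : List (Label (2 + K))) : Set where
    field
      {w v}      : List Letter
      {middle}   : List (Label (2 + K))
      w-frees    : Frees w
      v-clean    : Clean v
      main-lang  : Lang main middle
      written    : ∀ s → traffic l z ++ s ≡ mark ∷ (inputs x ++ w) ++ mark ∷ (traffic l middle ++ (map (const free) v ++ s))
      taken      : ∀ t → traffic r z ++ t ≡ (frees x ++ w) ++ mark ∷ (traffic r middle ++ ((v ++ mark ∷ []) ++ t))

  open Round

  regroup : ∀ (a w b c d : List Letter) → (a ++ ((w ++ mark ∷ []) ++ (b ++ c))) ++ d ≡ (a ++ w) ++ mark ∷ (b ++ (c ++ d))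
  regroup a w b c d = begin
    (a ++ ((w ++ mark ∷ []) ++ (b ++ c))) ++ d  ≡⟨ Listₚ.++-assoc a _ d ⟩
    a ++ (((w ++ mark ∷ []) ++ (b ++ c)) ++ d)  ≡⟨ cong (a ++_) (Listₚ.++-assoc (w ++ mark ∷ []) (b ++ c) d) ⟩
    a ++ ((w ++ mark ∷ []) ++ ((b ++ c) ++ d))  ≡⟨ cong (λ x → a ++ ((w ++ mark ∷ []) ++ x)) (Listₚ.++-assoc b c d) ⟩
    a ++ ((w ++ mark ∷ []) ++ (b ++ (c ++ d)))  ≡⟨ cong (a ++_) (Listₚ.++-assoc w (mark ∷ []) _) ⟩
    a ++ (w ++ mark ∷ (b ++ (c ++ d)))          ≡⟨ sym (Listₚ.++-assoc a w _) ⟩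
    (a ++ w) ++ mark ∷ (b ++ (c ++ d)) ∎
    where open ≡-Reasoning

  mkRound : ∀ {x z₁ z₂ z₃ z₄ w v} → Frees w → Clean v → Lang main z₃ →
    traffic l z₁ ≡ inputs x → traffic r z₁ ≡ frees x → traffic l z₂ ≡ w ++ mark ∷ [] → traffic r z₂ ≡ w ++ mark ∷ [] →
    traffic l z₄ ≡ map (const free) v → traffic r z₄ ≡ v ++ mark ∷ [] →
    Round x (put mark ∷ z₁ ++ (z₂ ++ (z₃ ++ z₄)))
  mkRound {x} {z₁} {z₂} {z₃} {z₄} {w} {v} fw cv h l₁ r₁ l₂ r₂ l₄ r₄ = record
    { w = w ; v = v ; middle = z₃ ; w-frees = fw ; v-clean = cv ; main-lang = h
    ; written = λ s → cong (mark ∷_) (trans (cong (_++ s) (parts l l₁ l₂ l₄)) (regroup (inputs x) w (traffic l z₃) _ s))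
    ; taken = λ t → trans (cong (_++ t) (parts r r₁ r₂ r₄)) (regroup (frees x) w (traffic r z₃) _ t) }
    where
    parts : ∀ c {a b d} → traffic c z₁ ≡ a → traffic c z₂ ≡ b → traffic c z₄ ≡ d → traffic c (z₁ ++ (z₂ ++ (z₃ ++ z₄))) ≡ a ++ (b ++ (traffic c z₃ ++ d))
    parts c refl refl refl = trans (traffic-++ c z₁ _) (cong (traffic c z₁ ++_) (trans (traffic-++ c z₂ _) (cong (traffic c z₂ ++_) (traffic-++ c z₃ z₄))))

  roundOf : ∀ {x z} → Lang (body x) z → Round x z
  roundOf {x} (prim · (_·_ {y = z₁} h₁ (_·_ {y = z₂} h₂ (_·_ {y = z₃} {z = z₄} h₃ h₄)))) with chain-traffic x h₁ | check-traffic h₂ | reset-traffic h₄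
  ... | l₁ , r₁ | w , fw , l₂ , r₂ | v , cv , l₄ , r₄ = mkRound {z₁ = z₁} {z₂} {z₃} {z₄} fw cv h₃ l₁ r₁ l₂ r₂ l₄ r₄

  body-sound : ∀ {x z} → Lang (body x) z → ∀ {W s t} → Clean W → W ++ (traffic l z ++ s) ≡ traffic r z ++ t → Accepts x
  body-sound {x} {z} h {W} {s} {t} cW eq
    with firstMark cW (Allₚ.++⁺ (frees-clean (frees-Frees x)) (frees-clean (R .w-frees))) (trans (cong (W ++_) (sym (R .written s))) (trans eq (R .taken t)))
    where R = roundOf {x} h
  ... | _ , eq′ with main-sound (R .main-lang) (Allₚ.++⁺ (inputs-clean x) (frees-clean (R .w-frees))) eq′
    where R = roundOf {x} h
  ... | _ , _ , accepted , _ = accepted x 0 (rep-initial x (roundOf {x} h .w-frees))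

  balanced-main : Balanced main
  balanced-main = balanced-· (balanced-* (balanced-change {guessed} {free} (λ ()) (λ ())))
    (balanced-· (balanced-lower program 3≤K fitting) (balanced-change {free} {result} (λ ()) (λ ())))

  clean-count : ∀ {v} → Clean v → count mark v ≡ 0
  clean-count = all⇒absent mark

  body-balanced : ∀ x → Balanced (body x)
  body-balanced x {z} h = lengths , counts
    where
    open ≡-Reasoning
    R = roundOf {x} h
    a = inputs x ++ R .w
    b = frees x ++ R .w
    L = traffic l (R .middle)
    M = traffic r (R .middle)
    f = map (const free) (R .v)
    el : traffic l z ≡ mark ∷ a ++ mark ∷ (L ++ f)
    el = trans (sym (Listₚ.++-identityʳ _)) (trans (R .written []) (cong (λ s → mark ∷ a ++ mark ∷ (L ++ s)) (Listₚ.++-identityʳ f)))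
    er : traffic r z ≡ b ++ mark ∷ (M ++ (R .v ++ mark ∷ []))
    er = trans (sym (Listₚ.++-identityʳ _)) (trans (R .taken []) (cong (λ s → b ++ mark ∷ (M ++ s)) (Listₚ.++-identityʳ _)))
    same-length : length a ≡ length b
    same-length = trans (Listₚ.length-++ (inputs x)) (trans (cong (_+ length (R .w)) (trans (Listₚ.length-replicate x) (sym (Listₚ.length-replicate x)))) (sym (Listₚ.length-++ (frees x))))
    lengths : length (traffic l z) ≡ length (traffic r z)
    lengths = begin
      length (traffic l z)                                     ≡⟨ cong length el ⟩
      suc (length (a ++ mark ∷ (L ++ f)))                      ≡⟨ cong suc (Listₚ.length-++ a) ⟩
      suc (length a + suc (length (L ++ f)))                   ≡⟨ sym (+-suc (length a) _) ⟩
      length a + suc (suc (length (L ++ f)))                   ≡⟨ cong₂ (λ i j → i + suc (suc j)) same-length (trans (Listₚ.length-++ L) (cong₂ _+_ (proj₁ (balanced-main (R .main-lang))) (Listₚ.length-map (const free) (R .v)))) ⟩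
      length b + suc (suc (length M + length (R .v)))          ≡⟨ cong (λ i → length b + suc i) (sym (+-suc (length M) _)) ⟩
      length b + suc (length M + suc (length (R .v)))          ≡⟨ cong (λ i → length b + suc (length M + i)) (trans (+-comm 1 (length (R .v))) (sym (Listₚ.length-++ (R .v)))) ⟩
      length b + suc (length M + length (R .v ++ mark ∷ []))   ≡⟨ cong (λ i → length b + suc i) (sym (Listₚ.length-++ M)) ⟩
      length b + suc (length (M ++ (R .v ++ mark ∷ [])))       ≡⟨ sym (Listₚ.length-++ b) ⟩
      length (b ++ mark ∷ (M ++ (R .v ++ mark ∷ [])))          ≡⟨ cong length (sym er) ⟩
      length (traffic r z) ∎
    all-free : ∀ v → count mark (map (const free) v) ≡ 0
    all-free []      = refl
    all-free (_ ∷ v) = all-free v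
    counts : count mark (traffic l z) ≡ count mark (traffic r z)
    counts = begin
      count mark (traffic l z)                                 ≡⟨ cong (count mark) el ⟩
      1 + count mark (a ++ mark ∷ (L ++ f))                    ≡⟨ cong suc (count-++ mark a _) ⟩
      1 + (count mark a + (1 + count mark (L ++ f)))           ≡⟨ cong₂ (λ i j → 1 + (i + (1 + j))) (clean-count (Allₚ.++⁺ (inputs-clean x) (frees-clean (R .w-frees)))) (trans (count-++ mark L f) (cong₂ _+_ (proj₂ (balanced-main (R .main-lang))) (all-free (R .v)))) ⟩
      1 + (1 + (count mark M + 0))                             ≡⟨ cong suc (sym (+-suc (count mark M) 0)) ⟩
      1 + (count mark M + 1)                                   ≡⟨ cong (λ i → 1 + (count mark M + i)) (sym (trans (count-++ mark (R .v) (mark ∷ [])) (cong (_+ 1) (clean-count (R .v-clean))))) ⟩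
      1 + (count mark M + count mark (R .v ++ mark ∷ []))      ≡⟨ cong suc (sym (count-++ mark M _)) ⟩
      1 + count mark (M ++ (R .v ++ mark ∷ []))                ≡⟨ cong (_+ (1 + count mark (M ++ (R .v ++ mark ∷ [])))) (sym (clean-count (Allₚ.++⁺ (frees-clean (frees-Frees x)) (frees-clean (R .w-frees))))) ⟩
      count mark b + (1 + count mark (M ++ (R .v ++ mark ∷ []))) ≡⟨ sym (count-++ mark b _) ⟩
      count mark (b ++ mark ∷ (M ++ (R .v ++ mark ∷ [])))      ≡⟨ cong (count mark) (sym er) ⟩
      count mark (traffic r z) ∎

  guess-run : ∀ y {y₀ x} M {v} → Clean v → Rep 3≤K v (0 ∷ y₀ ∷ x ∷ []) → y + M ≤ count free v →
    ∃[ v′ ] Clean v′ × Rep 3≤K v′ (0 ∷ y + y₀ ∷ x ∷ []) × M ≤ count free v′ × Run (change guessed free *) v v′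
  guess-run zero    M c h b = _ , c , h , b , run-stop
  guess-run (suc y) {y₀} {x} M {v} c h b with occurs free v (≤-trans (s≤s z≤n) b)
  ... | w , w′ , refl with clean-swap {free} {guessed} w {w′} (λ ()) c
  ... | cw , cw′ , c′ with guess-run y {suc y₀} M c′ (rep-inc 3≤K (suc zero) w w′ h)
      (≤-trans (s≤s⁻¹ (≤-trans b (≤-reflexive (count-insert free w free w′)))) (≤-reflexive (sym (count-insert free w guessed w′))))
  ... | v′ , c″ , h″ , b″ , ρ = v′ , c″ , subst (λ k → Rep 3≤K v′ (0 ∷ k ∷ x ∷ [])) (+-suc y y₀) h″ , b″ , run-again (run-change w w′ cw cw′) ρ

  main-run : ∀ {x y ys} → program ⊢ 0 ∷ y ∷ x ∷ [] ⇒ (ys [ zero ]+1) → ∃[ N ] ∃[ v ] Clean v × Run main (inputs x ++ frees N) v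
  main-run {x} {y} {ys} d with run-lower 3≤K fitting d
  ... | c , run = finish (guess-run y {0} {x} (c + 0) (Allₚ.++⁺ (inputs-clean x) (frees-clean (frees-Frees N))) (rep-initial x (frees-Frees N)) enough)
    where
    N = y + (c + 0)
    enough : N ≤ count free (inputs x ++ frees N)
    enough = ≤-trans (≤-reflexive (sym (all-free N))) (≤-trans (m≤n+m _ (count free (inputs x))) (≤-reflexive (sym (count-++ free (inputs x) (frees N)))))
      where
      all-free : ∀ n → count free (frees n) ≡ n
      all-free zero    = refl
      all-free (suc n) = cong suc (all-free n)
    finish : (∃[ v′ ] Clean v′ × Rep 3≤K v′ (0 ∷ y + 0 ∷ x ∷ []) × c + 0 ≤ count free v′ × Run (change guessed free *) (inputs x ++ frees N) v′) →
      ∃[ N ] ∃[ v ] Clean v × Run main (inputs x ++ frees N) v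
    finish (v₁ , c₁ , h₁ , b₁ , ρ₁) with run 0 c₁ (subst (λ k → Rep 3≤K v₁ (0 ∷ k ∷ x ∷ [])) (+-identityʳ y) h₁) b₁
    ... | v₂ , c₂ , h₂ , _ , ρ₂ with occurs result v₂ (≤-trans (s≤s z≤n) (≤-reflexive (sym (trans (Rep.present h₂ zero) (lookup-[]+1 ys zero)))))
    ... | w , w′ , refl with clean-swap {result} {free} w {w′} (λ ()) c₂
    ... | cw , cw′ , c₃ = N , w ++ free ∷ w′ , c₃ , run-· ρ₁ (run-· ρ₂ (run-change w w′ cw cw′))

  body-run : ∀ {x y ys} → program ⊢ 0 ∷ y ∷ x ∷ [] ⇒ (ys [ zero ]+1) →
    ∃[ n ] ∃[ z ] Lang (body x) z × frees n ++ traffic l z ≡ traffic r z ++ frees n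
  body-run {x} d with main-run d
  ... | N , v , cv , (z₃ , h₃ , eqs) with chain-lang x | sweep⁺ id [] (frees-Frees N) | sweep⁺ (const free) regs (All.map ∈-regs cv)
  ... | z₁ , h₁ | y₂ , h₂ , e₂ , e₂′ | y₄ , h₄ , e₄ , e₄′ with chain-traffic x h₁
  ... | l₁ , r₁ = x + N , z , prim · (h₁ · ((h₂ · (prim · prim)) · (h₃ · (h₄ · prim)))) , equation
    where
    open ≡-Reasoning
    z₂ = y₂ ++ put mark ∷ take mark ∷ []
    z₄ = y₄ ++ take mark ∷ []
    z = put mark ∷ z₁ ++ (z₂ ++ (z₃ ++ z₄))
    R : Round x z
    R = mkRound {z₁ = z₁} {z₂} {z₃} {z₄} (frees-Frees N) cv h₃ l₁ r₁
      (trans (traffic-++ l y₂ _) (cong (_++ mark ∷ []) (trans e₂ (Listₚ.map-id (frees N))))) (trans (traffic-++ r y₂ _) (cong (_++ mark ∷ []) e₂′))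
      (trans (traffic-++ l y₄ _) (trans (Listₚ.++-identityʳ _) e₄)) (trans (traffic-++ r y₄ _) (cong (_++ mark ∷ []) e₄′))
    preserved : length v ≡ x + N
    preserved = trans (+-cancelʳ-≡ (length (traffic l z₃)) _ _ (ℕₚ.suc-injective total)) (trans (Listₚ.length-++ (inputs x)) (cong₂ _+_ (Listₚ.length-replicate x) (Listₚ.length-replicate N)))
      where
      total : suc (length v + length (traffic l z₃)) ≡ suc (length (inputs x ++ frees N) + length (traffic l z₃))
      total = sym (begin
        suc (length (inputs x ++ frees N) + length (traffic l z₃))       ≡⟨ sym (+-suc _ _) ⟩
        length (inputs x ++ frees N) + suc (length (traffic l z₃))       ≡⟨ cong (λ w → length (inputs x ++ frees N) + suc (length w)) (sym (Listₚ.++-identityʳ (traffic l z₃))) ⟩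
        length (inputs x ++ frees N) + suc (length (traffic l z₃ ++ [])) ≡⟨ sym (Listₚ.length-++ (inputs x ++ frees N)) ⟩
        length ((inputs x ++ frees N) ++ mark ∷ (traffic l z₃ ++ []))    ≡⟨ cong length (eqs []) ⟩
        length (traffic r z₃ ++ v ++ mark ∷ [])                          ≡⟨ Listₚ.length-++ (traffic r z₃) ⟩
        length (traffic r z₃) + length (v ++ mark ∷ [])                  ≡⟨ cong₂ _+_ (sym (proj₁ (balanced-main h₃))) (trans (Listₚ.length-++ v) (+-comm (length v) 1)) ⟩
        length (traffic l z₃) + suc (length v)                           ≡⟨ +-suc _ _ ⟩
        suc (length (traffic l z₃) + length v)                           ≡⟨ cong suc (+-comm (length (traffic l z₃)) _) ⟩
        suc (length v + length (traffic l z₃)) ∎)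
    erased : ∀ (u : List Letter) → map (const free) u ≡ frees (length u)
    erased []      = refl
    erased (_ ∷ u) = cong (free ∷_) (erased u)
    F : map (const free) v ≡ frees (x + N)
    F = trans (erased v) (cong frees preserved)
    split-frees : ∀ a → frees (a + N) ≡ frees a ++ frees N
    split-frees zero    = refl
    split-frees (suc a) = cong (free ∷_) (split-frees a)
    equation : frees (x + N) ++ traffic l z ≡ traffic r z ++ frees (x + N)
    equation = begin
      frees (x + N) ++ traffic l z ≡⟨ cong₂ _++_ (split-frees x) (trans (sym (Listₚ.++-identityʳ _)) (R .written [])) ⟩
      (frees x ++ frees N) ++ mark ∷ (inputs x ++ frees N) ++ mark ∷ (traffic l z₃ ++ (map (const free) v ++ [])) ≡⟨ cong (λ s → (frees x ++ frees N) ++ mark ∷ s) (eqs _) ⟩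
      (frees x ++ frees N) ++ mark ∷ (traffic r z₃ ++ (v ++ mark ∷ (map (const free) v ++ []))) ≡⟨ cong (λ s → (frees x ++ frees N) ++ mark ∷ (traffic r z₃ ++ s)) (sym (Listₚ.++-assoc v (mark ∷ []) _)) ⟩
      (frees x ++ frees N) ++ mark ∷ (traffic r z₃ ++ ((v ++ mark ∷ []) ++ (map (const free) v ++ []))) ≡⟨ sym (R .taken _) ⟩
      traffic r z ++ (map (const free) v ++ []) ≡⟨ cong (traffic r z ++_) (trans (Listₚ.++-identityʳ _) F) ⟩
      traffic r z ++ frees (x + N) ∎

all-lang : ∀ {m} {Q : Label m → Set} {P : Reg m} {z} → Q skipL → AllPrims Q P → Lang P z → All Q z
all-lang s (prim q) prim      = q ∷ []
all-lang s (h · h′) (k · k′)  = Allₚ.++⁺ (all-lang s h k) (all-lang s h′ k′)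
all-lang s (h ∪ h′) (inl k)   = s ∷ all-lang s h k
all-lang s (h ∪ h′) (inr k)   = s ∷ all-lang s h′ k
all-lang s (h *) stop         = s ∷ []
all-lang s (h *) (again k k′) = s ∷ Allₚ.++⁺ (all-lang s h k) (all-lang s (h *) k′)

all-prims-map : ∀ {m} {Q Q′ : Label m → Set} {P : Reg m} → (∀ {a} → Q a → Q′ a) → AllPrims Q P → AllPrims Q′ P
all-prims-map f (prim q) = prim (f q)
all-prims-map f (h · h′) = all-prims-map f h · all-prims-map f h′
all-prims-map f (h ∪ h′) = all-prims-map f h ∪ all-prims-map f h′
all-prims-map f (h *)    = all-prims-map f h *

module _ (K : ℕ) where
  open Queue K
  open Lower K

  comm-swap : ∀ b a → AllPrims IsComm (swap b a)
  comm-swap b a = prim comm · prim comm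

  comm-sweep : ∀ f S → AllPrims IsComm (sweep f S)
  comm-sweep f S = go free S *
    where
    go : ∀ a S → AllPrims IsComm (oneOf f a S)
    go a []      = comm-swap (f a) a
    go a (b ∷ S) = comm-swap (f a) a ∪ go b S

  comm-change : ∀ b a → AllPrims IsComm (change b a)
  comm-change b a = (comm-sweep id regs · (comm-swap b a · comm-sweep id regs)) · comm-swap mark mark

  comm-absence : ∀ j → AllPrims IsComm (absence j)
  comm-absence j = comm-sweep id (others j) · comm-swap mark mark

  comm-lower : ∀ {k} (p : Prog k) le f → AllPrims IsComm (lower p le f)
  comm-lower skip       le f          = prim comm
  comm-lower (inc i)    le f          = comm-change (cell le i) free
  comm-lower (p ⨟ q)    le (f , g)    = comm-lower p le f · comm-lower q le g
  comm-lower (loop i p) le f          = (comm-change free (cell le i) · comm-lower p le f) * · comm-absence (level le i)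
  comm-lower (new p)    le (le′ , f)  = comm-lower p le′ f · comm-absence (level le′ zero)

-- Runs up to their first test

module _ (S : UCST) (restricted : IsUCST[Z₁ʳ] S) where
  open UCST S
  open Extract

  record FirstTest (C D : Config S) : Set where
    field
      {s}        : Fin n₁
      {t}        : Fin n₂
      {v}        : Word m
      before     : Extract S C (s , t , [] , v)
      untested   : All IsComm (sent before)
      after      : Extract S (s , t , [] , v) D
      {z}        : List (Label m)
      tests      : sent after ≡ (r , test Z) ∷ z

  open FirstTest

  private
    testOrComm : ∀ {B C} (e : Step S B C) →
      (proj₁ (proj₂ (proj₂ B)) ≡ [] × (∀ {D} (x : Extract S C D) → sent (proj₁ (extract-∷ S e x)) ≡ (r , test Z) ∷ sent x)) ⊎
      (∀ {D} (x : Extract S C D) → All IsComm (sent x) → All IsComm (sent (proj₁ (extract-∷ S e x))))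
    testOrComm (test₁ i h) with All.lookup (proj₁ restricted) i | h
    ... | isZʳ | Regex.ε = inj₁ (refl , λ x → refl)
    testOrComm (test₂ i h) = case All.lookup (proj₂ restricted) i of λ ()
    testOrComm (write {c = r} i) = inj₂ λ x c → comm ∷ c
    testOrComm (write {c = l} i) = inj₂ λ x c → comm ∷ c
    testOrComm (read {c = r} i eq) = inj₂ λ x c → c
    testOrComm (read {c = l} i refl) = inj₂ λ x c → c
    testOrComm (loss i) = inj₂ λ x c → c

    extend : ∀ {B C D} → Step S B C → Star (Step S) C D → (Σ[ x ∈ Extract S C D ] All IsComm (sent x)) ⊎ FirstTest C D →
      (Σ[ x ∈ Extract S B D ] All IsComm (sent x) × 0 < steps x) ⊎ FirstTest B D
    extend e p (inj₁ (x , c)) with testOrComm e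
    ... | inj₁ (refl , eq) = inj₂ record { before = extractStar S ε ; untested = [] ; after = proj₁ (extract-∷ S e x) ; tests = eq x }
    ... | inj₂ f = inj₁ (proj₁ (extract-∷ S e x) , f x c , proj₂ (extract-∷ S e x))
    extend e p (inj₂ f) with testOrComm e
    ... | inj₁ (refl , eq) = inj₂ record { before = extractStar S ε ; untested = [] ; after = proj₁ (extract-∷ S e (extractStar S p)) ; tests = eq _ }
    ... | inj₂ h = inj₂ record { before = proj₁ (extract-∷ S e (before f)) ; untested = h (before f) (untested f) ; after = after f ; tests = tests f }

  firstTest : ∀ {C D} → Star (Step S) C D → (Σ[ x ∈ Extract S C D ] All IsComm (sent x)) ⊎ FirstTest C D
  firstTest ε       = inj₁ (extractStar S ε , [])
  firstTest (e ◅ p) = Sum.map₁ (map₂ proj₁) (extend e p (firstTest p))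

  firstTest⁺ : ∀ {C D} → TransClosure (Step S) C D → (Σ[ x ∈ Extract S C D ] All IsComm (sent x) × 0 < steps x) ⊎ FirstTest C D
  firstTest⁺ [ e ]   = extend e ε (firstTest ε)
  firstTest⁺ (e ∷ p) = extend e (Trans⇒Star p) (firstTest (Trans⇒Star p))

-- The forwarding receiver

module Echo (M : ℕ) where

  echo : Fin M → List (Rule M (suc M))
  echo a = rule zero l (comm (just a)) (suc a) ∷ rule (suc a) r (comm (just a)) zero ∷ []

  echoes : List (Rule M (suc M))
  echoes = concatMap echo (allFin M)

  data IsEcho : Rule M (suc M) → Set where
    first  : ∀ {a} → IsEcho (rule zero l (comm (just a)) (suc a))
    second : ∀ {a} → IsEcho (rule (suc a) r (comm (just a)) zero)

  echoes-are : All IsEcho echoes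
  echoes-are = go (allFin M)
    where
    go : ∀ as → All IsEcho (concatMap echo as)
    go []       = []
    go (a ∷ as) = first ∷ second ∷ go as

  pending : Fin (suc M) → Word M
  pending zero    = []
  pending (suc a) = a ∷ []

  forwards : ∀ {t y t′} → Path echoes t y t′ → pending t ++ traffic l y ≡ traffic r y ++ pending t′
  forwards [] = Listₚ.++-identityʳ _
  forwards (i ∷ p) with All.lookup echoes-are i
  ... | first  = forwards p
  ... | second = cong (_ ∷_) (forwards p)

  idles : ∀ {y t} → Path echoes zero y t → traffic l y ≡ [] → y ≡ []
  idles [] _ = refl
  idles (i ∷ p) eq with All.lookup echoes-are i
  idles (i ∷ p) () | first

  forward : Word M → List (Label M)
  forward = concatMap λ a → (l , comm (just a)) ∷ (r , comm (just a)) ∷ []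

  forward-traffic : ∀ c w → traffic c (forward w) ≡ w
  forward-traffic c [] = refl
  forward-traffic r (a ∷ w) = cong (a ∷_) (forward-traffic r w)
  forward-traffic l (a ∷ w) = cong (a ∷_) (forward-traffic l w)

  forward-comm : ∀ w → All IsComm (forward w)
  forward-comm []      = []
  forward-comm (a ∷ w) = comm ∷ comm ∷ forward-comm w

  forward-path : ∀ w → Path echoes zero (forward w) zero
  forward-path []      = []
  forward-path (a ∷ w) = member (here refl) ∷ member (there (here refl)) ∷ forward-path w
    where
    member : ∀ {ρ} → ρ ∈ echo a → ρ ∈ echoes
    member i = ∈-concatMap⁺ echo (lose (∈-allFin a) i)

-- The system of a predicate

module System (g : PR 2) where
  open Body g public
  open Echo (2 + K) public

  silent : Reg (2 + K)
  silent = prim skipL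

  cycle whole : ℕ → Reg (2 + K)
  cycle x = prim (r , test Z) · body x
  whole x = prim (put free) * · cycle x *

  -- The states outside the chain are numbered below those of the chain, so
  -- that their numbers do not depend on x.

  ladder : ℕ → Reg (2 + K)
  ladder zero    = silent
  ladder (suc k) = ladder k · (silent · silent)

  layout : ℕ → Reg (2 + K)
  layout x = ((silent · silent) · (silent · (silent · silent))) · (rest · (silent · ladder x))

  climb : ∀ x → St (chain x) → St (ladder x)
  climb zero    tt               = tt
  climb (suc x) (inj₁ tt)        = inj₂ (inj₂ tt)
  climb (suc x) (inj₂ (inj₁ tt)) = inj₂ (inj₁ tt)
  climb (suc x) (inj₂ (inj₂ s))  = inj₁ (climb x s)

  climb-injective : ∀ x {s s′} → climb x s ≡ climb x s′ → s ≡ s′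
  climb-injective zero    _ = refl
  climb-injective (suc x) {inj₁ _}        {inj₁ _}        _  = refl
  climb-injective (suc x) {inj₁ _}        {inj₂ (inj₁ _)} ()
  climb-injective (suc x) {inj₁ _}        {inj₂ (inj₂ _)} ()
  climb-injective (suc x) {inj₂ (inj₁ _)} {inj₁ _}        ()
  climb-injective (suc x) {inj₂ (inj₁ _)} {inj₂ (inj₂ _)} ()
  climb-injective (suc x) {inj₂ (inj₂ _)} {inj₁ _}        ()
  climb-injective (suc x) {inj₂ (inj₂ _)} {inj₂ (inj₁ _)} ()
  climb-injective (suc x) {inj₂ (inj₁ _)} {inj₂ (inj₁ _)} _  = refl
  climb-injective (suc x) {inj₂ (inj₂ s)} {inj₂ (inj₂ s′)} eq = cong (λ s → inj₂ (inj₂ s)) (climb-injective x (inj₁-injective eq))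
    where
    inj₁-injective : ∀ {A B : Set} {a b : A} → inj₁ {B = B} a ≡ inj₁ b → a ≡ b
    inj₁-injective refl = refl

  module _ (x : ℕ) where

    arrange : St (whole x) → St (layout x)
    arrange (inj₁ (inj₁ tt)) = inj₁ (inj₁ (inj₁ tt))
    arrange (inj₁ (inj₂ tt)) = inj₁ (inj₁ (inj₂ tt))
    arrange (inj₂ (inj₁ tt)) = inj₁ (inj₂ (inj₁ tt))
    arrange (inj₂ (inj₂ (inj₁ tt))) = inj₁ (inj₂ (inj₂ (inj₁ tt)))
    arrange (inj₂ (inj₂ (inj₂ (inj₁ tt)))) = inj₁ (inj₂ (inj₂ (inj₂ tt)))
    arrange (inj₂ (inj₂ (inj₂ (inj₂ (inj₁ s))))) = inj₂ (inj₂ (inj₂ (climb x s)))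
    arrange (inj₂ (inj₂ (inj₂ (inj₂ (inj₂ s))))) = inj₂ (inj₁ s)

    Origin : St (layout x) → St (whole x) → Set
    Origin (inj₁ (inj₁ (inj₁ _))) s = s ≡ inj₁ (inj₁ tt)
    Origin (inj₁ (inj₁ (inj₂ _))) s = s ≡ inj₁ (inj₂ tt)
    Origin (inj₁ (inj₂ (inj₁ _))) s = s ≡ inj₂ (inj₁ tt)
    Origin (inj₁ (inj₂ (inj₂ (inj₁ _)))) s = s ≡ inj₂ (inj₂ (inj₁ tt))
    Origin (inj₁ (inj₂ (inj₂ (inj₂ _)))) s = s ≡ inj₂ (inj₂ (inj₂ (inj₁ tt)))
    Origin (inj₂ (inj₁ a)) s = s ≡ inj₂ (inj₂ (inj₂ (inj₂ (inj₂ a))))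
    Origin (inj₂ (inj₂ (inj₁ _))) s = ⊥
    Origin (inj₂ (inj₂ (inj₂ a))) s = ∃[ c ] s ≡ inj₂ (inj₂ (inj₂ (inj₂ (inj₁ c)))) × climb x c ≡ a

    origin : ∀ s → Origin (arrange s) s
    origin (inj₁ (inj₁ tt)) = refl
    origin (inj₁ (inj₂ tt)) = refl
    origin (inj₂ (inj₁ tt)) = refl
    origin (inj₂ (inj₂ (inj₁ tt))) = refl
    origin (inj₂ (inj₂ (inj₂ (inj₁ tt)))) = refl
    origin (inj₂ (inj₂ (inj₂ (inj₂ (inj₁ s))))) = s , refl , refl
    origin (inj₂ (inj₂ (inj₂ (inj₂ (inj₂ s))))) = refl

    origin-unique : ∀ a {s s′} → Origin a s → Origin a s′ → s ≡ s′
    origin-unique (inj₁ (inj₁ (inj₁ _))) refl refl = refl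
    origin-unique (inj₁ (inj₁ (inj₂ _))) refl refl = refl
    origin-unique (inj₁ (inj₂ (inj₁ _))) refl refl = refl
    origin-unique (inj₁ (inj₂ (inj₂ (inj₁ _)))) refl refl = refl
    origin-unique (inj₁ (inj₂ (inj₂ (inj₂ _)))) refl refl = refl
    origin-unique (inj₂ (inj₁ _)) refl refl = refl
    origin-unique (inj₂ (inj₂ (inj₂ a))) (c , refl , e) (c′ , refl , e′) =
      cong (λ c → inj₂ (inj₂ (inj₂ (inj₂ (inj₁ c))))) (climb-injective x (trans e (sym e′)))

    gap : St (layout x)
    gap = inj₂ (inj₂ (inj₁ tt))

    hub testing tested : St (whole x)
    hub     = inj₂ (inj₁ tt)
    testing = inj₂ (inj₂ (inj₁ tt))
    tested  = inj₂ (inj₂ (inj₂ (inj₁ tt)))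

    body-comm : AllPrims IsComm (body x)
    body-comm = prim comm · (chain-comm x · ((comm-sweep K id [] · comm-swap K mark mark) ·
      ((comm-change K guessed free * · (comm-lower K program 3≤K fitting · comm-change K free result)) ·
       (comm-sweep K (const free) regs · prim comm))))
      where
      chain-comm : ∀ x → AllPrims IsComm (chain x)
      chain-comm zero    = prim comm
      chain-comm (suc x) = prim comm · (prim comm · chain-comm x)

    opaque
      states : ℕ
      states = size (layout x)

      ι : St (whole x) → Fin states
      ι s = number (layout x) (arrange s)

      exit : Fin states
      exit = number (layout x) gap

      rules : List (Rule (2 + K) states)
      rules = edges (whole x) ι exit

      ι-injective : ∀ {s s′} → ι s ≡ ι s′ → s ≡ s′
      ι-injective {s} {s′} eq = origin-unique (arrange s) (origin s)
        (subst (λ a → Origin a s′) (sym (number-injective (layout x) {arrange s} {arrange s′} eq)) (origin s′))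

      ι≢exit : ∀ s → ι s ≢ exit
      ι≢exit s eq = subst (λ a → Origin a s) (number-injective (layout x) {arrange s} {gap} eq) (origin s)

      rules-restricted : All OnlyZʳ rules
      rules-restricted = edges-restricted {ι = ι} (prim isComm * · (prim isZʳ · all-prims-map (λ { comm → isComm }) body-comm) *)

      hubRules : Included (edges (cycle x *) (ι ∘ inj₂) exit) rules
      hubRules = ∈-++⁺ʳ (edges (prim (put free) *) (ι ∘ inj₁) (ι hub))

      whole-sound : ∀ s {z} → Path rules (ι s) z (ι hub) → From (whole x) s (z ++ skipL ∷ [])
      whole-sound s p = automaton-sound (whole x) (λ {s} {s′} → ι-injective {s} {s′}) ι≢exit s (p ⧺ (hubRules (here refl) ∷ []))

      fill-path : ∀ {z} → Lang (prim (put free) *) z → Path rules (ι (start (whole x))) z (ι hub)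
      fill-path = edges-complete (prim (put free) *) {ι ∘ inj₁} {ι hub} ∈-++⁺ˡ

      body-path : ∀ {z} → Lang (body x) z → Path rules (ι tested) z (ι hub)
      body-path = edges-complete (body x) {ι ∘ inj₂ ∘ inj₂ ∘ inj₂} {ι hub} (hubRules ∘ there ∘ there ∘ there)

      leave : rule (ι hub) r (comm nothing) (ι testing) ∈ rules
      leave = hubRules (there (here refl))

      check-empty : rule (ι testing) r (test Z) (ι tested) ∈ rules
      check-empty = hubRules (there (there (here refl)))

    system : UCST
    system = record { m = 2 + K ; n₁ = states ; n₂ = 3 + K ; Δ₁ = rules ; Δ₂ = echoes }

    instanceOf : Instance
    instanceOf = record { system = system ; pᵢₙ = ι (start (whole x)) ; p = ι hub ; qᵢₙ = zero ; q = zero }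

    restricted : IsUCST[Z₁ʳ] system
    restricted = rules-restricted , All.map (λ { first → isComm ; second → isComm }) echoes-are

-- Recurrence of the system means acceptance

module Recurrence (g : PR 2) (x : ℕ) where
  open System g
  open Extract

  private
    I = instanceOf x
    S = system x
    Δ = rules x
    home = ι x (hub x)

  balanced-cycle : Balanced (cycle x *)
  balanced-cycle = balanced-* (balanced-· {prim (r , test Z)} {body x} (λ { prim → refl , refl }) (body-balanced x))

  marks : ∀ {z} → Lang (whole x) z → count mark (traffic l z) ≡ count mark (traffic r z)
  marks (_·_ {y = y} {z} h h′) = trans (cong (count mark) (traffic-++ l y z)) (trans (count-++ mark (traffic l y) _)
    (trans (cong₂ _+_ (go h) (proj₂ (balanced-cycle h′))) (trans (sym (count-++ mark (traffic r y) _)) (cong (count mark) (sym (traffic-++ r y z))))))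
    where
    go : ∀ {y} → Lang (prim (put free) *) y → count mark (traffic l y) ≡ count mark (traffic r y)
    go stop = refl
    go (again prim h) = go h

  traffic-silent : ∀ c (z : List (Label (2 + K))) → traffic c (z ++ skipL ∷ []) ≡ traffic c z
  traffic-silent c z = trans (traffic-++ c z (skipL ∷ [])) (trans (cong (traffic c z ++_) (empty c)) (Listₚ.++-identityʳ _))
    where
    empty : ∀ c → traffic c (skipL ∷ []) ≡ []
    empty r = refl
    empty l = refl

  returns : ∀ {z} → Path Δ home z home → z ≡ [] ⊎ (∃[ b ] ∃[ c ] z ++ skipL ∷ [] ≡ skipL ∷ (r , test Z) ∷ b ++ c × Lang (body x) b × Lang (cycle x *) c)
  returns {z} p = go refl (whole-sound x (hub x) p)
    where
    go : ∀ {w} → w ≡ z ++ skipL ∷ [] → Lang (cycle x *) w →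
      z ≡ [] ⊎ (∃[ b ] ∃[ c ] z ++ skipL ∷ [] ≡ skipL ∷ (r , test Z) ∷ b ++ c × Lang (body x) b × Lang (cycle x *) c)
    go eq stop = inj₁ (empty z eq)
      where
      empty : ∀ z → skipL ∷ [] ≡ z ++ skipL ∷ [] → z ≡ []
      empty []          _ = refl
      empty (_ ∷ [])    ()
      empty (_ ∷ _ ∷ _) ()
    go eq (again (prim · h) h′) = inj₂ (_ , _ , sym eq , h , h′)

  commuting-loop : ∀ {z} → Path Δ home z home → All IsComm z → z ≡ []
  commuting-loop {z} p c with returns p
  ... | inj₁ eq = eq
  ... | inj₂ (_ , _ , eq , _) = contradiction c (tests z eq)
    where
    tests : ∀ z {w} → z ++ skipL ∷ [] ≡ skipL ∷ (r , test Z) ∷ w → ¬ All IsComm z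
    tests [] ()
    tests (_ ∷ []) ()
    tests (_ ∷ _ ∷ _) refl (_ ∷ () ∷ _)

  first-test : ∀ {y z w : List (Label (2 + K))} → All IsComm y → (y ++ (r , test Z) ∷ z) ++ skipL ∷ [] ≡ skipL ∷ (r , test Z) ∷ w →
    y ≡ skipL ∷ [] × z ++ skipL ∷ [] ≡ w
  first-test [] ()
  first-test (_ ∷ []) refl = refl , refl
  first-test (_ ∷ comm ∷ _) ()

  no-loop : ∀ {C} (e : Extract S (home , zero , C) (home , zero , C)) → All IsComm (sent e) → steps e ≡ 0
  no-loop {u , v} (extract {received = y} lost path path′ rel los bal) c with commuting-loop path c
  ... | refl with Listₚ.++-cancelʳ u (traffic r y) [] (sym (trans (sym (Listₚ.++-identityʳ u)) rel))
  ... | eq with idles path′ (trans (forwards path′) (trans (Listₚ.++-identityʳ _) eq))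
  ... | refl = +-cancelˡ-≡ (length v) lost 0 (trans bal (trans (cong length (Listₚ.++-identityʳ v)) (sym (+-identityʳ _))))

  Loop : Contents (2 + K) → Set
  Loop w = FirstTest S (restricted x) (home , zero , w) (home , zero , w)

  -- The contents W are those at the test, the letter held by the receiver
  -- included. The word equation of the cycle is then "closed".
  accepts : ∀ {u v} → Extract S (ι x (start (whole x)) , zero , [] , []) (home , zero , u , v) → (f : Loop (u , v)) →
    ∀ {b c} → sent (FirstTest.before f) ≡ skipL ∷ [] → FirstTest.z f ++ skipL ∷ [] ≡ b ++ c → Lang (body x) b → Lang (cycle x *) c → Accepts x
  accepts {u} {v} i f {b} {c} eqB eqz h h′ = body-sound h clean equation
    where
    open FirstTest f using (t; tests) renaming (v to v₁; z to z′; before to B; after to A)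
    W = pending t ++ v₁
    -- Everything in r before the test is forwarded, together with the
    -- letter that the receiver holds at the test.
    passed : traffic l (received B) ≡ u ++ pending t
    passed = trans (forwards (receiver B)) (cong (_++ pending t)
      (trans (sym (Listₚ.++-identityʳ _)) (trans (sym (reliable B)) (trans (cong (λ z → u ++ traffic r z) eqB) (Listₚ.++-identityʳ u)))))
    kept : u ++ W ⊆ v
    kept = subst₂ _⊆_ (trans (cong (_++ v₁) passed) (Listₚ.++-assoc u (pending t) v₁))
      (trans (cong (λ z → v ++ traffic l z) eqB) (Listₚ.++-identityʳ v)) (lossy B)
    returned : ∀ c → traffic c (sent A) ≡ traffic c z′
    returned r = cong (traffic r) tests
    returned l = cong (traffic l) tests
    taken : traffic r z′ ≡ pending t ++ (traffic l (received A) ++ u)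
    taken = trans (sym (returned r)) (trans (reliable A) (trans (cong (_++ u) (trans (sym (Listₚ.++-identityʳ _)) (sym (forwards (receiver A))))) (Listₚ.++-assoc (pending t) _ u)))
    cyclic : traffic r z′ ++ W ⊆ W ++ traffic l z′
    cyclic = subst₂ _⊆_ (sym (trans (cong (_++ W) taken) (trans (Listₚ.++-assoc (pending t) _ W) (cong (pending t ++_) (Listₚ.++-assoc (traffic l (received A)) u W)))))
      (sym (trans (Listₚ.++-assoc (pending t) v₁ _) (cong (λ w → pending t ++ (v₁ ++ w)) (sym (returned l)))))
      (Subₚ.++⁺ (⊆-refl {x = pending t}) (⊆-trans (Subₚ.++⁺ (⊆-refl {x = traffic l (received A)}) kept) (lossy A)))
    parts : ∀ c′ → traffic c′ z′ ≡ traffic c′ b ++ traffic c′ c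
    parts c′ = trans (sym (traffic-silent c′ z′)) (trans (cong (traffic c′) eqz) (traffic-++ c′ b c))
    same-length : length (traffic l z′) ≡ length (traffic r z′)
    same-length = trans (cong length (parts l)) (trans (Listₚ.length-++ (traffic l b)) (trans (cong₂ _+_ (proj₁ (body-balanced x h)) (proj₁ (balanced-cycle h′)))
      (trans (sym (Listₚ.length-++ (traffic r b))) (cong length (sym (parts r))))))
    closed : traffic r z′ ++ W ≡ W ++ traffic l z′
    closed = ⊆-length⇒≡ cyclic (≤-reflexive (trans (Listₚ.length-++ W) (trans (+-comm (length W) _) (trans (cong (_+ length W) same-length) (sym (Listₚ.length-++ (traffic r z′)))))))
    equation : W ++ (traffic l b ++ traffic l c) ≡ traffic r b ++ (traffic r c ++ W)
    equation = trans (cong (W ++_) (sym (parts l))) (trans (sym closed) (trans (cong (_++ W) (parts r)) (Listₚ.++-assoc (traffic r b) _ W)))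
    -- No mark is ever lost or forged on the way to the hub, so v has no
    -- more marks than u.
    fewer : count mark v ≤ count mark u
    fewer = +-cancelˡ-≤ (count mark (traffic r (received i))) _ _ (begin
      count mark (traffic r (received i)) + count mark v   ≡⟨ cong (λ w → count mark w + count mark v) (sym (trans (forwards (receiver i)) (Listₚ.++-identityʳ _))) ⟩
      count mark (traffic l (received i)) + count mark v   ≡⟨ sym (count-++ mark (traffic l (received i)) v) ⟩
      count mark (traffic l (received i) ++ v)             ≤⟨ count-⊆ mark (lossy i) ⟩
      count mark (traffic l (sent i))                      ≡⟨ cong (count mark) (sym (traffic-silent l (sent i))) ⟩
      count mark (traffic l (sent i ++ skipL ∷ []))        ≡⟨ marks (From⇒Lang (whole x) (whole-sound x (start (whole x)) (sender i))) ⟩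
      count mark (traffic r (sent i ++ skipL ∷ []))        ≡⟨ cong (count mark) (trans (traffic-silent r (sent i)) (reliable i)) ⟩
      count mark (traffic r (received i) ++ u)             ≡⟨ count-++ mark (traffic r (received i)) u ⟩
      count mark (traffic r (received i)) + count mark u   ∎)
      where open ≤-Reasoning hiding (start)
    clean : Clean W
    clean = absent⇒all mark W (n≤0⇒n≡0 (+-cancelˡ-≤ (count mark u) _ 0 (begin
      count mark u + count mark W  ≡⟨ sym (count-++ mark u W) ⟩
      count mark (u ++ W)          ≤⟨ count-⊆ mark kept ⟩
      count mark v                 ≤⟨ fewer ⟩
      count mark u                 ≡⟨ sym (+-identityʳ _) ⟩
      count mark u + 0             ∎)))
      where open ≤-Reasoning hiding (start)

  Lasso⇒Accepts : Lasso I → Accepts x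
  Lasso⇒Accepts (w , reach , inj₂ (_ , _ , path , c)) = contradiction (commuting-loop path c) λ ()
  Lasso⇒Accepts (w , reach , inj₁ lap) = [ (λ (e , c , pos) → contradiction (no-loop e c) (>⇒≢ pos)) , tested-loop ]′ (firstTest⁺ S (restricted x) lap)
    where
    tested-loop : Loop w → Accepts x
    tested-loop f = [ (λ eq → ⊥-elim (nonempty (sent before) (trans (cong (sent before ++_) (sym tests)) eq)))
                    , (λ (b , c , eq , h , h′) → let eqB , eqz = first-test untested (trans (cong (λ w → (sent before ++ w) ++ skipL ∷ []) (sym tests)) eq) in
                         accepts (extractStar S reach) f eqB eqz h h′)
                    ]′ (returns (sender before ⧺ sender after))
      where
      open FirstTest f
      nonempty : ∀ {A : Set} (y : List A) {a z} → y ++ a ∷ z ≢ []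
      nonempty [] ()
      nonempty (_ ∷ _) ()

  fill : ∀ n → ∃[ w ] Lang (prim (put free) *) w × All IsComm w × traffic r w ≡ [] × traffic l w ≡ frees n
  fill zero    = _ , stop , comm ∷ [] , refl , refl
  fill (suc n) = let w , f , c , e , e′ = fill n in _ , again prim f , comm ∷ comm ∷ c , e , cong (free ∷_) e′

  reach : ∀ n → Star (Step S) (ι x (start (whole x)) , zero , [] , []) (home , zero , [] , frees n)
  reach n = let w , f , c , e , e′ = fill n in
    subst₂ (λ u v → Star (Step S) (ι x (start (whole x)) , zero , [] , []) (home , zero , u , v)) e e′ (senderRun S (fill-path x f) c)

  lap : ∀ n z → Lang (body x) z → frees n ++ traffic l z ≡ traffic r z ++ frees n →
    TransClosure (Step S) (home , zero , [] , frees n) (home , zero , [] , frees n)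
  lap n z h eq = write {c = r} {x = nothing} (leave x) ∷ Star⇒Trans (test₁ {c = r} {R = Z} (check-empty x) Regex.ε) (run ◅◅ relay)
    where
    word = traffic r z
    run : Star (Step S) (ι x (tested x) , zero , [] , frees n) (home , zero , word , frees n ++ traffic l z)
    run = senderRun S (body-path x h) (all-lang comm (body-comm x) h)
    relay : Star (Step S) (home , zero , word , frees n ++ traffic l z) (home , zero , [] , frees n)
    relay = subst₂ (λ u v → Star (Step S) (home , zero , u , v) (home , zero , [] , frees n))
      (trans (Listₚ.++-identityʳ _) (forward-traffic r word)) (trans (cong (_++ frees n) (forward-traffic l word)) (sym eq))
      (receiverRun S {s = home} {u = []} {v = frees n} (forward-path word) (forward-comm word))

  Accepts⇒Lasso : Accepts x → Lasso I
  Accepts⇒Lasso (y , ys , d) = let n , z , h , eq = body-run d in ([] , frees n) , reach n , inj₁ (lap n z h eq)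

-- The code of the system as a function of the predicate and its argument

rise : ℕ → ℕ → ℕ
rise b zero    = b
rise b (suc k) = suc (suc (rise b k))

ruleCode : ℕ → ℕ → ℕ → ℕ → ℕ
ruleCode s c a t = encode (s ∷ c ∷ a ∷ t ∷ [])

chainCodes : ℕ → ℕ → ℕ → ℕ → List ℕ → ℕ → List ℕ
chainCodes p t b s rest zero    = ruleCode b 0 epsilon s ∷ rest
chainCodes p t b s rest (suc k) = ruleCode (suc (suc (rise b k))) 1 p (suc (rise b k)) ∷
  ruleCode (suc (rise b k)) 0 t (rise b k) ∷ chainCodes p t b s rest k

module Codes (g : PR 2) where
  open System g

  putCode takeCode : ℕ
  putCode  = encodeAct (comm (just input))
  takeCode = encodeAct (comm (just free))

  ladder-size : ∀ b k → b + size (ladder k) ≡ suc (rise b k)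
  ladder-size b zero    = +-comm b 1
  ladder-size b (suc k) = trans (sym (+-assoc b (size (ladder k)) 2)) (trans (+-comm _ 2) (cong (2 +_) (ladder-size b k)))

  position : ∀ x → St (chain x) → ℕ
  position x s = toℕ (number (ladder x) (climb x s))

  top : ∀ b x → b + position x (start (chain x)) ≡ rise b x
  top b zero    = +-identityʳ b
  top b (suc x) = trans (cong (b +_) (trans (Finₚ.toℕ-↑ʳ (size (ladder x)) _) (+-comm (size (ladder x)) 1)))
    (trans (+-suc b _) (cong suc (ladder-size b x)))

  chain-codes : ∀ b s rest x {n} {ι : St (chain x) → Fin n} {e} → (∀ s → toℕ (ι s) ≡ b + position x s) → toℕ e ≡ s →
    map encodeRule (edges (chain x) ι e) ++ rest ≡ chainCodes putCode takeCode b s rest x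
  chain-codes b s rest zero h eq = cong₂ (λ i j → ruleCode i 0 epsilon j ∷ rest) (trans (h tt) (+-identityʳ b)) eq
  chain-codes b s rest (suc x) {ι = ι} h eq = cong₂ _∷_ (cong₂ (λ i j → ruleCode i 1 putCode j) (trans (h (inj₁ tt)) (top b (suc x))) below)
    (cong₂ _∷_ (cong₂ (λ i j → ruleCode i 0 takeCode j) below (trans (inner (start (chain x))) (top b x)))
      (chain-codes b s rest x inner eq))
    where
    below : toℕ (ι (inj₂ (inj₁ tt))) ≡ suc (rise b x)
    below = trans (h (inj₂ (inj₁ tt))) (trans (cong (b +_) (trans (Finₚ.toℕ-↑ʳ (size (ladder x)) _) (+-identityʳ _))) (ladder-size b x))
    inner : ∀ s → toℕ (ι (inj₂ (inj₂ s))) ≡ b + position x s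
    inner s = trans (h (inj₂ (inj₂ s))) (cong (b +_) (Finₚ.toℕ-↑ˡ _ 2))

  base restEntry : ℕ
  base  = 6 + size rest
  restEntry = 5 + toℕ (number rest (start rest))

  inRest : ∀ x → St rest → St (whole x)
  inRest x s = inj₂ (inj₂ (inj₂ (inj₂ (inj₂ s))))

  inChain : ∀ x → St (chain x) → St (whole x)
  inChain x s = inj₂ (inj₂ (inj₂ (inj₂ (inj₁ s))))

  restRules : ℕ → List ℕ
  restRules x = map encodeRule (edges rest (ι x ∘ inRest x) (ι x (hub x)))

  fixedRules : List ℕ
  fixedRules = ruleCode 0 0 epsilon 2 ∷ ruleCode 0 0 epsilon 1 ∷ ruleCode 1 1 takeCode 0 ∷
    ruleCode 2 0 epsilon (5 + (size rest + 0)) ∷ ruleCode 2 0 epsilon 3 ∷ ruleCode 3 0 (encodeAct (test {2 + K} Z)) 4 ∷ []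

  opaque
    unfolding rules

    toℕ-rest : ∀ x s → toℕ (ι x (inRest x s)) ≡ 5 + toℕ (number rest s)
    toℕ-rest x s = trans (Finₚ.toℕ-↑ʳ 5 (number rest s ↑ˡ (1 + size (ladder x)))) (cong (5 +_) (Finₚ.toℕ-↑ˡ (number rest s) _))

    toℕ-chain : ∀ x s → toℕ (ι x (inChain x s)) ≡ base + position x s
    toℕ-chain x s = trans (Finₚ.toℕ-↑ʳ 5 (size rest ↑ʳ (1 ↑ʳ number (ladder x) (climb x s)))) (cong (5 +_)
      (trans (Finₚ.toℕ-↑ʳ (size rest) (1 ↑ʳ number (ladder x) (climb x s))) (+-suc (size rest) _)))

    toℕ-exit : ∀ x → toℕ (exit x) ≡ 5 + (size rest + 0)
    toℕ-exit x = trans (Finₚ.toℕ-↑ʳ 5 (size rest ↑ʳ zero {size (ladder x)})) (cong (5 +_) (Finₚ.toℕ-↑ʳ (size rest) (zero {size (ladder x)})))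

    toℕ-hub : ∀ x → toℕ (ι x (hub x)) ≡ 2
    toℕ-hub x = refl

    toℕ-start : ∀ x → toℕ (ι x (start (whole x))) ≡ 0
    toℕ-start x = refl

    states-rise : ∀ x → states x ≡ suc (rise base x)
    states-rise x = trans (cong (5 +_) (+-suc (size rest) (size (ladder x)))) (ladder-size base x)

    rules-shape : ∀ x → map encodeRule (rules x) ≡
      ruleCode 0 0 epsilon 2 ∷ ruleCode 0 0 epsilon 1 ∷ ruleCode 1 1 takeCode 0 ∷
      ruleCode 2 0 epsilon (toℕ (exit x)) ∷ ruleCode 2 0 epsilon 3 ∷ ruleCode 3 0 (encodeAct (test {2 + K} Z)) 4 ∷
      ruleCode 4 1 (encodeAct (comm (just mark))) (toℕ (ι x (inChain x (start (chain x))))) ∷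
      map encodeRule (edges (chain x) (ι x ∘ inChain x) (ι x (inRest x (start rest))) ++ edges rest (ι x ∘ inRest x) (ι x (hub x)))
    rules-shape x = refl

  restRules-fixed : ∀ x → restRules x ≡ restRules 0
  restRules-fixed x = edges-codes rest (λ s → trans (toℕ-rest x s) (sym (toℕ-rest 0 s))) (trans (toℕ-hub x) (sym (toℕ-hub 0)))

  rules-codes : ∀ x → map encodeRule (rules x) ≡
    fixedRules ++ ruleCode 4 1 (encodeAct (comm (just mark))) (rise base x) ∷ chainCodes putCode takeCode base restEntry (restRules 0) x
  rules-codes x = trans (rules-shape x) (cong₂ (λ e → λ (t , cs) → ruleCode 0 0 epsilon 2 ∷ ruleCode 0 0 epsilon 1 ∷ ruleCode 1 1 takeCode 0 ∷
      ruleCode 2 0 epsilon e ∷ ruleCode 2 0 epsilon 3 ∷ ruleCode 3 0 (encodeAct (test {2 + K} Z)) 4 ∷ ruleCode 4 1 (encodeAct (comm (just mark))) t ∷ cs)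
    (toℕ-exit x) (cong₂ _,_ (trans (toℕ-chain x (start (chain x))) (top base x)) chains))
    where
    chains : map encodeRule (edges (chain x) (ι x ∘ inChain x) (ι x (inRest x (start rest))) ++ edges rest (ι x ∘ inRest x) (ι x (hub x)))
      ≡ chainCodes putCode takeCode base restEntry (restRules 0) x
    chains = trans (Listₚ.map-++ encodeRule (edges (chain x) (ι x ∘ inChain x) (ι x (inRest x (start rest)))) _)
      (trans (cong (map encodeRule (edges (chain x) (ι x ∘ inChain x) (ι x (inRest x (start rest)))) ++_) (restRules-fixed x))
        (chain-codes base restEntry (restRules 0) x {ι = ι x ∘ inChain x} (toℕ-chain x) (toℕ-rest x (start rest))))

-- The reduction

ruleᵗ : ∀ {n} → Tm n → ℕ → Tm n → Tm n → Tm n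
ruleᵗ s c a t = consᵗ s (consᵗ (lit c) (consᵗ a (consᵗ t (lit 0))))

riseᵗ : ∀ {n} → Fin n → Fin n → Tm n
riseᵗ b k = rec (var k) (var b) (suc (suc (var 1F)))

-- The variables are m, the number of the last state of the chain, the rules
-- before the chain, the actions on mark, input and free, the rules after the
-- chain, those of the receiver, and the argument of the predicate.

chainᵗ : Tm 9
chainᵗ = rec (var 8F) (var 6F) (consᵗ (ruleᵗ (suc (suc (riseᵗ 3F 0F))) 1 (var 6F) (suc (riseᵗ 3F 0F)))
  (consᵗ (ruleᵗ (suc (riseᵗ 3F 0F)) 0 (var 7F) (riseᵗ 3F 0F)) (var 1F)))

rulesᵗ : Tm 9
rulesᵗ = var 2F ++ᵗ consᵗ (ruleᵗ (lit 4) 1 (var 3F) (riseᵗ 1F 8F)) chainᵗ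

template : Tm 9
template = consᵗ (var 0F) (consᵗ (suc (riseᵗ 1F 8F)) (consᵗ (suc (var 0F)) (consᵗ rulesᵗ
  (consᵗ (var 7F) (consᵗ (lit 0) (consᵗ (lit 0) (consᵗ (lit 2) (consᵗ (lit 0) (lit 0)))))))))

⟦riseᵗ⟧ : ∀ {n} (b k : Fin n) xs → ⟦ riseᵗ b k ⟧ᵗ xs ≡ rise (lookup xs b) (lookup xs k)
⟦riseᵗ⟧ b k xs = go (lookup xs k)
  where
  go : ∀ k → primrec (λ ys → lookup ys b) (λ ys → suc (suc (lookup ys 1F))) k xs ≡ rise (lookup xs b) k
  go zero    = refl
  go (suc k) = cong (2 +_) (go k)

module _ (M b : ℕ) (F : List ℕ) (cm ci cf s : ℕ) (rest : List ℕ) (D : ℕ) where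

  private
    fields : Vec ℕ 8
    fields = M ∷ b ∷ encode F ∷ cm ∷ ci ∷ cf ∷ encode (ruleCode b 0 epsilon s ∷ rest) ∷ D ∷ []

  ⟦chainᵗ⟧ : ∀ x → ⟦ chainᵗ ⟧ᵗ (fields Vec.++ x ∷ []) ≡ encode (chainCodes ci cf b s rest x)
  ⟦chainᵗ⟧ x = go x
    where
    step : Tm 11
    step = consᵗ (ruleᵗ (suc (suc (riseᵗ 3F 0F))) 1 (var 6F) (suc (riseᵗ 3F 0F)))
      (consᵗ (ruleᵗ (suc (riseᵗ 3F 0F)) 0 (var 7F) (riseᵗ 3F 0F)) (var 1F))
    go : ∀ k → primrec ⟦ var 6F ⟧ᵗ ⟦ step ⟧ᵗ k (fields Vec.++ x ∷ []) ≡ encode (chainCodes ci cf b s rest k)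
    go zero    = refl
    go (suc k) = cong₂ (λ n L → cons (ruleCode (suc (suc n)) 1 ci (suc n)) (cons (ruleCode (suc n) 0 cf n) L))
      (⟦riseᵗ⟧ 3F 0F (k ∷ primrec ⟦ var 6F ⟧ᵗ ⟦ step ⟧ᵗ k (fields Vec.++ x ∷ []) ∷ fields Vec.++ x ∷ [])) (go k)

  ⟦template⟧ : ∀ x → ⟦ template ⟧ᵗ (fields Vec.++ x ∷ []) ≡
    encode (M ∷ suc (rise b x) ∷ suc M ∷ encode (F ++ ruleCode 4 1 cm (rise b x) ∷ chainCodes ci cf b s rest x) ∷ D ∷ 0 ∷ 0 ∷ 2 ∷ 0 ∷ [])
  ⟦template⟧ x = cong₂ (λ n L → encode (M ∷ suc n ∷ suc M ∷ L ∷ D ∷ 0 ∷ 0 ∷ 2 ∷ 0 ∷ [])) (⟦riseᵗ⟧ 1F 8F (fields Vec.++ x ∷ []))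
    (⟦++ᵗ⟧ (var 2F) (consᵗ (ruleᵗ (lit 4) 1 (var 3F) (riseᵗ 1F 8F)) chainᵗ) {xs = fields Vec.++ x ∷ []} {u = F} {v = ruleCode 4 1 cm (rise b x) ∷ chainCodes ci cf b s rest x} refl
      (cong₂ (λ n L → cons (ruleCode 4 1 cm n) L) (⟦riseᵗ⟧ 1F 8F (fields Vec.++ x ∷ [])) (⟦chainᵗ⟧ x)))

opaque

  instanceCode : ℕ → ℕ → ℕ
  instanceCode e x = ⟦ template ⟧ᵗ (nths 8 e Vec.++ x ∷ [])

  instanceCodeᶠ : Fun 2 (λ xs → instanceCode (lookup xs 0F) (lookup xs 1F))
  instanceCodeᶠ = compᶠ (funᵗ template) (nthsᶠ 8 (projᶠ 0F) ++ᶠ (projᶠ 1F ∷ []))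

  instanceCode-encode : ∀ (as : Vec ℕ 8) x → instanceCode (encode (Vec.toList as)) x ≡ ⟦ template ⟧ᵗ (as Vec.++ x ∷ [])
  instanceCode-encode as x = cong (λ as → ⟦ template ⟧ᵗ (as Vec.++ x ∷ [])) (nths-encode as)

Hard : ℕ → Set
Hard = RecurrentReachability IsUCST[Z₁ʳ]

module Reduction (g : PR 2) where
  open System g
  open Codes g
  open Recurrence g

  parameters : Vec ℕ 8
  parameters = (2 + K) ∷ base ∷ encode fixedRules ∷ encodeAct (comm (just mark)) ∷ putCode ∷ takeCode ∷
    encode (ruleCode base 0 epsilon restEntry ∷ restRules 0) ∷ encode (map encodeRule echoes) ∷ []

  index : ℕ
  index = encode (Vec.toList parameters)

  instanceCode-index : ∀ x → instanceCode index x ≡ encodeInstance (instanceOf x)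
  instanceCode-index x = trans (instanceCode-encode parameters x)
    (trans (⟦template⟧ (2 + K) base fixedRules (encodeAct (comm (just mark))) putCode takeCode restEntry (restRules 0) (encode (map encodeRule echoes)) x)
      (sym (fit (states-rise x) (rules-codes x) (toℕ-start x) (toℕ-hub x))))
    where
    fit : ∀ {n n′ L L′ a a′ b b′} → n ≡ n′ → L ≡ L′ → a ≡ a′ → b ≡ b′ →
      encode (2 + K ∷ n ∷ 3 + K ∷ encode L ∷ encode (map encodeRule echoes) ∷ a ∷ 0 ∷ b ∷ 0 ∷ []) ≡
      encode (2 + K ∷ n′ ∷ 3 + K ∷ encode L′ ∷ encode (map encodeRule echoes) ∷ a′ ∷ 0 ∷ b′ ∷ 0 ∷ [])
    fit refl refl refl refl = refl

  hard⇒accepts : ∀ x → Hard (instanceCode index x) → Accepts x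
  hard⇒accepts x (I , eq , h , rr) = let y , φ = lasso⁺ I h (RecurrentlyReachable⇒Lasso I h rr) in
    Lasso⇒Accepts x (lasso⁻ (instanceOf x) (restricted x) {y}
      (subst (λ c → ⟦ lassoᶠ ⟧ (c ∷ y ∷ [])) (trans (encodeInstance≡codeInstance I) (trans eq (instanceCode-index x))) φ))

  accepts⇒hard : ∀ x → Accepts x → Hard (instanceCode index x)
  accepts⇒hard x h = instanceOf x , trans (sym (encodeInstance≡codeInstance (instanceOf x))) (sym (instanceCode-index x)) ,
    restricted x , Lasso⇒RecurrentlyReachable (instanceOf x) (Accepts⇒Lasso x h)

  module _ {R : Vec ℕ 2 → Set} (decides : ∀ xs → (R xs × g ⟨ xs ⟩⇓ 1) ⊎ (¬ R xs × g ⟨ xs ⟩⇓ 0)) where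

    private
      computes : ∀ {x y v} → g ⟨ x ∷ y ∷ [] ⟩⇓ v → program ⊢ 0 ∷ y ∷ x ∷ [] ⇒ (v ∷ y ∷ x ∷ [])
      computes e = compute⇒ g e λ { zero → refl ; (suc zero) → refl }

    accepts⁺ : ∀ {x y} → R (x ∷ y ∷ []) → Accepts x
    accepts⁺ {x} {y} h = [ (λ (_ , e) → y , 0 ∷ y ∷ x ∷ [] , computes e) , (λ (n , _) → contradiction h n) ]′ (decides (x ∷ y ∷ []))

    accepts⁻ : ∀ {x} → Accepts x → ∃[ y ] R (x ∷ y ∷ [])
    accepts⁻ {x} (y , ys , d) = y , [ proj₁ , (λ (_ , e) → contradiction (⇒-deterministic d (computes e) refl) (positive ys)) ]′ (decides (x ∷ y ∷ []))
      where
      positive : ∀ (ys : Vec ℕ 3) → ys [ zero ]+1 ≢ 0 ∷ y ∷ x ∷ []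
      positive (_ ∷ _) ()

    reduction : ∀ x → (∃[ y ] R (x ∷ y ∷ [])) ⇔ Hard (instanceCode index x)
    reduction x = mk⇔ (λ (y , h) → accepts⇒hard x (accepts⁺ h)) (λ h → accepts⁻ (hard⇒accepts x h))

hard : ∀ B → Σ⁰₁ B → B ≤ₘ Hard
hard B (R , (g , decides) , B⇔) = proj₁ f , λ x → instanceCode index x , proj₂ f (x ∷ []) ,
  mk⇔ (Equivalence.to (reduction decides x) ∘ Equivalence.to (B⇔ x)) (Equivalence.from (B⇔ x) ∘ Equivalence.from (reduction decides x))
  where
  open Reduction g
  f : Fun 1 (λ xs → instanceCode index (lookup xs 0F))
  f = compᶠ instanceCodeᶠ (litᶠ index ∷ projᶠ 0F ∷ [])

-- A decision procedure would decide the diagonal set of all e for which the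
-- e-th reduction sends e outside the problem.

undecidable : ¬ DecidableSet Hard
undecidable (f , decides) = outside (Equivalence.to (reduction diagonal index) (0 , outside))
  where
  flipped : Fun 1 (λ xs → ifz (lookup xs 0F) 1 0)
  flipped = compᶠ ifzᶠ (projᶠ 0F ∷ litᶠ 1 ∷ litᶠ 0 ∷ [])
  self : Fun 2 (λ xs → instanceCode (lookup xs 0F) (lookup xs 0F))
  self = compᶠ instanceCodeᶠ (projᶠ 0F ∷ projᶠ 0F ∷ [])
  g : PR 2
  g = comp (proj₁ flipped) (comp f (proj₁ self ∷ []) ∷ [])
  R : Vec ℕ 2 → Set
  R xs = ¬ Hard (instanceCode (lookup xs 0F) (lookup xs 0F))
  evaluate : ∀ xs {v} → f ⟨ instanceCode (lookup xs 0F) (lookup xs 0F) ∷ [] ⟩⇓ v → g ⟨ xs ⟩⇓ ifz v 1 0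
  evaluate xs {v} e = comp (comp (proj₂ self xs ∷ []) e ∷ []) (proj₂ flipped (v ∷ []))
  diagonal : ∀ xs → (R xs × g ⟨ xs ⟩⇓ 1) ⊎ (¬ R xs × g ⟨ xs ⟩⇓ 0)
  diagonal xs = [ (λ (h , e) → inj₂ ((λ n → n h) , evaluate xs e)) , (λ (n , e) → inj₁ (n , evaluate xs e)) ]′
    (decides (instanceCode (lookup xs 0F) (lookup xs 0F) ∷ []))
  open Reduction g
  outside : ¬ Hard (instanceCode index index)
  outside h = proj₂ (Equivalence.from (reduction diagonal index) h) h

theorem8p1 :
  DecidableSet (RecurrentReachability IsUCS) ×
  Σ⁰₁-Complete (RecurrentReachability IsUCST[Z₁ʳ]) ×
  ¬ DecidableSet (RecurrentReachability IsUCST[Z₁ʳ])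
theorem8p1 = decidable , (semidecidable , hard) , undecidable
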